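{- Let $n_1 \geq 3$ and $m_2 \geq 1$ be integers such that, with $j=j_{n_1,m_2}$, $k=k_{n_1,m_2}$ and $r=r_{n_1,m_2}$ as in the context, $k \geq 1$ and $j < \lfloor (m_2-1)/2 \rfloor$. Then there is a function $\epsilon(m_1) = \Theta(m_1/\log m_1)$ such that, for all sufficiently large $m_1$ and all positive integers $n_2$, the graph $K_{m_1(n_1), m_2(n_2)}$ has a distinguishing partition if and only if $n_2 \leq r m_1 + \epsilon(m_1)$.
   Context: $K_{m_1(n_1),m_2(n_2)}$ denotes the complete multipartite graph whose parts are $m_1$ sets of size $n_1$ and $m_2$ sets of size $n_2$. For a graph $X$ with automorphism group $\mathrm{aut}(X)$ and a partition $P=\{P_1,\dots,P_t\}$ of $V(X)$, put $\gamma(P)=\{\gamma(P_1),\dots,\gamma(P_t)\}$; $P$ is a distinguishing partition if $\gamma(P)\neq P$ for every nontrivial $\gamma\in\mathrm{aut}(X)$. For $n_1 \geq 3$, $j=j_{n_1,m_2}\ge0$ and $k=k_{n_1,m_2}\ge0$ are the integers with $n_1 = 2 + \sum_{i=0}^{j}\binom{m_2}{i} + k$ and either ($j < \lfloor (m_2-1)/2 \rfloor$ and $0 \leq k < \binom{m_2}{j+1}$) or ($j = \lfloor (m_2-1)/2 \rfloor$ and $k \geq 0$). If $j < \lfloor (m_2-1)/2 \rfloor$, $r = 1 + \sum_{i=0}^{j}\frac{m_2-i}{m_2}\binom{m_2}{i} + \frac{m_2 - j - 1}{m_2}k$; otherwise $r = 1 + \sum_{i=0}^{j}\frac{m_2-i}{m_2}\binom{m_2}{i}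 + \frac{k}{2}$. -}

module Defs where

open import Data.Nat as ℕ using (ℕ; suc; _∸_; NonZero)
open import Data.Nat.DivMod using (_/_)
open import Data.Nat.Combinatorics using (_C_)
open import Data.Nat.Logarithm using (⌊log₂_⌋)
open import Data.Integer using (+_)
open import Data.Rational as ℚ using (ℚ)
open import Data.List using (List; map; upTo)
open import Data.Nat.ListAction using (sum)
open import Data.Fin using (Fin)
open import Data.Product using (_×_; Σ; ∃; ∃-syntax; proj₁)
open import Data.Sum using (_⊎_; inj₁; inj₂)
open import Relation.Binary.PropositionalEquality using (_≡_; _≢_; setoid)
open import Relation.Nullary using (¬_)
open import Function.Bundles using (Inverse; _⇔_; _↔_)
open import Level using (0ℓ)

record Graph : Set₁ where
  field
    V   : Set
    Adj : V → V → Set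
open Graph public

record Aut (X : Graph) : Set where
  field
    perm    : V X ↔ V X
    presAdj : ∀ u v → Adj X u v ⇔ Adj X (Inverse.to perm u) (Inverse.to perm v)
open Aut public

act : {X : Graph} → Aut X → V X → V X
act γ = Inverse.to (perm γ)

Nontrivial : {X : Graph} → Aut X → Set
Nontrivial {X} γ = ∃[ v ] act γ v ≢ v

-- A partition of V(X) is given by a block-labelling c : V → ℕ;
-- its blocks are the nonempty fibres of c.
Partition : Graph → Set
Partition X = V X → ℕ

-- γ(P) = P : the image of every block under γ is again a block, i.e.
-- γ maps the equivalence relation "same block" onto itself.
FixesPartition : {X : Graph} → Aut X → Partition X → Set
FixesPartition γ c = ∀ u v → (c u ≡ c v) ⇔ (c (act γ u) ≡ c (act γ v))

IsDistinguishing : {X : Graph} → Partition X → Set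
IsDistinguishing {X} c = (γ : Aut X) → Nontrivial γ → ¬ FixesPartition γ c

HasDistinguishingPartition : Graph → Set
HasDistinguishingPartition X = ∃[ c ] IsDistinguishing {X} c

KV : ℕ → ℕ → ℕ → ℕ → Set
KV m₁ n₁ m₂ n₂ = (Fin m₁ × Fin n₁) ⊎ (Fin m₂ × Fin n₂)

partOf : ∀ {m₁ n₁ m₂ n₂} → KV m₁ n₁ m₂ n₂ → Fin m₁ ⊎ Fin m₂
partOf (inj₁ x) = inj₁ (proj₁ x)
partOf (inj₂ y) = inj₂ (proj₁ y)

K : ℕ → ℕ → ℕ → ℕ → Graph
K m₁ n₁ m₂ n₂ = record
  { V   = KV m₁ n₁ m₂ n₂
  ; Adj = λ u v → partOf u ≢ partOf v
  }

sumTo : ℕ → (ℕ → ℕ) → ℕ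
sumTo j f = sum (map f (upTo (suc j)))

halfBound : ℕ → ℕ
halfBound m₂ = (m₂ ∸ 1) / 2

toℚ : ℕ → ℚ
toℚ n = ℚ._/_ (+ n) 1

-- r = 1 + Σ_{i=0}^{j} ((m₂-i)/m₂) C(m₂,i) + ((m₂-j-1)/m₂) k
-- (the case j < ⌊(m₂-1)/2⌋)
rVal : (m₂ j k : ℕ) → .{{NonZero m₂}} → ℚ
rVal m₂ j k = ℚ._+_ ℚ.1ℚ
  (ℚ._/_ (+ (sumTo j (λ i → (m₂ ∸ i) ℕ.* (m₂ C i)) ℕ.+ (m₂ ∸ j ∸ 1) ℕ.* k)) m₂)

-- ε(m) = Θ(m / log m), with log taken as ⌊log₂ m⌋ (equivalent up to
-- constant factors for m ≥ 2): there are rationals 0 < c₁, c₂ and M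
-- such that for all m ≥ M,  c₁ m ≤ ε(m) ⌊log₂ m⌋ ≤ c₂ m.
IsTheta-m/logm : (ℕ → ℚ) → Set
IsTheta-m/logm ε =
  ∃[ c₁ ] ∃[ c₂ ] ∃[ M ]
    (ℚ.0ℚ ℚ.< c₁) × (ℚ.0ℚ ℚ.< c₂) ×
    (∀ m → M ℕ.≤ m →
       (ℚ._*_ c₁ (toℚ m) ℚ.≤ ℚ._*_ (ε m) (toℚ ⌊log₂ m ⌋)) ×
       (ℚ._*_ (ε m) (toℚ ⌊log₂ m ⌋) ℚ.≤ ℚ._*_ c₂ (toℚ m)))

{-# OPTIONS --safe #-}

-- A partition is a hypergraph on the parts: each small part (of size n₁) lies in n₁ blocks, each
-- large part (of size n₂) in n₂ blocks. It is distinguishing iff blocks never meet a part twice,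
-- are determined by their members, and the hypergraph has no symmetry.
--
-- Upper bound. Let s(e) be the number of small parts in the block e, W = m₂ − j − 1 and
-- u = 2 W − m₂ ≥ 1. A block with s(e) = 1 is a set of large parts at its small part, and there are
-- only so many big ones; summing the numbers of large parts over all blocks gives
-- m₂ n₂ + u Q ≤ m₁ (m₂ + X + u) + O(1), where Q = Σ (s(e) − 1) and r = 1 + X / m₂. As m₁ ≤ Q + t for
-- the number t of tree components, m₂ n₂ ≤ m₁ (m₂ + X) + u t + O(1). Disjoint isomorphic trees could be
-- exchanged and there are only exponentially many trees of a given size, so t = O(m₁ / log m₁).
--
-- Lower bound. A rigid forest of about m₁ / log m₁ caterpillars is realised by blocks of two small
-- parts, its edges also mark the large parts, and all other blocks have one small part and many
-- large parts.
--
-- No gaps. If n₂ + 1 is attained above that lower bound, many trees of equal size have a block with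
-- one small part and all large parts. Uniting two such blocks of different trees and dropping the
-- large vertices of one of them lowers n₂ to the given value. If all these mergers had symmetries, then
-- by the pigeonhole principle two of the symmetries would agree well enough to exchange two of the trees.
--
-- Hence the attained n₂ form an interval [1, N] with N computable, and ε = N − r m₁.

module Submission where

open import Defs
open import Data.Bool.Base using (Bool; true; false; if_then_else_)
open import Data.Bool.Properties using () renaming (_≟_ to _≟b_)
open import Data.Empty using (⊥; ⊥-elim)
open import Data.Maybe.Base using (Maybe; just; nothing)
open import Data.Maybe.Properties using (just-injective)
open import Data.Nat using (ℕ; zero; suc; _+_; _*_; _∸_; _^_; _≤_; _<_; z≤n; s≤s; NonZero; >-nonZero; _≟_; _≤?_; _<?_; ⌊_/2⌋; ⌈_/2⌉)
open import Data.Nat.Properties hiding (_≟_; _≤?_; _<?_)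
open import Data.Nat.DivMod using (_/_; _%_; m≡m%n+[m/n]*n; m%n<n; m/n*n≤m; m<n⇒m%n≡m; [m+n]%n≡m%n)
open import Data.Nat.Combinatorics using (_C_; nCk+nC[k+1]≡[n+1]C[k+1])
open import Data.Nat.Logarithm using (⌊log₂_⌋; ⌊log₂⌋-mono-≤; ⌊log₂[2^n]⌋≡n; ⌊log₂⌊n/2⌋⌋≡⌊log₂n⌋∸1)
open import Data.Nat.ListAction using (sum)
open import Data.Nat.Solver using (module +-*-Solver)
open import Data.Integer as ℤ using (ℤ)
open import Data.Rational as ℚ using (ℚ)
import Data.Rational.Properties as ℚP
import Data.Rational.Unnormalised.Base as ℚᵘ
import Data.Rational.Unnormalised.Properties as ℚᵘP
import Data.Rational.Solver as ℚSolver
import Data.Integer.Properties as ℤP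
open import Data.Fin as Fin using (Fin; zero; suc; toℕ; fromℕ<; inject≤; punchIn; punchOut; combine; remQuot; finToFun; funToFin)
import Data.Fin.Properties as FinP
open import Data.Vec.Base as Vec using (Vec; []; _∷_)
import Data.Vec.Properties as VecP
open import Data.List.Base as List using (List; []; _∷_; _++_; map; length; filter; concatMap; allFin; lookup; upTo)
import Data.List.Properties as ListP
open import Data.List.Membership.Propositional using (_∈_; _∉_; find)
import Data.List.Membership.Propositional.Properties as MemP
open import Data.List.Relation.Unary.Any using (Any; here; there)
import Data.List.Relation.Unary.Any as Any
import Data.List.Relation.Unary.Any.Properties as AnyP
open import Data.List.Relation.Unary.All as All using (All; []; _∷_)
import Data.List.Relation.Unary.All.Properties as AllP
open import Data.List.Relation.Unary.AllPairs using (AllPairs; []; _∷_)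
import Data.List.Relation.Unary.AllPairs as AllPairs
import Data.List.Relation.Unary.AllPairs.Properties as AllPairsP
open import Data.List.Relation.Unary.Unique.Propositional using (Unique)
import Data.List.Relation.Unary.Unique.Propositional.Properties as UniqueP
open import Data.List.Relation.Binary.Pointwise.Base using (Pointwise; []; _∷_)
open import Data.Product using (_×_; Σ; ∃; ∃-syntax; ∃₂; _,_; proj₁; proj₂)
import Data.Product.Properties as ProdP
open import Data.Sum using (_⊎_; inj₁; inj₂; [_,_]′)
import Data.Sum.Properties as SumP
open import Relation.Binary.PropositionalEquality using (_≡_; _≢_; refl; sym; trans; cong; cong₂; subst; subst₂; module ≡-Reasoning)
open import Relation.Binary.Definitions using (DecidableEquality)
open import Relation.Nullary using (¬_; Dec; yes; no; does; contradiction)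
open import Relation.Nullary.Decidable using (_×-dec_; _⊎-dec_; ¬?; map′; decidable-stable; dec-true)
open import Relation.Unary using (Decidable)
open import Function.Base using (_∘_; id; case_of_)
open import Function.Bundles using (Inverse; _⇔_; mk⇔; mk↔ₛ′; Equivalence)

-- Sums over lists, and positions in lists

-- W is the price of one place of a small part in a linear program. A block with two small parts and
-- all large parts breaks even, because m₂ + u = 2 W, and a further small part only wastes places,
-- because u < W. So only blocks with one small part and more than W large parts, that is with at
-- most j missing, bring a surplus. The condition on j says exactly that u ≥ 1, so that each tree
-- component is worth something; this is why the order of ε is that of the number of trees in a
-- rigid forest. The obstacle is that the attained n₂ are not clearly closed downwards: deleting
-- large vertices can create symmetries, and for n₁ = n₂ a symmetry may even mix small and large
-- parts. Explicit partitions therefore cover all small n₂, the case n₁ = n₂ included. Mergers serve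
-- only above them, where n₂ > n₁ and where the weight inequality itself supplies many trees with a
-- full block. As ε must be a function, N comes from a bounded search. For this the existence of a
-- partition is decided, and the decision also produces the symmetry of a failed merger as an object
-- to which the pigeonhole principle applies.

module _ where

  private variable
    A B : Set

  sumL : (A → ℕ) → List A → ℕ
  sumL f xs = sum (map f xs)

  sumL-++ : (f : A → ℕ) (xs ys : List A) → sumL f (xs ++ ys) ≡ sumL f xs + sumL f ys
  sumL-++ f []       ys = refl
  sumL-++ f (x ∷ xs) ys = trans (cong (f x +_) (sumL-++ f xs ys)) (sym (+-assoc (f x) _ _))

  sumL-cong : {f g : A → ℕ} (xs : List A) → (∀ {x} → x ∈ xs → f x ≡ g x) → sumL f xs ≡ sumL g xs
  sumL-cong []       h = refl
  sumL-cong (x ∷ xs) h = cong₂ _+_ (h (here refl)) (sumL-cong xs (h ∘ there))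

  sumL-mono : {f g : A → ℕ} (xs : List A) → (∀ {x} → x ∈ xs → f x ≤ g x) → sumL f xs ≤ sumL g xs
  sumL-mono []       h = z≤n
  sumL-mono (x ∷ xs) h = +-mono-≤ (h (here refl)) (sumL-mono xs (h ∘ there))

  +-interchange : ∀ a b c d → (a + b) + (c + d) ≡ (a + c) + (b + d)
  +-interchange = solve 4 (λ a b c d → (a :+ b) :+ (c :+ d) := (a :+ c) :+ (b :+ d)) refl
    where open +-*-Solver

  sumL-+ : (f g : A → ℕ) (xs : List A) → sumL (λ x → f x + g x) xs ≡ sumL f xs + sumL g xs
  sumL-+ f g []       = refl
  sumL-+ f g (x ∷ xs) = trans (cong ((f x + g x) +_) (sumL-+ f g xs)) (+-interchange (f x) (g x) _ _)

  sumL-* : (c : ℕ) (f : A → ℕ) (xs : List A) → sumL (λ x → c * f x) xs ≡ c * sumL f xs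
  sumL-* c f []       = sym (*-zeroʳ c)
  sumL-* c f (x ∷ xs) = trans (cong (c * f x +_) (sumL-* c f xs)) (sym (*-distribˡ-+ c (f x) _))

  sumL-const : (c : ℕ) (xs : List A) → sumL (λ _ → c) xs ≡ length xs * c
  sumL-const c []       = refl
  sumL-const c (x ∷ xs) = cong (c +_) (sumL-const c xs)

  sumL-zero : {f : A → ℕ} (xs : List A) → (∀ {x} → x ∈ xs → f x ≡ 0) → sumL f xs ≡ 0
  sumL-zero xs h = trans (sumL-cong xs h) (trans (sumL-const 0 xs) (*-zeroʳ (length xs)))

  sumL-one : (xs : List A) → sumL (λ _ → 1) xs ≡ length xs
  sumL-one xs = trans (sumL-const 1 xs) (*-identityʳ _)

  sumL-swap : (f : A → B → ℕ) (xs : List A) (ys : List B) →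
    sumL (λ x → sumL (f x) ys) xs ≡ sumL (λ y → sumL (λ x → f x y) xs) ys
  sumL-swap f []       ys = sym (sumL-zero ys (λ _ → refl))
  sumL-swap f (x ∷ xs) ys =
    trans (cong (sumL (f x) ys +_) (sumL-swap f xs ys)) (sym (sumL-+ (f x) _ ys))

  sumL-map : (f : B → ℕ) (g : A → B) (xs : List A) → sumL f (map g xs) ≡ sumL (f ∘ g) xs
  sumL-map f g xs = cong sum (sym (ListP.map-∘ xs))

  sumL-concatMap : (f : B → ℕ) (g : A → List B) (xs : List A) →
    sumL f (concatMap g xs) ≡ sumL (λ x → sumL f (g x)) xs
  sumL-concatMap f g []       = refl
  sumL-concatMap f g (x ∷ xs) =
    trans (sumL-++ f (g x) (concatMap g xs)) (cong (sumL f (g x) +_) (sumL-concatMap f g xs))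

  ∈⇒∃++ : {x : A} {ys : List A} → x ∈ ys → ∃₂ λ as bs → ys ≡ as ++ x ∷ bs
  ∈⇒∃++ = MemP.∈-∃++

  ∈-remove : {x y : A} (as : List A) {bs : List A} → y ≢ x → y ∈ as ++ x ∷ bs → y ∈ as ++ bs
  ∈-remove as y≢x p with MemP.∈-++⁻ as p
  ... | inj₁ q         = MemP.∈-++⁺ˡ q
  ... | inj₂ (here e)  = ⊥-elim (y≢x e)
  ... | inj₂ (there q) = MemP.∈-++⁺ʳ as q

  All≢⇒∉ : {x : A} {xs : List A} → All (x ≢_) xs → ∀ {y} → y ∈ xs → y ≢ x
  All≢⇒∉ ps y∈ e = All.lookup ps y∈ (sym e)

  sumL-⊆ : (f : A → ℕ) {xs ys : List A} → Unique xs → (∀ {x} → x ∈ xs → x ∈ ys) → sumL f xs ≤ sumL f ys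
  sumL-⊆ f {[]}     {ys} u        s = z≤n
  sumL-⊆ f {x ∷ xs} {ys} (x# ∷ u) s with as , bs , refl ← ∈⇒∃++ (s (here refl)) = begin
      f x + sumL f xs
        ≤⟨ +-monoʳ-≤ (f x) (sumL-⊆ f u (λ y∈ → ∈-remove as (All≢⇒∉ x# y∈) (s (there y∈)))) ⟩
      f x + sumL f (as ++ bs)          ≡⟨ cong (f x +_) (sumL-++ f as bs) ⟩
      f x + (sumL f as + sumL f bs)    ≡⟨ solve 3 (λ a b c → a :+ (b :+ c) := b :+ (a :+ c)) refl (f x) (sumL f as) (sumL f bs) ⟩
      sumL f as + (f x + sumL f bs)    ≡⟨ sumL-++ f as (x ∷ bs) ⟨
      sumL f (as ++ x ∷ bs)            ∎
    where open ≤-Reasoning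
          open +-*-Solver

  length-⊆ : {xs ys : List A} → Unique xs → (∀ {x} → x ∈ xs → x ∈ ys) → length xs ≤ length ys
  length-⊆ {xs = xs} {ys} u s = begin
      length xs             ≡⟨ sumL-one xs ⟨
      sumL (λ _ → 1) xs     ≤⟨ sumL-⊆ (λ _ → 1) u s ⟩
      sumL (λ _ → 1) ys     ≡⟨ sumL-one ys ⟩
      length ys             ∎
    where open ≤-Reasoning

  ∷-unique : {x : A} {xs : List A} → x ∉ xs → Unique xs → Unique (x ∷ xs)
  ∷-unique x∉ u = All.tabulate (λ y∈ e → x∉ (subst (_∈ _) (sym e) y∈)) ∷ u

  map-unique : (g : A → B) {xs : List A} → Unique xs →
    (∀ {x y} → x ∈ xs → y ∈ xs → g x ≡ g y → x ≡ y) → Unique (map g xs)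
  map-unique g {[]}     u        inj = []
  map-unique g {x ∷ xs} (x# ∷ u) inj = ∷-unique
    (λ gx∈ → case MemP.∈-map⁻ g gx∈ of λ where
       (y , y∈ , e) → All.lookup x# y∈ (inj (here refl) (there y∈) e))
    (map-unique g u (λ p q → inj (there p) (there q)))

  concatMap-unique : (g : A → List B) {xs : List A} → Unique xs → (∀ {x} → x ∈ xs → Unique (g x)) →
    (∀ {x y b} → x ∈ xs → y ∈ xs → b ∈ g x → b ∈ g y → x ≡ y) → Unique (concatMap g xs)
  concatMap-unique g {[]}     u        v inj = []
  concatMap-unique g {x ∷ xs} (x# ∷ u) v inj =
    UniqueP.++⁺ (v (here refl)) (concatMap-unique g u (v ∘ there) (λ p q → inj (there p) (there q)))
      (λ (p , q) → let (y , y∈ , b∈) = find (MemP.∈-concatMap⁻ g {xs = xs} q)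
                   in All.lookup x# y∈ (inj (here refl) (there y∈) p b∈))

  ∈-concatMap : (g : A → List B) {xs : List A} {x : A} {b : B} → x ∈ xs → b ∈ g x → b ∈ concatMap g xs
  ∈-concatMap g x∈ b∈ = MemP.∈-concatMap⁺ g (Any.map (λ { refl → b∈ }) x∈)

  ∈-concatMap⁻ : (g : A → List B) {xs : List A} {b : B} → b ∈ concatMap g xs → ∃ λ x → x ∈ xs × b ∈ g x
  ∈-concatMap⁻ g {xs} p = find (MemP.∈-concatMap⁻ g {xs = xs} p)

  length-concatMap-≤ : (k : ℕ) (g : A → List B) (xs : List A) → (∀ x → length (g x) ≤ k) →
    length (concatMap g xs) ≤ length xs * k
  length-concatMap-≤ k g []       h = z≤n
  length-concatMap-≤ k g (x ∷ xs) h =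
    ≤-trans (≤-reflexive (ListP.length-++ (g x))) (+-mono-≤ (h x) (length-concatMap-≤ k g xs h))

  -- Positions are counted from the end of the list, so they survive consing.
  data At {A : Set} : List A → ℕ → A → Set where
    here  : ∀ {x xs} → At (x ∷ xs) (length xs) x
    there : ∀ {x y k xs} → At xs k x → At (y ∷ xs) k x

  At-< : {xs : List A} {k : ℕ} {x : A} → At xs k x → k < length xs
  At-< here      = ≤-refl
  At-< (there p) = m<n⇒m<1+n (At-< p)

  At⇒∈ : {xs : List A} {k : ℕ} {x : A} → At xs k x → x ∈ xs
  At⇒∈ here      = here refl
  At⇒∈ (there p) = there (At⇒∈ p)

  ∈⇒At : {xs : List A} {x : A} → x ∈ xs → ∃ λ k → At xs k x
  ∈⇒At {xs = x ∷ xs} (here refl) = length xs , here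
  ∈⇒At (there p) with k , a ← ∈⇒At p = k , there a

  At-fun′ : {xs : List A} {k l : ℕ} {x y : A} → k ≡ l → At xs k x → At xs l y → x ≡ y
  At-fun′ e here      here      = refl
  At-fun′ e here      (there q) = ⊥-elim (<⇒≢ (At-< q) (sym e))
  At-fun′ e (there p) here      = ⊥-elim (<⇒≢ (At-< p) e)
  At-fun′ e (there p) (there q) = At-fun′ e p q

  At-fun : {xs : List A} {k : ℕ} {x y : A} → At xs k x → At xs k y → x ≡ y
  At-fun = At-fun′ refl

  At-inj : {xs : List A} {k l : ℕ} {x : A} → Unique xs → At xs k x → At xs l x → k ≡ l
  At-inj u        here      here      = refl
  At-inj (x# ∷ u) here      (there q) = ⊥-elim (All.lookup x# (At⇒∈ q) refl)
  At-inj (x# ∷ u) (there p) here      = ⊥-elim (All.lookup x# (At⇒∈ p) refl)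
  At-inj (_ ∷ u)  (there p) (there q) = At-inj u p q

  <⇒At : (xs : List A) {k : ℕ} → k < length xs → ∃ λ x → At xs k x
  <⇒At (x ∷ xs) {k} k< with k ≟ length xs
  ... | yes refl = x , here
  ... | no  k≢   with y , a ← <⇒At xs (≤∧≢⇒< (≤-pred k<) k≢) = y , there a

  nth : (xs : List A) {n : ℕ} → length xs ≡ n → Fin n → A
  nth xs refl i = lookup xs i

  nth-∈ : (xs : List A) {n : ℕ} (e : length xs ≡ n) (i : Fin n) → nth xs e i ∈ xs
  nth-∈ xs refl i = MemP.∈-lookup i

  lookup-injective : {xs : List A} → Unique xs → (i j : Fin (length xs)) → lookup xs i ≡ lookup xs j → i ≡ j
  lookup-injective {xs = _ ∷ _} u        zero    zero    e = refl
  lookup-injective {xs = _ ∷ _} (x# ∷ u) zero    (suc j) e = ⊥-elim (All.lookup x# (MemP.∈-lookup j) e)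
  lookup-injective {xs = _ ∷ _} (x# ∷ u) (suc i) zero    e = ⊥-elim (All.lookup x# (MemP.∈-lookup i) (sym e))
  lookup-injective {xs = _ ∷ _} (x# ∷ u) (suc i) (suc j) e = cong suc (lookup-injective u i j e)

  nth-injective : {xs : List A} → Unique xs → {n : ℕ} (e : length xs ≡ n) {i j : Fin n} →
    nth xs e i ≡ nth xs e j → i ≡ j
  nth-injective u refl = lookup-injective u _ _

  ∈⇒nth : {xs : List A} {n : ℕ} (e : length xs ≡ n) {x : A} → x ∈ xs → ∃ λ i → nth xs e i ≡ x
  ∈⇒nth refl x∈ = Any.index x∈ , sym (AnyP.lookup-index x∈)

  length-filter-split : {P : A → Set} (P? : Decidable P) (xs : List A) →
    length xs ≡ length (filter P? xs) + length (filter (¬? ∘ P?) xs)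
  length-filter-split P? []       = refl
  length-filter-split P? (x ∷ xs) with P? x
  ... | yes _ = cong suc (length-filter-split P? xs)
  ... | no  _ = trans (cong suc (length-filter-split P? xs)) (sym (+-suc _ _))

  length-filter-filter : {P Q : A → Set} (P? : Decidable P) (Q? : Decidable Q) (xs : List A) →
    length (filter P? (filter Q? xs)) ≤ length (filter P? xs)
  length-filter-filter P? Q? [] = z≤n
  length-filter-filter P? Q? (x ∷ xs) with Q? x
  ... | yes _ with P? x
  ...   | yes _ = s≤s (length-filter-filter P? Q? xs)
  ...   | no  _ = length-filter-filter P? Q? xs
  length-filter-filter P? Q? (x ∷ xs) | no _ with P? x
  ...   | yes _ = m≤n⇒m≤1+n (length-filter-filter P? Q? xs)
  ...   | no  _ = length-filter-filter P? Q? xs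

  -- A pigeonhole principle by averaging. The elements of value s + 1 are split off, induction picks
  -- a value for the rest, and the larger of the two fibres is taken.
  large-fibre : (f : A → ℕ) (s : ℕ) (xs : List A) → (∀ {x} → x ∈ xs → f x ≤ s) →
    ∃ λ t → length xs ≤ suc s * length (filter (λ x → f x ≟ t) xs)
  large-fibre f zero xs h = 0 , ≤-reflexive (trans
    (cong length (sym (ListP.filter-all (λ x → f x ≟ 0) (All.tabulate (λ x∈ → n≤0⇒n≡0 (h x∈))))))
    (sym (+-identityʳ _)))
  large-fibre {A} f (suc s) xs h
    with t , p ← large-fibre f s (filter (λ x → ¬? (f x ≟ suc s)) xs)
      (λ x∈ → let (x∈xs , x≢) = MemP.∈-filter⁻ (λ x → ¬? (f x ≟ suc s)) {xs = xs} x∈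
              in ≤-pred (≤∧≢⇒< (h x∈xs) x≢)) =
    case ≤-total (F t) (F (suc s)) of λ where
      (inj₁ le) → suc s , bound (suc s) ≤-refl le
      (inj₂ le) → t , bound t le ≤-refl
    where
    open ≤-Reasoning
    F : ℕ → ℕ
    F t = length (filter (λ x → f x ≟ t) xs)
    ys = filter (λ x → ¬? (f x ≟ suc s)) xs
    bound : ∀ r → F (suc s) ≤ F r → F t ≤ F r → length xs ≤ suc (suc s) * F r
    bound r p₁ p₂ = begin
      length xs              ≡⟨ length-filter-split (λ x → f x ≟ suc s) xs ⟩
      F (suc s) + length ys  ≤⟨ +-mono-≤ p₁ (≤-trans p (*-monoʳ-≤ (suc s)
                                  (≤-trans (length-filter-filter _ _ xs) p₂))) ⟩
      F r + suc s * F r      ∎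

  does-true : {P : Set} (d : Dec P) → does d ≡ true → P
  does-true (yes p) _ = p

-- Partitions as hypergraphs on the parts

Part : ℕ → ℕ → Set
Part m₁ m₂ = Fin m₁ ⊎ Fin m₂

_≟P_ : {m₁ m₂ : ℕ} → DecidableEquality (Part m₁ m₂)
_≟P_ = SumP.≡-dec FinP._≟_ FinP._≟_

_≟U_ : {m₁ n₁ m₂ n₂ : ℕ} → DecidableEquality (KV m₁ n₁ m₂ n₂)
_≟U_ = SumP.≡-dec (ProdP.≡-dec FinP._≟_ FinP._≟_) (ProdP.≡-dec FinP._≟_ FinP._≟_)

transpose : {A : Set} → DecidableEquality A → A → A → A → A
transpose _≟_ a b x with x ≟ a | x ≟ b
... | yes _ | _     = b
... | no  _ | yes _ = a
... | no  _ | no  _ = x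

module _ {A : Set} (_≟_ : DecidableEquality A) where

  transpose-left : ∀ a b → transpose _≟_ a b a ≡ b
  transpose-left a b with a ≟ a
  ... | yes _ = refl
  ... | no  n = ⊥-elim (n refl)

  transpose-right : ∀ a b → transpose _≟_ a b b ≡ a
  transpose-right a b with b ≟ a | b ≟ b
  ... | yes e | _     = e
  ... | no  _ | yes _ = refl
  ... | no  _ | no  n = ⊥-elim (n refl)

  -- P relates a point to its image, so that one case distinction serves every property of a
  -- transposition used below.
  transpose-cases : (P : A → A → Set) → ∀ a b x → (x ≡ a → P a b) → (x ≡ b → P b a) →
    (x ≢ a → x ≢ b → P x x) → P x (transpose _≟_ a b x)
  transpose-cases P a b x p q r with x ≟ a | x ≟ b
  ... | yes refl | _        = p refl
  ... | no  _    | yes refl = q refl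
  ... | no  x≢a  | no  x≢b  = r x≢a x≢b

  transpose-involutive : ∀ a b x → transpose _≟_ a b (transpose _≟_ a b x) ≡ x
  transpose-involutive a b x = transpose-cases (λ y z → transpose _≟_ a b z ≡ y) a b x
    (λ _ → transpose-right a b) (λ _ → transpose-left a b) fixed
    where
    fixed : x ≢ a → x ≢ b → transpose _≟_ a b x ≡ x
    fixed x≢a x≢b with x ≟ a | x ≟ b
    ... | yes e | _     = ⊥-elim (x≢a e)
    ... | no  _ | yes e = ⊥-elim (x≢b e)
    ... | no  _ | no  _ = refl

inverse : {X : Graph} → Aut X → Aut X
inverse {X} γ = record
  { perm    = mk↔ₛ′ from to from-to to-from
  ; presAdj = λ u v → mk⇔
      (λ h → Equivalence.from (presAdj γ _ _) (subst₂ (Adj X) (sym (to-from u)) (sym (to-from v)) h))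
      (λ h → subst₂ (Adj X) (to-from u) (to-from v) (Equivalence.to (presAdj γ _ _) h)) }
  where
  to   = Inverse.to (perm γ)
  from = Inverse.from (perm γ)
  to-from : ∀ u → to (from u) ≡ u
  to-from u = Inverse.inverseˡ (perm γ) refl
  from-to : ∀ u → from (to u) ≡ u
  from-to u = Inverse.inverseʳ (perm γ) refl

-- Labels lie in any type with decidable equality: the explicit construction names a block by what
-- it is, the finite search uses `Fin`, and only `fromHasDist` turns labels into numbers.
module Labelled {m₁ n₁ m₂ n₂ : ℕ} {Lab : Set} (_≟L_ : DecidableEquality Lab)
                (c : KV m₁ n₁ m₂ n₂ → Lab) where

  U : Set
  U = KV m₁ n₁ m₂ n₂

  Pt : Set
  Pt = Part m₁ m₂

  Fixes : Aut (K m₁ n₁ m₂ n₂) → Set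
  Fixes γ = ∀ u v → (c u ≡ c v) ⇔ (c (act γ u) ≡ c (act γ v))

  fixes-inverse : ∀ γ → Fixes γ → Fixes (inverse γ)
  fixes-inverse γ fix u w = mk⇔
    (λ eq → Equivalence.from (fix _ _) (trans (cong c (to-from u)) (trans eq (sym (cong c (to-from w))))))
    (λ eq → trans (sym (cong c (to-from u))) (trans (Equivalence.to (fix _ _) eq) (cong c (to-from w))))
    where
    to-from : ∀ u → act γ (Inverse.from (perm γ) u) ≡ u
    to-from u = Inverse.inverseˡ (perm γ) refl

  Dist : Set
  Dist = (γ : Aut (K m₁ n₁ m₂ n₂)) → Nontrivial γ → ¬ Fixes γ

  Mem : Pt → Lab → Set
  Mem p e = ∃ λ u → partOf u ≡ p × c u ≡ e

  SlotInjective : Set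
  SlotInjective = ∀ {u u′} → partOf u ≡ partOf u′ → c u ≡ c u′ → u ≡ u′

  -- All labels that do not occur have the same members, namely none; `Mem p e` restricts the
  -- comparison to labels that occur.
  BlockExtensional : Set
  BlockExtensional = ∀ {e e′ p} → Mem p e → (∀ q → (Mem q e → Mem q e′) × (Mem q e′ → Mem q e)) → e ≡ e′

  slot : (p : Pt) → Set
  slot (inj₁ _) = Fin n₁
  slot (inj₂ _) = Fin n₂

  vertex : (p : Pt) → slot p → U
  vertex (inj₁ v) i = inj₁ (v , i)
  vertex (inj₂ b) i = inj₂ (b , i)

  mem? : (p : Pt) (e : Lab) → Dec (Mem p e)
  mem? (inj₁ v) e = map′ (λ (i , eq) → inj₁ (v , i) , refl , eq)
    (λ { (inj₁ (_ , i) , refl , eq) → i , eq }) (FinP.any? (λ i → c (inj₁ (v , i)) ≟L e))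
  mem? (inj₂ b) e = map′ (λ (i , eq) → inj₂ (b , i) , refl , eq)
    (λ { (inj₂ (_ , i) , refl , eq) → i , eq }) (FinP.any? (λ i → c (inj₂ (b , i)) ≟L e))

  -- What a distinguishing partition forces

  module Rigidity (dist : Dist) where

    rigid : (Φ Ψ : U → U) → (∀ u → Ψ (Φ u) ≡ u) → (∀ u → Φ (Ψ u) ≡ u) →
      (∀ u v → (partOf u ≡ partOf v → partOf (Φ u) ≡ partOf (Φ v)) × (partOf (Φ u) ≡ partOf (Φ v) → partOf u ≡ partOf v)) →
      (∀ u v → (c u ≡ c v → c (Φ u) ≡ c (Φ v)) × (c (Φ u) ≡ c (Φ v) → c u ≡ c v)) →
      ∀ u → Φ u ≡ u
    rigid Φ Ψ ΨΦ ΦΨ pp cc u = decidable-stable (Φ u ≟U u) λ Φu≢u →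
      dist γ (u , Φu≢u) (λ x y → mk⇔ (proj₁ (cc x y)) (proj₂ (cc x y)))
      where
      γ : Aut (K m₁ n₁ m₂ n₂)
      γ = record
        { perm    = mk↔ₛ′ Φ Ψ ΦΨ ΨΦ
        ; presAdj = λ x y → mk⇔ (λ h e → h (proj₂ (pp x y) e)) (λ h e → h (proj₁ (pp x y) e)) }

    -- The transposition of u and u′ respects parts and blocks, so it is an automorphism that fixes
    -- the partition and must be the identity.
    slot-injective : SlotInjective
    slot-injective {u} {u′} p≡ c≡ =
      trans (sym (transpose-right _≟U_ u u′))
        (rigid τ τ (transpose-involutive _≟U_ u u′) (transpose-involutive _≟U_ u u′)
          (λ x y → (λ e → trans (part x) (trans e (sym (part y)))) , (λ e → trans (sym (part x)) (trans e (part y))))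
          (λ x y → (λ e → trans (lab x) (trans e (sym (lab y)))) , (λ e → trans (sym (lab x)) (trans e (lab y)))) u′)
      where
      τ = transpose _≟U_ u u′
      part : ∀ x → partOf (τ x) ≡ partOf x
      part x = transpose-cases _≟U_ (λ y z → partOf z ≡ partOf y) u u′ x (λ _ → sym p≡) (λ _ → p≡) (λ _ _ → refl)
      lab : ∀ x → c (τ x) ≡ c x
      lab x = transpose-cases _≟U_ (λ y z → c z ≡ c y) u u′ x (λ _ → sym c≡) (λ _ → c≡) (λ _ _ → refl)

    -- By `slot-injective` a vertex is known from its part and its label. Hence a permutation σ of
    -- the parts and a change E of the labels define a map of the vertices as soon as the new block
    -- meets the new part; σ′ and E′ give the inverse map, and `rigid` makes it the identity.
    module Move (σ σ′ : Pt → Pt) (σ′σ : ∀ p → σ′ (σ p) ≡ p) (σσ′ : ∀ p → σ (σ′ p) ≡ p)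
                (E E′ : U → Lab)
                (E-cong : ∀ u v → c u ≡ c v → E u ≡ E v) (E′-cong : ∀ u v → c u ≡ c v → E′ u ≡ E′ v)
                (E-mem : ∀ u → Mem (σ (partOf u)) (E u)) (E′-mem : ∀ u → Mem (σ′ (partOf u)) (E′ u))
                (E′E : ∀ u w → c w ≡ E u → E′ w ≡ c u) (EE′ : ∀ u w → c w ≡ E′ u → E w ≡ c u) where

      Φ Ψ : U → U
      Φ u = proj₁ (E-mem u)
      Ψ u = proj₁ (E′-mem u)

      Φ-part : ∀ u → partOf (Φ u) ≡ σ (partOf u)
      Φ-part u = proj₁ (proj₂ (E-mem u))

      Φ-lab : ∀ u → c (Φ u) ≡ E u
      Φ-lab u = proj₂ (proj₂ (E-mem u))

      Ψ-part : ∀ u → partOf (Ψ u) ≡ σ′ (partOf u)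
      Ψ-part u = proj₁ (proj₂ (E′-mem u))

      Ψ-lab : ∀ u → c (Ψ u) ≡ E′ u
      Ψ-lab u = proj₂ (proj₂ (E′-mem u))

      ΨΦ : ∀ u → Ψ (Φ u) ≡ u
      ΨΦ u = slot-injective (trans (Ψ-part (Φ u)) (trans (cong σ′ (Φ-part u)) (σ′σ _)))
                            (trans (Ψ-lab (Φ u)) (E′E u (Φ u) (Φ-lab u)))

      ΦΨ : ∀ u → Φ (Ψ u) ≡ u
      ΦΨ u = slot-injective (trans (Φ-part (Ψ u)) (trans (cong σ (Ψ-part u)) (σσ′ _)))
                            (trans (Φ-lab (Ψ u)) (EE′ u (Ψ u) (Ψ-lab u)))

      fixed : ∀ u → Φ u ≡ u
      fixed = rigid Φ Ψ ΨΦ ΦΨ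
        (λ u v → (λ e → trans (Φ-part u) (trans (cong σ e) (sym (Φ-part v)))) ,
                 (λ e → trans (sym (σ′σ _)) (trans (cong σ′ (trans (sym (Φ-part u)) (trans e (Φ-part v)))) (σ′σ _))))
        (λ u v → (λ e → trans (Φ-lab u) (trans (E-cong u v e) (sym (Φ-lab v)))) ,
                 (λ e → trans (sym (E′E u (Φ v) (trans (sym e) (Φ-lab u)))) (E′E v (Φ v) (Φ-lab v))))

      part-fixed : ∀ u → σ (partOf u) ≡ partOf u
      part-fixed u = trans (sym (Φ-part u)) (cong partOf (fixed u))

      lab-fixed : ∀ u → E u ≡ c u
      lab-fixed u = trans (sym (Φ-lab u)) (cong c (fixed u))

    -- Two blocks with the same members can be exchanged inside each part: `Move` with σ the
    -- identity and E a transposition of labels.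
    block-extensional : BlockExtensional
    block-extensional {e} {e′} (u , _ , u∈e) same =
      trans (sym u∈e) (trans (sym (M.lab-fixed u)) (trans (cong τ u∈e) (transpose-left _≟L_ e e′)))
      where
      τ = transpose _≟L_ e e′
      mem : ∀ u → Mem (partOf u) (τ (c u))
      mem u = transpose-cases _≟L_ (λ y z → Mem (partOf u) y → Mem (partOf u) z) e e′ (c u)
        (λ _ → proj₁ (same _)) (λ _ → proj₂ (same _)) (λ _ _ → id) (u , refl , refl)
      ττ : ∀ u w → c w ≡ τ (c u) → τ (c w) ≡ c u
      ττ u w eq = trans (cong τ eq) (transpose-involutive _≟L_ e e′ (c u))
      module M = Move id id (λ _ → refl) (λ _ → refl) (τ ∘ c) (τ ∘ c)
        (λ _ _ → cong τ) (λ _ _ → cong τ) mem mem ττ ττ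

    Transports : (Pt → Pt) → Set
    Transports σ = ∀ u → ∃ λ e → ∀ p → (Mem p (c u) → Mem (σ p) e) × (Mem (σ p) e → Mem p (c u))

    -- `Transports` names a target block separately for every vertex. Extensionality shows that it
    -- depends on the block only and that the targets under σ and σ′ undo each other, which is what
    -- `Move` asks for.
    transport-trivial : (σ σ′ : Pt → Pt) → (∀ p → σ′ (σ p) ≡ p) → (∀ p → σ (σ′ p) ≡ p) →
      Transports σ → Transports σ′ → ∀ u → σ (partOf u) ≡ partOf u
    transport-trivial σ σ′ σ′σ σσ′ T T′ = M.part-fixed
      where
      well : (ρ ρ′ : Pt → Pt) → (∀ p → ρ (ρ′ p) ≡ p) → (S : Transports ρ) →
             ∀ u v → c u ≡ c v → proj₁ (S u) ≡ proj₁ (S v)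
      well ρ ρ′ ρρ′ S u v eq = block-extensional (proj₁ (proj₂ (S u) (partOf u)) (u , refl , refl)) λ q →
        (λ m → subst (λ z → Mem z (proj₁ (S v))) (ρρ′ q) (proj₁ (proj₂ (S v) (ρ′ q))
                 (subst (Mem (ρ′ q)) eq (proj₂ (proj₂ (S u) (ρ′ q)) (subst (λ z → Mem z (proj₁ (S u))) (sym (ρρ′ q)) m))))) ,
        (λ m → subst (λ z → Mem z (proj₁ (S u))) (ρρ′ q) (proj₁ (proj₂ (S u) (ρ′ q))
                 (subst (Mem (ρ′ q)) (sym eq) (proj₂ (proj₂ (S v) (ρ′ q)) (subst (λ z → Mem z (proj₁ (S v))) (sym (ρρ′ q)) m)))))
      back : (ρ ρ′ : Pt → Pt) → (∀ p → ρ′ (ρ p) ≡ p) → (∀ p → ρ (ρ′ p) ≡ p) →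
             (S : Transports ρ) (S′ : Transports ρ′) →
             ∀ u w → c w ≡ proj₁ (S u) → proj₁ (S′ w) ≡ c u
      back ρ ρ′ ρ′ρ ρρ′ S S′ u w eq = sym (block-extensional (u , refl , refl) λ q →
        (λ m → subst (λ z → Mem z (proj₁ (S′ w))) (ρ′ρ q) (proj₁ (proj₂ (S′ w) (ρ q))
                 (subst (Mem (ρ q)) (sym eq) (proj₁ (proj₂ (S u) q) m)))) ,
        (λ m → proj₂ (proj₂ (S u) q) (subst (Mem (ρ q)) eq
                 (proj₂ (proj₂ (S′ w) (ρ q)) (subst (λ z → Mem z (proj₁ (S′ w))) (sym (ρ′ρ q)) m)))))
      module M = Move σ σ′ σ′σ σσ′ (proj₁ ∘ T) (proj₁ ∘ T′) (well σ σ′ σσ′ T) (well σ′ σ σ′σ T′)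
        (λ u → proj₁ (proj₂ (T u) (partOf u)) (u , refl , refl))
        (λ u → proj₁ (proj₂ (T′ u) (partOf u)) (u , refl , refl))
        (back σ σ′ σ′σ σσ′ T T′) (back σ′ σ σσ′ σ′σ T′ T)

  -- The slots i₁ and i₂ supply a vertex in every part. Two vertices share a part exactly if they
  -- are not adjacent, so γ permutes the parts, and this permutation is read off from
  -- representatives.
  module Action (i₁ : Fin n₁) (i₂ : Fin n₂) (γ : Aut (K m₁ n₁ m₂ n₂)) where

    to from : U → U
    to   = Inverse.to (perm γ)
    from = Inverse.from (perm γ)

    to-from : ∀ u → to (from u) ≡ u
    to-from u = Inverse.inverseˡ (perm γ) refl

    from-to : ∀ u → from (to u) ≡ u
    from-to u = Inverse.inverseʳ (perm γ) refl

    rep : Pt → U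
    rep (inj₁ v) = inj₁ (v , i₁)
    rep (inj₂ b) = inj₂ (b , i₂)

    rep-part : ∀ p → partOf (rep p) ≡ p
    rep-part (inj₁ _) = refl
    rep-part (inj₂ _) = refl

    to-part : ∀ u v → partOf u ≡ partOf v → partOf (to u) ≡ partOf (to v)
    to-part u v e = decidable-stable (partOf (to u) ≟P partOf (to v))
      (λ ne → Equivalence.from (presAdj γ u v) ne e)

    from-part : ∀ u v → partOf u ≡ partOf v → partOf (from u) ≡ partOf (from v)
    from-part u v e = decidable-stable (partOf (from u) ≟P partOf (from v))
      (λ ne → Equivalence.to (presAdj γ (from u) (from v)) ne
                (trans (cong partOf (to-from u)) (trans e (cong partOf (sym (to-from v))))))

    σ σ′ : Pt → Pt
    σ  p = partOf (to (rep p))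
    σ′ p = partOf (from (rep p))

    part-to : ∀ u → partOf (to u) ≡ σ (partOf u)
    part-to u = to-part u _ (sym (rep-part (partOf u)))

    part-from : ∀ u → partOf (from u) ≡ σ′ (partOf u)
    part-from u = from-part u _ (sym (rep-part (partOf u)))

    σ′σ : ∀ p → σ′ (σ p) ≡ p
    σ′σ p = trans (sym (part-from (to (rep p)))) (trans (cong partOf (from-to (rep p))) (rep-part p))

    σσ′ : ∀ p → σ (σ′ p) ≡ p
    σσ′ p = trans (sym (part-to (from (rep p)))) (trans (cong partOf (to-from (rep p))) (rep-part p))

    -- An automorphism mixes small and large parts only if they have equal size.
    σ-small : n₁ ≢ n₂ → ∀ v → ∃ λ v′ → σ (inj₁ v) ≡ inj₁ v′
    σ-small n₁≢n₂ v with σ (inj₁ v) in eq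
    ... | inj₁ v′ = v′ , refl
    ... | inj₂ b  = ⊥-elim (n₁≢n₂ (≤-antisym (FinP.injective⇒≤ f-inj) (FinP.injective⇒≤ g-inj)))
      where
      f : ∀ i → ∃ λ k → to (inj₁ (v , i)) ≡ inj₂ (b , k)
      f i with to (inj₁ (v , i)) | trans (part-to (inj₁ (v , i))) eq
      ... | inj₂ (_ , k) | refl = k , refl
      f-inj : ∀ {i k} → proj₁ (f i) ≡ proj₁ (f k) → i ≡ k
      f-inj {i} {k} e = case trans (sym (from-to _)) (trans (cong from
        (trans (proj₂ (f i)) (trans (cong (λ z → inj₂ (b , z)) e) (sym (proj₂ (f k)))))) (from-to _)) of λ { refl → refl }
      g : ∀ i → ∃ λ k → from (inj₂ (b , i)) ≡ inj₁ (v , k)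
      g i with from (inj₂ (b , i)) | trans (part-from (inj₂ (b , i))) (trans (cong σ′ (sym eq)) (σ′σ (inj₁ v)))
      ... | inj₁ (_ , k) | refl = k , refl
      g-inj : ∀ {i k} → proj₁ (g i) ≡ proj₁ (g k) → i ≡ k
      g-inj {i} {k} e = case trans (sym (to-from _)) (trans (cong to
        (trans (proj₂ (g i)) (trans (cong (λ z → inj₁ (v , z)) e) (sym (proj₂ (g k)))))) (to-from _)) of λ { refl → refl }

    module _ (fix : Fixes γ) where

      mem-to : ∀ u p → Mem p (c u) → Mem (σ p) (c (to u))
      mem-to u p (w , refl , w∈) = to w , part-to w , Equivalence.to (fix w u) w∈

      mem-from : ∀ u p → Mem (σ p) (c (to u)) → Mem p (c u)
      mem-from u p (w , w-part , w∈) = from w ,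
        trans (part-from w) (trans (cong σ′ w-part) (σ′σ p)) ,
        Equivalence.from (fix (from w) u) (trans (cong c (to-from w)) w∈)

      -- If no part moves, the block of `to u` has the members of the block of u, so it is the same
      -- block; and that block has only the vertex u in its part.
      trivial : SlotInjective → BlockExtensional → (∀ p → σ p ≡ p) → ∀ u → to u ≡ u
      trivial slot-inj block-ext σ-id u = slot-inj (trans (part-to u) (σ-id _)) (sym (block-ext (u , refl , refl) λ q →
        (λ m → subst (λ z → Mem z (c (to u))) (σ-id q) (mem-to u q m)) ,
        (λ m → mem-from u q (subst (λ z → Mem z (c (to u))) (sym (σ-id q)) m))))

  distinguishes : Fin n₁ → Fin n₂ → SlotInjective → BlockExtensional →
    (∀ γ → Fixes γ → ∀ (i₁ : Fin n₁) (i₂ : Fin n₂) p → Action.σ i₁ i₂ γ p ≡ p) → Dist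
  distinguishes i₁ i₂ slot-inj block-ext h γ (v , v≢) fix =
    v≢ (Action.trivial i₁ i₂ γ fix slot-inj block-ext (h γ fix i₁ i₂) v)

-- Deciding whether a distinguishing partition exists

_→-dec_ : {A B : Set} → Dec A → Dec B → Dec (A → B)
yes a →-dec yes b = yes (λ _ → b)
yes a →-dec no ¬b = no (λ f → ¬b (f a))
no ¬a →-dec _     = yes (⊥-elim ∘ ¬a)

-- The least index with the same label is a canonical label. It moves every labelling into
-- `Fin size`, so that only finitely many labellings have to be searched.
first : {A : Set} → DecidableEquality A → {n : ℕ} → (Fin n → A) → Fin n → Fin n
first _≟_ f zero    = zero
first _≟_ f (suc i) with f (suc i) ≟ f zero
... | yes _ = zero
... | no  _ = suc (first _≟_ (f ∘ suc) i)

first-same : {A : Set} (_≟_ : DecidableEquality A) {n : ℕ} (f : Fin n → A) (i : Fin n) → f (first _≟_ f i) ≡ f i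
first-same _≟_ f zero    = refl
first-same _≟_ f (suc i) with f (suc i) ≟ f zero
... | yes e = sym e
... | no  _ = first-same _≟_ (f ∘ suc) i

first-cong : {A : Set} (_≟_ : DecidableEquality A) {n : ℕ} (f : Fin n → A) (i k : Fin n) → f i ≡ f k → first _≟_ f i ≡ first _≟_ f k
first-cong _≟_ f zero    zero    e = refl
first-cong _≟_ f zero    (suc k) e with f (suc k) ≟ f zero
... | yes _ = refl
... | no  n = ⊥-elim (n (sym e))
first-cong _≟_ f (suc i) zero    e with f (suc i) ≟ f zero
... | yes _ = refl
... | no  n = ⊥-elim (n e)
first-cong _≟_ f (suc i) (suc k) e with f (suc i) ≟ f zero | f (suc k) ≟ f zero
... | yes _ | yes _ = refl
... | yes p | no  q = ⊥-elim (q (trans (sym e) p))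
... | no  p | yes q = ⊥-elim (p (trans e q))
... | no  _ | no  _ = cong suc (first-cong _≟_ (f ∘ suc) i k e)

module _ {m₁ n₁ m₂ n₂ : ℕ} where

  size : ℕ
  size = m₁ * n₁ + m₂ * n₂

  enc : KV m₁ n₁ m₂ n₂ → Fin size
  enc (inj₁ (v , i)) = Fin.join (m₁ * n₁) (m₂ * n₂) (inj₁ (combine v i))
  enc (inj₂ (b , i)) = Fin.join (m₁ * n₁) (m₂ * n₂) (inj₂ (combine b i))

  dec : Fin size → KV m₁ n₁ m₂ n₂
  dec x with Fin.splitAt (m₁ * n₁) x
  ... | inj₁ y = inj₁ (remQuot n₁ y)
  ... | inj₂ y = inj₂ (remQuot n₂ y)

  dec-enc : ∀ u → dec (enc u) ≡ u
  dec-enc (inj₁ (v , i)) rewrite FinP.splitAt-join (m₁ * n₁) (m₂ * n₂) (inj₁ (combine v i)) =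
    cong inj₁ (FinP.remQuot-combine v i)
  dec-enc (inj₂ (b , i)) rewrite FinP.splitAt-join (m₁ * n₁) (m₂ * n₂) (inj₂ (combine b i)) =
    cong inj₂ (FinP.remQuot-combine b i)

  enc-dec : ∀ x → enc (dec x) ≡ x
  enc-dec x with Fin.splitAt (m₁ * n₁) x in eq
  ... | inj₁ y = trans (cong (Fin.join (m₁ * n₁) (m₂ * n₂) ∘ inj₁) (FinP.combine-remQuot {m₁} n₁ y))
                       (trans (cong (Fin.join (m₁ * n₁) (m₂ * n₂)) (sym eq)) (FinP.join-splitAt (m₁ * n₁) (m₂ * n₂) x))
  ... | inj₂ y = trans (cong (Fin.join (m₁ * n₁) (m₂ * n₂) ∘ inj₂) (FinP.combine-remQuot {m₂} n₂ y))
                       (trans (cong (Fin.join (m₁ * n₁) (m₂ * n₂)) (sym eq)) (FinP.join-splitAt (m₁ * n₁) (m₂ * n₂) x))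

  private
    N : ℕ
    N = size

  dist-kernel : {L L′ : Set} (_≟L_ : DecidableEquality L) (_≟L′_ : DecidableEquality L′)
    (c : KV m₁ n₁ m₂ n₂ → L) (c′ : KV m₁ n₁ m₂ n₂ → L′) →
    (∀ u v → (c u ≡ c v → c′ u ≡ c′ v) × (c′ u ≡ c′ v → c u ≡ c v)) →
    Labelled.Dist _≟L_ c → Labelled.Dist _≟L′_ c′
  dist-kernel _ _ c c′ same d γ nt fix = d γ nt λ u v → mk⇔
    (λ e → proj₂ (same _ _) (Equivalence.to (fix u v) (proj₁ (same u v) e)))
    (λ e → proj₂ (same u v) (Equivalence.from (fix u v) (proj₁ (same _ _) e)))

  HasDist : Set → Set
  HasDist L = Σ (DecidableEquality L) λ _≟L_ → ∃ λ c → Labelled.Dist {m₁} {n₁} {m₂} {n₂} _≟L_ c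

  normalise : {L : Set} → HasDist L → ∃ λ c → Labelled.Dist {m₁} {n₁} {m₂} {n₂} (FinP._≟_ {N}) c
  normalise (_≟L_ , c , d) = first _≟L_ (c ∘ dec) ∘ enc , dist-kernel _≟L_ FinP._≟_ c _
    (λ u v → (λ e → first-cong _≟L_ (c ∘ dec) _ _ (trans (cong c (dec-enc u)) (trans e (cong c (sym (dec-enc v)))))) ,
             (λ e → trans (back u) (trans (cong (c ∘ dec) e) (sym (back v))))) d
    where
    back : ∀ u → c u ≡ c (dec (first _≟L_ (c ∘ dec) (enc u)))
    back u = trans (cong c (sym (dec-enc u))) (sym (first-same _≟L_ (c ∘ dec) (enc u)))

  fromHasDist : {L : Set} → HasDist L → HasDistinguishingPartition (K m₁ n₁ m₂ n₂)
  fromHasDist h with c , d ← normalise h = toℕ ∘ c ,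
    dist-kernel FinP._≟_ _≟_ c _ (λ u v → cong toℕ , FinP.toℕ-injective) d

  module _ {L : Set} (_≟L_ : DecidableEquality L) (c : KV m₁ n₁ m₂ n₂ → L) where

    open Labelled {m₁} {n₁} {m₂} {n₂} _≟L_ c using (Dist; Fixes)

    private
      -- A map and its inverse are searched together, each coded by an element of `Fin (N ^ N)`;
      -- bijectivity then consists of two finite checks.
      Sym : (Fin N → Fin N) → (Fin N → Fin N) → Set
      Sym Φ Ψ = (∀ x → Ψ (Φ x) ≡ x) × (∀ x → Φ (Ψ x) ≡ x)
        × (∀ x y → (pt (Φ x) ≡ pt (Φ y) → pt x ≡ pt y) × (pt x ≡ pt y → pt (Φ x) ≡ pt (Φ y)))
        × (∀ x y → (lb x ≡ lb y → lb (Φ x) ≡ lb (Φ y)) × (lb (Φ x) ≡ lb (Φ y) → lb x ≡ lb y))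
        × (∃ λ x → Φ x ≢ x)
        where
        pt : Fin N → Part m₁ m₂
        pt x = partOf (dec x)
        lb : Fin N → L
        lb x = c (dec x)

      sym? : ∀ Φ Ψ → Dec (Sym Φ Ψ)
      sym? Φ Ψ = FinP.all? (λ x → Ψ (Φ x) FinP.≟ x) ×-dec FinP.all? (λ x → Φ (Ψ x) FinP.≟ x)
        ×-dec FinP.all? (λ x → FinP.all? λ y → ((_ ≟P _) →-dec (_ ≟P _)) ×-dec ((_ ≟P _) →-dec (_ ≟P _)))
        ×-dec FinP.all? (λ x → FinP.all? λ y → ((_ ≟L _) →-dec (_ ≟L _)) ×-dec ((_ ≟L _) →-dec (_ ≟L _)))
        ×-dec FinP.any? (λ x → ¬? (Φ x FinP.≟ x))

    -- A failure yields an actual automorphism instead of a negation; the symmetries of failed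
    -- mergers are later compared with each other.
    dist-or-symmetry : Dist ⊎ ∃ λ γ → Nontrivial γ × Fixes γ
    dist-or-symmetry with FinP.any? (λ a → FinP.any? λ b → sym? (finToFun a) (finToFun b))
    ... | yes (a , b , ΨΦ , ΦΨ , pp , ll , x , Φx≢) = inj₂ (γ , (dec x , λ e → Φx≢ (begin
          Φ x                  ≡⟨ cong Φ (enc-dec x) ⟨
          Φ (enc (dec x))      ≡⟨ enc-dec _ ⟨
          enc (dec (Φ (enc (dec x)))) ≡⟨ cong enc e ⟩
          enc (dec x)          ≡⟨ enc-dec x ⟩
          x                    ∎)) ,
          λ u v → mk⇔ (λ e → proj₁ (ll _ _) (trans (cong c (dec-enc u)) (trans e (cong c (sym (dec-enc v))))))
                      (λ e → trans (cong c (sym (dec-enc u))) (trans (proj₂ (ll _ _) e) (cong c (dec-enc v)))))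
          where
          open ≡-Reasoning
          Φ Ψ : Fin N → Fin N
          Φ = finToFun a
          Ψ = finToFun b
          γ : Aut (K m₁ n₁ m₂ n₂)
          γ = record
            { perm = mk↔ₛ′ (dec ∘ Φ ∘ enc) (dec ∘ Ψ ∘ enc)
                (λ u → trans (cong (dec ∘ Φ) (enc-dec _)) (trans (cong dec (ΦΨ _)) (dec-enc u)))
                (λ u → trans (cong (dec ∘ Ψ) (enc-dec _)) (trans (cong dec (ΨΦ _)) (dec-enc u)))
            ; presAdj = λ u v → mk⇔
                (λ h e → h (trans (cong partOf (sym (dec-enc u))) (trans (proj₁ (pp _ _) e) (cong partOf (dec-enc v)))))
                (λ h e → h (proj₂ (pp _ _) (trans (cong partOf (dec-enc u)) (trans e (cong partOf (sym (dec-enc v)))))))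
            }
    ... | no ¬sym = inj₁ λ γ (v , γv≢v) fix → ¬sym (witness γ v γv≢v fix)
      where
      witness : ∀ γ v → act γ v ≢ v → Fixes γ → ∃ λ a → ∃ λ b → Sym (finToFun a) (finToFun b)
      witness γ v γv≢v fix = funToFin f , funToFin g ,
          (λ x → trans (gg _) (trans (cong g (ff x)) (trans (cong (enc ∘ from) (dec-enc _)) (trans (cong enc (Inverse.inverseʳ (perm γ) refl)) (enc-dec x))))) ,
          (λ x → trans (ff _) (trans (cong f (gg x)) (trans (cong (enc ∘ to) (dec-enc _)) (trans (cong enc (Inverse.inverseˡ (perm γ) refl)) (enc-dec x))))) ,
          (λ x y → (λ e → decidable-stable (_ ≟P _) λ ne →
                       Equivalence.to (presAdj γ (dec x) (dec y)) ne (trans (cong partOf (sym (df x))) (trans e (cong partOf (df y))))) ,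
                   (λ e → decidable-stable (_ ≟P _) λ ne →
                       Equivalence.from (presAdj γ (dec x) (dec y))
                         (λ e′ → ne (trans (cong partOf (df x)) (trans e′ (cong partOf (sym (df y)))))) e)) ,
          (λ x y → (λ e → trans (cong c (df x)) (trans (Equivalence.to (fix _ _) e) (cong c (sym (df y))))) ,
                   (λ e → Equivalence.from (fix _ _) (trans (cong c (sym (df x))) (trans e (cong c (df y)))))) ,
          enc v , λ e → γv≢v (trans (cong to (sym (dec-enc v))) (trans (sym (df (enc v))) (trans (cong dec e) (dec-enc v))))
        where
        to from : KV m₁ n₁ m₂ n₂ → KV m₁ n₁ m₂ n₂
        to = Inverse.to (perm γ)
        from = Inverse.from (perm γ)
        f g : Fin N → Fin N
        f x = enc (to (dec x))
        g x = enc (from (dec x))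
        ff : ∀ x → finToFun (funToFin f) x ≡ f x
        ff = FinP.finToFun-funToFin f
        gg : ∀ x → finToFun (funToFin g) x ≡ g x
        gg = FinP.finToFun-funToFin g
        df : ∀ x → dec (finToFun (funToFin f) x) ≡ to (dec x)
        df x = trans (cong dec (ff x)) (dec-enc _)

  private
    dist? : (c : KV m₁ n₁ m₂ n₂ → Fin N) → Dec (Labelled.Dist {m₁} {n₁} {m₂} {n₂} FinP._≟_ c)
    dist? c with dist-or-symmetry FinP._≟_ c
    ... | inj₁ d              = yes d
    ... | inj₂ (γ , nt , fix) = no λ d → d γ nt fix

    eq : (c : KV m₁ n₁ m₂ n₂ → Fin N) → ∀ u → finToFun (funToFin (c ∘ dec)) (enc u) ≡ c u
    eq c u = trans (FinP.finToFun-funToFin (c ∘ dec) (enc u)) (cong c (dec-enc u))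

  hasDistinguishingPartition? : Dec (HasDistinguishingPartition (K m₁ n₁ m₂ n₂))
  hasDistinguishingPartition? with FinP.any? {N ^ N} (λ a → dist? (finToFun a ∘ enc))
  ... | yes (a , d) = yes (fromHasDist (FinP._≟_ , _ , d))
  ... | no  none    = no λ (c , d) → let (c′ , d′) = normalise (_≟_ , c , d) in
    none (funToFin (c′ ∘ dec) , dist-kernel FinP._≟_ FinP._≟_ c′ _
      (λ u v → (λ e → trans (eq c′ u) (trans e (sym (eq c′ v)))) ,
               (λ e → trans (sym (eq c′ u)) (trans e (eq c′ v)))) d′)

-- Exploration of a hypergraph: its tree components and their codes

data Letter (X : Set) : Set where
  next : Letter X
  add  : Letter X
  edge : X → Letter X

-- A new vertex always belongs to the edge opened last, which is the head of the list.
addHead : {X : Set} → ℕ → List (X × List ℕ) → List (X × List ℕ)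
addHead p []            = []
addHead p ((x , I) ∷ D) = (x , p ∷ I) ∷ D

-- A word, read from its end, describes a search of a tree-like hypergraph: the vertex being
-- processed, the number of vertices found, and the edges as lists of vertex positions.
decode : {X : Set} → List (Letter X) → ℕ × ℕ × List (X × List ℕ)
decode []            = 0 , 1 , []
decode (next ∷ w)    = let (i , p , D) = decode w in suc i , p , D
decode (add ∷ w)     = let (i , p , D) = decode w in i , suc p , addHead p D
decode (edge x ∷ w)  = let (i , p , D) = decode w in i , p , (x , i ∷ []) ∷ D

module Explore {m n : ℕ} {Lab : Set} (_≟L_ : DecidableEquality Lab) {X : Set} (A : Lab → X)
               (inc : Fin m → Fin n → Lab) where

  Inc : Fin m → Lab → Set
  Inc z e = ∃ λ j → inc z j ≡ e

  inc? : ∀ z e → Dec (Inc z e)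
  inc? z e = FinP.any? (λ j → inc z j ≟L e)

  members : Lab → List (Fin m)
  members e = filter (λ z → inc? z e) (allFin m)

  members-unique : ∀ e → Unique (members e)
  members-unique e = UniqueP.filter⁺ (λ z → inc? z e) (UniqueP.allFin⁺ m)

  ∈-members : ∀ {z e} → Inc z e → z ∈ members e
  ∈-members {z} {e} p = MemP.∈-filter⁺ (λ z → inc? z e) (MemP.∈-allFin z) p

  ∈-members⁻ : ∀ {z e} → z ∈ members e → Inc z e
  ∈-members⁻ {z} {e} p = proj₂ (MemP.∈-filter⁻ (λ z → inc? z e) {xs = allFin m} p)

  excess : Lab → ℕ
  excess e = length (members e) ∸ 1

  Closed : (Fin m → Set) → Set
  Closed P = ∀ {e z z′} → Inc z e → Inc z′ e → P z → P z′

  _∈V?_ : (z : Fin m) (xs : List (Fin m)) → Dec (z ∈ xs)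
  z ∈V? xs = Any.any? (z FinP.≟_) xs

  _∈L?_ : (e : Lab) (D : List Lab) → Dec (e ∈ D)
  e ∈L? D = Any.any? (e ≟L_) D

  Match : List (Fin m) → X × List ℕ → Lab → Set
  Match seen (x , I) e = x ≡ A e
    × (∀ {z} → Inc z e → ∃ λ k → k ∈ I × At seen k z)
    × (∀ {k} → k ∈ I → ∃ λ z → At seen k z × Inc z e)

  _⊑_ : List (Fin m) → List (Fin m) → Set
  seen ⊑ seen′ = ∀ {k z} → At seen k z → At seen′ k z

  match-mono : ∀ {seen seen′ xI e} → seen ⊑ seen′ → Match seen xI e → Match seen′ xI e
  match-mono s (eq , f , g) = eq , (λ p → let (k , k∈ , a) = f p in k , k∈ , s a) ,
                                   (λ p → let (z , a , q) = g p in z , s a , q)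

  matches-mono : ∀ {seen seen′ DI D} → seen ⊑ seen′ → Pointwise (Match seen) DI D → Pointwise (Match seen′) DI D
  matches-mono s []       = []
  matches-mono s (m ∷ ms) = match-mono s m ∷ matches-mono s ms

  -- δ counts the members in zs that had been found before. Such a repetition closes a cycle;
  -- without one, `code` extends the word by one `add` for each new vertex. `old` stands for the
  -- members that I lists already.
  record Added (e : Lab) (seen zs : List (Fin m)) : Set₁ where
    field
      seen′   : List (Fin m)
      δ       : ℕ
      grows   : seen ⊑ seen′
      has     : ∀ {z} → z ∈ zs → z ∈ seen′
      only    : ∀ {z} → z ∈ seen′ → z ∈ seen ⊎ z ∈ zs
      uniq    : Unique seen → Unique seen′
      len     : length seen′ + δ ≡ length seen + length zs
      code    : δ ≡ 0 → ∀ {i I DI w} {old : Fin m → Set} → decode w ≡ (i , length seen , (A e , I) ∷ DI) →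
                (∀ {z} → old z → ∃ λ k → k ∈ I × At seen k z) →
                (∀ {k} → k ∈ I → ∃ λ z → At seen k z × Inc z e) →
                ∃₂ λ w′ I′ → decode w′ ≡ (i , length seen′ , (A e , I′) ∷ DI)
                  × length w′ ≡ length w + length zs
                  × (∀ {z} → old z ⊎ z ∈ zs → ∃ λ k → k ∈ I′ × At seen′ k z)
                  × (∀ {k} → k ∈ I′ → ∃ λ z → At seen′ k z × Inc z e)

  addAll : ∀ e seen zs → (∀ {z} → z ∈ zs → Inc z e) → Added e seen zs
  addAll e seen [] h = record
    { seen′ = seen ; δ = 0 ; grows = id ; has = λ () ; only = inj₁ ; uniq = id ; len = refl
    ; code = λ _ {I = I} {w = w} dw f g → w , I , dw , sym (+-identityʳ _) , (λ { (inj₁ o) → f o }) , g }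
  addAll e seen (z ∷ zs) h with z ∈V? seen
  ... | yes z∈ = record
    { seen′ = seen′ ; δ = suc δ ; grows = grows
    ; has   = λ { (here refl) → At⇒∈ (grows (proj₂ (∈⇒At z∈))) ; (there p) → has p }
    ; only  = λ p → case only p of λ { (inj₁ q) → inj₁ q ; (inj₂ q) → inj₂ (there q) }
    ; uniq  = uniq
    ; len   = trans (+-suc _ _) (trans (cong suc len) (sym (+-suc _ _)))
    ; code  = λ () }
    where open Added (addAll e seen zs (h ∘ there))
  ... | no z∉ = record
    { seen′ = seen′ ; δ = δ ; grows = grows ∘ there
    ; has   = λ { (here refl) → At⇒∈ (grows here) ; (there p) → has p }
    ; only  = λ p → case only p of λ { (inj₁ (here refl)) → inj₂ (here refl) ; (inj₁ (there q)) → inj₁ q ; (inj₂ q) → inj₂ (there q) }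
    ; uniq  = λ u → uniq (∷-unique z∉ u)
    ; len   = trans len (sym (+-suc _ _))
    ; code  = λ δ≡0 {i} {I} {DI} {w} {old} dw f g →
        let (w′ , I′ , dw′ , lw′ , f′ , g′) = code δ≡0 {i} {length seen ∷ I} {DI} {add ∷ w} {λ y → old y ⊎ y ≡ z}
              (cong (λ (i , p , D) → i , suc p , addHead p D) dw)
              (λ { (inj₁ o) → let (k , k∈ , a) = f o in k , there k∈ , there a
                 ; (inj₂ refl) → _ , here refl , here })
              (λ { (here refl) → z , here , h (here refl)
                 ; (there k∈) → let (y , a , p) = g k∈ in y , there a , p })
        in w′ , I′ , dw′ , trans lw′ (sym (+-suc _ _)) ,
           (λ { (inj₁ o) → f′ (inj₁ (inj₁ o)) ; (inj₂ (here refl)) → f′ (inj₁ (inj₂ refl)) ; (inj₂ (there q)) → f′ (inj₂ q) }) , g′ }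
    where open Added (addAll e (z ∷ seen) zs (h ∘ there))

  Coded : List (Fin m) → List Lab → ℕ → List (Letter X) → Set
  Coded seen D i w = ∃ λ DI → decode w ≡ (i , length seen , DI) × Pointwise (Match seen) DI D

  -- A breadth-first search with `seen` in order of discovery and its first i vertices processed.
  -- `conn` replaces paths: a closed set containing the root contains all of `seen`. For `count`, an
  -- edge with s members brings at most s - 1 new vertices, and δ records repetitions. The bound in
  -- `code` is strict since there is one `next` per processed vertex, one `edge` per edge and one
  -- `add` per vertex other than the root.
  record Inv (root : Fin m) (seen : List (Fin m)) (D : List Lab) (i δ : ℕ) : Set where
    field
      root∈   : root ∈ seen
      i≤      : i ≤ length seen
      uniq    : Unique seen
      uniqD   : Unique D
      full    : ∀ {e z} → e ∈ D → Inc z e → z ∈ seen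
      touch   : ∀ {e} → e ∈ D → ∃ λ z → Inc z e
      conn    : ∀ (P : Fin m → Bool) → Closed (λ z → P z ≡ true) → P root ≡ true → ∀ {z} → z ∈ seen → P z ≡ true
      done    : ∀ {k z} → k < i → At seen k z → ∀ j → inc z j ∈ D
      count   : length seen + δ ≤ suc (sumL excess D)
      code    : δ ≡ 0 → ∃ λ w → Coded seen D i w × length w < i + length D + length seen

  start : ∀ r → Inv r (r ∷ []) [] 0 0
  start r = record
    { root∈ = here refl ; i≤ = z≤n ; uniq = [] ∷ [] ; uniqD = [] ; full = λ () ; touch = λ ()
    ; conn = λ { P c Pr (here refl) → Pr } ; done = λ () ; count = ≤-refl
    ; code = λ _ → [] , ([] , refl , []) , s≤s z≤n }

  record Step (root v : Fin m) (seen : List (Fin m)) (D : List Lab) (i : ℕ) (Done : Lab → Set) : Set where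
    field
      seen′ : List (Fin m)
      D′    : List Lab
      δ′    : ℕ
      inv   : Inv root seen′ D′ i δ′
      grows : seen ⊑ seen′
      keeps : ∀ {e} → e ∈ D → e ∈ D′
      did   : ∀ {e} → Done e → e ∈ D′

  edgeStep : ∀ {r seen D i δ v} → Inv r seen D i δ → At seen i v → ∀ j → Step r v seen D i (_≡ inc v j)
  edgeStep {r} {seen} {D} {i} {δ} {v} I at j with inc v j ∈L? D
  ... | yes e∈ = record { inv = I ; grows = id ; keeps = id ; did = λ { refl → e∈ } }
  ... | no e∉ = record
    { D′ = e ∷ D ; δ′ = δ + Added.δ ad
    ; inv = record
      { root∈ = At⇒∈ (ad.grows (proj₂ (∈⇒At root∈)))
      ; i≤    = ≤-trans (<⇒≤ (At-< at)) grow-len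
      ; uniq  = ad.uniq uniq
      ; uniqD = ∷-unique e∉ uniqD
      ; full  = λ { {z = z} (here refl) p → full-e p ; (there e∈) p → old∈ (full e∈ p) }
      ; touch = λ { (here refl) → v , j , refl ; (there e∈) → touch e∈ }
      ; conn  = λ P cl Pr z∈ → case ad.only z∈ of λ where
          (inj₁ q) → conn P cl Pr q
          (inj₂ q) → cl (j , refl) (zs-inc q) (conn P cl Pr (At⇒∈ at))
      ; done  = λ k< a j′ → case <⇒At seen (<-≤-trans k< (<⇒≤ (At-< at))) of λ where
          (z′ , a′) → there (done k< (subst (At seen _) (At-fun (ad.grows a′) a) a′) j′)
      ; count = count′
      ; code  = code′ }
    ; grows = ad.grows ; keeps = there ; did = λ { refl → here refl } }
    where
    open Inv I
    open ≤-Reasoning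
    e = inc v j
    zs = filter (λ z → ¬? (z FinP.≟ v)) (members e)
    zs-inc : ∀ {z} → z ∈ zs → Inc z e
    zs-inc p = ∈-members⁻ (proj₁ (MemP.∈-filter⁻ (λ z → ¬? (z FinP.≟ v)) {xs = members e} p))
    ad : Added e seen zs
    ad = addAll e seen zs zs-inc
    module ad = Added ad
    old∈ : ∀ {z} → z ∈ seen → z ∈ ad.seen′
    old∈ z∈ = At⇒∈ (ad.grows (proj₂ (∈⇒At z∈)))
    grow-len : length seen ≤ length ad.seen′
    grow-len = length-⊆ uniq old∈
    split : ∀ {z} → Inc z e → z ≡ v ⊎ z ∈ zs
    split {z} p with z FinP.≟ v
    ... | yes z≡v = inj₁ z≡v
    ... | no  z≢v = inj₂ (MemP.∈-filter⁺ (λ z → ¬? (z FinP.≟ v)) (∈-members p) z≢v)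
    full-e : ∀ {z} → Inc z e → z ∈ ad.seen′
    full-e p with split p
    ... | inj₁ refl = old∈ (At⇒∈ at)
    ... | inj₂ q    = ad.has q
    zs-len : length zs ≤ excess e
    zs-len = ∸-monoˡ-≤ 1 (length-⊆ {xs = v ∷ zs}
      (∷-unique (λ p → proj₂ (MemP.∈-filter⁻ (λ z → ¬? (z FinP.≟ v)) {xs = members e} p) refl)
                (UniqueP.filter⁺ (λ z → ¬? (z FinP.≟ v)) (members-unique e)))
      (λ { (here refl) → ∈-members (j , refl) ; (there p) → ∈-members (zs-inc p) }))
    count′ : length ad.seen′ + (δ + ad.δ) ≤ suc (excess e + sumL excess D)
    count′ = begin
      length ad.seen′ + (δ + ad.δ)        ≡⟨ cong (length ad.seen′ +_) (+-comm δ ad.δ) ⟩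
      length ad.seen′ + (ad.δ + δ)        ≡⟨ +-assoc (length ad.seen′) ad.δ δ ⟨
      length ad.seen′ + ad.δ + δ          ≡⟨ cong (_+ δ) ad.len ⟩
      length seen + length zs + δ         ≡⟨ trans (+-assoc (length seen) _ _) (trans (cong (length seen +_) (+-comm (length zs) δ)) (sym (+-assoc (length seen) _ _))) ⟩
      length seen + δ + length zs         ≤⟨ +-mono-≤ count zs-len ⟩
      suc (sumL excess D) + excess e      ≡⟨ cong suc (+-comm (sumL excess D) (excess e)) ⟩
      suc (excess e + sumL excess D)      ∎
    code′ : δ + ad.δ ≡ 0 → ∃ λ w → Coded ad.seen′ (e ∷ D) i w × length w < i + length (e ∷ D) + length ad.seen′
    code′ eq with w , (DI , dw , ms) , lw ← code (m+n≡0⇒m≡0 δ eq)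
             with w′ , I′ , dw′ , lw′ , f , g ← ad.code (m+n≡0⇒n≡0 δ eq) {i} {i ∷ []} {DI} {edge (A e) ∷ w} {_≡ v}
               (cong (λ (i , p , D) → i , p , (A e , i ∷ []) ∷ D) dw)
               (λ { refl → i , here refl , at })
               (λ { (here refl) → v , at , j , refl }) =
      w′ , ((A e , I′) ∷ DI , dw′ , (refl , (λ p → f (split p)) , g) ∷ matches-mono ad.grows ms) , (begin-strict
        length w′                                  ≡⟨ lw′ ⟩
        suc (length w + length zs)                 <⟨ s≤s (+-monoˡ-< (length zs) lw) ⟩
        suc (i + length D + length seen + length zs) ≡⟨ cong suc (+-assoc (i + length D) _ _) ⟩
        suc (i + length D + (length seen + length zs)) ≡⟨ cong (λ z → suc (i + length D + z)) (trans (sym ad.len) (trans (cong (length ad.seen′ +_) (m+n≡0⇒n≡0 δ eq)) (+-identityʳ _))) ⟩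
        suc (i + length D) + length ad.seen′       ≡⟨ cong (_+ length ad.seen′) (+-suc i (length D)) ⟨
        i + suc (length D) + length ad.seen′       ∎)

  slotsStep : ∀ {r seen D i δ v} → Inv r seen D i δ → At seen i v → (js : List (Fin n)) →
              Step r v seen D i (λ e → ∃ λ j → j ∈ js × e ≡ inc v j)
  slotsStep I at []       = record { inv = I ; grows = id ; keeps = id ; did = λ () }
  slotsStep {v = v} I at (j ∷ js) = record
    { inv = S₂.inv ; grows = S₂.grows ∘ S₁.grows ; keeps = S₂.keeps ∘ S₁.keeps
    ; did = λ { (_ , here refl , eq) → S₂.keeps (S₁.did eq) ; (j′ , there p , eq) → S₂.did (j′ , p , eq) } }
    where
    module S₁ = Step (edgeStep I at j)
    module S₂ = Step (slotsStep S₁.inv (S₁.grows at) js)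

  record Component : Set where
    field
      root   : Fin m
      seen   : List (Fin m)
      D      : List Lab
      δ      : ℕ
      root∈  : root ∈ seen
      uniq   : Unique seen
      uniqD  : Unique D
      full   : ∀ {e z} → e ∈ D → Inc z e → z ∈ seen
      touch  : ∀ {e} → e ∈ D → ∃ λ z → Inc z e
      conn   : ∀ (P : Fin m → Bool) → Closed (λ z → P z ≡ true) → P root ≡ true → ∀ {z} → z ∈ seen → P z ≡ true
      labels : ∀ {e z} → z ∈ seen → Inc z e → e ∈ D
      count  : length seen + δ ≤ suc (sumL excess D)
      code   : δ ≡ 0 → ∃₂ λ w DI → decode w ≡ (length seen , length seen , DI)
               × Pointwise (Match seen) DI D × length w ≤ (2 + n) * length seen

    closed : Closed (_∈ seen)
    closed p q z∈ = full (labels z∈ p) q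

    connected-root : (P : Fin m → Set) → (∀ z → Dec (P z)) → Closed P → P root → ∀ {z} → z ∈ seen → P z
    connected-root P P? cl Pr {z} z∈ = does-true (P? z) (conn (λ z → does (P? z))
      (λ p q e → dec-true (P? _) (cl p q (does-true (P? _) e))) (dec-true (P? root) Pr) z∈)

    -- `Closed` treats its two vertices alike, so the complement of a closed set is closed. If the
    -- root lay outside P, then so would v.
    connected : (P : Fin m → Set) → (∀ z → Dec (P z)) → Closed P → ∀ {v} → v ∈ seen → P v → ∀ {z} → z ∈ seen → P z
    connected P P? cl {v} v∈ Pv with P? root
    ... | yes Pr = connected-root P P? cl Pr
    ... | no ¬Pr = ⊥-elim (connected-root (λ z → ¬ P z) (¬? ∘ P?) (λ p q ¬Pz Pz′ → ¬Pz (cl q p Pz′)) ¬Pr v∈ Pv)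

  -- Each round processes one more vertex and at most m can be found, so m rounds are enough. The
  -- factor 2 + n bounds one `next`, one `add` and n edges per vertex, as a vertex has n slots.
  search : (fuel : ℕ) → ∀ {r seen D i δ} → Inv r seen D i δ → m ≤ fuel + i → Σ Component λ T → Component.root T ≡ r
  search fuel {r} {seen} {D} {i} {δ} I m≤ with i ≟ length seen
  ... | yes refl = record
    { root = r ; seen = seen ; D = D ; δ = δ ; root∈ = root∈ ; uniq = uniq ; uniqD = uniqD ; full = full ; touch = touch
    ; conn = conn ; labels = labels ; count = count
    ; code = λ δ≡0 → let (w , (DI , dw , ms) , lw) = code δ≡0 in w , DI , dw , ms , ≤-trans (<⇒≤ lw) bound } , refl
    where
    open Inv I
    open ≤-Reasoning
    labels : ∀ {e z} → z ∈ seen → Inc z e → e ∈ D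
    labels z∈ (j , refl) = let (k , a) = ∈⇒At z∈ in done (At-< a) a j
    D-len : length D ≤ length seen * n
    D-len = ≤-trans (length-⊆ uniqD λ e∈ → case touch e∈ of λ where
        (z , j , refl) → ∈-concatMap (λ z → map (inc z) (allFin n)) (full e∈ (j , refl)) (MemP.∈-map⁺ (inc z) (MemP.∈-allFin j)))
      (length-concatMap-≤ n _ seen λ z → ≤-reflexive (trans (ListP.length-map (inc z) (allFin n)) (ListP.length-tabulate {n = n} id)))
    bound : length seen + length D + length seen ≤ (2 + n) * length seen
    bound = begin
      length seen + length D + length seen       ≤⟨ +-monoˡ-≤ (length seen) (+-monoʳ-≤ (length seen) D-len) ⟩
      length seen + length seen * n + length seen ≡⟨ solve 2 (λ a n → a :+ a :* n :+ a := (con 2 :+ n) :* a) refl (length seen) n ⟩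
      (2 + n) * length seen ∎
      where open +-*-Solver
  search zero {r} {seen} {D} {i} {δ} I m≤ | no i≢ =
    ⊥-elim (i≢ (≤-antisym i≤ (≤-trans (≤-trans (length-⊆ uniq (λ {z} _ → MemP.∈-allFin z)) (≤-reflexive (ListP.length-tabulate {n = m} id))) m≤)))
    where open Inv I
  search (suc fuel) {r} {seen} {D} {i} {δ} I m≤ | no i≢ with v , at ← <⇒At seen (≤∧≢⇒< (Inv.i≤ I) i≢) =
    search fuel inv′ (≤-trans m≤ (≤-reflexive (sym (+-suc fuel i))))
    where
    module S = Step (slotsStep I at (allFin n))
    open Inv S.inv
    inv′ : Inv r S.seen′ S.D′ (suc i) S.δ′
    inv′ = record
      { root∈ = root∈ ; i≤ = At-< (S.grows at) ; uniq = uniq ; uniqD = uniqD ; full = full ; touch = touch ; conn = conn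
      ; done = λ {k} {z} k< a j → case k ≟ i of λ where
          (yes refl) → subst (λ y → inc y j ∈ S.D′) (At-fun (S.grows at) a) (S.did (j , MemP.∈-allFin j , refl))
          (no k≢i)   → done (≤∧≢⇒< (≤-pred k<) k≢i) a j
      ; count = count
      ; code = λ δ≡0 → let (w , (DI , dw , ms) , lw) = code δ≡0 in
          next ∷ w , (DI , cong (λ (i , p , D) → suc i , p , D) dw , ms) , s≤s lw }

  explore : ∀ r → Σ Component λ T → Component.root T ≡ r
  explore r = search m (start r) (≤-reflexive (sym (+-identityʳ m)))

  Apart : Component → Component → Set
  Apart T T′ = ∀ {z} → z ∈ Component.seen T → z ∉ Component.seen T′

  -- `trees` keeps the components with δ = 0 only. The total excess of the edges of a component is
  -- at least its number of vertices if δ ≥ 1, and at least that number minus one otherwise; so only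
  -- trees need a summand of their own in `count`.
  record Search : Set where
    field
      found  : List (Fin m)
      labs   : List Lab
      trees  : List Component
      closed : Closed (_∈ found)
      uniqL  : Unique labs
      met    : ∀ {e} → e ∈ labs → ∃ λ z → z ∈ found × Inc z e
      inside : ∀ {T} → T ∈ trees → Component.δ T ≡ 0 × (∀ {z} → z ∈ Component.seen T → z ∈ found)
      apart  : AllPairs Apart trees
      count  : length found ≤ length trees + sumL excess labs

  extend : ∀ v (S : Search) → Σ Search λ S′ → (∀ {z} → z ∈ Search.found S → z ∈ Search.found S′) × v ∈ Search.found S′
  extend v S with v ∈V? Search.found S
  ... | yes v∈ = S , id , v∈
  ... | no  v∉ with T , refl ← explore v = finish (δ ≟ 0)
    where
    open Search S
    open Component T using (seen; D; δ; root∈; full; touch; uniqD) renaming (count to countC; closed to closedC)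
    fresh : ∀ {z} → z ∈ seen → z ∉ found
    fresh = Component.connected-root T (_∉ found) (λ z → ¬? (z ∈V? found)) (λ p q z∉ z′∈ → z∉ (closed q p z′∈)) v∉
    closed′ : Closed (_∈ seen ++ found)
    closed′ p q z∈ with MemP.∈-++⁻ seen z∈
    ... | inj₁ z∈s = MemP.∈-++⁺ˡ (closedC p q z∈s)
    ... | inj₂ z∈f = MemP.∈-++⁺ʳ seen (closed p q z∈f)
    met′ : ∀ {e} → e ∈ D ++ labs → ∃ λ z → z ∈ seen ++ found × Inc z e
    met′ e∈ with MemP.∈-++⁻ D e∈
    ... | inj₁ e∈D = let (z , p) = touch e∈D in z , MemP.∈-++⁺ˡ (full e∈D p) , p
    ... | inj₂ e∈l = let (z , z∈ , p) = met e∈l in z , MemP.∈-++⁺ʳ seen z∈ , p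
    uniq′ : Unique (D ++ labs)
    uniq′ = UniqueP.++⁺ uniqD uniqL (λ (p , q) → let (z , z∈ , i) = met q in fresh (full p i) z∈)
    open ≤-Reasoning
    count′ : ∀ k → length seen ≤ k + sumL excess D → length (seen ++ found) ≤ k + length trees + sumL excess (D ++ labs)
    count′ k h = begin
      length (seen ++ found)            ≡⟨ ListP.length-++ seen ⟩
      length seen + length found        ≤⟨ +-mono-≤ h count ⟩
      (k + sumL excess D) + (length trees + sumL excess labs) ≡⟨ +-interchange k _ _ _ ⟩
      (k + length trees) + (sumL excess D + sumL excess labs) ≡⟨ cong (k + length trees +_) (sumL-++ excess D labs) ⟨
      k + length trees + sumL excess (D ++ labs) ∎
    finish : Dec (δ ≡ 0) → Σ Search λ S′ → (∀ {z} → z ∈ found → z ∈ Search.found S′) × v ∈ Search.found S′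
    finish (yes δ≡0) = record
      { found = seen ++ found ; labs = D ++ labs ; trees = T ∷ trees ; closed = closed′ ; uniqL = uniq′ ; met = met′
      ; inside = λ { (here refl) → δ≡0 , MemP.∈-++⁺ˡ ; (there p) → let (q , r) = inside p in q , λ z∈ → MemP.∈-++⁺ʳ seen (r z∈) }
      ; apart = All.tabulate (λ p z∈ z∈′ → fresh z∈ (proj₂ (inside p) z∈′)) ∷ apart
      ; count = count′ 1 (≤-trans (m≤m+n _ δ) countC) } , MemP.∈-++⁺ʳ seen , MemP.∈-++⁺ˡ root∈
    finish (no δ≢0) = record
      { found = seen ++ found ; labs = D ++ labs ; trees = trees ; closed = closed′ ; uniqL = uniq′ ; met = met′
      ; inside = λ p → let (q , r) = inside p in q , λ z∈ → MemP.∈-++⁺ʳ seen (r z∈)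
      ; apart = apart
      ; count = count′ 0 (≤-pred (≤-trans (≤-trans (≤-reflexive (+-comm 1 _)) (+-monoʳ-≤ _ (n≢0⇒n>0 δ≢0))) countC)) } , MemP.∈-++⁺ʳ seen , MemP.∈-++⁺ˡ root∈

  searchAll : (vs : List (Fin m)) → Σ Search λ S → ∀ {v} → v ∈ vs → v ∈ Search.found S
  searchAll [] = record
    { found = [] ; labs = [] ; trees = [] ; closed = λ _ _ () ; uniqL = [] ; met = λ () ; inside = λ ()
    ; apart = [] ; count = z≤n } , λ ()
  searchAll (v ∷ vs) with S , all ← searchAll vs with S′ , keep , v∈ ← extend v S =
    S′ , λ { (here refl) → v∈ ; (there p) → keep (all p) }

  forest : Σ Search λ S → m ≤ length (Search.trees S) + sumL excess (Search.labs S)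
  forest with S , all ← searchAll (allFin m) = S , (begin
      m                                  ≡⟨ ListP.length-tabulate {n = m} id ⟨
      length (allFin m)                  ≤⟨ length-⊆ (UniqueP.allFin⁺ m) all ⟩
      length (Search.found S)            ≤⟨ Search.count S ⟩
      length (Search.trees S) + sumL excess (Search.labs S) ∎)
    where open ≤-Reasoning

-- The weight inequality

Sub : ℕ → Set
Sub m = Vec Bool m

card : ∀ {m} → Sub m → ℕ
card []          = 0
card (true  ∷ A) = suc (card A)
card (false ∷ A) = card A

-- The subsets of an m-set with exactly i elements missing.
level : ∀ m → ℕ → List (Sub m)
level zero    zero    = [] ∷ []
level zero    (suc _) = []
level (suc m) zero    = map (true ∷_) (level m zero)
level (suc m) (suc i) = map (true ∷_) (level m (suc i)) ++ map (false ∷_) (level m i)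

levels : ∀ m → ℕ → List (Sub m)
levels m j = concatMap (level m) (upTo (suc j))

subsets : ∀ m → List (Sub m)
subsets m = levels m m

full : ∀ m → Sub m
full m = Vec.replicate m true

card≤ : ∀ {m} (A : Sub m) → card A ≤ m
card≤ []          = z≤n
card≤ (true  ∷ A) = s≤s (card≤ A)
card≤ (false ∷ A) = m≤n⇒m≤1+n (card≤ A)

card-full : ∀ m → card (full m) ≡ m
card-full zero    = refl
card-full (suc m) = cong suc (card-full m)

length-level : ∀ m i → length (level m i) ≡ m C i
length-level zero    zero    = refl
length-level zero    (suc i) = refl
length-level (suc m) zero    = trans (ListP.length-map (true ∷_) (level m 0)) (length-level m 0)
length-level (suc m) (suc i) = begin
  length (map (true ∷_) (level m (suc i)) ++ map (false ∷_) (level m i))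
    ≡⟨ ListP.length-++ (map (true ∷_) (level m (suc i))) ⟩
  length (map (true ∷_) (level m (suc i))) + length (map (false ∷_) (level m i))
    ≡⟨ cong₂ _+_ (trans (ListP.length-map _ (level m (suc i))) (length-level m (suc i)))
                 (trans (ListP.length-map _ (level m i)) (length-level m i)) ⟩
  m C suc i + m C i   ≡⟨ +-comm (m C suc i) (m C i) ⟩
  m C i + m C suc i   ≡⟨ nCk+nC[k+1]≡[n+1]C[k+1] m i ⟩
  suc m C suc i       ∎
  where open ≡-Reasoning

level-card : ∀ m i {A : Sub m} → A ∈ level m i → card A + i ≡ m
level-card zero    zero    (here refl) = refl
level-card (suc m) zero    A∈ with _ , B∈ , refl ← MemP.∈-map⁻ (true ∷_) A∈ = cong suc (level-card m 0 B∈)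
level-card (suc m) (suc i) A∈ with MemP.∈-++⁻ (map (true ∷_) (level m (suc i))) A∈
... | inj₁ p with _ , B∈ , refl ← MemP.∈-map⁻ (true ∷_) p = cong suc (level-card m (suc i) B∈)
... | inj₂ p with _ , B∈ , refl ← MemP.∈-map⁻ (false ∷_) p = trans (+-suc _ i) (cong suc (level-card m i B∈))

∈-level : ∀ {m} (A : Sub m) i → card A + i ≡ m → A ∈ level m i
∈-level []          zero    eq = here refl
∈-level (true  ∷ A) zero    eq = MemP.∈-map⁺ (true ∷_) (∈-level A zero (suc-injective eq))
∈-level (true  ∷ A) (suc i) eq = MemP.∈-++⁺ˡ (MemP.∈-map⁺ (true ∷_) (∈-level A (suc i) (suc-injective eq)))
∈-level (false ∷ A) zero    eq = ⊥-elim (<⇒≢ (s≤s (card≤ A)) (trans (sym (+-identityʳ _)) eq))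
∈-level {suc m} (false ∷ A) (suc i) eq = MemP.∈-++⁺ʳ (map (true ∷_) (level m (suc i)))
  (MemP.∈-map⁺ (false ∷_) (∈-level A i (suc-injective (trans (sym (+-suc _ i)) eq))))

level-unique : ∀ m i → Unique (level m i)
level-unique zero    zero    = [] ∷ []
level-unique zero    (suc i) = []
level-unique (suc m) zero    = UniqueP.map⁺ (λ { refl → refl }) (level-unique m zero)
level-unique (suc m) (suc i) = UniqueP.++⁺ (UniqueP.map⁺ (λ { refl → refl }) (level-unique m (suc i)))
  (UniqueP.map⁺ (λ { refl → refl }) (level-unique m i))
  λ (p , q) → case MemP.∈-map⁻ (true ∷_) p of λ { (_ , _ , refl) → case MemP.∈-map⁻ (false ∷_) q of λ () }

levels-unique : ∀ m j → Unique (levels m j)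
levels-unique m j = concatMap-unique (level m) (UniqueP.upTo⁺ (suc j)) (λ _ → level-unique m _)
  (λ _ _ p q → +-cancelˡ-≡ _ _ _ (trans (level-card m _ p) (sym (level-card m _ q))))

∈-levels : ∀ {m j} (A : Sub m) i → i ≤ j → card A + i ≡ m → A ∈ levels m j
∈-levels {m} A i i≤j eq = ∈-concatMap (level m) (MemP.∈-upTo⁺ (s≤s i≤j)) (∈-level A i eq)

∈-subsets : ∀ {m} (A : Sub m) → A ∈ subsets m
∈-subsets {m} A = ∈-levels A (m ∸ card A) (m∸n≤m m (card A)) (m+[n∸m]≡n (card≤ A))

ind : {P : Set} → Dec P → ℕ
ind (yes _) = 1
ind (no  _) = 0

card-tabulate : ∀ {m} {P : Fin m → Set} (P? : ∀ b → Dec (P b)) →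
  card (Vec.tabulate (λ b → does (P? b))) ≡ sumL (λ b → ind (P? b)) (allFin m)
card-tabulate {zero}  P? = refl
card-tabulate {suc m} P? = trans (head (P? zero)) (cong (ind (P? zero) +_) (trans (card-tabulate (λ b → P? (suc b)))
  (trans (sym (sumL-map (λ b → ind (P? b)) suc (allFin m))) (cong (sumL (λ b → ind (P? b))) (ListP.map-tabulate id suc)))))
  where
  head : ∀ {Q : Set} (d : Dec Q) {A : Sub m} → card (does d ∷ A) ≡ ind d + card A
  head (yes _) = refl
  head (no  _) = refl

module _ {A : Set} {P : A → Set} (P? : Decidable P) where

  sumL-ind : (xs : List A) → sumL (λ x → ind (P? x)) xs ≡ length (filter P? xs)
  sumL-ind []       = refl
  sumL-ind (x ∷ xs) with P? x
  ... | yes _ = cong suc (sumL-ind xs)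
  ... | no  _ = sumL-ind xs

  sumL-filter : (f : A → ℕ) (xs : List A) → (∀ {x} → ¬ P x → f x ≡ 0) → sumL f xs ≡ sumL f (filter P? xs)
  sumL-filter f []       h = refl
  sumL-filter f (x ∷ xs) h with P? x
  ... | yes _ = cong (f x +_) (sumL-filter f xs h)
  ... | no ¬p = trans (cong (_+ sumL f xs) (h ¬p)) (sumL-filter f xs h)

  sumL-ind-* : (f : A → ℕ) (xs : List A) → sumL (λ x → ind (P? x) * f x) xs ≡ sumL f (filter P? xs)
  sumL-ind-* f []       = refl
  sumL-ind-* f (x ∷ xs) with P? x
  ... | yes _ = cong₂ _+_ (+-identityʳ (f x)) (sumL-ind-* f xs)
  ... | no  _ = sumL-ind-* f xs

-- Only sets with more than w elements contribute. As w + (j + 1) = m they lack at most j elements,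
-- so they all occur in `levels m j`.
surplus-bound : ∀ {m j d} → suc j ≡ d → (w : ℕ) → w + d ≡ m → {xs : List (Sub m)} → Unique xs →
  sumL (λ A → card A ∸ w) xs ≤ sumL (λ A → card A ∸ w) (levels m j)
surplus-bound {m} {j} refl w w+d {xs} u = ≤-trans
  (≤-reflexive (sumL-filter (λ A → w <? card A) _ xs (λ ≮ → m≤n⇒m∸n≡0 (≮⇒≥ ≮))))
  (sumL-⊆ _ (UniqueP.filter⁺ (λ A → w <? card A) u) λ {A} A∈ →
    let w< = proj₂ (MemP.∈-filter⁻ (λ A → w <? card A) {xs = xs} A∈) in
    ∈-levels A (m ∸ card A)
      (≤-pred (≤-trans (s≤s (∸-monoʳ-≤ m w<)) (≤-reflexive (trans (cong (λ z → suc (z ∸ suc w)) (sym (trans (sym (+-suc w j)) w+d)))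
        (cong suc (m+n∸m≡n w j))))))
      (m+[n∸m]≡n (card≤ A)))

-- Double counting of the incidences between parts and blocks

module Weights {m₁ n₁ m₂ n₂ : ℕ} {Lab : Set} (_≟L_ : DecidableEquality Lab)
               (c : KV m₁ n₁ m₂ n₂ → Lab) (labs : List Lab) (labs-unique : Unique labs) (labs-all : ∀ u → c u ∈ labs)
               (slot-inj : Labelled.SlotInjective _≟L_ c) (block-ext : Labelled.BlockExtensional _≟L_ c) where

  open Labelled _≟L_ c using (Mem; mem?)

  big : Lab → Sub m₂
  big e = Vec.tabulate (λ b → does (mem? (inj₂ b) e))

  inc : Fin m₁ → Fin n₁ → Lab
  inc v i = c (inj₁ (v , i))

  open Explore _≟L_ big inc public

  size₁ size₂ : Lab → ℕ
  size₁ e = length (members e)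
  size₂ e = card (big e)

  big-true : ∀ {b e} → Mem (inj₂ b) e → Vec.lookup (big e) b ≡ true
  big-true {b} {e} m = trans (VecP.lookup∘tabulate _ b) (dec-true (mem? (inj₂ b) e) m)

  big-mem : ∀ {b e} → Vec.lookup (big e) b ≡ true → Mem (inj₂ b) e
  big-mem {b} {e} eq = does-true (mem? (inj₂ b) e) (trans (sym (VecP.lookup∘tabulate (λ b → does (mem? (inj₂ b) e)) b)) eq)

  big-same : ∀ {e e′} → big e ≡ big e′ → ∀ {b} → Mem (inj₂ b) e → Mem (inj₂ b) e′
  big-same eq {b} m = big-mem (trans (cong (λ A → Vec.lookup A b) (sym eq)) (big-true m))

  inc⇒mem : ∀ {v e} → Inc v e → Mem (inj₁ v) e
  inc⇒mem (j , eq) = inj₁ (_ , j) , refl , eq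

  mem⇒inc : ∀ {v e} → Mem (inj₁ v) e → Inc v e
  mem⇒inc (inj₁ (_ , j) , refl , eq) = j , eq

  same-block : ∀ {e e′ p} → Mem p e → big e ≡ big e′ → (∀ {z} → Inc z e → Inc z e′) → (∀ {z} → Inc z e′ → Inc z e) → e ≡ e′
  same-block {e} {e′} m eq f g = block-ext m λ where
    (inj₁ v) → inc⇒mem ∘ f ∘ mem⇒inc , inc⇒mem ∘ g ∘ mem⇒inc
    (inj₂ b) → big-same eq , big-same (sym eq)

  members≡1 : ∀ {e z y} → size₁ e ≡ 1 → Inc z e → Inc y e → z ≡ y
  members≡1 {e} s≡1 p q with members e | ∈-members p | ∈-members q
  members≡1 {e} refl p q | x ∷ [] | here refl | here refl = refl

  big-sum : m₂ * n₂ ≤ sumL size₂ labs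
  big-sum = begin
    m₂ * n₂                                    ≡⟨ cong (_* n₂) (ListP.length-tabulate {n = m₂} id) ⟨
    length (allFin m₂) * n₂                    ≡⟨ sumL-const n₂ (allFin m₂) ⟨
    sumL (λ _ → n₂) (allFin m₂)                ≤⟨ sumL-mono (allFin m₂) (λ {b} _ → deg b) ⟩
    sumL (λ b → sumL (λ e → ind (mem? (inj₂ b) e)) labs) (allFin m₂) ≡⟨ sumL-swap (λ b e → ind (mem? (inj₂ b) e)) (allFin m₂) labs ⟩
    sumL (λ e → sumL (λ b → ind (mem? (inj₂ b) e)) (allFin m₂)) labs ≡⟨ sumL-cong labs (λ {e} _ → card-tabulate (λ b → mem? (inj₂ b) e)) ⟨
    sumL size₂ labs                            ∎
    where
    open ≤-Reasoning
    deg : ∀ b → n₂ ≤ sumL (λ e → ind (mem? (inj₂ b) e)) labs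
    deg b = begin
      n₂                                              ≡⟨ ListP.length-tabulate {n = n₂} id ⟨
      length (allFin n₂)                              ≡⟨ ListP.length-map _ (allFin n₂) ⟨
      length (map (λ i → c (inj₂ (b , i))) (allFin n₂)) ≤⟨ length-⊆
        (map-unique _ (UniqueP.allFin⁺ n₂) (λ _ _ e → case slot-inj {inj₂ (b , _)} {inj₂ (b , _)} refl e of λ { refl → refl }))
        (λ e∈ → case MemP.∈-map⁻ _ e∈ of λ { (i , _ , refl) → MemP.∈-filter⁺ (mem? (inj₂ b)) (labs-all _) (_ , refl , refl) }) ⟩
      length (filter (mem? (inj₂ b)) labs)            ≡⟨ sumL-ind (mem? (inj₂ b)) labs ⟨
      sumL (λ e → ind (mem? (inj₂ b) e)) labs         ∎

  small-size : ∀ e → size₁ e ≡ sumL (λ v → ind (inc? v e)) (allFin m₁)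
  small-size e = sym (sumL-ind (λ v → inc? v e) (allFin m₁))

  small-sum : sumL size₁ labs ≤ m₁ * n₁
  small-sum = begin
    sumL size₁ labs                            ≡⟨ sumL-cong labs (λ {e} _ → small-size e) ⟩
    sumL (λ e → sumL (λ v → ind (inc? v e)) (allFin m₁)) labs ≡⟨ sumL-swap (λ e v → ind (inc? v e)) labs (allFin m₁) ⟩
    sumL (λ v → sumL (λ e → ind (inc? v e)) labs) (allFin m₁) ≤⟨ sumL-mono (allFin m₁) (λ {v} _ → deg v) ⟩
    sumL (λ _ → n₁) (allFin m₁)                ≡⟨ sumL-const n₁ (allFin m₁) ⟩
    length (allFin m₁) * n₁                    ≡⟨ cong (_* n₁) (ListP.length-tabulate {n = m₁} id) ⟩
    m₁ * n₁                                    ∎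
    where
    open ≤-Reasoning
    deg : ∀ v → sumL (λ e → ind (inc? v e)) labs ≤ n₁
    deg v = begin
      sumL (λ e → ind (inc? v e)) labs    ≡⟨ sumL-ind (inc? v) labs ⟩
      length (filter (inc? v) labs)       ≤⟨ length-⊆ (UniqueP.filter⁺ (inc? v) labs-unique)
        (λ e∈ → case proj₂ (MemP.∈-filter⁻ (inc? v) {xs = labs} e∈) of λ { (i , refl) → MemP.∈-map⁺ (inc v) (MemP.∈-allFin i) }) ⟩
      length (map (inc v) (allFin n₁))    ≡⟨ trans (ListP.length-map (inc v) (allFin n₁)) (ListP.length-tabulate {n = n₁} id) ⟩
      n₁                                  ∎

  -- The block that a merger needs: v is its only small part and it contains all large parts. A
  -- vertex without such a block also loses weight, as the most valuable set is missing there;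
  -- `lack` counts these vertices.
  FullAt : Fin m₁ → Set
  FullAt v = ∃ λ i → size₁ (inc v i) ≡ 1 × big (inc v i) ≡ full m₂

  fullAt? : ∀ v → Dec (FullAt v)
  fullAt? v = FinP.any? (λ i → (size₁ (inc v i) ≟ 1) ×-dec VecP.≡-dec (λ { true true → yes refl ; false false → yes refl ; true false → no λ () ; false true → no λ () }) (big (inc v i)) (full m₂))

  lack : ℕ
  lack = sumL (λ v → ind (¬? (fullAt? v))) (allFin m₁)

  module Bound (u j : ℕ) (m₂≡ : u + suc j + suc j ≡ m₂) where

    w : ℕ
    w = u + suc j

    surplus : ℕ
    surplus = sumL (λ A → card A ∸ w) (levels m₂ j)

    bare single : ℕ → ℕ → ℕ
    bare zero    a = a
    bare (suc _) a = 0
    single (suc zero) a = a ∸ w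
    single _          a = 0

    -- w is the price of a slot of a small part. Two small parts pay exactly for m₂ large parts and
    -- one unit of excess, as 2 w = m₂ + u, and each further one leaves w - u = j + 1 over. `bare`
    -- and `single` collect what blocks with no or one small part may exceed.
    edge-bound : ∀ s a → a ≤ m₂ → a + u * (s ∸ 1) ≤ w * s + (bare s a + single s a)
    edge-bound zero a a≤ = ≤-reflexive (solve 3 (λ a u w → a :+ u :* con 0 := w :* con 0 :+ (a :+ con 0)) refl a u w)
      where open +-*-Solver
    edge-bound (suc zero) a a≤ = begin
      a + u * 0            ≡⟨ trans (cong (a +_) (*-zeroʳ u)) (+-identityʳ a) ⟩
      a                    ≤⟨ m≤n+m∸n a w ⟩
      w + (a ∸ w)          ≡⟨ cong (_+ (a ∸ w)) (*-identityʳ w) ⟨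
      w * 1 + (a ∸ w)      ∎
      where open ≤-Reasoning
    edge-bound (suc (suc t)) a a≤ = begin
      a + u * suc t                ≤⟨ +-monoˡ-≤ (u * suc t) (≤-trans a≤ (≤-reflexive (sym m₂≡))) ⟩
      u + suc j + suc j + u * suc t ≤⟨ m≤m+n _ (suc j * t) ⟩
      u + suc j + suc j + u * suc t + suc j * t ≡⟨ solve 3 (λ u d t → u :+ d :+ d :+ u :* (con 1 :+ t) :+ d :* t := (u :+ d) :* (con 2 :+ t) :+ (con 0 :+ con 0)) refl u (suc j) t ⟩
      w * suc (suc t) + (0 + 0)    ∎
      where open ≤-Reasoning
            open +-*-Solver

    -- A block without small parts is determined by its set of large parts, so these blocks
    -- contribute a constant however large m₁ is.
    bare-sum : sumL (λ e → bare (size₁ e) (size₂ e)) labs ≤ sumL card (subsets m₂)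
    bare-sum = begin
      sumL (λ e → bare (size₁ e) (size₂ e)) labs  ≡⟨ sumL-filter B? _ labs zero-off ⟩
      sumL (λ e → bare (size₁ e) (size₂ e)) es    ≤⟨ sumL-mono es (λ {e} _ → le (size₁ e) (size₂ e)) ⟩
      sumL size₂ es                                ≡⟨ sumL-map card big es ⟨
      sumL card (map big es)                       ≤⟨ sumL-⊆ card (map-unique big (UniqueP.filter⁺ B? labs-unique) inj) (λ _ → ∈-subsets _) ⟩
      sumL card (subsets m₂)                       ∎
      where
      open ≤-Reasoning
      B? : ∀ e → Dec (size₁ e ≡ 0 × ∃ λ b → Mem (inj₂ b) e)
      B? e = (size₁ e ≟ 0) ×-dec FinP.any? (λ b → mem? (inj₂ b) e)
      es = filter B? labs
      le : ∀ s a → bare s a ≤ a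
      le zero    a = ≤-refl
      le (suc _) a = z≤n
      none : ∀ {e z} → size₁ e ≡ 0 → ¬ Inc z e
      none {e} s≡0 p with members e | ∈-members p
      none {e} () p | _ ∷ _ | _
      inj : ∀ {e e′} → e ∈ es → e′ ∈ es → big e ≡ big e′ → e ≡ e′
      inj e∈ e′∈ eq with _ , s≡0 , b , m ← MemP.∈-filter⁻ B? {xs = labs} e∈ with _ , s′≡0 , _ ← MemP.∈-filter⁻ B? {xs = labs} e′∈ =
        same-block m eq (⊥-elim ∘ none s≡0) (⊥-elim ∘ none s′≡0)
      zero-off : ∀ {e} → ¬ (size₁ e ≡ 0 × ∃ λ b → Mem (inj₂ b) e) → bare (size₁ e) (size₂ e) ≡ 0
      zero-off {e} ¬B with size₁ e
      ... | suc _ = refl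
      ... | zero  = trans (card-tabulate (λ b → mem? (inj₂ b) e)) (sumL-zero (allFin m₂) (λ {b} _ → off b (mem? (inj₂ b) e)))
        where
        off : ∀ b (d : Dec (Mem (inj₂ b) e)) → ind d ≡ 0
        off b (yes m) = ⊥-elim (¬B (refl , b , m))
        off b (no _)  = refl

    -- Blocks whose only small part is v have different sets of large parts, so `surplus-bound`
    -- applies to the list of these sets. If the full set is absent, it may be added to the list,
    -- which leaves room for its contribution m₂ - w ≥ 1.
    single-at : ∀ v → sumL (λ e → ind (inc? v e) * single (size₁ e) (size₂ e)) labs + ind (¬? (fullAt? v)) ≤ surplus
    single-at v = ≤-trans (+-monoˡ-≤ (ind (¬? (fullAt? v))) step) (finish (fullAt? v))
      where
      open ≤-Reasoning
      S? : ∀ e → Dec (Inc v e × size₁ e ≡ 1)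
      S? e = inc? v e ×-dec (size₁ e ≟ 1)
      es = filter S? labs
      As = map big es
      As-unique : Unique As
      As-unique = map-unique big (UniqueP.filter⁺ S? labs-unique) λ e∈ e′∈ eq →
        let (_ , p , s≡1) = MemP.∈-filter⁻ S? {xs = labs} e∈ ; (_ , p′ , s′≡1) = MemP.∈-filter⁻ S? {xs = labs} e′∈ in
        same-block (inc⇒mem p) eq (λ q → subst (λ z → Inc z _) (members≡1 s≡1 p q) p′) (λ q → subst (λ z → Inc z _) (members≡1 s′≡1 p′ q) p)
      value : ∀ {e} → e ∈ es → ind (inc? v e) * single (size₁ e) (size₂ e) ≤ card (big e) ∸ w
      value {e} e∈ with _ , _ , s≡1 ← MemP.∈-filter⁻ S? {xs = labs} e∈ rewrite s≡1 with inc? v e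
      ... | yes _ = ≤-reflexive (+-identityʳ _)
      ... | no  _ = z≤n
      off : ∀ {e} → ¬ (Inc v e × size₁ e ≡ 1) → ind (inc? v e) * single (size₁ e) (size₂ e) ≡ 0
      off {e} ¬S with inc? v e | size₁ e
      ... | no  _ | _           = refl
      ... | yes _ | zero        = refl
      ... | yes p | suc zero    = ⊥-elim (¬S (p , refl))
      ... | yes _ | suc (suc _) = refl
      step : sumL (λ e → ind (inc? v e) * single (size₁ e) (size₂ e)) labs ≤ sumL (λ A → card A ∸ w) As
      step = begin
        _                                             ≡⟨ sumL-filter S? _ labs off ⟩
        sumL (λ e → ind (inc? v e) * single (size₁ e) (size₂ e)) es ≤⟨ sumL-mono es value ⟩
        sumL (λ e → card (big e) ∸ w) es              ≡⟨ sumL-map (λ A → card A ∸ w) big es ⟨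
        sumL (λ A → card A ∸ w) As                    ∎
      finish : (d : Dec (FullAt v)) → sumL (λ A → card A ∸ w) As + ind (¬? d) ≤ surplus
      finish (yes _)   = ≤-trans (≤-reflexive (+-identityʳ _)) (surplus-bound refl w m₂≡ As-unique)
      finish (no ¬f) = begin
        sumL (λ A → card A ∸ w) As + 1          ≡⟨ +-comm _ 1 ⟩
        1 + sumL (λ A → card A ∸ w) As          ≤⟨ +-monoˡ-≤ _ one ⟩
        sumL (λ A → card A ∸ w) (full m₂ ∷ As)  ≤⟨ surplus-bound refl w m₂≡ (∷-unique full∉ As-unique) ⟩
        surplus                                 ∎
        where
        one : 1 ≤ card (full m₂) ∸ w
        one = ≤-trans (s≤s z≤n) (≤-reflexive (sym (trans (cong (_∸ w) (trans (card-full m₂) (sym m₂≡))) (m+n∸m≡n w (suc j)))))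
        full∉ : full m₂ ∉ As
        full∉ p with e , e∈ , eq ← MemP.∈-map⁻ big p with _ , (i , refl) , s≡1 ← MemP.∈-filter⁻ S? {xs = labs} e∈ = ¬f (i , s≡1 , sym eq)

    -- Each block with one small part is charged to that part, after which `single-at` is summed
    -- over all small parts.
    single-sum : sumL (λ e → single (size₁ e) (size₂ e)) labs + lack ≤ m₁ * surplus
    single-sum = begin
      sumL (λ e → single (size₁ e) (size₂ e)) labs + lack
        ≤⟨ +-monoˡ-≤ lack (sumL-mono labs (λ {e} _ → spread e)) ⟩
      sumL (λ e → sumL (λ v → ind (inc? v e) * single (size₁ e) (size₂ e)) (allFin m₁)) labs + lack
        ≡⟨ cong (_+ lack) (sumL-swap (λ e v → ind (inc? v e) * single (size₁ e) (size₂ e)) labs (allFin m₁)) ⟩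
      sumL (λ v → sumL (λ e → ind (inc? v e) * single (size₁ e) (size₂ e)) labs) (allFin m₁) + lack
        ≡⟨ sumL-+ _ _ (allFin m₁) ⟨
      sumL (λ v → sumL (λ e → ind (inc? v e) * single (size₁ e) (size₂ e)) labs + ind (¬? (fullAt? v))) (allFin m₁)
        ≤⟨ sumL-mono (allFin m₁) (λ {v} _ → single-at v) ⟩
      sumL (λ _ → surplus) (allFin m₁)  ≡⟨ sumL-const surplus (allFin m₁) ⟩
      length (allFin m₁) * surplus      ≡⟨ cong (_* surplus) (ListP.length-tabulate {n = m₁} id) ⟩
      m₁ * surplus                      ∎
      where
      open ≤-Reasoning
      spread : ∀ e → single (size₁ e) (size₂ e) ≤ sumL (λ v → ind (inc? v e) * single (size₁ e) (size₂ e)) (allFin m₁)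
      spread e = begin
        single (size₁ e) (size₂ e)                       ≤⟨ scale (size₁ e) ⟩
        single (size₁ e) (size₂ e) * size₁ e             ≡⟨ cong (single (size₁ e) (size₂ e) *_) (small-size e) ⟩
        single (size₁ e) (size₂ e) * sumL (λ v → ind (inc? v e)) (allFin m₁) ≡⟨ sumL-* (single (size₁ e) (size₂ e)) (λ v → ind (inc? v e)) (allFin m₁) ⟨
        sumL (λ v → single (size₁ e) (size₂ e) * ind (inc? v e)) (allFin m₁) ≡⟨ sumL-cong (allFin m₁) (λ {v} _ → *-comm _ (ind (inc? v e))) ⟩
        sumL (λ v → ind (inc? v e) * single (size₁ e) (size₂ e)) (allFin m₁) ∎
        where
        scale : ∀ s → single s (size₂ e) ≤ single s (size₂ e) * s
        scale zero          = z≤n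
        scale (suc zero)    = ≤-reflexive (sym (*-identityʳ _))
        scale (suc (suc _)) = z≤n

    weight-bound : m₂ * n₂ + u * sumL excess labs + lack ≤ w * (m₁ * n₁) + (sumL card (subsets m₂) + m₁ * surplus)
    weight-bound = begin
      m₂ * n₂ + u * sumL excess labs + lack
        ≤⟨ +-monoˡ-≤ lack (+-monoˡ-≤ _ big-sum) ⟩
      sumL size₂ labs + u * sumL excess labs + lack
        ≡⟨ cong (_+ lack) (trans (cong (sumL size₂ labs +_) (sym (sumL-* u excess labs))) (sym (sumL-+ size₂ _ labs))) ⟩
      sumL (λ e → size₂ e + u * excess e) labs + lack
        ≤⟨ +-monoˡ-≤ lack (sumL-mono labs (λ {e} _ → edge-bound (size₁ e) (size₂ e) (card≤ (big e)))) ⟩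
      sumL (λ e → w * size₁ e + (bare (size₁ e) (size₂ e) + single (size₁ e) (size₂ e))) labs + lack
        ≡⟨ cong (_+ lack) (trans (sumL-+ _ _ labs) (cong₂ _+_ (sumL-* w size₁ labs) (sumL-+ _ _ labs))) ⟩
      w * sumL size₁ labs + (sumL (λ e → bare (size₁ e) (size₂ e)) labs + sumL (λ e → single (size₁ e) (size₂ e)) labs) + lack
        ≡⟨ trans (+-assoc (w * sumL size₁ labs) _ lack) (cong (w * sumL size₁ labs +_) (+-assoc (sumL (λ e → bare (size₁ e) (size₂ e)) labs) _ lack)) ⟩
      w * sumL size₁ labs + (sumL (λ e → bare (size₁ e) (size₂ e)) labs + (sumL (λ e → single (size₁ e) (size₂ e)) labs + lack))
        ≤⟨ +-mono-≤ (*-monoʳ-≤ w small-sum) (+-mono-≤ bare-sum single-sum) ⟩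
      w * (m₁ * n₁) + (sumL card (subsets m₂) + m₁ * surplus) ∎
      where open ≤-Reasoning

-- Disjoint isomorphic trees can be exchanged

words : {X : Set} → List X → ℕ → List (List X)
words as zero    = [] ∷ []
words as (suc l) = [] ∷ concatMap (λ a → map (a ∷_) (words as l)) as

∈-words : {X : Set} (as : List X) → (∀ a → a ∈ as) → ∀ l w → length w ≤ l → w ∈ words as l
∈-words as all zero    []      h = here refl
∈-words as all (suc l) []      h = here refl
∈-words as all (suc l) (a ∷ w) h = there (∈-concatMap (λ a → map (a ∷_) (words as l)) (all a)
  (MemP.∈-map⁺ (a ∷_) (∈-words as all l w (≤-pred h))))

length-words : {X : Set} (as : List X) (l : ℕ) → length (words as l) ≤ suc (length as) ^ l
length-words as zero    = ≤-refl
length-words as (suc l) = +-mono-≤ (m^n>0 (suc (length as)) l)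
  (≤-trans (length-concatMap-≤ (length (words as l)) (λ a → map (a ∷_) (words as l)) as
              (λ a → ≤-reflexive (ListP.length-map (a ∷_) (words as l))))
           (*-monoʳ-≤ (length as) (length-words as l)))

letters : ∀ m → List (Letter (Sub m))
letters m = next ∷ add ∷ map edge (subsets m)

∈-letters : ∀ {m} (l : Letter (Sub m)) → l ∈ letters m
∈-letters next     = here refl
∈-letters add      = there (here refl)
∈-letters (edge A) = there (there (MemP.∈-map⁺ edge (∈-subsets A)))

module Asymmetric {m₁ n₁ m₂ n₂ : ℕ} {Lab : Set} (_≟L_ : DecidableEquality Lab)
                  (c : KV m₁ n₁ m₂ n₂ → Lab) (labs : List Lab) (labs-unique : Unique labs) (labs-all : ∀ u → c u ∈ labs)
                  (i₁ : Fin n₁) (dist : Labelled.Dist _≟L_ c) where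

  open Labelled _≟L_ c using (Mem; mem?; module Rigidity)
  open Rigidity dist public using (slot-injective; block-extensional; Transports; transport-trivial)
  open Weights _≟L_ c labs labs-unique labs-all slot-injective block-extensional public using
    (Inc; inc?; excess; Closed; _∈V?_; Match; Component; module Component; Apart; Search; module Search; forest;
     big; inc; size₁; big-mem; big-same; inc⇒mem; mem⇒inc; members≡1; FullAt; fullAt?; lack; module Bound)

  -- An isomorphism of the closed set P onto P′, in one direction.
  Embeds : (P P′ : List (Fin m₁)) → (Fin m₁ → Fin m₁) → Set
  Embeds P P′ f = ∀ {e z} → Inc z e → z ∈ P → ∃ λ e′ →
    (∀ {b} → (Mem (inj₂ b) e → Mem (inj₂ b) e′) × (Mem (inj₂ b) e′ → Mem (inj₂ b) e))
    × (∀ {y} → y ∈ P → (Inc y e → Inc (f y) e′) × (Inc (f y) e′ → Inc y e))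

  -- Exchanging P and P′ along f and g and fixing all else carries blocks to blocks: the small parts
  -- of a block that meets P all lie in P and `Embeds` names the image, while a block that meets
  -- neither set is kept. A distinguishing partition has no such symmetry, so P must be empty.
  module Swap (P P′ : List (Fin m₁)) (P-closed : Closed (_∈ P)) (P′-closed : Closed (_∈ P′))
              (apart : ∀ {z} → z ∈ P → z ∉ P′)
              (f g : Fin m₁ → Fin m₁) (f-P : ∀ {z} → z ∈ P → f z ∈ P′) (g-P : ∀ {z} → z ∈ P′ → g z ∈ P)
              (gf : ∀ {z} → z ∈ P → g (f z) ≡ z) (fg : ∀ {z} → z ∈ P′ → f (g z) ≡ z)
              (emb : Embeds P P′ f) (emb′ : Embeds P′ P g) where

    π : Fin m₁ → Fin m₁
    π z with z ∈V? P | z ∈V? P′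
    ... | yes _ | _     = f z
    ... | no  _ | yes _ = g z
    ... | no  _ | no  _ = z

    π-P : ∀ {z} → z ∈ P → π z ≡ f z
    π-P {z} z∈ with z ∈V? P | z ∈V? P′
    ... | yes _ | _     = refl
    ... | no z∉ | _     = ⊥-elim (z∉ z∈)

    π-P′ : ∀ {z} → z ∈ P′ → π z ≡ g z
    π-P′ {z} z∈ with z ∈V? P | z ∈V? P′
    ... | yes p | _     = ⊥-elim (apart p z∈)
    ... | no  _ | yes _ = refl
    ... | no  _ | no z∉ = ⊥-elim (z∉ z∈)

    π-out : ∀ {z} → z ∉ P → z ∉ P′ → π z ≡ z
    π-out {z} z∉ z∉′ with z ∈V? P | z ∈V? P′
    ... | yes p | _     = ⊥-elim (z∉ p)
    ... | no  _ | yes p = ⊥-elim (z∉′ p)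
    ... | no  _ | no  _ = refl

    Where : Fin m₁ → Set
    Where z = z ∈ P ⊎ z ∈ P′ ⊎ (z ∉ P × z ∉ P′)

    locate : ∀ z → Where z
    locate z with z ∈V? P | z ∈V? P′
    ... | yes p | _     = inj₁ p
    ... | no  _ | yes p = inj₂ (inj₁ p)
    ... | no  p | no  q = inj₂ (inj₂ (p , q))

    ππ : ∀ z → π (π z) ≡ z
    ππ z with locate z
    ... | inj₁ p              = trans (cong π (π-P p)) (trans (π-P′ (f-P p)) (gf p))
    ... | inj₂ (inj₁ p)       = trans (cong π (π-P′ p)) (trans (π-P (g-P p)) (fg p))
    ... | inj₂ (inj₂ (p , q)) = trans (cong π (π-out p q)) (π-out p q)

    π∈P′ : ∀ {y} → π y ∈ P′ → y ∈ P
    π∈P′ {y} p with locate y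
    ... | inj₁ q              = q
    ... | inj₂ (inj₁ q)       = ⊥-elim (apart (subst (_∈ P) (sym (π-P′ q)) (g-P q)) p)
    ... | inj₂ (inj₂ (q , r)) = ⊥-elim (r (subst (_∈ P′) (π-out q r) p))

    π∈P : ∀ {y} → π y ∈ P → y ∈ P′
    π∈P {y} p with locate y
    ... | inj₁ q              = ⊥-elim (apart p (subst (_∈ P′) (sym (π-P q)) (f-P q)))
    ... | inj₂ (inj₁ q)       = q
    ... | inj₂ (inj₂ (q , r)) = ⊥-elim (q (subst (_∈ P) (π-out q r) p))

    σ : Part m₁ m₂ → Part m₁ m₂
    σ (inj₁ v) = inj₁ (π v)
    σ (inj₂ b) = inj₂ b

    σσ : ∀ p → σ (σ p) ≡ p
    σσ (inj₁ v) = cong inj₁ (ππ v)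
    σσ (inj₂ b) = refl

    Image : Lab → Set
    Image e = ∃ λ e′ → ∀ p → (Mem p e → Mem (σ p) e′) × (Mem (σ p) e′ → Mem p e)

    via : (Q Q′ : List (Fin m₁)) (h : Fin m₁ → Fin m₁) → Closed (_∈ Q) → Closed (_∈ Q′) → (∀ {z} → z ∈ Q → h z ∈ Q′) →
      Embeds Q Q′ h → (∀ {z} → z ∈ Q → π z ≡ h z) → (∀ {y} → π y ∈ Q′ → y ∈ Q) → ∀ {e z} → Inc z e → z ∈ Q → Image e
    via Q Q′ h Qc Q′c h-Q em π-Q π∈ {e} {z} p z∈ with e′ , bigs , smalls ← em p z∈ = e′ , λ where
      (inj₂ b) → bigs
      (inj₁ y) →
        (λ m → let q = mem⇒inc m ; y∈ = Qc p q z∈ in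
               subst (λ x → Mem (inj₁ x) e′) (sym (π-Q y∈)) (inc⇒mem (proj₁ (smalls y∈) q))) ,
        (λ m → let y∈ = π∈ (Q′c (proj₁ (smalls z∈) p) (mem⇒inc m) (h-Q z∈)) in
               inc⇒mem (proj₂ (smalls y∈) (mem⇒inc (subst (λ x → Mem (inj₁ x) e′) (π-Q y∈) m))))

    image : ∀ e → Image e
    image e with FinP.any? (λ z → inc? z e ×-dec (z ∈V? P)) | FinP.any? (λ z → inc? z e ×-dec (z ∈V? P′))
    ... | yes (z , p , z∈) | _ = via P P′ f P-closed P′-closed f-P emb π-P π∈P′ p z∈
    ... | no _ | yes (z , p , z∈) = via P′ P g P′-closed P-closed g-P emb′ π-P′ π∈P p z∈
    ... | no ¬P | no ¬P′ = e , λ where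
      (inj₂ b) → id , id
      (inj₁ y) →
        (λ m → subst (λ x → Mem (inj₁ x) e) (sym (π-out (λ y∈ → ¬P (y , mem⇒inc m , y∈)) (λ y∈ → ¬P′ (y , mem⇒inc m , y∈)))) m) ,
        (λ m → subst (λ x → Mem (inj₁ x) e)
                 (π-out (λ y∈ → ¬P′ (π y , mem⇒inc m , subst (_∈ P′) (sym (π-P y∈)) (f-P y∈)))
                        (λ y∈ → ¬P (π y , mem⇒inc m , subst (_∈ P) (sym (π-P′ y∈)) (g-P y∈)))) m)

    absurd : ∀ {z} → z ∉ P
    absurd {z} z∈ = apart z∈ (subst (_∈ P′) (trans (sym (π-P z∈)) πz≡z) (f-P z∈))
      where
      πz≡z : π z ≡ z
      πz≡z = SumP.inj₁-injective (transport-trivial σ σ σσ σσ (λ u → image (c u)) (λ u → image (c u)) (inj₁ (z , i₁)))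

  open Component

  -- Equal words describe the same lists of positions. Sending the vertex at position k of T to the
  -- one at position k of T′ thus respects the edges, and also their sets of large parts, which the
  -- letters record.
  module SameWord (T T′ : Component) (DI : List (Sub m₂ × List ℕ))
                  (len : length (seen T) ≡ length (seen T′))
                  (ms : Pointwise (Match (seen T)) DI (D T)) (ms′ : Pointwise (Match (seen T′)) DI (D T′)) where

    position : (z : Fin m₁) → z ∈ seen T → ∃ λ z′ → ∃ λ k → At (seen T) k z × At (seen T′) k z′
    position z z∈ = let (k , a) = ∈⇒At z∈ ; (z′ , a′) = <⇒At (seen T′) (<-≤-trans (At-< a) (≤-reflexive len)) in z′ , k , a , a′

    f : Fin m₁ → Fin m₁
    f z with z ∈V? seen T
    ... | yes z∈ = proj₁ (position z z∈)
    ... | no  _  = z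

    f-at : ∀ {z k} → At (seen T) k z → At (seen T′) k (f z)
    f-at {z} {k} a with z ∈V? seen T
    ... | no z∉  = ⊥-elim (z∉ (At⇒∈ a))
    ... | yes z∈ = let (z′ , l , b , b′) = position z z∈ in subst (λ l → At (seen T′) l z′) (At-inj (uniq T) b a) b′

    partner : ∀ {DI D₁ D₂ e} → Pointwise (Match (seen T)) DI D₁ → Pointwise (Match (seen T′)) DI D₂ → e ∈ D₁ →
              ∃₂ λ e′ xI → Match (seen T) xI e × Match (seen T′) xI e′
    partner (p ∷ _)  (q ∷ _)  (here refl) = _ , _ , p , q
    partner (_ ∷ ps) (_ ∷ qs) (there e∈)  = partner ps qs e∈

    embeds : Embeds (seen T) (seen T′) f
    embeds {e} p z∈ with e′ , (x , I) , (x≡ , to , from) , (x≡′ , to′ , from′) ← partner ms ms′ (labels T z∈ p) =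
      e′ , (big-same (trans (sym x≡) x≡′) , big-same (trans (sym x≡′) x≡)) , λ {y} y∈ →
        (λ q → let (k , k∈ , a) = to q ; (z′ , a′ , r) = from′ k∈ in subst (λ z → Inc z e′) (At-fun a′ (f-at a)) r) ,
        (λ q → let (k , k∈ , a′) = to′ q ; (z , a , r) = from k∈ ; (l , b) = ∈⇒At y∈
               in subst (λ z → Inc z e) (At-fun a (subst (λ l → At (seen T) l y) (At-inj (uniq T′) (f-at b) a′) b)) r)

  same-word-absurd : ∀ T T′ DI → length (seen T) ≡ length (seen T′) → Pointwise (Match (seen T)) DI (D T) →
                     Pointwise (Match (seen T′)) DI (D T′) → ¬ Apart T T′
  same-word-absurd T T′ DI len ms ms′ ap = Swap.absurd (seen T) (seen T′) (closed T) (closed T′) ap F.f G.f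
      (λ z∈ → At⇒∈ (F.f-at (proj₂ (∈⇒At z∈)))) (λ z∈ → At⇒∈ (G.f-at (proj₂ (∈⇒At z∈))))
      (λ z∈ → At-fun (G.f-at (F.f-at (proj₂ (∈⇒At z∈)))) (proj₂ (∈⇒At z∈)))
      (λ z∈ → At-fun (F.f-at (G.f-at (proj₂ (∈⇒At z∈)))) (proj₂ (∈⇒At z∈)))
      F.embeds G.embeds (root∈ T)
    where
    module F = SameWord T T′ DI len ms ms′
    module G = SameWord T′ T DI (sym len) ms′ ms

  word : Component → List (Letter (Sub m₂))
  word T with δ T ≟ 0
  ... | yes p = proj₁ (code T p)
  ... | no  _ = []

  word-spec : ∀ T → δ T ≡ 0 → ∃ λ DI → decode (word T) ≡ (length (seen T) , length (seen T) , DI)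
                × Pointwise (Match (seen T)) DI (D T) × length (word T) ≤ (2 + n₁) * length (seen T)
  word-spec T δ≡0 with δ T ≟ 0
  ... | yes p = proj₂ (code T p)
  ... | no  q = ⊥-elim (q δ≡0)

  word-distinct : ∀ T T′ → δ T ≡ 0 → δ T′ ≡ 0 → Apart T T′ → word T ≢ word T′
  word-distinct T T′ p p′ ap eq with DI , d , ms , _ ← word-spec T p with DI′ , d′ , ms′ , _ ← word-spec T′ p′ =
    case trans (sym d) (trans (cong decode eq) d′) of λ e →
      same-word-absurd T T′ DI (cong proj₁ e) ms (subst (λ X → Pointwise (Match (seen T′)) X (D T′)) (sym (cong (proj₂ ∘ proj₂) e)) ms′) ap

  words-unique : (ts : List Component) → AllPairs Apart ts → (∀ {T} → T ∈ ts → δ T ≡ 0) → Unique (map word ts)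
  words-unique []       ap       h = []
  words-unique (T ∷ ts) (a ∷ ap) h =
    ∷-unique (λ p → case MemP.∈-map⁻ word p of λ where
        (T′ , T′∈ , eq) → word-distinct T T′ (h (here refl)) (h (there T′∈)) (All.lookup a T′∈) eq)
      (words-unique ts ap (h ∘ there))

  numWords : ℕ → ℕ
  numWords L = length (words (letters m₂) ((2 + n₁) * L))

  -- Disjoint trees have different words, and at most L vertices give a word of length at most (2 +
  -- n₁) L.
  few-small : ∀ L (ts : List Component) → AllPairs Apart ts → (∀ {T} → T ∈ ts → δ T ≡ 0 × length (seen T) ≤ L) → length ts ≤ numWords L
  few-small L ts ap h = begin
    length ts              ≡⟨ ListP.length-map word ts ⟨
    length (map word ts)   ≤⟨ length-⊆ (words-unique ts ap (proj₁ ∘ h)) (λ w∈ → case MemP.∈-map⁻ word w∈ of λ where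
        (T , T∈ , refl) → let (δ≡0 , s≤) = h T∈ ; (_ , _ , _ , lw) = word-spec T δ≡0 in
          ∈-words _ ∈-letters _ _ (≤-trans lw (*-monoʳ-≤ (2 + n₁) s≤))) ⟩
    numWords L             ∎
    where open ≤-Reasoning

  total-size : (ts : List Component) → AllPairs Apart ts → (ys : List (Fin m₁)) →
    (∀ {T z} → T ∈ ts → z ∈ seen T → z ∈ ys) → sumL (length ∘ seen) ts ≤ length ys
  total-size ts ap ys h = begin
    sumL (length ∘ seen) ts            ≡⟨ sumL-cong ts (λ {T} _ → sumL-one (seen T)) ⟨
    sumL (λ T → sumL (λ _ → 1) (seen T)) ts ≡⟨ sumL-concatMap (λ _ → 1) seen ts ⟨
    sumL (λ _ → 1) (concatMap seen ts) ≡⟨ sumL-one (concatMap seen ts) ⟩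
    length (concatMap seen ts)         ≤⟨ length-⊆ (UniqueP.concat⁺ (AllP.map⁺ (All.tabulate (λ {T} _ → uniq T)))
                                             (AllPairsP.map⁺ {f = seen} (AllPairs.map (λ a {_} (p , q) → a p q) ap)))
                                             (λ z∈ → let (T , T∈ , z∈T) = ∈-concatMap⁻ seen {xs = ts} z∈ in h T∈ z∈T) ⟩
    length ys                          ∎
    where open ≤-Reasoning

  few-large : ∀ L (ts : List Component) → AllPairs Apart ts → (ys : List (Fin m₁)) →
    (∀ {T z} → T ∈ ts → z ∈ seen T → z ∈ ys) → (∀ {T} → T ∈ ts → L ≤ length (seen T)) → length ts * L ≤ length ys
  few-large L ts ap ys h l = ≤-trans (≤-reflexive (sym (sumL-const L ts))) (≤-trans (sumL-mono ts (λ T∈ → l T∈)) (total-size ts ap ys h))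

  trees : List Component
  trees = Search.trees (proj₁ forest)

  trees-apart : AllPairs Apart trees
  trees-apart = Search.apart (proj₁ forest)

  trees-δ : ∀ {T} → T ∈ trees → δ T ≡ 0
  trees-δ T∈ = proj₁ (Search.inside (proj₁ forest) T∈)

  Q : ℕ
  Q = sumL excess labs

  trees-count : m₁ ≤ length trees + Q
  trees-count = ≤-trans (proj₂ forest) (+-monoʳ-≤ (length trees) (sumL-⊆ excess (Search.uniqL S)
      (λ e∈ → case Search.met S e∈ of λ { (z , _ , j , refl) → labs-all _ })))
    where S = proj₁ forest

  small? : ∀ L T → Dec (length (seen T) ≤ L)
  small? L T = length (seen T) ≤? L

  Usable : Component → Set
  Usable T = Any FullAt (seen T)

  usable? : ∀ T → Dec (Usable T)
  usable? T = Any.any? fullAt? (seen T)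

  trees-small-large : ∀ L → ∃ λ large → length trees ≤ numWords L + large × large * suc L ≤ m₁
  trees-small-large L = length (filter (¬? ∘ small? L) trees) ,
    ≤-trans (≤-reflexive (length-filter-split (small? L) trees)) (+-monoˡ-≤ _
      (few-small L _ (AllPairsP.filter⁺ (small? L) trees-apart)
        (λ T∈ → let (p , q) = MemP.∈-filter⁻ (small? L) {xs = trees} T∈ in trees-δ p , q))) ,
    ≤-trans (few-large (suc L) _ (AllPairsP.filter⁺ (¬? ∘ small? L) trees-apart) (allFin m₁) (λ {_} {z} _ _ → MemP.∈-allFin z)
        (λ T∈ → ≰⇒> (proj₂ (MemP.∈-filter⁻ (¬? ∘ small? L) {xs = trees} T∈))))
      (≤-reflexive (ListP.length-tabulate {n = m₁} id))

  usable-trees : List Component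
  usable-trees = filter usable? trees

  -- An unusable tree either has at most u vertices, and these trees are few, or it has more than u
  -- vertices, all of which count in `lack`. In the weight inequality a tree gains u, so the loss at
  -- a tree of the second sort cancels its gain.
  trees-usable : ∀ u → u * length trees ≤ u * (length usable-trees + numWords u) + lack
  trees-usable u = begin
    u * length trees                          ≡⟨ cong (u *_) (length-filter-split usable? trees) ⟩
    u * (length usable-trees + length rest)   ≤⟨ *-monoʳ-≤ u (+-monoʳ-≤ (length usable-trees) (≤-trans (≤-reflexive (length-filter-split (small? u) rest)) (+-monoˡ-≤ (length rest-large) small-count))) ⟩
    u * (length usable-trees + (numWords u + length rest-large)) ≡⟨ solve 4 (λ u a b r → u :* (a :+ (b :+ r)) := u :* (a :+ b) :+ r :* u) refl u (length usable-trees) (numWords u) (length rest-large) ⟩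
    u * (length usable-trees + numWords u) + length rest-large * u ≤⟨ +-monoʳ-≤ (u * (length usable-trees + numWords u)) large-count ⟩
    u * (length usable-trees + numWords u) + lack ∎
    where
    open ≤-Reasoning
    open +-*-Solver
    rest = filter (¬? ∘ usable?) trees
    rest-small = filter (small? u) rest
    rest-large = filter (¬? ∘ small? u) rest
    rest-apart : AllPairs Apart rest
    rest-apart = AllPairsP.filter⁺ (¬? ∘ usable?) trees-apart
    small-count : length rest-small ≤ numWords u
    small-count = few-small u rest-small (AllPairsP.filter⁺ (small? u) rest-apart)
      (λ T∈ → let (p , q) = MemP.∈-filter⁻ (small? u) {xs = rest} T∈ in
              trees-δ (proj₁ (MemP.∈-filter⁻ (¬? ∘ usable?) {xs = trees} p)) , q)
    large-count : length rest-large * u ≤ lack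
    large-count = ≤-trans (few-large u rest-large (AllPairsP.filter⁺ (¬? ∘ small? u) rest-apart) (filter (¬? ∘ fullAt?) (allFin m₁))
        (λ {T} {z} T∈ z∈ → let (p , _) = MemP.∈-filter⁻ (¬? ∘ small? u) {xs = rest} T∈
                               (_ , ¬us) = MemP.∈-filter⁻ (¬? ∘ usable?) {xs = trees} p
                           in MemP.∈-filter⁺ (¬? ∘ fullAt?) (MemP.∈-allFin z) (λ fa → ¬us (Any.map (λ { refl → fa }) z∈)))
        (λ T∈ → <⇒≤ (≰⇒> (proj₂ (MemP.∈-filter⁻ (¬? ∘ small? u) {xs = rest} T∈)))))
      (≤-reflexive (sym (sumL-ind (¬? ∘ fullAt?) (allFin m₁))))

-- From n₂ + 1 to n₂: uniting two blocks

fin-choice : {A : Set} {n : ℕ} {B : Fin n → Set} → (∀ i → A ⊎ B i) → A ⊎ (∀ i → B i)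
fin-choice {n = zero}  f = inj₂ λ ()
fin-choice {n = suc n} f with f zero
... | inj₁ a = inj₁ a
... | inj₂ b with fin-choice (f ∘ suc)
...   | inj₁ a  = inj₁ a
...   | inj₂ bs = inj₂ λ { zero → b ; (suc i) → bs i }

allPairs-lookup : {A : Set} {R : A → A → Set} → (∀ {x y} → R x y → R y x) → {xs : List A} → AllPairs R xs →
  (i j : Fin (length xs)) → i ≢ j → R (lookup xs i) (lookup xs j)
allPairs-lookup sym-R (p ∷ ps) zero    zero    i≢j = ⊥-elim (i≢j refl)
allPairs-lookup sym-R (p ∷ ps) zero    (suc j) i≢j = All.lookup p (MemP.∈-lookup j)
allPairs-lookup sym-R (p ∷ ps) (suc i) zero    i≢j = sym-R (All.lookup p (MemP.∈-lookup i))
allPairs-lookup sym-R (p ∷ ps) (suc i) (suc j) i≢j = allPairs-lookup sym-R ps i j (i≢j ∘ cong suc)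

funToFin-inj : ∀ {m n} (f g : Fin m → Fin n) → funToFin f ≡ funToFin g → ∀ x → f x ≡ g x
funToFin-inj f g eq x = trans (sym (FinP.finToFun-funToFin f x)) (trans (cong (λ z → finToFun z x) eq) (FinP.finToFun-funToFin g x))

module MergeTrees {m₁ n₁ m₂ n₂ : ℕ} {Lab : Set} (_≟L_ : DecidableEquality Lab)
                  (c : KV m₁ n₁ m₂ (suc n₂) → Lab) (labs : List Lab) (labs-unique : Unique labs) (labs-all : ∀ u → c u ∈ labs)
                  (i₁ : Fin n₁) (dist : Labelled.Dist _≟L_ c) (i₂ : Fin n₂) (n₁≢n₂ : n₁ ≢ n₂) where

  open Labelled _≟L_ c using (Mem)
  open Asymmetric _≟L_ c labs labs-unique labs-all i₁ dist using
    (slot-injective; block-extensional; Transports; transport-trivial; Inc; Closed; _∈V?_; Component; module Component; Apart;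
     big; inc; size₁; big-mem; inc⇒mem; mem⇒inc; members≡1; Embeds; module Swap; few-large; trees; trees-apart; small?;
     Usable; usable?; usable-trees)
  open Component using (seen; closed; connected; uniq)

  record Site : Set where
    field
      tree    : Component
      v       : Fin m₁
      v∈      : v ∈ seen tree
      i       : Fin n₁
      lone    : size₁ (inc v i) ≡ 1
      all-big : big (inc v i) ≡ full m₂

    e : Lab
    e = inc v i

    only : ∀ {z} → Inc z e → z ≡ v
    only p = members≡1 lone p (i , refl)

    has-big : ∀ b → Mem (inj₂ b) e
    has-big b = big-mem (trans (cong (λ A → Vec.lookup A b) all-big) (VecP.lookup-replicate b true))

  open Site

  -- The blocks of the two sites are united, without the large vertices of the first block.
  module Merge (a b : Site) (apart : Apart (tree a) (tree b)) where

    va≢vb : v a ≢ v b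
    va≢vb eq = apart (v∈ a) (subst (_∈ seen (tree b)) (sym eq) (v∈ b))

    ea≢eb : e a ≢ e b
    ea≢eb eq = va≢vb (only b (i a , eq))

    rename : Lab → Lab
    rename l with l ≟L e a
    ... | yes _ = e b
    ... | no  _ = l

    rename-a : rename (e a) ≡ e b
    rename-a with e a ≟L e a
    ... | yes _ = refl
    ... | no ne = ⊥-elim (ne refl)

    rename-other : ∀ {l} → l ≢ e a → rename l ≡ l
    rename-other {l} ne with l ≟L e a
    ... | yes eq = ⊥-elim (ne eq)
    ... | no _   = refl

    rename-cases : ∀ l → (l ≡ e a × rename l ≡ e b) ⊎ (l ≢ e a × rename l ≡ l)
    rename-cases l with l ≟L e a
    ... | yes eq = inj₁ (eq , refl)
    ... | no ne  = inj₂ (ne , refl)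

    slot₂ : ∀ x → ∃ λ k → c (inj₂ (x , k)) ≡ e a
    slot₂ x with has-big a x
    ... | inj₂ (_ , k) , refl , eq = k , eq

    -- In each large part `punchIn` skips the vertex labelled `e a`, so that the part has size n₂;
    -- as `rename` replaces this label at the small parts, it disappears.
    c′ : KV m₁ n₁ m₂ n₂ → Lab
    c′ (inj₁ x)       = rename (c (inj₁ x))
    c′ (inj₂ (x , k)) = c (inj₂ (x , punchIn (proj₁ (slot₂ x)) k))

    module L′ = Labelled _≟L_ c′ using (Mem; Fixes; SlotInjective; BlockExtensional; fixes-inverse; module Action)

    Mem′ : Part m₁ m₂ → Lab → Set
    Mem′ = L′.Mem

    small⇒ : ∀ {z l} → Inc z l → Mem′ (inj₁ z) (rename l)
    small⇒ (k , refl) = inj₁ (_ , k) , refl , refl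

    mem⇒ : ∀ {p l} → l ≢ e a → Mem p l → Mem′ p l
    mem⇒ l≢ (inj₁ (z , k) , refl , eq) = inj₁ (z , k) , refl , trans (cong rename eq) (rename-other l≢)
    mem⇒ l≢ (inj₂ (x , k) , refl , eq) = inj₂ (x , punchOut k≢) , refl , trans (cong (λ z → c (inj₂ (x , z))) (FinP.punchIn-punchOut k≢)) eq
      where
      k≢ : proj₁ (slot₂ x) ≢ k
      k≢ refl = l≢ (trans (sym eq) (proj₂ (slot₂ x)))

    ⇒mem : ∀ {p l} → l ≢ e b → Mem′ p l → Mem p l
    ⇒mem l≢ (inj₁ (z , k) , refl , eq) with rename-cases (c (inj₁ (z , k)))
    ... | inj₁ (_ , r) = ⊥-elim (l≢ (trans (sym eq) r))
    ... | inj₂ (_ , r) = inj₁ (z , k) , refl , trans (sym r) eq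
    ⇒mem l≢ (inj₂ (x , k) , refl , eq) = inj₂ (x , punchIn (proj₁ (slot₂ x)) k) , refl , eq

    not-a : ∀ {p} → ¬ Mem′ p (e a)
    not-a (inj₁ (z , k) , refl , eq) with rename-cases (c (inj₁ (z , k)))
    ... | inj₁ (_ , r) = ea≢eb (trans (sym eq) r)
    ... | inj₂ (ne , r) = ne (trans (sym r) eq)
    not-a (inj₂ (x , k) , refl , eq) =
      FinP.punchInᵢ≢i (proj₁ (slot₂ x)) k (ProdP.,-injectiveʳ (SumP.inj₂-injective (slot-injective {inj₂ (x , _)} {inj₂ (x , _)} refl (trans eq (sym (proj₂ (slot₂ x)))))))

    mem≢a : ∀ {p l} → Mem′ p l → l ≢ e a
    mem≢a m refl = not-a m

    joined-small : ∀ {z} → Mem′ (inj₁ z) (e b) → z ≡ v a ⊎ z ≡ v b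
    joined-small (inj₁ (z , k) , refl , eq) with rename-cases (c (inj₁ (z , k)))
    ... | inj₁ (r , _) = inj₁ (only a (k , r))
    ... | inj₂ (_ , r) = inj₂ (only b (k , trans (sym r) eq))

    a-joined : Mem′ (inj₁ (v a)) (e b)
    a-joined = subst (Mem′ (inj₁ (v a))) rename-a (small⇒ (i a , refl))

    b-joined : Mem′ (inj₁ (v b)) (e b)
    b-joined = subst (Mem′ (inj₁ (v b))) (rename-other (ea≢eb ∘ sym)) (small⇒ (i b , refl))

    small-slot : ∀ {z k l} → inc z k ≡ inc z l → k ≡ l
    small-slot {z} eq = ProdP.,-injectiveʳ (SumP.inj₁-injective (slot-injective {inj₁ (z , _)} {inj₁ (z , _)} refl eq))

    slot-injective′ : L′.SlotInjective
    slot-injective′ {inj₁ (z , k)} {inj₁ (.z , l)} refl eq with rename-cases (c (inj₁ (z , k))) | rename-cases (c (inj₁ (z , l)))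
    ... | inj₁ (r , _) | inj₁ (s , _) = cong (λ y → inj₁ (z , y)) (small-slot (trans r (sym s)))
    ... | inj₁ (r , r′) | inj₂ (_ , s) = ⊥-elim (va≢vb (trans (sym (only a (k , r))) (only b (l , trans (sym s) (trans (sym eq) r′)))))
    ... | inj₂ (_ , s) | inj₁ (r , r′) = ⊥-elim (va≢vb (trans (sym (only a (l , r))) (only b (k , trans (sym s) (trans eq r′)))))
    ... | inj₂ (_ , r) | inj₂ (_ , s) = cong (λ y → inj₁ (z , y)) (small-slot (trans (sym r) (trans eq s)))
    slot-injective′ {inj₂ (x , k)} {inj₂ (.x , l)} refl eq =
      cong (λ z → inj₂ (x , z)) (FinP.punchIn-injective (proj₁ (slot₂ x)) k l
        (ProdP.,-injectiveʳ (SumP.inj₂-injective (slot-injective {inj₂ (x , _)} {inj₂ (x , _)} refl eq))))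

    not-both : ∀ {l} → l ≢ e b → Mem′ (inj₁ (v a)) l → ¬ Mem′ (inj₁ (v b)) l
    not-both l≢ m m′ = apart (closed (tree a) (mem⇒inc (⇒mem l≢ m)) (mem⇒inc (⇒mem l≢ m′)) (v∈ a)) (v∈ b)

    -- Only the joined block meets both trees, by `not-both`, and all other blocks have kept their
    -- members.
    block-extensional′ : L′.BlockExtensional
    block-extensional′ {l} {l′} {p} m same with l ≟L e b | l′ ≟L e b
    ... | yes q | yes q′ = trans q (sym q′)
    ... | yes refl | no q′ = ⊥-elim (not-both q′ (proj₁ (same _) a-joined) (proj₁ (same _) b-joined))
    ... | no q | yes refl = ⊥-elim (not-both q (proj₂ (same _) a-joined) (proj₂ (same _) b-joined))
    ... | no q | no q′ = block-extensional (⇒mem q m) λ r →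
          (λ x → ⇒mem q′ (proj₁ (same r) (mem⇒ (mem≢a m) x))) ,
          (λ x → ⇒mem q (proj₂ (same r) (mem⇒ (mem≢a (proj₁ (same p) m)) x)))

    Closed′ : (Fin m₁ → Set) → Set
    Closed′ P = ∀ {l z z′} → Mem′ (inj₁ z) l → Mem′ (inj₁ z′) l → P z → P z′

    closed′⇒closed : ∀ {P} → Closed′ P → Closed P
    closed′⇒closed cl p q = cl (small⇒ p) (small⇒ q)

    Either : Fin m₁ → Set
    Either z = z ∈ seen (tree a) ⊎ z ∈ seen (tree b)

    either? : ∀ z → Dec (Either z)
    either? z = (z ∈V? seen (tree a)) ⊎-dec (z ∈V? seen (tree b))

    ends-either : ∀ {z} → z ≡ v a ⊎ z ≡ v b → Either z
    ends-either (inj₁ refl) = inj₁ (v∈ a)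
    ends-either (inj₂ refl) = inj₂ (v∈ b)

    either-closed : Closed′ Either
    either-closed {l} m m′ z∈ with l ≟L e b
    ... | yes refl = ends-either (joined-small m′)
    ... | no l≢ with z∈
    ...   | inj₁ q = inj₁ (closed (tree a) (mem⇒inc (⇒mem l≢ m)) (mem⇒inc (⇒mem l≢ m′)) q)
    ...   | inj₂ q = inj₂ (closed (tree b) (mem⇒inc (⇒mem l≢ m)) (mem⇒inc (⇒mem l≢ m′)) q)

    module Symmetry (γ : Aut (K m₁ n₁ m₂ n₂)) (fix : L′.Fixes γ) where

      module A = L′.Action i₁ i₂ γ
      open A using (σ; σ′; σσ′; σ′σ; part-to) public

      -- A vertex of the joined block, through which the image of that block under γ is followed.
      origin : KV m₁ n₁ m₂ n₂
      origin = inj₁ (v a , i a)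

      image-label : Lab
      image-label = c′ (A.to origin)

      transport : ∀ {p l} → Mem′ p l → ∃ λ h → (∀ q → (Mem′ q l → Mem′ (σ q) h) × (Mem′ (σ q) h → Mem′ q l))
        × (h ≡ image-label → l ≡ e b) × (l ≡ e b → h ≡ image-label)
      transport (u , _ , refl) = c′ (A.to u) , (λ q → A.mem-to fix u q , A.mem-from fix u q) ,
        (λ eq → trans (Equivalence.from (fix u origin) eq) rename-a) ,
        (λ eq → Equivalence.to (fix u origin) (trans eq (sym rename-a)))

      transport′ : ∀ {p h} → Mem′ p h → ∃ λ l → (∀ q → (Mem′ q h → Mem′ (σ′ q) l) × (Mem′ (σ′ q) l → Mem′ q h))
        × (h ≡ image-label → l ≡ e b) × (l ≡ e b → h ≡ image-label)
      transport′ (w , _ , refl) = c′ (A.from w) ,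
        (λ q → (λ m → A.mem-from fix (A.from w) (σ′ q) (subst (λ z → Mem′ z (c′ (A.to (A.from w)))) (sym (σσ′ q)) (subst (λ z → Mem′ q (c′ z)) (sym (A.to-from w)) m))) ,
               (λ m → subst (λ z → Mem′ q (c′ z)) (A.to-from w) (subst (λ z → Mem′ z (c′ (A.to (A.from w)))) (σσ′ q) (A.mem-to fix (A.from w) (σ′ q) m)))) ,
        (λ eq → trans (Equivalence.from (fix (A.from w) origin) (trans (cong c′ (A.to-from w)) eq)) rename-a) ,
        (λ eq → trans (sym (cong c′ (A.to-from w))) (Equivalence.to (fix (A.from w) origin) (trans eq (sym rename-a))))

      σ-inj : ∀ {p q} → σ p ≡ σ q → p ≡ q
      σ-inj eq = trans (sym (σ′σ _)) (trans (cong σ′ eq) (σ′σ _))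

      π : Fin m₁ → Fin m₁
      π z = proj₁ (A.σ-small n₁≢n₂ z)

      σ-π : ∀ z → σ (inj₁ z) ≡ inj₁ (π z)
      σ-π z = proj₂ (A.σ-small n₁≢n₂ z)

      π′ : Fin m₁ → Fin m₁
      π′ z = proj₁ (L′.Action.σ-small i₁ i₂ (inverse γ) n₁≢n₂ z)

      σ-π′ : ∀ z → σ′ (inj₁ z) ≡ inj₁ (π′ z)
      σ-π′ z = proj₂ (L′.Action.σ-small i₁ i₂ (inverse γ) n₁≢n₂ z)

      π′π : ∀ z → π′ (π z) ≡ z
      π′π z = SumP.inj₁-injective (trans (sym (σ-π′ (π z))) (trans (cong σ′ (sym (σ-π z))) (σ′σ _)))

      ππ′ : ∀ z → π (π′ z) ≡ z
      ππ′ z = SumP.inj₁-injective (trans (sym (σ-π (π′ z))) (trans (cong σ (sym (σ-π′ z))) (σσ′ _)))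

      σ-big : ∀ x → ∃ λ y → σ (inj₂ x) ≡ inj₂ y
      σ-big x with σ (inj₂ x) in eq
      ... | inj₂ y = y , refl
      ... | inj₁ z = case trans (sym (σ′σ (inj₂ x))) (trans (cong σ′ eq) (σ-π′ z)) of λ ()

      module _ (fixed : image-label ≡ e b) where

        end-image : ∀ s → Mem′ (inj₁ (v s)) (e b) → ∃ λ t → σ (inj₁ (v s)) ≡ inj₁ (v t)
        end-image s m with h , same , _ , b-h ← transport m
          with joined-small (subst₂ Mem′ (σ-π (v s)) (trans (b-h refl) fixed) (proj₁ (same _) m))
        ... | inj₁ eq = a , trans (σ-π (v s)) (cong inj₁ eq)
        ... | inj₂ eq = b , trans (σ-π (v s)) (cong inj₁ eq)

        -- Each of the two original blocks consists of all large parts and one small part. A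
        -- symmetry that keeps the joined block permutes these two small parts, hence also the two
        -- original blocks.
        lone-image : ∀ s → Mem′ (inj₁ (v s)) (e b) → ∃ λ l → ∀ p → (Mem p (e s) → Mem (σ p) l) × (Mem (σ p) l → Mem p (e s))
        lone-image s m with t , eq ← end-image s m = e t , λ where
          (inj₁ z) →
            (λ q → subst (λ p → Mem p (e t)) (sym (trans (cong (σ ∘ inj₁) (only s (mem⇒inc q))) eq)) (inc⇒mem (i t , refl))) ,
            (λ q → subst (λ p → Mem p (e s)) (σ-inj (trans eq (trans (cong inj₁ (sym (only t (mem⇒inc (subst (λ p → Mem p (e t)) (σ-π z) q))))) (sym (σ-π z)))))
                     (inc⇒mem (i s , refl)))
          (inj₂ x) → (λ _ → subst (λ p → Mem p (e t)) (sym (proj₂ (σ-big x))) (has-big t _)) , (λ _ → has-big s x)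

        -- If the joined block is fixed, γ comes from a symmetry of the original partition.
        transports : Transports σ
        transports u with c u ≟L e a | c u ≟L e b
        ... | yes eq | _ = subst (λ l → ∃ λ h → ∀ p → (Mem p l → Mem (σ p) h) × (Mem (σ p) h → Mem p l)) (sym eq) (lone-image a a-joined)
        ... | no _ | yes eq = subst (λ l → ∃ λ h → ∀ p → (Mem p l → Mem (σ p) h) × (Mem (σ p) h → Mem p l)) (sym eq) (lone-image b b-joined)
        ... | no ≢a | no ≢b with h , same , h-b , _ ← transport (mem⇒ ≢a (u , refl , refl)) =
                h , λ q → (λ m → ⇒mem (λ eq → ≢b (h-b (trans eq (sym fixed)))) (proj₁ (same q) (mem⇒ ≢a m))) ,
                          (λ m → ⇒mem ≢b (proj₂ (same q) (mem⇒ (mem≢a (proj₁ (same (partOf u)) (mem⇒ ≢a (u , refl , refl)))) m)))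

    -- The inverse of γ fixes the joined block as well, so `transports` applies to both, and the
    -- rigidity of c leaves no part to move.
    fixing-trivial : ∀ γ (fix : L′.Fixes γ) → Symmetry.image-label γ fix ≡ e b → ∀ u → act γ u ≡ u
    fixing-trivial γ fix fixed = S.A.trivial fix slot-injective′ block-extensional′ σ-id
      where
      module S = Symmetry γ fix using (module A; origin; image-label; σ; σ′; σ′σ; σσ′; transports)
      fix⁻ : L′.Fixes (inverse γ)
      fix⁻ = L′.fixes-inverse γ fix
      module S⁻ = Symmetry (inverse γ) fix⁻ using (image-label; transports)
      fixed⁻ : S⁻.image-label ≡ e b
      fixed⁻ = trans (Equivalence.from (fix (S.A.from S.origin) S.origin)
        (trans (cong c′ (S.A.to-from S.origin)) (trans rename-a (sym fixed)))) rename-a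
      σ-id : ∀ p → S.σ p ≡ p
      σ-id (inj₁ z) = transport-trivial S.σ S.σ′ S.σ′σ S.σσ′ (S.transports fixed) (S⁻.transports fixed⁻) (inj₁ (z , i₁))
      σ-id (inj₂ x) = transport-trivial S.σ S.σ′ S.σ′σ S.σσ′ (S.transports fixed) (S⁻.transports fixed⁻) (inj₂ (x , zero))

    -- The image f of the joined block is now an unchanged block of c. It contains x, the image of
    -- `v a`, and the image of `v b`. The aim is that f avoids both trees.
    module Moved (γ : Aut (K m₁ n₁ m₂ n₂)) (fix : L′.Fixes γ) (moved : Symmetry.image-label γ fix ≢ e b)
                 (equal : length (seen (tree a)) ≡ length (seen (tree b))) where

      open Symmetry γ fix public using
        (origin; image-label; transport; transport′; σ; σ′; σσ′; σ′σ; part-to; π; π′; σ-π; σ-π′; π′π; ππ′; σ-big)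

      f : Lab
      f = image-label

      f-π : ∀ {z} → Mem′ (inj₁ z) (e b) → Mem′ (inj₁ (π z)) f
      f-π {z} m with h , same , _ , b-h ← transport m = subst₂ Mem′ (σ-π z) (b-h refl) (proj₁ (same _) m)

      f-π′ : ∀ {z} → Mem′ (inj₁ z) f → π′ z ≡ v a ⊎ π′ z ≡ v b
      f-π′ {z} m with l , same , h-b , _ ← transport′ m =
        joined-small (subst₂ Mem′ (σ-π′ z) (h-b refl) (proj₁ (same _) m))

      f-inc : ∀ {z} → Mem′ (inj₁ z) f → Inc z f
      f-inc m = mem⇒inc (⇒mem moved m)

      pull-closed : ∀ {P} → Closed′ P → Closed′ (P ∘ π′)
      pull-closed {P} cl {l} {z} {z′} m m′ with h , same , _ ← transport′ m =
        cl (subst (λ p → Mem′ p h) (σ-π′ z) (proj₁ (same _) m)) (subst (λ p → Mem′ p h) (σ-π′ z′) (proj₁ (same _) m′))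

      -- The preimage of a block other than f is not the joined block, so its small parts already
      -- lay together in a block of c and hence in one tree.
      pull-closed-tree : ∀ {T} l {z z′} → l ≢ f → Mem′ (inj₁ z) l → Mem′ (inj₁ z′) l → π′ z ∈ seen T → π′ z′ ∈ seen T
      pull-closed-tree {T} l {z} {z′} l≢f m m′ with h , same , _ , b-h ← transport′ m =
        closed T (mem⇒inc (⇒mem (l≢f ∘ b-h) (subst (λ p → Mem′ p h) (σ-π′ z) (proj₁ (same _) m))))
                 (mem⇒inc (⇒mem (l≢f ∘ b-h) (subst (λ p → Mem′ p h) (σ-π′ z′) (proj₁ (same _) m′))))

      x : Fin m₁
      x = π (v a)

      -- The image block would be a bridge with one side properly containing a tree of the size of both sides.
      not-inside : ∀ s t → Apart (tree s) (tree t) →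
        Mem′ (inj₁ (v s)) (e b) → Mem′ (inj₁ (v t)) (e b) →
        (∀ R → R ≡ tree a ⊎ R ≡ tree b → length (seen R) ≡ length (seen (tree t))) → x ∉ seen (tree s)
      not-inside s t ap s-in t-in lens x∈ = case side of λ where
          (inj₁ p) → overfull (tree a) len-a p (proj₁ (moves (tree a) p)) (proj₂ (moves (tree a) p))
          (inj₂ p) → overfull (tree b) len-b p (proj₁ (moves (tree b) p)) (proj₂ (moves (tree b) p))
        where
        P-closed : Closed (Either ∘ π′)
        P-closed = closed′⇒closed (pull-closed either-closed)
        P-at-s : Either (π′ (v s))
        P-at-s = connected (tree s) (Either ∘ π′) (either? ∘ π′) P-closed x∈ (subst Either (sym (π′π (v a))) (inj₁ (v∈ a))) (v∈ s)
        side : Either (π′ (v s))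
        side = P-at-s
        len-a : length (seen (tree a)) ≤ length (seen (tree t))
        len-a = ≤-reflexive (lens (tree a) (inj₁ refl))
        len-b : length (seen (tree b)) ≤ length (seen (tree t))
        len-b = ≤-reflexive (lens (tree b) (inj₂ refl))
        f-in-s : ∀ {z} → Mem′ (inj₁ z) f → z ∈ seen (tree s)
        f-in-s m = closed (tree s) (f-inc (f-π a-joined)) (f-inc m) x∈
        moves : ∀ R → π′ (v s) ∈ seen R → π′ (v t) ∈ seen R × (∀ {z} → z ∈ seen (tree t) → π′ z ∈ seen R)
        moves R p = at-t , λ z∈ → connected (tree t) (λ z → z ∈ seen (tree t) → π′ z ∈ seen R) (λ z → (z ∈V? seen (tree t)) →-dec (π′ z ∈V? seen R)) cl (v∈ t) (λ _ → at-t) z∈ z∈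
          where
          at-t : π′ (v t) ∈ seen R
          at-t = pull-closed-tree {R} (e b) (moved ∘ sym) s-in t-in p
          cl : Closed (λ z → z ∈ seen (tree t) → π′ z ∈ seen R)
          cl {l} q q′ Pz z′∈ = pull-closed-tree {R} (rename l) (λ eq → ap (f-in-s (subst (Mem′ _) eq (small⇒ q′))) z′∈) (small⇒ q) (small⇒ q′)
            (Pz (closed (tree t) q′ q z′∈))
        overfull : ∀ R → length (seen R) ≤ length (seen (tree t)) → π′ (v s) ∈ seen R → π′ (v t) ∈ seen R →
          (∀ {z} → z ∈ seen (tree t) → π′ z ∈ seen R) → ⊥
        overfull R le p _ all = <⇒≱ (s≤s le) (≤-trans (≤-reflexive (sym (ListP.length-map π′ (v s ∷ seen (tree t)))))
          (length-⊆ (map-unique π′ (∷-unique (ap (v∈ s)) (uniq (tree t))) (λ _ _ eq → trans (sym (ππ′ _)) (trans (cong π eq) (ππ′ _))))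
            λ q → case MemP.∈-map⁻ π′ q of λ { (_ , here refl , refl) → p ; (_ , there r , refl) → all r }))

      outside-a : x ∉ seen (tree a)
      outside-a = not-inside a b apart a-joined b-joined λ { _ (inj₁ refl) → equal ; _ (inj₂ refl) → refl }

      outside-b : x ∉ seen (tree b)
      outside-b = not-inside b a (λ p q → apart q p) b-joined a-joined λ { _ (inj₁ refl) → refl ; _ (inj₂ refl) → sym equal }

  -- A failed merger. Its symmetry is nontrivial and therefore moves the joined block, by
  -- `fixing-trivial`.
  record Bad (a b : Site) : Set where
    field
      apart : Apart (tree a) (tree b)
      γ     : Aut (K m₁ n₁ m₂ n₂)
      fix   : Merge.L′.Fixes a b apart γ
      moved : Merge.Symmetry.image-label a b apart γ fix ≢ e b
      equal : length (seen (tree a)) ≡ length (seen (tree b))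

    open Merge a b apart public using
      (Mem′; c′; rename-cases; mem⇒; ⇒mem; mem≢a; joined-small; a-joined; b-joined; va≢vb)
    open Merge.Moved a b apart γ fix moved equal public using
      (origin; transport; transport′; σ; σ′; σ′σ; part-to; π; π′; σ-π; σ-π′; π′π; ππ′; σ-big; f; f-inc; f-π; f-π′; x; outside-a; outside-b)

  -- φ applies the symmetry of one failed merger and then the inverse of the other. Both agree on
  -- the large parts and send their joined blocks to the same f, so φ embeds the tree of s in that
  -- of t, provided that the intermediate image avoids all four trees; there neither merger has
  -- changed anything.
  module Half {a b a₂ b₂ : Site} (B₁ : Bad a b) (B₂ : Bad a₂ b₂) (s t : Site) (s-end : s ≡ a ⊎ s ≡ b) (t-end : t ≡ a₂ ⊎ t ≡ b₂)
              (σ≡ : ∀ y → Bad.σ B₁ (inj₂ y) ≡ Bad.σ B₂ (inj₂ y)) (f≡ : Bad.f B₁ ≡ Bad.f B₂) where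


    Outside : Fin m₁ → Set
    Outside z = (z ∉ seen (tree a) × z ∉ seen (tree b)) × (z ∉ seen (tree a₂) × z ∉ seen (tree b₂))

    outside? : ∀ z → Dec (Outside z)
    outside? z = (¬? (z ∈V? _) ×-dec ¬? (z ∈V? _)) ×-dec (¬? (z ∈V? _) ×-dec ¬? (z ∈V? _))

    outside-closed : Closed Outside
    outside-closed p q ((z₁ , z₂) , (z₃ , z₄)) =
      (z₁ ∘ closed (tree a) q p , z₂ ∘ closed (tree b) q p) , (z₃ ∘ closed (tree a₂) q p , z₄ ∘ closed (tree b₂) q p)

    φ : Fin m₁ → Fin m₁
    φ z = (Bad.π′ B₂) (Bad.π B₁ z)

    ψ : Part m₁ m₂ → Part m₁ m₂
    ψ p = (Bad.σ′ B₂) (Bad.σ B₁ p)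

    ψ-small : ∀ z → ψ (inj₁ z) ≡ inj₁ (φ z)
    ψ-small z = trans (cong (Bad.σ′ B₂) (Bad.σ-π B₁ z)) (Bad.σ-π′ B₂ (Bad.π B₁ z))

    ψ-big : ∀ y → ψ (inj₂ y) ≡ inj₂ y
    ψ-big y = trans (cong (Bad.σ′ B₂) (σ≡ y)) (Bad.σ′σ B₂ (inj₂ y))

    -- The image h lies outside the four trees, so it is a block of c and of both mergers and can be
    -- taken back by the second symmetry. The result is not the second joined block: h would then be
    -- f, and l would have been `e b`.
    chain : ∀ {l z} → l ≢ e a → l ≢ e b → Inc z l → Outside (Bad.π B₁ z) →
      (∀ {y} → Inc y l → Outside (Bad.π B₁ y)) × ∃ λ l′ → ∀ p → (Mem p l → Mem (ψ p) l′) × (Mem (ψ p) l′ → Mem p l)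
    chain {l} {z} l≢a l≢b q out@((o₁ , o₂) , (o₃ , o₄))
      with h , same , h-b , _ ← (Bad.transport B₁) (Bad.mem⇒ B₁ l≢a (inc⇒mem q)) =
        (λ {y} r → outside-closed z-h (push r) out) ,
        l′ , λ p → (λ m → (Bad.⇒mem B₂) l′≢b₂ (proj₁ (same′ (Bad.σ B₁ p)) (Bad.mem⇒ B₂ h≢a₂ (Bad.⇒mem B₁ h≢b (proj₁ (same p) (Bad.mem⇒ B₁ l≢a m)))))) ,
                   (λ m → (Bad.⇒mem B₁) l≢b (proj₂ (same p) (Bad.mem⇒ B₁ (Bad.mem≢a B₁ z-mem) (Bad.⇒mem B₂ h≢b₂ (proj₂ (same′ (Bad.σ B₁ p)) (Bad.mem⇒ B₂ (Bad.mem≢a B₂ z-mem′) m))))))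
        where
        z-mem : (Bad.Mem′ B₁) (inj₁ (Bad.π B₁ z)) h
        z-mem = subst (λ p → (Bad.Mem′ B₁) p h) (Bad.σ-π B₁ z) (proj₁ (same _) (Bad.mem⇒ B₁ l≢a (inc⇒mem q)))
        h≢b : h ≢ e b
        h≢b refl = [ (λ eq → o₁ (subst (_∈ seen (tree a)) (sym eq) (v∈ a))) , (λ eq → o₂ (subst (_∈ seen (tree b)) (sym eq) (v∈ b))) ]′ (Bad.joined-small B₁ z-mem)
        z-h : Inc (Bad.π B₁ z) h
        z-h = mem⇒inc (Bad.⇒mem B₁ h≢b z-mem)
        push : ∀ {y} → Inc y l → Inc (Bad.π B₁ y) h
        push {y} r = mem⇒inc (Bad.⇒mem B₁ h≢b (subst (λ p → (Bad.Mem′ B₁) p h) (Bad.σ-π B₁ y) (proj₁ (same _) (Bad.mem⇒ B₁ l≢a (inc⇒mem r)))))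
        h≢a₂ : h ≢ e a₂
        h≢a₂ refl = o₃ (subst (_∈ seen (tree a₂)) (sym (only a₂ z-h)) (v∈ a₂))
        h≢b₂ : h ≢ e b₂
        h≢b₂ refl = o₄ (subst (_∈ seen (tree b₂)) (sym (only b₂ z-h)) (v∈ b₂))
        T = (Bad.transport′ B₂) (Bad.mem⇒ B₂ h≢a₂ (inc⇒mem z-h))
        l′ = proj₁ T
        same′ = proj₁ (proj₂ T)
        l′≢b₂ : l′ ≢ e b₂
        l′≢b₂ eq = l≢b (h-b (trans (proj₂ (proj₂ (proj₂ T)) eq) (sym f≡)))
        z-mem′ : (Bad.Mem′ B₂) (Bad.σ′ B₂ (inj₁ (Bad.π B₁ z))) l′
        z-mem′ = proj₁ (same′ _) (Bad.mem⇒ B₂ h≢a₂ (inc⇒mem z-h))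

    other : ∀ {l z} → l ≢ e s → Inc z l → z ∈ seen (tree s) → l ≢ e a × l ≢ e b
    other {l} {z} l≢ q z∈ = [ in-a , in-b ]′ s-end
      where
      at : ∀ r → l ≡ e r → z ∈ seen (tree r)
      at r eq = subst (_∈ seen (tree r)) (sym (only r (subst (Inc z) eq q))) (v∈ r)
      in-a : s ≡ a → l ≢ e a × l ≢ e b
      in-a s≡a = (λ eq → l≢ (trans eq (cong e (sym s≡a)))) ,
                 (λ eq → (Bad.apart B₁) (subst (λ r → z ∈ seen (tree r)) s≡a z∈) (at b eq))
      in-b : s ≡ b → l ≢ e a × l ≢ e b
      in-b s≡b = (λ eq → (Bad.apart B₁) (at a eq) (subst (λ r → z ∈ seen (tree r)) s≡b z∈)) ,
                 (λ eq → l≢ (trans eq (cong e (sym s≡b))))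

    module _ (meet : (Bad.π B₁) (v s) ≡ (Bad.π B₂) (v t)) (out : Outside (Bad.π B₁ (v s))) where

      φ-end : φ (v s) ≡ v t
      φ-end = trans (cong (Bad.π′ B₂) meet) (Bad.π′π B₂ (v t))

      W : Fin m₁ → Set
      W z = z ∈ seen (tree s) → Outside (Bad.π B₁ z) × φ z ∈ seen (tree t)

      w? : ∀ z → Dec (W z)
      w? z = (z ∈V? seen (tree s)) →-dec (outside? (Bad.π B₁ z) ×-dec (φ z ∈V? seen (tree t)))

      w-closed : Closed W
      w-closed {l} {z} {z′} q q′ Wz z′∈ = case l ≟L e s of λ where
        (yes refl) → subst W (trans (only s q) (sym (only s q′))) Wz z′∈
        (no l≢) →
          let (o , φz∈) = Wz (closed (tree s) q′ q z′∈)
              (l≢a , l≢b) = other l≢ q′ z′∈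
              (outs , l′ , same) = chain l≢a l≢b q o
          in outs q′ , closed (tree t) (mem⇒inc (subst (λ p → Mem p l′) (ψ-small z) (proj₁ (same _) (inc⇒mem q))))
                                       (mem⇒inc (subst (λ p → Mem p l′) (ψ-small z′) (proj₁ (same _) (inc⇒mem q′)))) φz∈

      inside : ∀ {z} → z ∈ seen (tree s) → Outside (Bad.π B₁ z) × φ z ∈ seen (tree t)
      inside z∈ = connected (tree s) W w? w-closed (v∈ s) (λ _ → out , subst (_∈ seen (tree t)) (sym φ-end) (v∈ t)) z∈ z∈

      Image : Lab → Set
      Image l = ∃ λ l′ → (∀ {y} → (Mem (inj₂ y) l → Mem (inj₂ y) l′) × (Mem (inj₂ y) l′ → Mem (inj₂ y) l))
        × (∀ {y} → y ∈ seen (tree s) → (Inc y l → Inc (φ y) l′) × (Inc (φ y) l′ → Inc y l))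

      end-image : Image (e s)
      end-image = e t , (λ {y} → (λ _ → has-big t y) , (λ _ → has-big s y)) , λ {y} _ →
          (λ r → i t , cong (λ x → inc x (i t)) (trans (cong φ (only s r)) φ-end)) ,
          (λ r → subst (λ x → Inc x (e s)) (φ-inj (trans φ-end (sym (only t r)))) (i s , refl))
        where
        φ-inj : ∀ {x y} → φ x ≡ φ y → x ≡ y
        φ-inj {x} {y} eq = trans (sym (Bad.π′π B₁ x)) (trans (cong (Bad.π′ B₁) (trans (sym (Bad.ππ′ B₂ _)) (trans (cong (Bad.π B₂) eq) (Bad.ππ′ B₂ _)))) (Bad.π′π B₁ y))

      embeds : Embeds (seen (tree s)) (seen (tree t)) φ
      embeds {l} {z} q z∈ = case l ≟L e s of λ where
          (yes eq) → subst Image (sym eq) end-image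
          (no l≢) →
            let (l≢a , l≢b) = other l≢ q z∈
                (_ , l′ , same) = chain l≢a l≢b q (proj₁ (inside z∈))
            in l′ , (λ {y} → (λ m → subst (λ p → Mem p l′) (ψ-big y) (proj₁ (same _) m)) , (λ m → proj₂ (same _) (subst (λ p → Mem p l′) (sym (ψ-big y)) m))) ,
               λ {y} _ → (λ r → mem⇒inc (subst (λ p → Mem p l′) (ψ-small y) (proj₁ (same _) (inc⇒mem r)))) ,
                         (λ r → mem⇒inc (proj₂ (same _) (subst (λ p → Mem p l′) (sym (ψ-small y)) (inc⇒mem r))))

  module Collision {a b a₂ b₂ : Site} (B₁ : Bad a b) (B₂ : Bad a₂ b₂)
                   (σ≡ : ∀ y → Bad.σ B₁ (inj₂ y) ≡ Bad.σ B₂ (inj₂ y))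
                   (to≡ : act (Bad.γ B₁) (Bad.origin B₁) ≡ act (Bad.γ B₂) (Bad.origin B₂)) where


    x≡ : (Bad.x B₁) ≡ (Bad.x B₂)
    x≡ = SumP.inj₁-injective (trans (sym (trans (Bad.part-to B₁ (Bad.origin B₁)) (Bad.σ-π B₁ (v a))))
           (trans (cong partOf to≡) (trans (Bad.part-to B₂ (Bad.origin B₂)) (Bad.σ-π B₂ (v a₂)))))

    f≡ : (Bad.f B₁) ≡ (Bad.f B₂)
    f≡ = let (k , eq) = shape _ (trans (Bad.part-to B₁ (Bad.origin B₁)) (Bad.σ-π B₁ (v a))) in
         trans (f-inc B₁ eq) (sym (f-inc B₂ (trans (sym to≡) eq)))
      where
      shape : ∀ {y} (u : KV m₁ n₁ m₂ n₂) → partOf u ≡ inj₁ y → ∃ λ k → u ≡ inj₁ (y , k)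
      shape (inj₁ (_ , k)) refl = k , refl
      f-inc : ∀ {s t y k} (B : Bad s t) → act (Bad.γ B) (Bad.origin B) ≡ inj₁ (y , k) → Bad.f B ≡ inc y k
      f-inc {y = y} {k} B eq with Bad.rename-cases B (inc y k)
      ... | inj₁ (_ , r) = ⊥-elim (Bad.moved B (trans (cong (Bad.c′ B) eq) r))
      ... | inj₂ (_ , r) = trans (cong (Bad.c′ B) eq) r

    outside : ∀ {y} → Inc y (Bad.f B₁) → (y ∉ seen (tree a) × y ∉ seen (tree b)) × (y ∉ seen (tree a₂) × y ∉ seen (tree b₂))
    outside {y} q = (Bad.outside-a B₁ ∘ closed (tree a) q x-f , (Bad.outside-b B₁) ∘ closed (tree b) q x-f) ,
                    (Bad.outside-a B₂ ∘ subst (_∈ seen (tree a₂)) x≡ ∘ closed (tree a₂) q x-f ,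
                     (Bad.outside-b B₂) ∘ subst (_∈ seen (tree b₂)) x≡ ∘ closed (tree b₂) q x-f)
      where
      x-f : Inc (Bad.x B₁) (Bad.f B₁)
      x-f = (Bad.f-inc B₁) (Bad.f-π B₁ (Bad.a-joined B₁))

    absurd : ∀ s t → s ≡ a ⊎ s ≡ b → t ≡ a₂ ⊎ t ≡ b₂ → (Bad.π B₁) (v s) ≡ (Bad.π B₂) (v t) → Inc (Bad.π B₁ (v s)) (Bad.f B₁) → ¬ Apart (tree s) (tree t)
    absurd s t s-end t-end meet inc-f ap = Swap.absurd (seen (tree s)) (seen (tree t)) (closed (tree s)) (closed (tree t)) ap
        H₁.φ H₂.φ (λ z∈ → proj₂ (H₁.inside meet o z∈)) (λ z∈ → proj₂ (H₂.inside (sym meet) o₂ z∈))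
        (λ {z} _ → trans (cong (Bad.π′ B₁) (Bad.ππ′ B₂ (Bad.π B₁ z))) (Bad.π′π B₁ z)) (λ {z} _ → trans (cong (Bad.π′ B₂) (Bad.ππ′ B₁ (Bad.π B₂ z))) (Bad.π′π B₂ z))
        (H₁.embeds meet o) (H₂.embeds (sym meet) o₂) (v∈ s)
      where
      module H₁ = Half B₁ B₂ s t s-end t-end σ≡ f≡
      module H₂ = Half B₂ B₁ t s t-end s-end (sym ∘ σ≡) (sym f≡)
      o : H₁.Outside (Bad.π B₁ (v s))
      o = outside inc-f
      o₂ : H₂.Outside (Bad.π B₂ (v t))
      o₂ = subst H₂.Outside meet (proj₂ o , proj₁ o)

    first-side : ¬ Apart (tree a) (tree a₂)
    first-side = absurd a a₂ (inj₁ refl) (inj₁ refl) x≡ (Bad.f-inc B₁ (Bad.f-π B₁ (Bad.a-joined B₁)))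

    -- The image of `v b` lies in f, so the second symmetry brings it back to `v a₂` or `v b₂`. The
    -- former already goes to x, the image of `v a`, so the latter remains.
    second-side : ¬ Apart (tree b) (tree b₂)
    second-side = absurd b b₂ (inj₂ refl) (inj₂ refl) y≡ y-inc
      where
      y-inc : Inc (Bad.π B₁ (v b)) (Bad.f B₁)
      y-inc = (Bad.f-inc B₁) (Bad.f-π B₁ (Bad.b-joined B₁))
      y-mem : (Bad.Mem′ B₂) (inj₁ (Bad.π B₁ (v b))) (Bad.f B₂)
      y-mem = (Bad.mem⇒ B₂) (Bad.mem≢a B₂ (Bad.f-π B₂ (Bad.a-joined B₂))) (inc⇒mem (subst (Inc (Bad.π B₁ (v b))) f≡ y-inc))
      y≡ : (Bad.π B₁) (v b) ≡ (Bad.π B₂) (v b₂)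
      y≡ = [ (λ eq → ⊥-elim (Bad.va≢vb B₁ (trans (sym (Bad.π′π B₁ (v a)))
                 (trans (cong (Bad.π′ B₁) (trans x≡ (trans (cong (Bad.π B₂) (sym eq)) (Bad.ππ′ B₂ _)))) (Bad.π′π B₁ (v b)))))) ,
             (λ eq → trans (sym (Bad.ππ′ B₂ _)) (cong (Bad.π B₂) eq)) ]′ (Bad.f-π′ B₂ y-mem)

  Goal : Set
  Goal = HasDist {m₁} {n₁} {m₂} {n₂} Lab

  try : (a b : Site) → Apart (Site.tree a) (Site.tree b) → length (seen (Site.tree a)) ≡ length (seen (Site.tree b)) → Goal ⊎ Bad a b
  try a b apart equal with dist-or-symmetry _≟L_ (Merge.c′ a b apart)
  ... | inj₁ d = inj₁ (_≟L_ , _ , d)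
  ... | inj₂ (γ , (w , γw≢w) , fix) = inj₂ record
    { apart = apart ; γ = γ ; fix = fix ; equal = equal
    ; moved = λ fixed → γw≢w (Merge.fixing-trivial a b apart γ fix fixed w) }

  -- What two failed mergers must share for `Collision`: the small vertex to which the origin goes,
  -- with m₁ n₁ possibilities, and the map on the large parts, with at most m₂ ^ m₂.
  key : ∀ {a b} → Bad a b → Fin (m₁ * n₁ * m₂ ^ m₂)
  key B with act (Bad.γ B) (Bad.origin B) | trans (Bad.part-to B (Bad.origin B)) (Bad.σ-π B _)
  ... | inj₁ (y , k) | _ = combine (combine y k) (funToFin (λ x → proj₁ (Bad.σ-big B x)))
  ... | inj₂ _ | ()

  key-inj : ∀ {a b a₂ b₂} (B₁ : Bad a b) (B₂ : Bad a₂ b₂) → key B₁ ≡ key B₂ →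
    (∀ x → Bad.σ B₁ (inj₂ x) ≡ Bad.σ B₂ (inj₂ x)) × act (Bad.γ B₁) (Bad.origin B₁) ≡ act (Bad.γ B₂) (Bad.origin B₂)
  key-inj B₁ B₂ eq
    with act (Bad.γ B₁) (Bad.origin B₁) | trans (Bad.part-to B₁ (Bad.origin B₁)) (Bad.σ-π B₁ _)
       | act (Bad.γ B₂) (Bad.origin B₂) | trans (Bad.part-to B₂ (Bad.origin B₂)) (Bad.σ-π B₂ _)
  ... | inj₁ (y , k) | _ | inj₁ (y′ , k′) | _ with yk≡ , ρ≡ ← FinP.combine-injective _ _ _ _ eq
      with refl , refl ← FinP.combine-injective y k y′ k′ yk≡ =
        (λ x → trans (proj₂ (Bad.σ-big B₁ x)) (trans (cong inj₂ (funToFin-inj _ _ ρ≡ x)) (sym (proj₂ (Bad.σ-big B₂ x))))) , refl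
  ... | inj₁ _ | _ | inj₂ _ | ()
  ... | inj₂ _ | () | _ | _

  apart-sym : ∀ {T T′} → Apart T T′ → Apart T′ T
  apart-sym ap p q = ap q p

  -- One site from each of two families makes h² pairs, more than there are keys. Two failed pairs
  -- with the same key have the same row and the same column by `Collision`, a contradiction.
  module Grid (h : ℕ) (as bs : Fin h → Site) (len : ℕ)
              (as-len : ∀ i → length (seen (Site.tree (as i))) ≡ len) (bs-len : ∀ i → length (seen (Site.tree (bs i))) ≡ len)
              (ab : ∀ i k → Apart (Site.tree (as i)) (Site.tree (bs k)))
              (aa : ∀ {i k} → i ≢ k → Apart (Site.tree (as i)) (Site.tree (as k)))
              (bb : ∀ {i k} → i ≢ k → Apart (Site.tree (bs i)) (Site.tree (bs k)))
              (large : m₁ * n₁ * m₂ ^ m₂ < h * h) where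

    row col : Fin (h * h) → Fin h
    row x = proj₁ (remQuot {h} h x)
    col x = proj₂ (remQuot {h} h x)

    goal : Goal
    goal with fin-choice (λ x → try (as (row x)) (bs (col x)) (ab _ _) (trans (as-len _) (sym (bs-len _))))
    ... | inj₁ g = g
    ... | inj₂ bad with x , y , x<y , eq ← FinP.pigeonhole large (λ x → key (bad x))
      with σ≡ , to≡ ← key-inj (bad x) (bad y) eq
      with row x FinP.≟ row y | col x FinP.≟ col y
    ... | no ne | _     = ⊥-elim (Collision.first-side (bad x) (bad y) σ≡ to≡ (aa ne))
    ... | _     | no ne = ⊥-elim (Collision.second-side (bad x) (bad y) σ≡ to≡ (bb ne))
    ... | yes r | yes s = ⊥-elim (FinP.<⇒≢ x<y (trans (sym (FinP.combine-remQuot {h} h x))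
            (trans (cong₂ (combine {h} {h}) r s) (FinP.combine-remQuot {h} h y))))

  site : (T : Component) → Usable T → Site
  site T us with find us
  ... | v , v∈ , i , lone , all-big = record { tree = T ; v = v ; v∈ = v∈ ; i = i ; lone = lone ; all-big = all-big }

  site-tree : ∀ T us → Site.tree (site T us) ≡ T
  site-tree T us with find us
  ... | v , v∈ , i , lone , all-big = refl

  module SameSize (S h len : ℕ) where

    small-ones big-ones cs : List Component
    small-ones = filter (small? S) usable-trees
    big-ones = filter (¬? ∘ small? S) usable-trees
    cs = filter (λ T → length (seen T) ≟ len) small-ones

    usable-apart : AllPairs Apart usable-trees
    usable-apart = AllPairsP.filter⁺ usable? trees-apart

    big-count : length big-ones * suc S ≤ m₁
    big-count = ≤-trans (few-large (suc S) big-ones (AllPairsP.filter⁺ (¬? ∘ small? S) usable-apart) (allFin m₁) (λ {_} {z} _ _ → MemP.∈-allFin z)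
        (λ T∈ → ≰⇒> (proj₂ (MemP.∈-filter⁻ (¬? ∘ small? S) {xs = usable-trees} T∈))))
      (≤-reflexive (ListP.length-tabulate {n = m₁} id))

    many : length small-ones ≤ suc S * length cs → (∀ l → l * suc S ≤ m₁ → l + suc S * (h + h) ≤ length usable-trees) → h + h ≤ length cs
    many fibre enough = ≮⇒≥ λ few → <⇒≱ (less few) (enough (length big-ones) big-count)
      where
      open ≤-Reasoning
      less : length cs < h + h → length usable-trees < length big-ones + suc S * (h + h)
      less few = begin-strict
        length usable-trees                     ≡⟨ length-filter-split (small? S) usable-trees ⟩
        length small-ones + length big-ones     ≤⟨ +-monoˡ-≤ _ fibre ⟩
        suc S * length cs + length big-ones     <⟨ +-monoˡ-< (length big-ones) (*-monoʳ-< (suc S) few) ⟩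
        suc S * (h + h) + length big-ones       ≡⟨ +-comm _ (length big-ones) ⟩
        length big-ones + suc S * (h + h)       ∎

    goal : h + h ≤ length cs → m₁ * n₁ * m₂ ^ m₂ < h * h → Goal
    goal many = Grid.goal h (λ i → at (left i)) (λ k → at (right k)) len (λ i → at-len (left i)) (λ k → at-len (right k))
      (λ i k → at-apart (left≢right i k)) (λ ne → at-apart (ne ∘ left-inj)) (λ ne → at-apart (ne ∘ right-inj))
      where
      left right : Fin h → Fin (length cs)
      left  i = inject≤ (i Fin.↑ˡ h) many
      right k = inject≤ (h Fin.↑ʳ k) many
      left-inj : ∀ {i k} → left i ≡ left k → i ≡ k
      left-inj {i} {k} eq = FinP.↑ˡ-injective h i k (FinP.inject≤-injective many many _ _ eq)
      right-inj : ∀ {i k} → right i ≡ right k → i ≡ k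
      right-inj {i} {k} eq = FinP.↑ʳ-injective h i k (FinP.inject≤-injective many many _ _ eq)
      left≢right : ∀ i k → left i ≢ right k
      left≢right i k eq = <⇒≢ (<-≤-trans (FinP.toℕ<n i) (m≤m+n h (toℕ k)))
        (trans (sym (FinP.toℕ-↑ˡ i h)) (trans (cong toℕ (FinP.inject≤-injective many many _ _ eq)) (FinP.toℕ-↑ʳ h k)))
      member : ∀ x → lookup cs x ∈ small-ones × length (seen (lookup cs x)) ≡ len
      member x = MemP.∈-filter⁻ (λ T → length (seen T) ≟ len) {xs = small-ones} (MemP.∈-lookup x)
      usable : ∀ x → Usable (lookup cs x)
      usable x = proj₂ (MemP.∈-filter⁻ usable? {xs = trees} (proj₁ (MemP.∈-filter⁻ (small? S) {xs = usable-trees} (proj₁ (member x)))))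
      at : Fin (length cs) → Site
      at x = site (lookup cs x) (usable x)
      at-tree : ∀ x → Site.tree (at x) ≡ lookup cs x
      at-tree x = site-tree (lookup cs x) (usable x)
      at-len : ∀ x → length (seen (Site.tree (at x))) ≡ len
      at-len x = trans (cong (length ∘ seen) (at-tree x)) (proj₂ (member x))
      cs-apart : AllPairs Apart cs
      cs-apart = AllPairsP.filter⁺ (λ T → length (seen T) ≟ len) (AllPairsP.filter⁺ (small? S) (AllPairsP.filter⁺ usable? trees-apart))
      at-apart : ∀ {x y} → x ≢ y → Apart (Site.tree (at x)) (Site.tree (at y))
      at-apart {x} {y} ne = subst₂ Apart (sym (at-tree x)) (sym (at-tree y)) (allPairs-lookup (λ {T} {T′} → apart-sym {T} {T′}) cs-apart x y ne)

  -- l stands for the number of usable trees with more than S vertices. The others have only S + 1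
  -- possible sizes and are at least 2 h (S + 1) in number, so 2 h of them share a size; half of
  -- these become rows and half columns.
  merge-step : ∀ S h → m₁ * n₁ * m₂ ^ m₂ < h * h →
    (∀ l → l * suc S ≤ m₁ → l + suc S * (h + h) ≤ length usable-trees) → Goal
  merge-step S h large enough =
    let (len , fibre) = large-fibre (length ∘ seen) S (filter (small? S) usable-trees)
          (λ T∈ → proj₂ (MemP.∈-filter⁻ (small? S) {xs = usable-trees} T∈))
    in SameSize.goal S h len (SameSize.many S h len fibre enough) large

-- An explicit partition from a rigid forest

module Parents {m : ℕ} (par : Fin m → Maybe (Fin m)) where

  -- An edge is named by its child end: e names the edge from e to its parent, and a root names
  -- none.
  Ends : Fin m → Fin m → Set
  Ends v e = ∃ λ p → par e ≡ just p × (v ≡ e ⊎ v ≡ p)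

  ends? : ∀ v e → Dec (Ends v e)
  ends? v e with par e
  ... | nothing = no λ { (_ , () , _) }
  ... | just p  = map′ (λ h → p , refl , h) (λ { (_ , refl , h) → h }) ((v FinP.≟ e) ⊎-dec (v FinP.≟ p))

  edgesAt : Fin m → List (Fin m)
  edgesAt v = filter (ends? v) (allFin m)

  deg : Fin m → ℕ
  deg v = length (edgesAt v)

  Adj′ : Fin m → Fin m → Set
  Adj′ u w = par u ≡ just w ⊎ par w ≡ just u

  NonRoot : Fin m → Set
  NonRoot e = ∃ λ p → par e ≡ just p

  nonRoot? : ∀ e → Dec (NonRoot e)
  nonRoot? e with par e
  ... | nothing = no λ ()
  ... | just p  = yes (p , refl)

-- The y form a path of vertices of degree two. Its edges come first in the numbering by which the
-- large parts are told apart, and its vertices guarantee that the long blocks, which fill slots of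
-- vertices without single blocks, have many members.
record Forest (m Y : ℕ) : Set where
  field
    par : Fin m → Maybe (Fin m)
  open Parents par public
  field
    irrefl   : ∀ {v} → par v ≢ just v
    no-2-cyc : ∀ {u w} → par u ≡ just w → par w ≢ just u
    deg≥1    : ∀ v → 1 ≤ deg v
    deg≤3    : ∀ v → deg v ≤ 3
    rigid    : (π π′ : Fin m → Fin m) → (∀ v → π′ (π v) ≡ v) → (∀ v → π (π′ v) ≡ v) →
               (∀ {u w} → Adj′ u w → Adj′ (π u) (π w)) → (∀ {u w} → Adj′ u w → Adj′ (π′ u) (π′ w)) → ∀ v → π v ≡ v
    y        : Fin Y → Fin m
    y-inj    : ∀ {i k} → y i ≡ y k → i ≡ k
    y-deg    : ∀ i → deg (y i) ≡ 2
    y-root   : ∀ i → NonRoot (y i)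
    y-par    : ∀ i k → toℕ k ≡ suc (toℕ i) → par (y k) ≡ just (y i)


  OffPath : Fin m → Set
  OffPath e = NonRoot e × (∀ i → y i ≢ e)

  offPath? : ∀ e → Dec (OffPath e)
  offPath? e = nonRoot? e ×-dec FinP.all? (λ i → ¬? (y i FinP.≟ e))

  edges : List (Fin m)
  edges = map y (allFin Y) ++ filter offPath? (allFin m)

  edges-unique : Unique edges
  edges-unique = UniqueP.++⁺ (UniqueP.map⁺ y-inj (UniqueP.allFin⁺ Y)) (UniqueP.filter⁺ offPath? (UniqueP.allFin⁺ m))
    λ (p , q) → case MemP.∈-map⁻ y p of λ { (i , _ , refl) → proj₂ (proj₂ (MemP.∈-filter⁻ offPath? {xs = allFin m} q)) i refl }

  edges-nonroot : ∀ {e} → e ∈ edges → NonRoot e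
  edges-nonroot e∈ with MemP.∈-++⁻ (map y (allFin Y)) e∈
  ... | inj₁ p = case MemP.∈-map⁻ y p of λ { (i , _ , refl) → y-root i }
  ... | inj₂ q = proj₁ (proj₂ (MemP.∈-filter⁻ offPath? {xs = allFin m} q))

  -- Edges are numbered along the path first.
  edges-prefix : (i : Fin Y) (x : Fin (length edges)) → toℕ x ≡ toℕ i → lookup edges x ≡ y i
  edges-prefix i = prefix (filter offPath? (allFin m)) y id (ListP.map-tabulate id y) i
    where
    prefix : ∀ {Y} (zs : List (Fin m)) (f : Fin Y → Fin m) {ws} → (Fin m → Fin m) → ws ≡ List.tabulate f →
      (i : Fin Y) (x : Fin (length (ws ++ zs))) → toℕ x ≡ toℕ i → lookup (ws ++ zs) x ≡ f i
    prefix zs f g refl zero    zero    eq = refl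
    prefix zs f g refl (suc i) (suc x) eq = prefix zs (f ∘ suc) g refl i x (suc-injective eq)

pattern pr e   = inj₁ e
pattern sg v A = inj₂ (inj₁ (v , A))
pattern em v   = inj₂ (inj₂ (inj₁ v))
pattern tt′ t  = inj₂ (inj₂ (inj₂ t))

lookup-ext : ∀ {n} (A A′ : Sub n) → (∀ b → (Vec.lookup A b ≡ true → Vec.lookup A′ b ≡ true) × (Vec.lookup A′ b ≡ true → Vec.lookup A b ≡ true)) → A ≡ A′
lookup-ext []      []        h = refl
lookup-ext (a ∷ A) (a′ ∷ A′) h = cong₂ _∷_ (head a a′ (h zero)) (lookup-ext A A′ (h ∘ suc))
  where
  head : ∀ a a′ → (a ≡ true → a′ ≡ true) × (a′ ≡ true → a ≡ true) → a ≡ a′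
  head true  a′    (f , g) = sym (f refl)
  head false false (f , g) = refl
  head false true  (f , g) = g refl

contains? : ∀ {n} (b : Fin n) (A : Sub n) → Dec (Vec.lookup A b ≡ true)
contains? b A = Vec.lookup A b ≟b true

module Explicit {m Y : ℕ} (n₁ n₂ m₂ : ℕ) (F : Forest m Y)
  (3≤n₁ : 3 ≤ n₁) (Y-large : n₁ + m₂ + 6 ≤ Y)
  {Rich : Fin m → Set} (rich? : ∀ v → Dec (Rich v)) (y-poor : ∀ i → ¬ Rich (Forest.y F i))
  (fam : Fin m → List (Sub m₂)) (fam-unique : ∀ {v} → Rich v → Unique (fam v))
  (fam-length : ∀ {v} → Rich v → length (fam v) ≡ n₁ ∸ Forest.deg F v)
  where

  open Forest F

  -- Blocks: an edge of the forest, a single vertex with a set of large parts, a single vertex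
  -- alone, and for each t a large block without large parts.
  Blk : Set
  Blk = Fin m ⊎ (Fin m × Sub m₂) ⊎ Fin m ⊎ ℕ

  _≟B_ : DecidableEquality Blk
  _≟B_ = SumP.≡-dec FinP._≟_ (SumP.≡-dec (ProdP.≡-dec FinP._≟_ (VecP.≡-dec _≟b_)) (SumP.≡-dec FinP._≟_ _≟_))

  -- Layer t is left out at y t, where a block of its own fills the slot, so that different layers
  -- have different members. Layer n₁ - 2 would exist only at vertices of degree one and might have
  -- too few members, so it is replaced in this way everywhere.
  Special : Fin m → ℕ → Set
  Special v t = t ≡ n₁ ∸ 2 ⊎ ∃ λ i → toℕ i ≡ t × y i ≡ v

  special? : ∀ v t → Dec (Special v t)
  special? v t = (t ≟ n₁ ∸ 2) ⊎-dec FinP.any? (λ i → (toℕ i ≟ t) ×-dec (y i FinP.≟ v))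

  layer : Fin m → ℕ → Blk
  layer v t with special? v t
  ... | yes _ = em v
  ... | no  _ = tt′ t

  single : Fin m → Sub m₂ → Blk
  single v A = sg v A

  rest : ∀ {v} → Dec (Rich v) → List Blk
  rest {v} (yes _) = map (single v) (fam v)
  rest {v} (no  _) = map (layer v) (upTo (n₁ ∸ deg v))

  slots : Fin m → List Blk
  slots v = map inj₁ (edgesAt v) ++ rest (rich? v)

  deg≤n₁ : ∀ v → deg v ≤ n₁
  deg≤n₁ v = ≤-trans (deg≤3 v) 3≤n₁

  slots-length : ∀ v → length (slots v) ≡ n₁
  slots-length v = trans (ListP.length-++ (map inj₁ (edgesAt v))) (trans (cong₂ _+_ (ListP.length-map inj₁ (edgesAt v)) (rest-length (rich? v))) (m+[n∸m]≡n (deg≤n₁ v)))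
    where
    rest-length : (d : Dec (Rich v)) → length (rest d) ≡ n₁ ∸ deg v
    rest-length (yes r) = trans (ListP.length-map (single v) (fam v)) (fam-length r)
    rest-length (no _)  = trans (ListP.length-map (layer v) (upTo (n₁ ∸ deg v))) (ListP.length-upTo (n₁ ∸ deg v))

  layer≢pr : ∀ v t {e} → inj₁ e ≢ layer v t
  layer≢pr v t eq with special? v t
  layer≢pr v t () | yes _
  layer≢pr v t () | no _

  layer-inj : ∀ v {t t′} → t < n₁ ∸ deg v → t′ < n₁ ∸ deg v → layer v t ≡ layer v t′ → t ≡ t′
  layer-inj v {t} {t′} t< t′< eq with special? v t | special? v t′
  layer-inj v t< t′< refl | no _ | no _ = refl
  layer-inj v t< t′< ()   | yes _ | no _
  layer-inj v t< t′< ()   | no _ | yes _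
  layer-inj v t< t′< eq | yes (inj₁ p) | yes (inj₁ q) = trans p (sym q)
  layer-inj v t< t′< eq | yes (inj₂ (i , p , yi)) | yes (inj₂ (k , q , yk)) = trans (sym p) (trans (cong toℕ (y-inj (trans yi (sym yk)))) q)
  layer-inj v t< t′< eq | yes (inj₁ p) | yes (inj₂ (k , q , refl)) = ⊥-elim (<⇒≢ (<-≤-trans t< (≤-reflexive (cong (n₁ ∸_) (y-deg k)))) p)
  layer-inj v t< t′< eq | yes (inj₂ (k , q , refl)) | yes (inj₁ p) = ⊥-elim (<⇒≢ (<-≤-trans t′< (≤-reflexive (cong (n₁ ∸_) (y-deg k)))) p)

  In : Fin m → Blk → Set
  In v (pr e)   = Ends v e
  In v (sg x A) = x ≡ v × Rich v × A ∈ fam v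
  In v (em x)   = x ≡ v × ¬ Rich v × 0 < n₁ ∸ deg v
  In v (tt′ t)  = ¬ Rich v × t < n₁ ∸ deg v × ¬ Special v t

  slots⇒In : ∀ {v B} → B ∈ slots v → In v B
  slots⇒In {v} {B} B∈ with MemP.∈-++⁻ (map inj₁ (edgesAt v)) B∈
  ... | inj₁ p with e , e∈ , refl ← MemP.∈-map⁻ inj₁ p = proj₂ (MemP.∈-filter⁻ (ends? v) {xs = allFin m} e∈)
  ... | inj₂ p with rich? v
  ...   | yes r with A , A∈ , refl ← MemP.∈-map⁻ (single v) p = refl , r , A∈
  ...   | no ¬r with t , t∈ , refl ← MemP.∈-map⁻ (layer v) p with special? v t
  ...     | yes _  = refl , ¬r , ≤-trans (s≤s z≤n) (MemP.∈-upTo⁻ t∈)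
  ...     | no ¬sp = ¬r , MemP.∈-upTo⁻ t∈ , ¬sp

  In⇒slots-pr : ∀ {v e} → Ends v e → pr e ∈ slots v
  In⇒slots-pr {v} {e} h = MemP.∈-++⁺ˡ (MemP.∈-map⁺ inj₁ (MemP.∈-filter⁺ (ends? v) (MemP.∈-allFin e) h))

  In⇒slots-sg : ∀ {v A} → Rich v → A ∈ fam v → sg v A ∈ slots v
  In⇒slots-sg {v} r A∈ with rich? v
  ... | yes _ = MemP.∈-++⁺ʳ (map inj₁ (edgesAt v)) (MemP.∈-map⁺ (single v) A∈)
  ... | no ¬r = ⊥-elim (¬r r)

  layer∈ : ∀ {v t} → ¬ Rich v → t < n₁ ∸ deg v → layer v t ∈ slots v
  layer∈ {v} ¬r t< with rich? v
  ... | yes r = ⊥-elim (¬r r)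
  ... | no  _ = MemP.∈-++⁺ʳ (map inj₁ (edgesAt v)) (MemP.∈-map⁺ (layer v) (MemP.∈-upTo⁺ t<))

  layer-ordinary : ∀ {v t} → ¬ Special v t → layer v t ≡ tt′ t
  layer-ordinary {v} {t} ¬sp with special? v t
  ... | yes sp = ⊥-elim (¬sp sp)
  ... | no  _  = refl

  In⇒slots-tt : ∀ {v t} → In v (tt′ t) → tt′ t ∈ slots v
  In⇒slots-tt (¬r , t< , ¬sp) = subst (_∈ slots _) (layer-ordinary ¬sp) (layer∈ ¬r t<)

  slots-unique : ∀ v → Unique (slots v)
  slots-unique v = UniqueP.++⁺ (UniqueP.map⁺ SumP.inj₁-injective (UniqueP.filter⁺ (ends? v) (UniqueP.allFin⁺ m))) (rest-unique (rich? v))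
    λ (p , q) → case MemP.∈-map⁻ inj₁ p of λ { (_ , _ , refl) → not-pr (rich? v) q }
    where
    rest-unique : (d : Dec (Rich v)) → Unique (rest d)
    rest-unique (yes r) = UniqueP.map⁺ (λ { refl → refl }) (fam-unique r)
    rest-unique (no _)  = map-unique (layer v) (UniqueP.upTo⁺ _) (λ p q → layer-inj v (MemP.∈-upTo⁻ p) (MemP.∈-upTo⁻ q))
    not-pr : (d : Dec (Rich v)) → ∀ {e} → inj₁ e ∉ rest d
    not-pr (yes _) q = case MemP.∈-map⁻ (single v) q of λ { (_ , _ , ()) }
    not-pr (no _)  q = let (t , _ , eq) = MemP.∈-map⁻ (layer v) q in layer≢pr v t eq

  singles : Fin m₂ → List Blk
  singles b = concatMap (λ v → map (single v) (filter (contains? b) (fam v))) (filter rich? (allFin m))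

  singles⁻ : ∀ {b B} → B ∈ singles b → ∃₂ λ v A → B ≡ sg v A × Rich v × A ∈ fam v × Vec.lookup A b ≡ true
  singles⁻ {b} B∈ with v , v∈ , p ← ∈-concatMap⁻ (λ v → map (single v) (filter (contains? b) (fam v))) {xs = filter rich? (allFin m)} B∈
                  with A , A∈ , refl ← MemP.∈-map⁻ (single v) p =
    let (q , r) = MemP.∈-filter⁻ (contains? b) {xs = fam v} A∈ in v , A , refl , proj₂ (MemP.∈-filter⁻ rich? {xs = allFin m} v∈) , q , r

  singles⁺ : ∀ {b v A} → Rich v → A ∈ fam v → Vec.lookup A b ≡ true → sg v A ∈ singles b
  singles⁺ {b} {v} r A∈ t = ∈-concatMap (λ v → map (single v) (filter (contains? b) (fam v))) (MemP.∈-filter⁺ rich? (MemP.∈-allFin v) r)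
    (MemP.∈-map⁺ (single v) (MemP.∈-filter⁺ (contains? b) A∈ t))

  singles-unique : ∀ b → Unique (singles b)
  singles-unique b = concatMap-unique (λ v → map (single v) (filter (contains? b) (fam v))) (UniqueP.filter⁺ rich? (UniqueP.allFin⁺ m))
    (λ v∈ → UniqueP.map⁺ (λ { refl → refl }) (UniqueP.filter⁺ (contains? b) (fam-unique (proj₂ (MemP.∈-filter⁻ rich? {xs = allFin m} v∈)))))
    (λ {v} {w} _ _ p q → case MemP.∈-map⁻ (single v) p of λ { (_ , _ , refl) → case MemP.∈-map⁻ (single w) q of λ { (_ , _ , refl) → refl } })

  base : Fin m₂ → ℕ
  base b = length (singles b)

  -- d b is the number of edges that contain the large part b, which is what the single blocks leave
  -- of n₂. It is positive because the first of these edges identifies b.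
  module Build (d : Fin m₂ → ℕ) (d≥1 : ∀ b → 1 ≤ d b) (d-fits : ∀ b → 2 + toℕ b + d b ≤ length edges)
               (d-total : ∀ b → d b + base b ≡ n₂) (poor-if-equal : n₁ ≡ n₂ → ∀ v → ¬ Rich v) where

    -- The large part b lies on the edges 2 + b, …, 1 + b + d b.
    pos : ∀ b → Fin (d b) → Fin (length edges)
    pos b i = fromℕ< (<-≤-trans (+-monoʳ-< (2 + toℕ b) (FinP.toℕ<n i)) (d-fits b))

    toℕ-pos : ∀ b i → toℕ (pos b i) ≡ 2 + toℕ b + toℕ i
    toℕ-pos b i = FinP.toℕ-fromℕ< _

    D : Fin m₂ → List (Fin m)
    D b = map (lookup edges ∘ pos b) (allFin (d b))

    D-unique : ∀ b → Unique (D b)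
    D-unique b = UniqueP.map⁺ (λ {i} {k} eq → FinP.toℕ-injective (+-cancelˡ-≡ (2 + toℕ b) _ _
      (trans (sym (toℕ-pos b i)) (trans (cong toℕ (lookup-injective edges-unique _ _ eq)) (toℕ-pos b k))))) (UniqueP.allFin⁺ (d b))

    D-nonroot : ∀ {b e} → e ∈ D b → NonRoot e
    D-nonroot {b} e∈ with i , _ , refl ← MemP.∈-map⁻ (lookup edges ∘ pos b) e∈ = edges-nonroot (MemP.∈-lookup (pos b i))

    big-slots : Fin m₂ → List Blk
    big-slots b = map inj₁ (D b) ++ singles b

    big-slots-length : ∀ b → length (big-slots b) ≡ n₂
    big-slots-length b = trans (ListP.length-++ (map inj₁ (D b))) (trans (cong (_+ base b)
      (trans (ListP.length-map inj₁ (D b)) (trans (ListP.length-map _ (allFin (d b))) (ListP.length-tabulate {n = d b} id)))) (d-total b))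

    big-slots-unique : ∀ b → Unique (big-slots b)
    big-slots-unique b = UniqueP.++⁺ (UniqueP.map⁺ SumP.inj₁-injective (D-unique b)) (singles-unique b)
      λ (p , q) → case MemP.∈-map⁻ inj₁ p of λ { (_ , _ , refl) → case singles⁻ {b} q of λ { (_ , _ , () , _) } }

    InB : Fin m₂ → Blk → Set
    InB b (pr e)   = e ∈ D b
    InB b (sg v A) = Rich v × A ∈ fam v × Vec.lookup A b ≡ true
    InB b (em _)   = ⊥
    InB b (tt′ _)  = ⊥

    big-slots⇒InB : ∀ {b B} → B ∈ big-slots b → InB b B
    big-slots⇒InB {b} B∈ with MemP.∈-++⁻ (map inj₁ (D b)) B∈
    ... | inj₁ p = case MemP.∈-map⁻ inj₁ p of λ { (_ , e∈ , refl) → e∈ }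
    ... | inj₂ q with v , A , refl , r ← singles⁻ {b} q = r

    c : KV m n₁ m₂ n₂ → Blk
    c (inj₁ (v , i)) = nth (slots v) (slots-length v) i
    c (inj₂ (b , i)) = nth (big-slots b) (big-slots-length b) i

    open Labelled _≟B_ c using
      (Pt; Mem; Fixes; Dist; SlotInjective; BlockExtensional; fixes-inverse; distinguishes; module Action)

    mem⇒In : ∀ {v B} → Mem (inj₁ v) B → In v B
    mem⇒In (inj₁ (v , i) , refl , refl) = slots⇒In (nth-∈ (slots v) (slots-length v) i)

    slots⇒mem : ∀ {v B} → B ∈ slots v → Mem (inj₁ v) B
    slots⇒mem {v} B∈ = let (i , eq) = ∈⇒nth (slots-length v) B∈ in inj₁ (v , i) , refl , eq

    mem⇒InB : ∀ {b B} → Mem (inj₂ b) B → InB b B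
    mem⇒InB (inj₂ (b , i) , refl , refl) = big-slots⇒InB {b} (nth-∈ (big-slots b) (big-slots-length b) i)

    bslots⇒mem : ∀ {b B} → B ∈ big-slots b → Mem (inj₂ b) B
    bslots⇒mem {b} B∈ = let (i , eq) = ∈⇒nth (big-slots-length b) B∈ in inj₂ (b , i) , refl , eq

    D⇒mem : ∀ {b e} → e ∈ D b → Mem (inj₂ b) (pr e)
    D⇒mem {b} e∈ = bslots⇒mem {b} (MemP.∈-++⁺ˡ (MemP.∈-map⁺ inj₁ e∈))

    slot-inj : SlotInjective
    slot-inj {inj₁ (v , i)} {inj₁ (.v , k)} refl eq = cong (λ z → inj₁ (v , z)) (nth-injective (slots-unique v) (slots-length v) eq)
    slot-inj {inj₂ (b , i)} {inj₂ (.b , k)} refl eq = cong (λ z → inj₂ (b , z)) (nth-injective (big-slots-unique b) (big-slots-length b) eq)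

    Has : Fin m → Blk → Set
    Has v B = Mem (inj₁ v) B

    -- The sorts of blocks are recognised by their numbers of small parts: one for `sg` and `em`,
    -- two for an edge, at least three for a layer. Any symmetry that does not mix small and large
    -- parts preserves these numbers.
    Lone Two Three : Blk → Set
    Lone B  = ∀ {u w} → Has u B → Has w B → u ≡ w
    Two B   = ∃₂ λ u w → u ≢ w × Has u B × Has w B × (∀ {z} → Has z B → z ≡ u ⊎ z ≡ w)
    Three B = ∃ λ u → ∃₂ λ v w → (u ≢ v × u ≢ w × v ≢ w) × Has u B × Has v B × Has w B

    ends⇒mem : ∀ {v e} → Ends v e → Has v (pr e)
    ends⇒mem h = slots⇒mem (In⇒slots-pr h)

    pr-two : ∀ {e p} → par e ≡ just p → Two (pr e)
    pr-two {e} {p} eq = e , p , (λ { refl → irrefl eq }) , ends⇒mem (p , eq , inj₁ refl) , ends⇒mem (p , eq , inj₂ refl) ,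
      λ m → case mem⇒In m of λ { (q , eq′ , inj₁ r) → inj₁ r ; (q , eq′ , inj₂ r) → inj₂ (trans r (just-injective (trans (sym eq′) eq))) }

    used-pr : ∀ {p e} → Mem p (pr e) → NonRoot e
    used-pr {inj₁ v} m = let (p , eq , _) = mem⇒In m in p , eq
    used-pr {inj₂ b} m = D-nonroot {b} (mem⇒InB m)

    used-sg : ∀ {p v A} → Mem p (sg v A) → Rich v × A ∈ fam v
    used-sg {inj₁ v} m = case mem⇒In m of λ { (refl , r , A∈) → r , A∈ }
    used-sg {inj₂ b} m = let (r , A∈ , _) = mem⇒InB {b} m in r , A∈

    used-em : ∀ {p v} → Mem p (em v) → Has v (em v) × ¬ Rich v
    used-em {inj₁ v} m = case mem⇒In m of λ { (refl , ¬r , _) → m , ¬r }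
    used-em {inj₂ b} m = ⊥-elim (mem⇒InB {b} m)

    pred-pred : ∀ {n} → 3 ≤ n → n ∸ 1 ≡ suc (n ∸ 2)
    pred-pred (s≤s (s≤s _)) = refl

    used-tt : ∀ {p t} → Mem p (tt′ t) → t < n₁ ∸ 2
    used-tt {inj₁ v} {t} m = let (_ , t< , ¬sp) = mem⇒In m in
      ≤∧≢⇒< (≤-pred (≤-trans t< (≤-trans (∸-monoʳ-≤ n₁ (deg≥1 v)) (≤-reflexive (pred-pred 3≤n₁))))) (¬sp ∘ inj₁)
    used-tt {inj₂ b} m = ⊥-elim (mem⇒InB {b} m)

    y-tt : ∀ {t} → t < n₁ ∸ 2 → ∀ i → toℕ i ≢ t → Has (y i) (tt′ t)
    y-tt t< i i≢ = slots⇒mem (In⇒slots-tt (y-poor i , ≤-trans t< (≤-reflexive (cong (n₁ ∸_) (sym (y-deg i)))) ,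
      λ { (inj₁ eq) → <⇒≢ t< eq ; (inj₂ (k , eq , yk)) → i≢ (trans (cong toℕ (sym (y-inj yk))) eq) }))

    below-Y : ∀ {x} → x ≤ n₁ + m₂ + 5 → x < Y
    below-Y x≤ = ≤-trans (≤-trans (s≤s x≤) (≤-reflexive (sym (+-suc (n₁ + m₂) 5)))) Y-large

    abstract
      at : ∀ x → x ≤ n₁ + m₂ + 5 → Fin Y
      at x x≤ = fromℕ< (below-Y x≤)

      toℕ-at : ∀ {x} (x≤ : x ≤ n₁ + m₂ + 5) → toℕ (at x x≤) ≡ x
      toℕ-at x≤ = FinP.toℕ-fromℕ< (below-Y x≤)

    module _ {t : ℕ} (t< : t < n₁ ∸ 2) where

      next-fits : (x : Fin 4) → toℕ x + t ≤ n₁ + m₂ + 5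
      next-fits x = begin
        toℕ x + t      ≤⟨ +-mono-≤ (≤-trans (FinP.toℕ≤pred[n] x) (m≤m+n 3 2)) (≤-trans (<⇒≤ t<) (≤-trans (m∸n≤m n₁ 2) (m≤m+n n₁ m₂))) ⟩
        5 + (n₁ + m₂)  ≡⟨ +-comm 5 (n₁ + m₂) ⟩
        n₁ + m₂ + 5    ∎
        where open ≤-Reasoning

      nth-y : Fin 4 → Fin Y
      nth-y x = at (toℕ x + t) (next-fits x)

      nth-y-distinct : ∀ {x x′} → x ≢ x′ → y (nth-y x) ≢ y (nth-y x′)
      nth-y-distinct {x} {x′} ne eq = ne (FinP.toℕ-injective (+-cancelʳ-≡ t (toℕ x) (toℕ x′)
        (trans (sym (toℕ-at (next-fits x))) (trans (cong toℕ (y-inj eq)) (toℕ-at (next-fits x′))))))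

      nth-y-has : ∀ x → Has (y (nth-y (suc x))) (tt′ t)
      nth-y-has x = y-tt t< _ λ eq → <⇒≢ (s≤s (m≤n+m t (toℕ x))) (trans (sym eq) (toℕ-at (next-fits (suc x))))

      tt-three : Three (tt′ t)
      tt-three = _ , _ , _ , (nth-y-distinct {suc zero} {suc (suc zero)} (λ ()) , nth-y-distinct {suc zero} {suc (suc (suc zero))} (λ ()) ,
          nth-y-distinct {suc (suc zero)} {suc (suc (suc zero))} (λ ())) ,
        nth-y-has zero , nth-y-has (suc zero) , nth-y-has (suc (suc zero))

    lone-sg : ∀ {v A} → Lone (sg v A)
    lone-sg m m′ = trans (sym (proj₁ (mem⇒In m))) (proj₁ (mem⇒In m′))

    lone-em : ∀ {v} → Lone (em v)
    lone-em m m′ = trans (sym (proj₁ (mem⇒In m))) (proj₁ (mem⇒In m′))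

    two≢lone : ∀ {B} → Two B → ¬ Lone B
    two≢lone (u , w , ne , hu , hw , _) l = ne (l hu hw)

    three≢lone : ∀ {B} → Three B → ¬ Lone B
    three≢lone (u , v , w , (ne , _) , hu , hv , _) l = ne (l hu hv)

    three≢two : ∀ {B} → Three B → ¬ Two B
    three≢two (x , y , z , (xy , xz , yz) , hx , hy , hz) (u , w , _ , _ , _ , all) with all hx | all hy | all hz
    ... | inj₁ p | inj₁ q | _      = xy (trans p (sym q))
    ... | inj₁ p | inj₂ q | inj₁ r = xz (trans p (sym r))
    ... | inj₁ p | inj₂ q | inj₂ r = yz (trans q (sym r))
    ... | inj₂ p | inj₂ q | _      = xy (trans p (sym q))
    ... | inj₂ p | inj₁ q | inj₁ r = yz (trans q (sym r))
    ... | inj₂ p | inj₁ q | inj₂ r = xz (trans p (sym r))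

    Kind : Blk → Set
    Kind (pr e)   = Two (pr e)
    Kind (sg v A) = Lone (sg v A)
    Kind (em v)   = Lone (em v)
    Kind (tt′ t)  = Three (tt′ t)

    kind : ∀ {p} B → Mem p B → Kind B
    kind (pr e)   m = pr-two (proj₂ (used-pr m))
    kind (sg v A) m = lone-sg
    kind (em v)   m = lone-em
    kind (tt′ t)  m = tt-three (used-tt m)

    edge-determined : ∀ {e e′} → NonRoot e → NonRoot e′ → (∀ {z} → Ends z e → Ends z e′) → e ≡ e′
    edge-determined {e} {e′} (p , eq) (p′ , eq′) h with h (p , eq , inj₁ refl) | h (p , eq , inj₂ refl)
    ... | _ , _ , inj₁ r | _ = r
    ... | q , s , inj₂ r | q′ , s′ , inj₂ r′ = ⊥-elim (irrefl (subst (λ z → par e ≡ just z) (trans r′ (trans (just-injective (trans (sym s′) s)) (sym r))) eq))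
    ... | q , s , inj₂ r | q′ , s′ , inj₁ r′ = ⊥-elim (no-2-cyc eq (subst (λ z → par z ≡ just e) (sym r′) (trans s (cong just (sym r)))))

    Same : Blk → Blk → Set
    Same B B′ = ∀ q → (Mem q B → Mem q B′) × (Mem q B′ → Mem q B)

    same-two : ∀ {B B′} → Same B B′ → Two B → Two B′
    same-two s (u , w , ne , hu , hw , all) = u , w , ne , proj₁ (s _) hu , proj₁ (s _) hw , λ h → all (proj₂ (s _) h)

    same-lone : ∀ {B B′} → Same B B′ → Lone B → Lone B′
    same-lone s l h h′ = l (proj₂ (s _) h) (proj₂ (s _) h′)

    flip : ∀ {B B′} → Same B B′ → Same B′ B
    flip s q = proj₂ (s q) , proj₁ (s q)

    -- The number of small parts and the richness of a lone vertex determine the sort. Within a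
    -- sort, an edge is known from its ends, a single block from its vertex and its large parts, and
    -- layer t from its absence at y t.
    block-ext : BlockExtensional
    block-ext {B} {B′} {p} m s = go B B′ m (proj₁ (s p) m) s
      where
      sub-ext : ∀ {v A A′} → Mem p (sg v A) → Mem p (sg v A′) → Same (sg v A) (sg v A′) → A ≡ A′
      sub-ext {v} {A} {A′} m m′ s = lookup-ext A A′ λ b →
        (λ t → let (r , A∈) = used-sg m in proj₂ (proj₂ (mem⇒InB {b} (proj₁ (s (inj₂ b)) (bslots⇒mem {b} (MemP.∈-++⁺ʳ (map inj₁ (D b)) (singles⁺ r A∈ t))))))) ,
        (λ t → let (r , A∈) = used-sg m′ in proj₂ (proj₂ (mem⇒InB {b} (proj₂ (s (inj₂ b)) (bslots⇒mem {b} (MemP.∈-++⁺ʳ (map inj₁ (D b)) (singles⁺ r A∈ t)))))))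
      tt-ext : ∀ {t t′} → t < n₁ ∸ 2 → t′ < n₁ ∸ 2 → Same (tt′ t) (tt′ t′) → t ≡ t′
      tt-ext {t} {t′} t< t′< s with t ≟ t′
      ... | yes eq = eq
      ... | no ne = ⊥-elim (proj₂ (proj₂ (mem⇒In (proj₂ (s (inj₁ (y i))) (y-tt t′< i (λ eq → ne (trans (sym i≡) eq)))))) (inj₂ (i , i≡ , refl)))
        where
        i : Fin Y
        i = nth-y t< zero
        i≡ : toℕ i ≡ t
        i≡ = toℕ-at (next-fits t< zero)
      go : ∀ B B′ → Mem p B → Mem p B′ → Same B B′ → B ≡ B′
      go (pr e) (pr e′) m m′ s = cong inj₁ (edge-determined (used-pr m) (used-pr m′) (λ h → mem⇒In (proj₁ (s _) (ends⇒mem h))))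
      go (pr e) (sg v A) m m′ s = ⊥-elim (two≢lone {sg v A} (same-two s (kind (pr e) m)) lone-sg)
      go (pr e) (em v)   m m′ s = ⊥-elim (two≢lone {em v} (same-two s (kind (pr e) m)) lone-em)
      go (pr e) (tt′ t)  m m′ s = ⊥-elim (three≢two {tt′ t} (kind (tt′ t) m′) (same-two s (kind (pr e) m)))
      go (sg v A) (pr e) m m′ s = ⊥-elim (two≢lone {sg v A} (same-two (flip s) (kind (pr e) m′)) lone-sg)
      go (em v) (pr e)   m m′ s = ⊥-elim (two≢lone {em v} (same-two (flip s) (kind (pr e) m′)) lone-em)
      go (tt′ t) (pr e)  m m′ s = ⊥-elim (three≢two {tt′ t} (kind (tt′ t) m) (same-two (flip s) (kind (pr e) m′)))
      go (sg v A) (tt′ t) m m′ s = ⊥-elim (three≢lone {tt′ t} (kind (tt′ t) m′) (same-lone {sg v A} s lone-sg))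
      go (em v) (tt′ t)   m m′ s = ⊥-elim (three≢lone {tt′ t} (kind (tt′ t) m′) (same-lone {em v} s lone-em))
      go (tt′ t) (sg v A) m m′ s = ⊥-elim (three≢lone {tt′ t} (kind (tt′ t) m) (same-lone {sg v A} (flip s) lone-sg))
      go (tt′ t) (em v)   m m′ s = ⊥-elim (three≢lone {tt′ t} (kind (tt′ t) m) (same-lone {em v} (flip s) lone-em))
      go (tt′ t) (tt′ t′) m m′ s = cong (λ z → inj₂ (inj₂ (inj₂ z))) (tt-ext (used-tt m) (used-tt m′) s)
      go (em v) (em v′) m m′ s with refl ← mem⇒In (proj₁ (s (inj₁ v)) (proj₁ (used-em m))) .proj₁ = refl
      go (em v) (sg v′ A) m m′ s with refl ← mem⇒In (proj₁ (s (inj₁ v)) (proj₁ (used-em m))) .proj₁ = ⊥-elim (proj₂ (used-em m) (proj₁ (used-sg m′)))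
      go (sg v A) (em v′) m m′ s with refl ← mem⇒In (proj₂ (s (inj₁ v′)) (proj₁ (used-em m′))) .proj₁ = ⊥-elim (proj₂ (used-em m′) (proj₁ (used-sg m)))
      go (sg v A) (sg v′ A′) m m′ s
        with refl ← mem⇒In (proj₁ (s (inj₁ v)) (let (r , A∈) = used-sg m in slots⇒mem (In⇒slots-sg r A∈))) .proj₁ =
        cong (single v) (sub-ext m m′ s)

    -- Symmetries of the explicit partition

    module Act (i₁ : Fin n₁) (i₂ : Fin n₂) (γ : Aut (K m n₁ m₂ n₂)) (fix : Fixes γ) where

      module A = Action i₁ i₂ γ using (to; from; to-from; σ; σ′; σσ′; σ′σ; σ-small; mem-to; mem-from)
      open A using (σ; σ′; σσ′; σ′σ) public

      σ-inj : ∀ {p q} → σ p ≡ σ q → p ≡ q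
      σ-inj eq = trans (sym (σ′σ _)) (trans (cong σ′ eq) (σ′σ _))

      Onto : Blk → Blk → Set
      Onto B B′ = ∀ q → (Mem q B → Mem (σ q) B′) × (Mem (σ q) B′ → Mem q B)

      image : ∀ {p B} → Mem p B → ∃ λ B′ → Onto B B′
      image (u , _ , refl) = c (A.to u) , λ q → A.mem-to fix u q , A.mem-from fix u q

      preimage : ∀ {p B′} → Mem p B′ → ∃ λ B → Onto B B′
      preimage (w , _ , refl) = c (A.from w) , λ q →
        (λ m → subst (λ z → Mem (σ q) (c z)) (A.to-from w) (A.mem-to fix (A.from w) q m)) ,
        (λ m → A.mem-from fix (A.from w) q (subst (λ z → Mem (σ q) (c z)) (sym (A.to-from w)) m))

      pull : ∀ {B B′ p} → Onto B B′ → Mem p B′ → Mem (σ′ p) B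
      pull {B} {B′} {p} s m = proj₂ (s (σ′ p)) (subst (λ z → Mem z B′) (sym (σσ′ p)) m)

      -- The case n₁ ≡ n₂: a long block without large parts is mapped to such a block.
      module Equal (poor : ∀ v → ¬ Rich v) where

        em-only : ∀ {p v} → Mem p (em v) → p ≡ inj₁ v
        em-only {inj₁ z} m = cong inj₁ (sym (proj₁ (mem⇒In m)))
        em-only {inj₂ b} m = ⊥-elim (mem⇒InB {b} m)

        pr-listed : ∀ {e p} → par e ≡ just p → ∀ {q} → Mem q (pr e) → q ∈ inj₁ e ∷ inj₁ p ∷ map inj₂ (allFin m₂)
        pr-listed {e} {p} eq {inj₁ z} m with mem⇒In m
        ... | _ , _ , inj₁ refl   = here refl
        ... | _ , eq′ , inj₂ refl = there (here (cong inj₁ (just-injective (trans (sym eq′) eq))))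
        pr-listed eq {inj₂ b} m = there (there (MemP.∈-map⁺ inj₂ (MemP.∈-allFin b)))

        -- A layer contains 3 + m₂ small parts of the path, but an edge at most 2 + m₂ parts of
        -- either kind. So layers go to layers even if small and large parts are mixed.
        module Long {t : ℕ} (t< : t < n₁ ∸ 2) where

          fits : (x : Fin (3 + m₂)) → suc (toℕ x) + t ≤ n₁ + m₂ + 5
          fits x = ≤-trans (+-mono-≤ (FinP.toℕ<n x) (<⇒≤ (<-≤-trans t< (m∸n≤m n₁ 2))))
            (≤-trans (≤-reflexive (solve 2 (λ n m → con 3 :+ m :+ n := n :+ m :+ con 3) refl n₁ m₂)) (+-monoʳ-≤ (n₁ + m₂) (m≤m+n 3 2)))
            where open +-*-Solver

          idx : Fin (3 + m₂) → Fin Y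
          idx x = at (suc (toℕ x) + t) (fits x)

          idx-val : ∀ x → toℕ (idx x) ≡ suc (toℕ x) + t
          idx-val x = toℕ-at (fits x)

          part : Fin (3 + m₂) → Pt
          part x = σ (inj₁ (y (idx x)))

          part-inj : ∀ {x x′} → part x ≡ part x′ → x ≡ x′
          part-inj {x} {x′} eq = FinP.toℕ-injective (suc-injective (+-cancelʳ-≡ t _ _
            (trans (sym (idx-val x)) (trans (cong toℕ (y-inj (SumP.inj₁-injective (σ-inj eq)))) (idx-val x′)))))

          part-mem : ∀ x → Has (y (idx x)) (tt′ t)
          part-mem x = y-tt t< (idx x) (λ eq → <⇒≢ (s≤s (m≤n+m t (toℕ x))) (trans (sym eq) (idx-val x)))

          not-pr : ∀ {e} → ¬ Onto (tt′ t) (pr e)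
          not-pr {e} s = <⇒≱ (≤-refl {3 + m₂}) (begin
              3 + m₂                              ≡⟨ trans (ListP.length-map part (allFin (3 + m₂))) (ListP.length-tabulate {n = 3 + m₂} id) ⟨
              length (map part (allFin (3 + m₂))) ≤⟨ length-⊆ (UniqueP.map⁺ part-inj (UniqueP.allFin⁺ (3 + m₂))) inside ⟩
              length ends                         ≡⟨ cong (2 +_) (trans (ListP.length-map inj₂ (allFin m₂)) (ListP.length-tabulate {n = m₂} id)) ⟩
              2 + m₂                              ∎)
            where
            open ≤-Reasoning
            mem : ∀ x → Mem (part x) (pr e)
            mem x = proj₁ (s (inj₁ (y (idx x)))) (part-mem x)
            root : NonRoot e
            root = used-pr {part zero} (mem zero)
            ends : List Pt
            ends = inj₁ e ∷ inj₁ (proj₁ root) ∷ map inj₂ (allFin m₂)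
            inside : ∀ {q} → q ∈ map part (allFin (3 + m₂)) → q ∈ ends
            inside q∈ = let (x , _ , q≡) = MemP.∈-map⁻ part q∈ in subst (_∈ ends) (sym q≡) (pr-listed (proj₂ root) (mem x))

          not-em : ∀ {v} → ¬ Onto (tt′ t) (em v)
          not-em {v} s = case part-inj {zero} {suc zero} (trans (em-only (mem zero)) (sym (em-only (mem (suc zero))))) of λ ()
            where
            mem : ∀ x → Mem (part x) (em v)
            mem x = proj₁ (s (inj₁ (y (idx x)))) (part-mem x)

          tt-image : ∀ B → Onto (tt′ t) B → ∃ λ t′ → B ≡ tt′ t′ × t′ < n₁ ∸ 2
          tt-image (tt′ t′) s = t′ , refl , used-tt {part zero} (proj₁ (s (inj₁ (y (idx zero)))) (part-mem zero))
          tt-image (sg v A) s = ⊥-elim (poor v (proj₁ (used-sg {part zero} (proj₁ (s (inj₁ (y (idx zero)))) (part-mem zero)))))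
          tt-image (em v)   s = ⊥-elim (not-em {v} s)
          tt-image (pr e)   s = ⊥-elim (not-pr {e} s)

        0<n₁-2 : 0 < n₁ ∸ 2
        0<n₁-2 = ∸-monoˡ-≤ 2 3≤n₁

        module L₀ = Long 0<n₁-2

        layer-cases : ∀ v t → layer v t ≡ em v ⊎ layer v t ≡ tt′ t
        layer-cases v t with special? v t
        ... | yes _ = inj₁ refl
        ... | no  _ = inj₂ refl

        no-tt : ∀ {v b} → σ (inj₁ v) ≡ inj₂ b → ¬ Has v (tt′ 0)
        no-tt {v} {b} eq m = let (B , s) = image m ; (t′ , B≡ , _) = L₀.tt-image B s in
          mem⇒InB {b} (subst₂ Mem eq B≡ (proj₁ (s _) m))

        -- The image of `em v` would have b as its only part. Without rich vertices only edges
        -- contain a large part, and these contain small parts too.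
        no-em : ∀ {v b} → σ (inj₁ v) ≡ inj₂ b → ¬ Has v (em v)
        no-em {v} {b} eq m = let (B , s) = image m in go B s (subst (λ q → Mem q B) eq (proj₁ (s _) m))
          where
          go : ∀ B → Onto (em v) B → ¬ Mem (inj₂ b) B
          go (sg x A) s m = poor x (proj₁ (used-sg {inj₂ b} m))
          go (em x)   s m = mem⇒InB {b} m
          go (tt′ t)  s m = mem⇒InB {b} m
          go (pr e)   s m = case trans (sym eq) (trans (cong σ (sym (em-only (pull s (ends⇒mem (p , par≡ , inj₁ refl)))))) (σσ′ (inj₁ e))) of λ ()
            where
            p = proj₁ (used-pr {inj₂ b} m)
            par≡ = proj₂ (used-pr {inj₂ b} m)

        -- What remains is n₁ = 3 with v of degree three, so that v lies on edges only. The edges of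
        -- b start at number 2 + b in order that both ends of the first one, y (1 + b) and y (2 +
        -- b), lie in layer 0, from which y 0 is missing. For n₁ = 3 this is the only layer, so it
        -- is mapped to itself, and the preimage of that edge contains v and two more small parts:
        -- too many for an edge.
        module NoRoom {v : Fin m} {b : Fin m₂} (eq : σ (inj₁ v) ≡ inj₂ b) (empty : n₁ ∸ deg v ≡ 0) where

          n₁≡3 : n₁ ≡ 3
          n₁≡3 = ≤-antisym (≤-trans (m∸n≡0⇒m≤n empty) (deg≤3 v)) 3≤n₁

          fits : ∀ k → k ≤ 2 → k + toℕ b ≤ n₁ + m₂ + 5
          fits k k≤ = ≤-trans (+-mono-≤ k≤ (<⇒≤ (FinP.toℕ<n b))) (≤-trans (≤-reflexive (+-comm 2 m₂)) (+-mono-≤ (m≤n+m m₂ n₁) (m≤m+n 2 3)))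

          y₁ y₂ : Fin Y
          y₁ = at (1 + toℕ b) (fits 1 (s≤s z≤n))
          y₂ = at (2 + toℕ b) (fits 2 ≤-refl)

          y₁≡ : toℕ y₁ ≡ 1 + toℕ b
          y₁≡ = toℕ-at (fits 1 (s≤s z≤n))

          y₂≡ : toℕ y₂ ≡ 2 + toℕ b
          y₂≡ = toℕ-at (fits 2 ≤-refl)

          e₂ : Fin m
          e₂ = y y₂

          0b : Fin (d b)
          0b = fromℕ< (d≥1 b)

          e₂∈ : e₂ ∈ D b
          e₂∈ = subst (_∈ D b) (edges-prefix y₂ (pos b 0b) (trans (toℕ-pos b 0b)
              (trans (cong (2 + toℕ b +_) (FinP.toℕ-fromℕ< (d≥1 b))) (trans (+-identityʳ _) (sym y₂≡)))))
            (MemP.∈-map⁺ (lookup edges ∘ pos b) (MemP.∈-allFin 0b))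

          par-e₂ : par e₂ ≡ just (y y₁)
          par-e₂ = y-par y₁ y₂ (trans y₂≡ (cong suc (sym y₁≡)))

          y₁≢0 : toℕ y₁ ≢ 0
          y₁≢0 e = case trans (sym y₁≡) e of λ ()

          y₂≢0 : toℕ y₂ ≢ 0
          y₂≢0 e = case trans (sym y₂≡) e of λ ()

          small : ∀ p → Mem p (tt′ 0) → ∃ λ z → p ≡ inj₁ z
          small (inj₁ z) _ = z , refl
          small (inj₂ x) h = ⊥-elim (mem⇒InB {x} h)

          img : ∃ λ B → Onto (tt′ 0) B
          img = image {inj₁ (y y₁)} (y-tt 0<n₁-2 y₁ y₁≢0)

          img-0 : proj₁ img ≡ tt′ 0
          img-0 = let (t′ , B≡ , t′<) = L₀.tt-image (proj₁ img) (proj₂ img) in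
            trans B≡ (cong (λ t → inj₂ (inj₂ (inj₂ t))) (n≤0⇒n≡0 (≤-pred (≤-trans t′< (≤-reflexive (cong (_∸ 2) n₁≡3))))))

          to-0 : ∀ {q} → Mem (σ q) (tt′ 0) → Mem q (tt′ 0)
          to-0 {q} h = proj₂ (proj₂ img q) (subst (Mem (σ q)) (sym img-0) h)

          lift : ∀ i → toℕ i ≢ 0 → Has (y i) (pr e₂) → ∀ B → Onto B (pr e₂) → ∃ λ z → σ (inj₁ z) ≡ inj₁ (y i) × Has z (tt′ 0) × Has z B
          lift i i≢0 h B s = proj₁ sm , trans (cong σ (sym (proj₂ sm))) (σσ′ (inj₁ (y i))) ,
              subst (λ q → Mem q (tt′ 0)) (proj₂ sm) in-0 , subst (λ q → Mem q B) (proj₂ sm) (pull {B} {pr e₂} {inj₁ (y i)} s h)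
            where
            in-0 : Mem (σ′ (inj₁ (y i))) (tt′ 0)
            in-0 = to-0 {σ′ (inj₁ (y i))} (subst (λ q → Mem q (tt′ 0)) (sym (σσ′ (inj₁ (y i)))) (y-tt 0<n₁-2 i i≢0))
            sm : ∃ λ z → σ′ (inj₁ (y i)) ≡ inj₁ z
            sm = small (σ′ (inj₁ (y i))) in-0

          by-kind : ∀ {z₁ z₂} → z₁ ≢ z₂ → z₁ ≢ v → z₂ ≢ v → ∀ B → Has v B → Has z₁ B → Has z₂ B → ⊥
          by-kind {z₁} {z₂} 12≢ 1≢ 2≢ (pr e) h h₁ h₂ = three≢two {pr e} (z₁ , z₂ , v , (12≢ , 1≢ , 2≢) , h₁ , h₂ , h) (kind {inj₁ v} (pr e) h)
          by-kind 12≢ 1≢ 2≢ (sg x A) h h₁ h₂ = 12≢ (lone-sg h₁ h₂)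
          by-kind 12≢ 1≢ 2≢ (em x)   h h₁ h₂ = 12≢ (lone-em h₁ h₂)
          by-kind 12≢ 1≢ 2≢ (tt′ t)  h h₁ h₂ = <⇒≱ (proj₁ (proj₂ (mem⇒In h))) (≤-trans (≤-reflexive empty) z≤n)

          v∉0 : ¬ Has v (tt′ 0)
          v∉0 h = <⇒≱ (proj₁ (proj₂ (mem⇒In h))) (≤-reflexive empty)

          absurd : ⊥
          absurd = by-kind
              (λ e → <⇒≢ (n<1+n (1 + toℕ b)) (trans (sym y₁≡) (trans (cong toℕ (y-inj (SumP.inj₁-injective
                (trans (sym (proj₁ (proj₂ l₁))) (trans (cong (σ ∘ inj₁) e) (proj₁ (proj₂ l₂))))))) y₂≡)))
              (λ e → v∉0 (subst (λ z → Has z (tt′ 0)) e (proj₁ (proj₂ (proj₂ l₁)))))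
              (λ e → v∉0 (subst (λ z → Has z (tt′ 0)) e (proj₁ (proj₂ (proj₂ l₂)))))
              B (proj₂ (s (inj₁ v)) (subst (λ q → Mem q (pr e₂)) (sym eq) (D⇒mem {b} e₂∈)))
              (proj₂ (proj₂ (proj₂ l₁))) (proj₂ (proj₂ (proj₂ l₂)))
            where
            B : Blk
            B = proj₁ (preimage {inj₂ b} (D⇒mem {b} e₂∈))
            s : Onto B (pr e₂)
            s = proj₂ (preimage {inj₂ b} (D⇒mem {b} e₂∈))
            l₁ : ∃ λ z → σ (inj₁ z) ≡ inj₁ (y y₁) × Has z (tt′ 0) × Has z B
            l₁ = lift y₁ y₁≢0 (ends⇒mem (y y₁ , par-e₂ , inj₂ refl)) B s
            l₂ : ∃ λ z → σ (inj₁ z) ≡ inj₁ (y y₂) × Has z (tt′ 0) × Has z B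
            l₂ = lift y₂ y₂≢0 (ends⇒mem (y y₁ , par-e₂ , inj₁ refl)) B s

        not-mixed : ∀ v b → σ (inj₁ v) ≢ inj₂ b
        not-mixed v b eq with 0 <? n₁ ∸ deg v
        ... | yes 0< = [ (λ e → no-em {v} {b} eq (subst (Has v) e h)) , (λ e → no-tt {v} {b} eq (subst (Has v) e h)) ]′ (layer-cases v 0)
          where
          h : Has v (layer v 0)
          h = slots⇒mem (layer∈ (poor v) 0<)
        ... | no ≮ = NoRoom.absurd {v} {b} eq (n≤0⇒n≡0 (≮⇒≥ ≮))

      unmixed : ∀ v → ∃ λ v′ → σ (inj₁ v) ≡ inj₁ v′
      unmixed v with n₁ ≟ n₂
      ... | no ne  = A.σ-small ne v
      ... | yes eq with σ (inj₁ v) in σv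
      ...   | inj₁ v′ = v′ , refl
      ...   | inj₂ b  = ⊥-elim (Equal.not-mixed (poor-if-equal eq) v b σv)

    module Trivial (i₁ : Fin n₁) (i₂ : Fin n₂) (γ : Aut (K m n₁ m₂ n₂)) (fix : Fixes γ) where

      module S = Act i₁ i₂ γ fix using (σ; σ′; σσ′; σ′σ; Onto; unmixed; pull; image)
      module S⁻ = Act i₁ i₂ (inverse γ) (fixes-inverse γ fix) using (unmixed)
      open S using (σ; σ′; σσ′; σ′σ; Onto) public

      π π′ : Fin m → Fin m
      π v = proj₁ (S.unmixed v)
      π′ v = proj₁ (S⁻.unmixed v)

      σ-π : ∀ v → σ (inj₁ v) ≡ inj₁ (π v)
      σ-π v = proj₂ (S.unmixed v)

      σ-π′ : ∀ v → σ′ (inj₁ v) ≡ inj₁ (π′ v)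
      σ-π′ v = proj₂ (S⁻.unmixed v)

      π′π : ∀ z → π′ (π z) ≡ z
      π′π z = SumP.inj₁-injective (trans (sym (σ-π′ (π z))) (trans (cong σ′ (sym (σ-π z))) (σ′σ _)))

      ππ′ : ∀ z → π (π′ z) ≡ z
      ππ′ z = SumP.inj₁-injective (trans (sym (σ-π (π′ z))) (trans (cong σ (sym (σ-π′ z))) (σσ′ _)))

      σ-big : ∀ x → ∃ λ x′ → σ (inj₂ x) ≡ inj₂ x′
      σ-big x with σ (inj₂ x) in eq
      ... | inj₂ x′ = x′ , refl
      ... | inj₁ z = case trans (sym (σ′σ (inj₂ x))) (trans (cong σ′ eq) (σ-π′ z)) of λ ()

      push : ∀ {B B′ z} → Onto B B′ → Has z B → Has (π z) B′
      push {B′ = B′} {z} s h = subst (λ p → Mem p B′) (σ-π z) (proj₁ (s (inj₁ z)) h)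

      back : ∀ {B B′ z} → Onto B B′ → Has z B′ → Has (π′ z) B
      back {B} {B′} {z} s h = subst (λ p → Mem p B) (σ-π′ z) (S.pull {B} {B′} s h)

      onto-two : ∀ {B B′} → Onto B B′ → Two B → Two B′
      onto-two {B} {B′} s (u , w , ne , hu , hw , all) = π u , π w , (λ eq → ne (trans (sym (π′π u)) (trans (cong π′ eq) (π′π w)))) ,
        push {B} {B′} s hu , push {B} {B′} s hw ,
        λ {z} h → case all (back {B} {B′} s h) of λ { (inj₁ eq) → inj₁ (trans (sym (ππ′ z)) (cong π eq)) ; (inj₂ eq) → inj₂ (trans (sym (ππ′ z)) (cong π eq)) }

      edge-image : ∀ {e} → NonRoot e → ∃ λ e′ → NonRoot e′ × Onto (pr e) (pr e′)
      edge-image {e} (p , eq) = let (B , s) = S.image {inj₁ e} h in go B s (push {pr e} {B} s h) (onto-two s (pr-two eq))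
        where
        h : Has e (pr e)
        h = ends⇒mem (p , eq , inj₁ refl)
        go : ∀ B → Onto (pr e) B → Has (π e) B → Two B → ∃ λ e′ → NonRoot e′ × Onto (pr e) (pr e′)
        go (pr e′)  s h t = e′ , used-pr h , s
        go (sg x A) s h t = ⊥-elim (two≢lone {sg x A} t lone-sg)
        go (em x)   s h t = ⊥-elim (two≢lone {em x} t lone-em)
        go (tt′ x)  s h t = ⊥-elim (three≢two {tt′ x} (kind (tt′ x) h) t)

      ends-adj : ∀ {u w e} → u ≢ w → Ends u e → Ends w e → Adj′ u w
      ends-adj ne (p , eq , inj₁ refl) (_ , _ , inj₁ refl)  = ⊥-elim (ne refl)
      ends-adj ne (p , eq , inj₁ refl) (q , eq′ , inj₂ refl) = inj₁ eq′
      ends-adj ne (p , eq , inj₂ refl) (q , eq′ , inj₁ refl) = inj₂ eq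
      ends-adj ne (p , eq , inj₂ refl) (q , eq′ , inj₂ refl) = ⊥-elim (ne (just-injective (trans (sym eq) eq′)))

      edge-adj : ∀ {e p} → par e ≡ just p → Adj′ (π e) (π p)
      edge-adj {e} {p} eq = let (e′ , _ , s) = edge-image (p , eq) in
        ends-adj (λ r → irrefl (subst (λ z → par e ≡ just z) (sym (trans (sym (π′π e)) (trans (cong π′ r) (π′π p)))) eq))
          (mem⇒In (push {pr e} {pr e′} s (ends⇒mem (p , eq , inj₁ refl)))) (mem⇒In (push {pr e} {pr e′} s (ends⇒mem (p , eq , inj₂ refl))))

      π-adj : ∀ {u w} → Adj′ u w → Adj′ (π u) (π w)
      π-adj (inj₁ eq) = edge-adj eq
      π-adj (inj₂ eq) = case edge-adj eq of λ { (inj₁ r) → inj₂ r ; (inj₂ r) → inj₁ r }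

    module Identity (i₁ : Fin n₁) (i₂ : Fin n₂) (γ : Aut (K m n₁ m₂ n₂)) (fix : Fixes γ) where

      module T = Trivial i₁ i₂ γ fix using (Onto; edge-image; push; π; π-adj; ππ′; π′; π′π; σ; σ-big; σ-π)
      module T⁻ = Trivial i₁ i₂ (inverse γ) (fixes-inverse γ fix) using (π-adj)
      open T using (σ; σ-π; π)

      π-id : ∀ v → π v ≡ v
      π-id = rigid T.π T.π′ T.π′π T.ππ′ T.π-adj (λ {u} {w} → T⁻.π-adj {u} {w})

      edge-fixed : ∀ {e} → NonRoot e → T.Onto (pr e) (pr e)
      edge-fixed {e} root = let (e′ , root′ , s) = T.edge-image root in
        subst (λ z → T.Onto (pr e) (pr z))
          (sym (edge-determined root root′ (λ {z} h → subst (λ x → Ends x e′) (π-id z) (mem⇒In (T.push {pr e} {pr e′} s (ends⇒mem h)))))) s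

      ρ : Fin m₂ → Fin m₂
      ρ b = proj₁ (T.σ-big b)

      -- Every edge is fixed, so the first edge of b, number 2 + b, also belongs to ρ b, whose edges
      -- start at number 2 + ρ b.
      ρ-decreasing : ∀ b → toℕ (ρ b) ≤ toℕ b
      ρ-decreasing b = go (MemP.∈-map⁻ (lookup edges ∘ pos (ρ b)) e∈ρ)
        where
        0b : Fin (d b)
        0b = fromℕ< (d≥1 b)
        e : Fin m
        e = lookup edges (pos b 0b)
        e∈ : e ∈ D b
        e∈ = MemP.∈-map⁺ (lookup edges ∘ pos b) (MemP.∈-allFin 0b)
        e∈ρ : e ∈ D (ρ b)
        e∈ρ = mem⇒InB {ρ b} (subst (λ p → Mem p (pr e)) (proj₂ (T.σ-big b)) (proj₁ (edge-fixed (D-nonroot {b} e∈) (inj₂ b)) (D⇒mem {b} e∈)))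
        go : (∃ λ i → i ∈ allFin (d (ρ b)) × e ≡ lookup edges (pos (ρ b) i)) → toℕ (ρ b) ≤ toℕ b
        go (i , _ , eq) = +-cancelˡ-≤ 2 _ _ (begin
          2 + toℕ (ρ b)            ≤⟨ m≤m+n _ (toℕ i) ⟩
          2 + toℕ (ρ b) + toℕ i    ≡⟨ toℕ-pos (ρ b) i ⟨
          toℕ (pos (ρ b) i)        ≡⟨ cong toℕ (lookup-injective edges-unique _ _ eq) ⟨
          toℕ (pos b 0b)           ≡⟨ toℕ-pos b 0b ⟩
          2 + toℕ b + toℕ 0b       ≡⟨ cong (2 + toℕ b +_) (FinP.toℕ-fromℕ< (d≥1 b)) ⟩
          2 + toℕ b + 0            ≡⟨ +-identityʳ _ ⟩
          2 + toℕ b                ∎)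
          where open ≤-Reasoning

    dist : Fin n₁ → Fin n₂ → Dist
    dist i₁ i₂ = distinguishes i₁ i₂ slot-inj block-ext λ γ fix k₁ k₂ → λ where
        (inj₁ v) → trans (Trivial.σ-π k₁ k₂ γ fix v) (cong inj₁ (Identity.π-id k₁ k₂ γ fix v))
        (inj₂ b) → trans (proj₂ (Trivial.σ-big k₁ k₂ γ fix b)) (cong inj₂ (FinP.toℕ-injective (≤-antisym
          (Identity.ρ-decreasing k₁ k₂ γ fix b)
          (subst (λ z → toℕ z ≤ toℕ (Identity.ρ k₁ k₂ γ fix b)) (back k₁ k₂ γ fix b) (Identity.ρ-decreasing k₁ k₂ (inverse γ) (fixes-inverse γ fix) _)))))
      where
      back : ∀ k₁ k₂ γ fix b → Identity.ρ k₁ k₂ (inverse γ) (fixes-inverse γ fix) (Identity.ρ k₁ k₂ γ fix b) ≡ b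
      back k₁ k₂ γ fix b = SumP.inj₂-injective (trans (sym (proj₂ (Trivial.σ-big k₁ k₂ (inverse γ) (fixes-inverse γ fix) _)))
        (trans (cong (Trivial.σ′ k₁ k₂ γ fix) (sym (proj₂ (Trivial.σ-big k₁ k₂ γ fix b)))) (Trivial.σ′σ k₁ k₂ γ fix (inj₂ b))))

    result : Fin n₁ → Fin n₂ → HasDist {m} {n₁} {m₂} {n₂} Blk
    result i₁ i₂ = _≟B_ , c , dist i₁ i₂

-- Periodic choice of large subsets

prefixSum : (ℕ → ℕ) → ℕ → ℕ
prefixSum f zero    = 0
prefixSum f (suc n) = prefixSum f n + f n

prefixSum-+ : ∀ f a b → prefixSum f (a + b) ≡ prefixSum f a + prefixSum (λ x → f (a + x)) b
prefixSum-+ f a zero    = trans (cong (prefixSum f) (+-identityʳ a)) (sym (+-identityʳ _))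
prefixSum-+ f a (suc b) = trans (cong (prefixSum f) (+-suc a b))
  (trans (cong (_+ f (a + b)) (prefixSum-+ f a b)) (+-assoc (prefixSum f a) _ _))

prefixSum-cong : ∀ {f g} n → (∀ x → f x ≡ g x) → prefixSum f n ≡ prefixSum g n
prefixSum-cong zero    h = refl
prefixSum-cong (suc n) h = cong₂ _+_ (prefixSum-cong n h) (h n)

prefixSum-≤ : ∀ {f} n → (∀ x → f x ≤ 1) → prefixSum f n ≤ n
prefixSum-≤ zero    h = z≤n
prefixSum-≤ (suc n) h = ≤-trans (+-mono-≤ (prefixSum-≤ n h) (h n)) (≤-reflexive (+-comm n 1))

prefixSum-period : ∀ f p a → (∀ x → f (p + x) ≡ f x) → prefixSum f (a * p) ≡ a * prefixSum f p
prefixSum-period f p zero    h = refl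
prefixSum-period f p (suc a) h = trans (prefixSum-+ f p (a * p))
  (cong (prefixSum f p +_) (trans (prefixSum-cong (a * p) h) (prefixSum-period f p a h)))

sumL-allFin-suc : ∀ {m} (f : Fin (suc m) → ℕ) → sumL f (allFin (suc m)) ≡ f zero + sumL (f ∘ suc) (allFin m)
sumL-allFin-suc {m} f = cong (f zero +_) (trans (cong (sumL f) (sym (ListP.map-tabulate id suc))) (sumL-map f suc (allFin m)))

prefixSum-toℕ : ∀ f n → prefixSum f n ≡ sumL (f ∘ toℕ) (allFin n)
prefixSum-toℕ f zero    = refl
prefixSum-toℕ f (suc n) = trans (prefixSum-+ f 1 n) (trans (cong (f 0 +_) (prefixSum-toℕ (f ∘ suc) n)) (sym (sumL-allFin-suc {n} (λ x → f (toℕ x)))))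

offset : ∀ {m} → (Fin m → ℕ) → Fin m → ℕ
offset w zero    = 0
offset w (suc v) = w zero + offset (w ∘ suc) v

-- Consecutive intervals of lengths w v tile an initial segment of ℕ.
offset-sum : ∀ {m} (w : Fin m → ℕ) (f : ℕ → ℕ) →
  sumL (λ v → prefixSum (λ t → f (offset w v + t)) (w v)) (allFin m) ≡ prefixSum f (sumL w (allFin m))
offset-sum {zero}  w f = refl
offset-sum {suc m} w f = begin
  sumL (λ v → prefixSum (λ t → f (offset w v + t)) (w v)) (allFin (suc m))
    ≡⟨ sumL-allFin-suc (λ v → prefixSum (λ t → f (offset w v + t)) (w v)) ⟩
  prefixSum f (w zero) + sumL (λ v → prefixSum (λ t → f (w zero + offset (w ∘ suc) v + t)) (w (suc v))) (allFin m)
    ≡⟨ cong (prefixSum f (w zero) +_) (sumL-cong (allFin m) (λ {v} _ → prefixSum-cong (w (suc v)) (λ t → cong f (+-assoc (w zero) _ t)))) ⟩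
  prefixSum f (w zero) + sumL (λ v → prefixSum (λ t → f (w zero + (offset (w ∘ suc) v + t))) (w (suc v))) (allFin m)
    ≡⟨ cong (prefixSum f (w zero) +_) (offset-sum (w ∘ suc) (λ x → f (w zero + x))) ⟩
  prefixSum f (w zero) + prefixSum (λ x → f (w zero + x)) (sumL (w ∘ suc) (allFin m))
    ≡⟨ prefixSum-+ f (w zero) _ ⟨
  prefixSum f (w zero + sumL (w ∘ suc) (allFin m)) ≡⟨ cong (prefixSum f) (sumL-allFin-suc w) ⟨
  prefixSum f (sumL w (allFin (suc m))) ∎
  where open ≡-Reasoning

count : ∀ {n} → Fin n → List (Sub n) → ℕ
count b = sumL (λ A → ind (contains? b A))

count-true : ∀ {n} (As : List (Sub n)) → count zero (map (true ∷_) As) ≡ length As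
count-true []       = refl
count-true (A ∷ As) = cong suc (count-true As)

count-false : ∀ {n} (As : List (Sub n)) → count zero (map (false ∷_) As) ≡ 0
count-false []       = refl
count-false (A ∷ As) = count-false As

count-level : ∀ n i (b : Fin n) → count b (level n i) ≡ (n ∸ 1) C i
count-level (suc n) zero zero = trans (count-true (level n 0)) (length-level n 0)
count-level (suc n) (suc i) zero = trans (sumL-++ _ (map (true ∷_) (level n (suc i))) _)
  (trans (cong₂ _+_ (trans (count-true (level n (suc i))) (length-level n (suc i))) (count-false (level n i))) (+-identityʳ _))
count-level (suc n) zero (suc b) = trans (sumL-map _ (true ∷_) (level n 0)) (count-level n 0 b)
count-level (suc (suc n)) (suc i) (suc b) = begin
  count (suc b) (level (suc (suc n)) (suc i))
    ≡⟨ sumL-++ _ (map (true ∷_) (level (suc n) (suc i))) _ ⟩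
  count (suc b) (map (true ∷_) (level (suc n) (suc i))) + count (suc b) (map (false ∷_) (level (suc n) i))
    ≡⟨ cong₂ _+_ (trans (sumL-map _ (true ∷_) (level (suc n) (suc i))) (count-level (suc n) (suc i) b))
                 (trans (sumL-map _ (false ∷_) (level (suc n) i)) (count-level (suc n) i b)) ⟩
  n C suc i + n C i  ≡⟨ +-comm (n C suc i) (n C i) ⟩
  n C i + n C suc i  ≡⟨ nCk+nC[k+1]≡[n+1]C[k+1] n i ⟩
  suc n C suc i      ∎
  where open ≡-Reasoning

card-count : ∀ {n} (A : Sub n) → card A ≡ sumL (λ b → ind (contains? b A)) (allFin n)
card-count []          = refl
card-count (true  ∷ A) = trans (cong suc (card-count A)) (sym (sumL-allFin-suc (λ b → ind (contains? b (true ∷ A)))))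
card-count (false ∷ A) = trans (card-count A) (sym (sumL-allFin-suc (λ b → ind (contains? b (false ∷ A)))))

-- Each element lies in the same number of sets of a level, so that number follows from the total size.
level-share : ∀ n i (b : Fin n) → n * count b (level n i) ≡ (n ∸ i) * (n C i)
level-share n i b = begin
  n * count b (level n i)                        ≡⟨ cong (n *_) (count-level n i b) ⟩
  n * ((n ∸ 1) C i)                              ≡⟨ cong (_* ((n ∸ 1) C i)) (ListP.length-tabulate {n = n} id) ⟨
  length (allFin n) * ((n ∸ 1) C i)              ≡⟨ sumL-const ((n ∸ 1) C i) (allFin n) ⟨
  sumL (λ _ → (n ∸ 1) C i) (allFin n)            ≡⟨ sumL-cong (allFin n) (λ {b} _ → count-level n i b) ⟨
  sumL (λ b → count b (level n i)) (allFin n)    ≡⟨ sumL-swap (λ b A → ind (contains? b A)) (allFin n) (level n i) ⟩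
  sumL (λ A → sumL (λ b → ind (contains? b A)) (allFin n)) (level n i) ≡⟨ sumL-cong (level n i) (λ {A} _ → card-count A) ⟨
  sumL card (level n i)                          ≡⟨ sumL-cong (level n i) (λ {A} A∈ → trans (sym (m+n∸n≡m (card A) i)) (cong (_∸ i) (level-card n i A∈))) ⟩
  sumL (λ _ → n ∸ i) (level n i)                 ≡⟨ sumL-const (n ∸ i) (level n i) ⟩
  length (level n i) * (n ∸ i)                   ≡⟨ trans (*-comm (length (level n i)) (n ∸ i)) (cong ((n ∸ i) *_) (length-level n i)) ⟩
  (n ∸ i) * (n C i)                              ∎
  where open ≡-Reasoning

count-levels : ∀ n j (b : Fin n) → n * count b (levels n j) ≡ sumTo j (λ i → (n ∸ i) * (n C i))
count-levels n j b = begin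
  n * count b (levels n j)                              ≡⟨ cong (n *_) (sumL-concatMap _ (level n) (upTo (suc j))) ⟩
  n * sumL (λ i → count b (level n i)) (upTo (suc j))   ≡⟨ sumL-* n _ (upTo (suc j)) ⟨
  sumL (λ i → n * count b (level n i)) (upTo (suc j))   ≡⟨ sumL-cong (upTo (suc j)) (λ {i} _ → level-share n i b) ⟩
  sumTo j (λ i → (n ∸ i) * (n C i))                     ∎
  where open ≡-Reasoning

length-levels : ∀ n j → length (levels n j) ≡ sumTo j (λ i → n C i)
length-levels n j = begin
  length (levels n j)                                    ≡⟨ sumL-one (levels n j) ⟨
  sumL (λ _ → 1) (levels n j)                            ≡⟨ sumL-concatMap (λ _ → 1) (level n) (upTo (suc j)) ⟩
  sumL (λ i → sumL (λ _ → 1) (level n i)) (upTo (suc j)) ≡⟨ sumL-cong (upTo (suc j)) (λ {i} _ → trans (sumL-one (level n i)) (length-level n i)) ⟩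
  sumTo j (λ i → n C i)                                  ∎
  where open ≡-Reasoning

count-levels-same : ∀ n j (b b′ : Fin n) → count b (levels n j) ≡ count b′ (levels n j)
count-levels-same n j b b′ = begin
  count b (levels n j)                                ≡⟨ sumL-concatMap _ (level n) (upTo (suc j)) ⟩
  sumL (λ i → count b (level n i)) (upTo (suc j))     ≡⟨ sumL-cong (upTo (suc j)) (λ {i} _ → trans (count-level n i b) (sym (count-level n i b′))) ⟩
  sumL (λ i → count b′ (level n i)) (upTo (suc j))    ≡⟨ sumL-concatMap _ (level n) (upTo (suc j)) ⟨
  count b′ (levels n j)                               ∎
  where open ≡-Reasoning

ind≤1 : {P : Set} (d : Dec P) → ind d ≤ 1
ind≤1 (yes _) = ≤-refl
ind≤1 (no  _) = z≤n

-- The sets of a nonempty list, repeated periodically.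
module Stream {n : ℕ} (L : List (Sub n)) (L-unique : Unique L) .{{nz : NonZero (length L)}} where

  p : ℕ
  p = length L

  at : ℕ → Sub n
  at x = lookup L (fromℕ< (m%n<n x p))

  at-≡ : ∀ {x x′} → x % p ≡ x′ % p → at x ≡ at x′
  at-≡ {x} {x′} eq = cong (lookup L) (FinP.fromℕ<-cong _ _ eq (m%n<n x p) (m%n<n x′ p))

  at-period : ∀ x → at (p + x) ≡ at x
  at-period x = at-≡ (trans (cong (_% p) (+-comm p x)) ([m+n]%n≡m%n x p))

  at-inj : ∀ {x x′} → at x ≡ at x′ → x % p ≡ x′ % p
  at-inj {x} {x′} eq = trans (sym (FinP.toℕ-fromℕ< (m%n<n x p))) (trans (cong toℕ (lookup-injective L-unique _ _ eq)) (FinP.toℕ-fromℕ< (m%n<n x′ p)))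

  -- Equal residues make t - s a multiple of p, but it is positive and less than p.
  close-inj : ∀ o {s t} → s < t → t < p → (o + s) % p ≢ (o + t) % p
  close-inj o {s} {t} s<t t<p eq = <⇒≱ (<-≤-trans t<p p≤gap) (m∸n≤m t s)
    where
    a = o + s
    b = o + t
    gap : b ∸ a ≡ t ∸ s
    gap = [m+n]∸[m+o]≡n∸o o t s
    a≤b : a ≤ b
    a≤b = +-monoʳ-≤ o (<⇒≤ s<t)
    quot : b ∸ a ≡ (b / p ∸ a / p) * p
    quot = begin
      b ∸ a                                       ≡⟨ cong₂ _∸_ (m≡m%n+[m/n]*n b p) (m≡m%n+[m/n]*n a p) ⟩
      (b % p + b / p * p) ∸ (a % p + a / p * p)   ≡⟨ cong (λ z → (b % p + b / p * p) ∸ (z + a / p * p)) eq ⟩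
      (b % p + b / p * p) ∸ (b % p + a / p * p)   ≡⟨ [m+n]∸[m+o]≡n∸o (b % p) _ _ ⟩
      b / p * p ∸ a / p * p                       ≡⟨ *-distribʳ-∸ p (b / p) (a / p) ⟨
      (b / p ∸ a / p) * p                         ∎
      where open ≡-Reasoning
    p≤gap : p ≤ t ∸ s
    p≤gap with b / p ∸ a / p in eq′
    ... | zero  = ⊥-elim (<⇒≢ (m<n⇒0<n∸m s<t) (sym (trans (sym gap) (trans quot (cong (_* p) eq′)))))
    ... | suc k = ≤-trans (m≤m+n p (k * p)) (≤-reflexive (trans (cong (_* p) (sym eq′)) (trans (sym quot) gap)))

  window : ℕ → ℕ → List (Sub n)
  window o zero    = []
  window o (suc w) = at (o + w) ∷ window o w

  ∈-window : ∀ {o w A} → A ∈ window o w → ∃ λ t → t < w × A ≡ at (o + t)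
  ∈-window {w = suc w} (here eq) = w , ≤-refl , eq
  ∈-window {w = suc w} (there A∈) = let (t , t< , eq) = ∈-window A∈ in t , m<n⇒m<1+n t< , eq

  window-unique : ∀ o w → w ≤ p → Unique (window o w)
  window-unique o zero    w≤ = []
  window-unique o (suc w) w≤ = ∷-unique (λ A∈ → let (t , t< , eq) = ∈-window {o} {w} A∈ in close-inj o t< w≤ (sym (at-inj eq)))
    (window-unique o w (<⇒≤ w≤))

  length-window : ∀ o w → length (window o w) ≡ w
  length-window o zero    = refl
  length-window o (suc w) = cong suc (length-window o w)

  hits : Fin n → ℕ → ℕ
  hits b x = ind (contains? b (at x))

  count-window : ∀ b o w → count b (window o w) ≡ prefixSum (λ t → hits b (o + t)) w
  count-window b o zero    = refl
  count-window b o (suc w) = trans (+-comm (hits b (o + w)) _) (cong (_+ hits b (o + w)) (count-window b o w))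

  one-period : ∀ b → prefixSum (hits b) p ≡ count b L
  one-period b = begin
    prefixSum (hits b) p                             ≡⟨ prefixSum-toℕ (hits b) p ⟩
    sumL (hits b ∘ toℕ) (allFin p)                   ≡⟨ sumL-cong (allFin p) (λ {i} _ → cong (λ A → ind (contains? b A)) (at-toℕ i)) ⟩
    sumL (λ i → ind (contains? b (lookup L i))) (allFin p) ≡⟨ sumL-map (λ A → ind (contains? b A)) (lookup L) (allFin p) ⟨
    count b (map (lookup L) (allFin p))              ≡⟨ cong (count b) (trans (ListP.map-tabulate id (lookup L)) (ListP.tabulate-lookup L)) ⟩
    count b L                                        ∎
    where
    open ≡-Reasoning
    at-toℕ : ∀ i → at (toℕ i) ≡ lookup L i
    at-toℕ i = cong (lookup L) (FinP.toℕ-injective (trans (FinP.toℕ-fromℕ< _) (m<n⇒m%n≡m (FinP.toℕ<n i))))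

  -- For a list that contains every element equally often, full periods treat all elements alike.
  -- The large parts thus stay in balance up to the last, incomplete period.
  hits-split : ∀ b M → prefixSum (hits b) M ≡ M / p * count b L + prefixSum (λ x → hits b (M / p * p + x)) (M % p)
  hits-split b M = begin
    prefixSum (hits b) M                       ≡⟨ cong (prefixSum (hits b)) (trans (m≡m%n+[m/n]*n M p) (+-comm (M % p) _)) ⟩
    prefixSum (hits b) (M / p * p + M % p)     ≡⟨ prefixSum-+ (hits b) (M / p * p) (M % p) ⟩
    prefixSum (hits b) (M / p * p) + r         ≡⟨ cong (_+ r) (trans (prefixSum-period (hits b) p (M / p) (λ x → cong (λ A → ind (contains? b A)) (at-period x))) (cong (M / p *_) (one-period b))) ⟩
    M / p * count b L + r ∎
    where
    open ≡-Reasoning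
    r = prefixSum (λ x → hits b (M / p * p + x)) (M % p)

  hits-lower : ∀ b M → M / p * count b L ≤ prefixSum (hits b) M
  hits-lower b M = ≤-trans (m≤m+n _ _) (≤-reflexive (sym (hits-split b M)))

  hits-upper : ∀ b M → prefixSum (hits b) M ≤ M / p * count b L + p
  hits-upper b M = ≤-trans (≤-reflexive (hits-split b M)) (+-monoʳ-≤ (M / p * count b L)
    (≤-trans (prefixSum-≤ (M % p) (λ x → ind≤1 (contains? b (at (M / p * p + x))))) (<⇒≤ (m%n<n M p))))

-- The range of n₂ covered by a rigid forest

module Range {m Y : ℕ} (n₁ m₂ j k u : ℕ) (F : Forest m Y)
  (m₂≡ : u + suc j + suc j ≡ m₂) (n₁≡ : n₁ ≡ 2 + sumTo j (λ i → m₂ C i) + k)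
  (1≤k : 1 ≤ k) (k< : k < m₂ C suc j) (3≤n₁ : 3 ≤ n₁) (b₀ : Fin m₂) where

  open Forest F

  top : List (Sub m₂)
  top = levels m₂ j

  instance
    level-nonempty : NonZero (length (level m₂ (suc j)))
    level-nonempty = >-nonZero (≤-trans (≤-trans (s≤s z≤n) k<) (≤-reflexive (sym (length-level m₂ (suc j)))))

  open Stream (level m₂ (suc j)) (level-unique m₂ (suc j)) using (p; at; window; ∈-window; window-unique; length-window; hits; count-window; hits-lower; hits-upper)

  -- Slack of the construction: at most m₂ + 2 for the edges skipped before those of a large part,
  -- and p for the imbalance between large parts.
  reserve : ℕ
  reserve = m₂ + 2 + p

  -- By how much `base` can grow when one more vertex becomes rich: all sets of `top` and at most k
  -- + 2 of the next level.
  step : ℕ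
  step = length top + (k + 2)

  module _ (Y-large : n₁ + m₂ + 6 + (step + p + reserve) ≤ Y) where

    Y-large′ : n₁ + m₂ + 6 ≤ Y
    Y-large′ = ≤-trans (m≤m+n _ _) Y-large

    E : ℕ
    E = length edges

    Y≤E : Y ≤ E
    Y≤E = ≤-trans (≤-reflexive (sym (trans (ListP.length-map y (allFin Y)) (ListP.length-tabulate {n = Y} id))))
      (≤-trans (m≤m+n _ _) (≤-reflexive (sym (ListP.length-++ (map y (allFin Y))))))

    -- q is a dial: only vertices below q and off the path get single blocks, so that the load on
    -- the large parts changes slowly with q and vanishes at q = 0.
    Rich : ℕ → Fin m → Set
    Rich q v = toℕ v < q × (∀ i → y i ≢ v)

    rich? : ∀ q v → Dec (Rich q v)
    rich? q v = (toℕ v <? q) ×-dec FinP.all? (λ i → ¬? (y i FinP.≟ v))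

    -- The slots that the edges at v and the sets of `top` leave over; they take sets with j + 1
    -- missing parts. Since 1 ≤ k, degrees up to 3 cause no truncation, and since deg v ≥ 1 and k <
    -- p, at most one period is taken, so no set is repeated at v.
    width : Fin m → ℕ
    width v = k + 2 ∸ deg v

    width-if : ∀ {P : Set} → Dec P → Fin m → ℕ
    width-if (yes _) v = width v
    width-if (no  _) v = 0

    w : ℕ → Fin m → ℕ
    w q v = width-if (rich? q v) v

    fam : ℕ → Fin m → List (Sub m₂)
    fam q v = top ++ window (offset (w q) v) (width v)

    deg≤k+2 : ∀ v → deg v ≤ k + 2
    deg≤k+2 v = ≤-trans (deg≤3 v) (+-monoˡ-≤ 2 1≤k)

    width≤p : ∀ v → width v ≤ p
    width≤p v = ≤-trans (∸-monoʳ-≤ (k + 2) (deg≥1 v)) (≤-trans (≤-reflexive (trans (cong (_∸ 1) (+-suc k 1)) (+-comm k 1)))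
      (≤-trans k< (≤-reflexive (sym (length-level m₂ (suc j))))))

    fam-unique : ∀ q v → Unique (fam q v)
    fam-unique q v = UniqueP.++⁺ (levels-unique m₂ j) (window-unique _ _ (width≤p v)) λ (A∈ , A∈′) →
      let (i , i∈ , A∈i) = ∈-concatMap⁻ (level m₂) {xs = upTo (suc j)} A∈
          (t , t< , eq) = ∈-window {offset (w q) v} {width v} A∈′
      in <⇒≢ (MemP.∈-upTo⁻ i∈) (+-cancelˡ-≡ _ _ _ (trans (level-card m₂ i A∈i)
           (sym (level-card m₂ (suc j) (subst (_∈ level m₂ (suc j)) (sym eq) (MemP.∈-lookup (fromℕ< (m%n<n (offset (w q) v + t) p))))))))

    fam-length : ∀ q v → length (fam q v) ≡ n₁ ∸ deg v
    fam-length q v = begin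
      length (fam q v)                                 ≡⟨ ListP.length-++ top ⟩
      length top + length (window (offset (w q) v) (width v)) ≡⟨ cong₂ _+_ (length-levels m₂ j) (length-window _ (width v)) ⟩
      S + (k + 2 ∸ deg v)                              ≡⟨ +-∸-assoc S (deg≤k+2 v) ⟨
      (S + (k + 2)) ∸ deg v                            ≡⟨ cong (_∸ deg v) (trans (solve 2 (λ s k → s :+ (k :+ con 2) := con 2 :+ s :+ k) refl S k) (sym n₁≡)) ⟩
      n₁ ∸ deg v                                       ∎
      where
      open ≡-Reasoning
      open +-*-Solver
      S = sumTo j (λ i → m₂ C i)

    R M : ℕ → ℕ
    R q = sumL (λ v → ind (rich? q v)) (allFin m)
    M q = sumL (w q) (allFin m)

    base : ℕ → Fin m₂ → ℕ
    base q b = R q * count b top + prefixSum (hits b) (M q)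

    y-poor : ∀ q i → ¬ Rich q (y i)
    y-poor q i (_ , h) = h i refl

    base-singles : ∀ n₂ q b → Explicit.base n₁ n₂ m₂ F 3≤n₁ Y-large′ (rich? q) (y-poor q) (fam q) (λ {v} _ → fam-unique q v) (λ {v} _ → fam-length q v) b ≡ base q b
    base-singles n₂ q b = begin
      length (concatMap G (filter (rich? q) (allFin m)))      ≡⟨ sumL-one (concatMap G (filter (rich? q) (allFin m))) ⟨
      sumL (λ _ → 1) (concatMap G (filter (rich? q) (allFin m))) ≡⟨ sumL-concatMap (λ _ → 1) G (filter (rich? q) (allFin m)) ⟩
      sumL (λ v → sumL (λ _ → 1) (G v)) (filter (rich? q) (allFin m)) ≡⟨ sumL-cong (filter (rich? q) (allFin m)) (λ {v} _ → G-size v) ⟩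
      sumL (λ v → count b (fam q v)) (filter (rich? q) (allFin m)) ≡⟨ sumL-ind-* (rich? q) (λ v → count b (fam q v)) (allFin m) ⟨
      sumL (λ v → ind (rich? q v) * count b (fam q v)) (allFin m) ≡⟨ sumL-cong (allFin m) (λ {v} _ → at-v v (rich? q v) refl) ⟩
      sumL (λ v → count b top * ind (rich? q v) + prefixSum (λ t → hits b (offset (w q) v + t)) (w q v)) (allFin m) ≡⟨ sumL-+ _ _ (allFin m) ⟩
      sumL (λ v → count b top * ind (rich? q v)) (allFin m) + sumL (λ v → prefixSum (λ t → hits b (offset (w q) v + t)) (w q v)) (allFin m)
        ≡⟨ cong₂ _+_ (trans (sumL-* (count b top) (λ v → ind (rich? q v)) (allFin m)) (*-comm (count b top) (R q))) (offset-sum (w q) (hits b)) ⟩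
      base q b                                                ∎
      where
      open ≡-Reasoning
      module X = Explicit n₁ n₂ m₂ F 3≤n₁ Y-large′ (rich? q) (y-poor q) (fam q) (λ {v} _ → fam-unique q v) (λ {v} _ → fam-length q v)
        using (Blk; single)
      G : Fin m → List X.Blk
      G v = map (X.single v) (filter (contains? b) (fam q v))
      G-size : ∀ v → sumL (λ _ → 1) (G v) ≡ count b (fam q v)
      G-size v = trans (sumL-one (G v)) (trans (ListP.length-map (X.single v) (filter (contains? b) (fam q v))) (sym (sumL-ind (contains? b) (fam q v))))
      at-v : ∀ v (d : Dec (Rich q v)) → rich? q v ≡ d → ind d * count b (fam q v) ≡ count b top * ind d + prefixSum (λ t → hits b (offset (w q) v + t)) (width-if d v)
      at-v v (no _)  eq = sym (cong (_+ 0) (*-zeroʳ (count b top)))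
      at-v v (yes _) eq = trans (+-identityʳ _) (trans (sumL-++ (λ A → ind (contains? b A)) top _)
        (cong₂ _+_ (sym (*-identityʳ (count b top))) (count-window b (offset (w q) v) (width v))))

    attained : ∀ {n₂} q → 1 ≤ n₂ → (∀ b → base q b < n₂) → (∀ b → n₂ + (2 + toℕ b) ≤ base q b + E) → (n₁ ≡ n₂ → q ≡ 0) →
      HasDistinguishingPartition (K m n₁ m₂ n₂)
    attained {n₂} q 1≤n₂ lower upper eq = fromHasDist (Explicit.Build.result n₁ n₂ m₂ F 3≤n₁ Y-large′ (rich? q) (y-poor q) (fam q)
        (λ {v} _ → fam-unique q v) (λ {v} _ → fam-length q v) (λ b → n₂ ∸ base q b) (λ b → m<n⇒0<n∸m (lower b))
        (λ b → +-cancelˡ-≤ (base q b) _ _ (≤-trans (≤-reflexive (trans (swap (base q b) (2 + toℕ b) (n₂ ∸ base q b))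
          (cong (_+ (2 + toℕ b)) (m+[n∸m]≡n (<⇒≤ (lower b)))))) (upper b)))
        (λ b → trans (cong (n₂ ∸ base q b +_) (base-singles n₂ q b)) (m∸n+n≡m (<⇒≤ (lower b))))
        (λ n≡ v (v< , _) → n≮0 (subst (toℕ v <_) (eq n≡) v<))
        (fromℕ< (≤-trans (s≤s z≤n) 3≤n₁)) (fromℕ< 1≤n₂))
      where
      swap : ∀ a b c → a + (b + c) ≡ a + c + b
      swap = solve 3 (λ a b c → a :+ (b :+ c) := a :+ c :+ b) refl
        where open +-*-Solver

    balanced : ∀ q b b′ → base q b ≤ base q b′ + p
    balanced q b b′ = begin
      R q * count b top + prefixSum (hits b) (M q)
        ≤⟨ +-mono-≤ (≤-reflexive (cong (R q *_) (count-levels-same m₂ j b b′))) (≤-trans (hits-upper b (M q))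
            (+-monoˡ-≤ p (≤-trans (≤-reflexive (cong (M q / p *_) (trans (count-level m₂ (suc j) b) (sym (count-level m₂ (suc j) b′))))) (hits-lower b′ (M q))))) ⟩
      R q * count b′ top + (prefixSum (hits b′) (M q) + p) ≡⟨ +-assoc (R q * count b′ top) _ p ⟨
      base q b′ + p ∎
      where open ≤-Reasoning

    at-level : ℕ → Fin m → ℕ
    at-level q v = ind (toℕ v ≟ q)

    at-level-sum : ∀ q → sumL (at-level q) (allFin m) ≤ 1
    at-level-sum q = begin
      sumL (at-level q) (allFin m)               ≡⟨ sumL-ind (λ v → toℕ v ≟ q) (allFin m) ⟩
      length (filter (λ v → toℕ v ≟ q) (allFin m)) ≡⟨ ListP.length-map toℕ (filter (λ v → toℕ v ≟ q) (allFin m)) ⟨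
      length (map toℕ (filter (λ v → toℕ v ≟ q) (allFin m))) ≤⟨ length-⊆ {ys = q ∷ []} (UniqueP.map⁺ FinP.toℕ-injective (UniqueP.filter⁺ (λ v → toℕ v ≟ q) (UniqueP.allFin⁺ m)))
          (λ x∈ → let (v , v∈ , eq) = MemP.∈-map⁻ toℕ x∈ in here (trans eq (proj₂ (MemP.∈-filter⁻ (λ v → toℕ v ≟ q) {xs = allFin m} v∈)))) ⟩
      1 ∎
      where open ≤-Reasoning

    -- f sees only a decision and a vertex, so one argument bounds the growth both of the number of
    -- rich vertices and of their total width.
    grow : (f : ∀ {P : Set} → Dec P → Fin m → ℕ) (B : ℕ) → (∀ {P : Set} (d : Dec P) v → f d v ≤ B) → (∀ {P Q : Set} (p : P) (q : Q) v → f (yes p) v ≡ f (yes q) v) →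
      (∀ {P : Set} (n : ¬ P) v → f (no n) v ≡ 0) →
      ∀ q → sumL (λ v → f (rich? (suc q) v) v) (allFin m) ≤ sumL (λ v → f (rich? q v) v) (allFin m) + B
    grow f B bound same zero′ q = begin
      sumL (λ v → f (rich? (suc q) v) v) (allFin m)  ≤⟨ sumL-mono (allFin m) (λ {v} _ → one v (rich? (suc q) v) (rich? q v) (toℕ v ≟ q)) ⟩
      sumL (λ v → f (rich? q v) v + B * at-level q v) (allFin m) ≡⟨ trans (sumL-+ _ _ (allFin m)) (cong (sumL (λ v → f (rich? q v) v) (allFin m) +_) (sumL-* B (at-level q) (allFin m))) ⟩
      sumL (λ v → f (rich? q v) v) (allFin m) + B * sumL (at-level q) (allFin m) ≤⟨ +-monoʳ-≤ _ (≤-trans (*-monoʳ-≤ B (at-level-sum q)) (≤-reflexive (*-identityʳ B))) ⟩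
      sumL (λ v → f (rich? q v) v) (allFin m) + B ∎
      where
      open ≤-Reasoning
      one : ∀ v (d′ : Dec (Rich (suc q) v)) (d : Dec (Rich q v)) (e : Dec (toℕ v ≡ q)) → f d′ v ≤ f d v + B * ind e
      one v (no n)  d       e       = ≤-trans (≤-reflexive (zero′ n v)) z≤n
      one v (yes r) (yes s) e       = ≤-trans (≤-reflexive (same r s v)) (m≤m+n _ _)
      one v (yes r) (no n)  (yes _) = ≤-trans (bound (yes r) v) (≤-trans (≤-reflexive (sym (*-identityʳ B))) (m≤n+m _ _))
      one v (yes (v< , h)) (no n) (no v≢) = ⊥-elim (n (≤∧≢⇒< (≤-pred v<) v≢ , h))

    hits-mono : ∀ b a c → a ≤ c → prefixSum (hits b) a ≤ prefixSum (hits b) c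
    hits-mono b a c a≤c = ≤-trans (m≤m+n _ _) (≤-reflexive (trans (sym (prefixSum-+ (hits b) a (c ∸ a))) (cong (prefixSum (hits b)) (m+[n∸m]≡n a≤c))))

    count≤length : ∀ b (As : List (Sub m₂)) → count b As ≤ length As
    count≤length b As = ≤-trans (sumL-mono As (λ {A} _ → ind≤1 (contains? b A))) (≤-reflexive (sumL-one As))

    base-step : ∀ q b → base (suc q) b ≤ base q b + step
    base-step q b = begin
      R (suc q) * count b top + prefixSum (hits b) (M (suc q))
        ≤⟨ +-mono-≤ (*-monoˡ-≤ (count b top) (grow (λ d _ → ind d) 1 (λ d _ → ind≤1 d) (λ _ _ _ → refl) (λ _ _ → refl) q))
                    (hits-mono b _ _ (grow width-if (k + 2) width-if≤ (λ _ _ _ → refl) (λ _ _ → refl) q)) ⟩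
      (R q + 1) * count b top + prefixSum (hits b) (M q + (k + 2))
        ≤⟨ +-mono-≤ (≤-reflexive (trans (*-distribʳ-+ (count b top) (R q) 1) (cong (R q * count b top +_) (+-identityʳ _))))
             (≤-trans (≤-reflexive (prefixSum-+ (hits b) (M q) (k + 2))) (+-monoʳ-≤ _ (prefixSum-≤ (k + 2) (λ x → ind≤1 (contains? b (at (M q + x))))))) ⟩
      (R q * count b top + count b top) + (prefixSum (hits b) (M q) + (k + 2))
        ≡⟨ +-interchange (R q * count b top) _ _ _ ⟩
      base q b + (count b top + (k + 2)) ≤⟨ +-monoʳ-≤ (base q b) (+-monoˡ-≤ (k + 2) (count≤length b top)) ⟩
      base q b + step ∎
      where
      open ≤-Reasoning
      width-if≤ : ∀ {P : Set} (d : Dec P) v → width-if d v ≤ k + 2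
      width-if≤ (yes _) v = m∸n≤m (k + 2) (deg v)
      width-if≤ (no  _) v = z≤n

    base-zero : ∀ b → base 0 b ≡ 0
    base-zero b = cong₂ _+_ (cong (_* count b top) (sumL-zero (allFin m) (λ {v} _ → off-ind (rich? 0 v))))
                            (cong (prefixSum (hits b)) (sumL-zero (allFin m) (λ {v} _ → off-width v (rich? 0 v))))
      where
      off-ind : ∀ {v} (d : Dec (Rich 0 v)) → ind d ≡ 0
      off-ind (no _) = refl
      off-ind (yes (() , _))
      off-width : ∀ v (d : Dec (Rich 0 v)) → width-if d v ≡ 0
      off-width v (no _) = refl
      off-width v (yes (() , _))

    -- Decrease q until the single blocks of the rich vertices leave room for n₂.
    choose : ∀ {n₂} q → 1 ≤ n₂ → n₁ ≢ n₂ → n₂ + reserve ≤ base q b₀ + E → HasDistinguishingPartition (K m n₁ m₂ n₂)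
    choose {n₂} q 1≤n₂ ne fits with base q b₀ + p <? n₂
    ... | yes below = attained q 1≤n₂ (λ b → ≤-<-trans (balanced q b b₀) below)
        (λ b → +-cancelʳ-≤ p _ _ (≤-trans (room b) (≤-trans fits (≤-trans (+-monoˡ-≤ E (balanced q b₀ b))
          (≤-reflexive (trans (+-assoc (base q b) p E) (trans (cong (base q b +_) (+-comm p E)) (sym (+-assoc (base q b) E p)))))))))
        (λ eq → ⊥-elim (ne eq))
      where
      room : ∀ b → n₂ + (2 + toℕ b) + p ≤ n₂ + reserve
      room b = ≤-trans (≤-reflexive (+-assoc n₂ (2 + toℕ b) p)) (+-monoʳ-≤ n₂ (+-monoˡ-≤ p (≤-trans (+-monoʳ-≤ 2 (<⇒≤ (FinP.toℕ<n b))) (≤-reflexive (+-comm 2 m₂)))))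
    choose {n₂} zero 1≤n₂ ne fits | no ≮ = attained 0 1≤n₂ (λ b → ≤-trans (s≤s (≤-reflexive (base-zero b))) 1≤n₂)
        (λ b → begin
          n₂ + (2 + toℕ b)      ≤⟨ +-mono-≤ (≤-trans (≮⇒≥ ≮) (≤-reflexive (cong (_+ p) (base-zero b₀)))) (+-monoʳ-≤ 2 (<⇒≤ (FinP.toℕ<n b))) ⟩
          p + (2 + m₂)          ≡⟨ solve 2 (λ p m → p :+ (con 2 :+ m) := m :+ con 2 :+ p) refl p m₂ ⟩
          reserve               ≤⟨ ≤-trans (m≤n+m reserve (step + p)) (≤-trans (m≤n+m _ (n₁ + m₂ + 6)) (≤-trans Y-large Y≤E)) ⟩
          E                     ≡⟨ cong (_+ E) (base-zero b) ⟨
          base 0 b + E          ∎)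
        (λ _ → refl)
      where
      open ≤-Reasoning
      open +-*-Solver
    choose {n₂} (suc q) 1≤n₂ ne fits | no ≮ = choose q 1≤n₂ ne (begin
        n₂ + reserve                       ≤⟨ +-monoˡ-≤ reserve (≤-trans (≮⇒≥ ≮) (+-monoˡ-≤ p (base-step q b₀))) ⟩
        base q b₀ + step + p + reserve     ≡⟨ trans (+-assoc (base q b₀ + step) p reserve) (trans (+-assoc (base q b₀) step _) (cong (base q b₀ +_) (sym (+-assoc step p reserve)))) ⟩
        base q b₀ + (step + p + reserve)   ≤⟨ +-monoʳ-≤ (base q b₀) (≤-trans (m≤n+m _ (n₁ + m₂ + 6)) (≤-trans Y-large Y≤E)) ⟩
        base q b₀ + E                      ∎)
      where open ≤-Reasoning

    -- q = 0 leaves every vertex poor, as the explicit partition demands when n₁ = n₂.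
    equal-case : HasDistinguishingPartition (K m n₁ m₂ n₁)
    equal-case = attained 0 1≤n₁ (λ b → ≤-trans (s≤s (≤-reflexive (base-zero b))) 1≤n₁) (λ b → begin
        n₁ + (2 + toℕ b)      ≤⟨ +-monoʳ-≤ n₁ (+-monoʳ-≤ 2 (<⇒≤ (FinP.toℕ<n b))) ⟩
        n₁ + (2 + m₂)         ≤⟨ ≤-reflexive (solve 2 (λ n m → n :+ (con 2 :+ m) := n :+ m :+ con 2) refl n₁ m₂) ⟩
        n₁ + m₂ + 2           ≤⟨ +-monoʳ-≤ (n₁ + m₂) (m≤m+n 2 4) ⟩
        n₁ + m₂ + 6           ≤⟨ ≤-trans Y-large′ Y≤E ⟩
        E                     ≡⟨ cong (_+ E) (base-zero b) ⟨
        base 0 b + E          ∎) (λ _ → refl)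
      where
      open ≤-Reasoning
      open +-*-Solver
      1≤n₁ : 1 ≤ n₁
      1≤n₁ = ≤-trans (s≤s z≤n) 3≤n₁

    range : ∀ n₂ → 1 ≤ n₂ → n₂ + reserve ≤ base m b₀ + E → HasDistinguishingPartition (K m n₁ m₂ n₂)
    range n₂ 1≤n₂ fits with n₁ ≟ n₂
    ... | yes refl = equal-case
    ... | no ne    = choose m 1≤n₂ ne fits

    nonroots : ℕ
    nonroots = length (filter nonRoot? (allFin m))

    nonroots≤E : nonroots ≤ E
    nonroots≤E = length-⊆ (UniqueP.filter⁺ nonRoot? (UniqueP.allFin⁺ m)) λ {e} e∈ → listed e (proj₂ (MemP.∈-filter⁻ nonRoot? {xs = allFin m} e∈)) (FinP.any? (λ i → y i FinP.≟ e))
      where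
      listed : ∀ e → NonRoot e → Dec (∃ λ i → y i ≡ e) → e ∈ edges
      listed e r (yes (i , refl)) = MemP.∈-++⁺ˡ (MemP.∈-map⁺ y (MemP.∈-allFin i))
      listed e r (no none) = MemP.∈-++⁺ʳ (map y (allFin Y)) (MemP.∈-filter⁺ offPath? (MemP.∈-allFin e) (r , λ i eq → none (i , eq)))

    deg-sum : sumL deg (allFin m) ≤ 2 * nonroots
    deg-sum = begin
      sumL deg (allFin m)   ≡⟨ sumL-cong (allFin m) (λ {v} _ → sumL-ind (ends? v) (allFin m)) ⟨
      sumL (λ v → sumL (λ e → ind (ends? v e)) (allFin m)) (allFin m) ≡⟨ sumL-swap (λ v e → ind (ends? v e)) (allFin m) (allFin m) ⟩
      sumL (λ e → sumL (λ v → ind (ends? v e)) (allFin m)) (allFin m) ≤⟨ sumL-mono (allFin m) (λ {e} _ → at-e e (nonRoot? e)) ⟩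
      sumL (λ e → 2 * ind (nonRoot? e)) (allFin m) ≡⟨ sumL-* 2 (λ e → ind (nonRoot? e)) (allFin m) ⟩
      2 * sumL (λ e → ind (nonRoot? e)) (allFin m) ≡⟨ cong (2 *_) (sumL-ind nonRoot? (allFin m)) ⟩
      2 * nonroots ∎
      where
      open ≤-Reasoning
      at-e : ∀ e (d : Dec (NonRoot e)) → sumL (λ v → ind (ends? v e)) (allFin m) ≤ 2 * ind d
      at-e e (no n)  = ≤-trans (≤-reflexive (sumL-ind (λ v → ends? v e) (allFin m))) (length-⊆ {ys = []} (UniqueP.filter⁺ (λ v → ends? v e) (UniqueP.allFin⁺ m))
        (λ v∈ → let (p , eq , _) = proj₂ (MemP.∈-filter⁻ (λ v → ends? v e) {xs = allFin m} v∈) in ⊥-elim (n (p , eq))))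
      at-e e (yes (p , eq)) = ≤-trans (≤-reflexive (sumL-ind (λ v → ends? v e) (allFin m))) (length-⊆ {ys = e ∷ p ∷ []} (UniqueP.filter⁺ (λ v → ends? v e) (UniqueP.allFin⁺ m))
        (λ v∈ → case proj₂ (MemP.∈-filter⁻ (λ v → ends? v e) {xs = allFin m} v∈) of λ where
            (_ , _ , inj₁ r)   → here r
            (_ , eq′ , inj₂ r) → there (here (trans r (just-injective (trans (sym eq′) eq))))))

    rich-count : m ≤ R m + Y
    rich-count = begin
      m                        ≡⟨ ListP.length-tabulate {n = m} id ⟨
      length (allFin m)        ≡⟨ length-filter-split (rich? m) (allFin m) ⟩
      length (filter (rich? m) (allFin m)) + length (filter (¬? ∘ rich? m) (allFin m))
        ≤⟨ +-mono-≤ (≤-reflexive (sym (sumL-ind (rich? m) (allFin m)))) (≤-trans (length-⊆ {ys = map y (allFin Y)} (UniqueP.filter⁺ (¬? ∘ rich? m) (UniqueP.allFin⁺ m))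
              (λ {v} v∈ → poor v (proj₂ (MemP.∈-filter⁻ (¬? ∘ rich? m) {xs = allFin m} v∈)) (FinP.any? (λ i → y i FinP.≟ v))))
            (≤-reflexive (trans (ListP.length-map y (allFin Y)) (ListP.length-tabulate {n = Y} id)))) ⟩
      R m + Y                  ∎
      where
      open ≤-Reasoning
      poor : ∀ v → ¬ Rich m v → Dec (∃ λ i → y i ≡ v) → v ∈ map y (allFin Y)
      poor v ¬r (yes (i , refl)) = MemP.∈-map⁺ y (MemP.∈-allFin i)
      poor v ¬r (no none) = ⊥-elim (¬r (FinP.toℕ<n v , λ i eq → none (i , eq)))

    width-sum : (k + 2) * R m ≤ M m + 2 * nonroots
    width-sum = begin
      (k + 2) * R m           ≡⟨ sumL-* (k + 2) (λ v → ind (rich? m v)) (allFin m) ⟨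
      sumL (λ v → (k + 2) * ind (rich? m v)) (allFin m) ≤⟨ sumL-mono (allFin m) (λ {v} _ → at-v v (rich? m v)) ⟩
      sumL (λ v → w m v + deg v) (allFin m) ≡⟨ sumL-+ (w m) deg (allFin m) ⟩
      M m + sumL deg (allFin m) ≤⟨ +-monoʳ-≤ (M m) deg-sum ⟩
      M m + 2 * nonroots ∎
      where
      open ≤-Reasoning
      at-v : ∀ v {P : Set} (d : Dec P) → (k + 2) * ind d ≤ width-if d v + deg v
      at-v v (no _)  = ≤-trans (≤-reflexive (*-zeroʳ (k + 2))) z≤n
      at-v v (yes _) = ≤-reflexive (trans (*-identityʳ (k + 2)) (sym (m∸n+n≡m (deg≤k+2 v))))

    S₁ W Z : ℕ
    S₁ = sumTo j (λ i → (m₂ ∸ i) * (m₂ C i))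
    W  = u + suc j
    Z  = S₁ + W * (k + 2)

    -- At a rich vertex the sets of `top` are worth S₁, and each further slot is worth W when filled
    -- from the next level. An edge uses two such slots for one block worth m₂ = 2 W - u, so it
    -- costs u, and there are at most m - c edges. The constants pay for the path and for an
    -- incomplete period.
    top-bound : ∀ c → nonroots + c ≤ m → m * Z + u * c ≤ m₂ * (base m b₀ + E) + (W * p + Y * Z) + u * m
    top-bound c roots = begin
      m * Z + u * c                                 ≤⟨ +-monoˡ-≤ (u * c) (*-monoˡ-≤ Z rich-count) ⟩
      (R m + Y) * Z + u * c                         ≡⟨ solve 6 (λ r y s w k uc → (r :+ y) :* (s :+ w :* k) :+ uc := r :* s :+ w :* (k :* r) :+ (y :* (s :+ w :* k) :+ uc)) refl (R m) Y S₁ W (k + 2) (u * c) ⟩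
      R m * S₁ + W * ((k + 2) * R m) + (Y * Z + u * c)
        ≤⟨ +-monoˡ-≤ (Y * Z + u * c) (+-mono-≤ (≤-reflexive top-part) (*-monoʳ-≤ W (≤-trans width-sum (+-monoˡ-≤ (2 * nonroots) full-periods)))) ⟩
      m₂ * (R m * count b₀ top) + W * (M m / p * p + p + 2 * nonroots) + (Y * Z + u * c)
        ≡⟨ solve 8 (λ a w q p n y uc z → a :+ w :* (q :* p :+ p :+ con 2 :* n) :+ (y :+ uc) := a :+ q :* (w :* p) :+ con 2 :* w :* n :+ (w :* p :+ y) :+ uc) refl
             (m₂ * (R m * count b₀ top)) W (M m / p) p nonroots (Y * Z) (u * c) 0 ⟩
      m₂ * (R m * count b₀ top) + M m / p * (W * p) + 2 * W * nonroots + (W * p + Y * Z) + u * c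
        ≡⟨ cong (λ z → m₂ * (R m * count b₀ top) + z + 2 * W * nonroots + (W * p + Y * Z) + u * c) (cong (M m / p *_) (sym share)) ⟩
      m₂ * (R m * count b₀ top) + M m / p * (m₂ * κ) + 2 * W * nonroots + (W * p + Y * Z) + u * c
        ≡⟨ cong (λ z → m₂ * (R m * count b₀ top) + M m / p * (m₂ * κ) + z * nonroots + (W * p + Y * Z) + u * c) twice ⟩
      m₂ * (R m * count b₀ top) + M m / p * (m₂ * κ) + (m₂ + u) * nonroots + (W * p + Y * Z) + u * c
        ≡⟨ solve 9 (λ m a q κ n u c y z → m :* a :+ q :* (m :* κ) :+ (m :+ u) :* n :+ y :+ u :* c := m :* (a :+ q :* κ :+ n) :+ y :+ u :* (n :+ c)) refl
             m₂ (R m * count b₀ top) (M m / p) κ nonroots u c (W * p + Y * Z) 0 ⟩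
      m₂ * (R m * count b₀ top + M m / p * κ + nonroots) + (W * p + Y * Z) + u * (nonroots + c)
        ≤⟨ +-mono-≤ (+-monoˡ-≤ (W * p + Y * Z) (*-monoʳ-≤ m₂ (+-mono-≤ (+-monoʳ-≤ (R m * count b₀ top) (hits-lower b₀ (M m))) nonroots≤E))) (*-monoʳ-≤ u roots) ⟩
      m₂ * (base m b₀ + E) + (W * p + Y * Z) + u * m ∎
      where
      open ≤-Reasoning
      open +-*-Solver
      κ = count b₀ (level m₂ (suc j))
      top-part : R m * S₁ ≡ m₂ * (R m * count b₀ top)
      top-part = trans (cong (R m *_) (sym (count-levels m₂ j b₀))) (solve 3 (λ r m c → r :* (m :* c) := m :* (r :* c)) refl (R m) m₂ (count b₀ top))
      full-periods : M m ≤ M m / p * p + p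
      full-periods = ≤-trans (≤-reflexive (trans (m≡m%n+[m/n]*n (M m) p) (+-comm (M m % p) _))) (+-monoʳ-≤ (M m / p * p) (<⇒≤ (m%n<n (M m) p)))
      share : m₂ * κ ≡ W * p
      share = trans (level-share m₂ (suc j) b₀) (cong₂ _*_ (trans (cong (_∸ suc j) (sym m₂≡)) (m+n∸n≡m W (suc j))) (sym (length-level m₂ (suc j))))
      twice : 2 * W ≡ m₂ + u
      twice = trans (solve 2 (λ u d → con 2 :* (u :+ d) := u :+ d :+ d :+ u) refl u (suc j)) (cong (_+ u) m₂≡)

-- A rigid forest of caterpillars

funToFin-cong : ∀ {m n} {f g : Fin m → Fin n} → (∀ x → f x ≡ g x) → funToFin f ≡ funToFin g
funToFin-cong {zero}  h = refl
funToFin-cong {suc m} h = cong₂ combine (h zero) (funToFin-cong (h ∘ suc))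

-- One caterpillar for each word of L bits: the spine carries a pendant vertex at position 2 and,
-- for each p < L, at position 3 + 2p or 4 + 2p according to bit p. The spine of the caterpillar of
-- the zero word is prolonged by R vertices.
module Caterpillars (L R : ℕ) where

  Word : Set
  Word = Fin (2 ^ L)

  bit : Word → Fin L → Fin 2
  bit β = finToFun β

  bits-inj : ∀ {β β′} → (∀ p → bit β p ≡ bit β′ p) → β ≡ β′
  bits-inj {β} {β′} h = trans (sym (FinP.funToFin-finToFin {L} {2} β)) (trans (funToFin-cong h) (FinP.funToFin-finToFin {L} {2} β′))

  extra : Word → ℕ
  extra β = if does (toℕ β ≟ 0) then R else 0

  abstract
    tail : Word → ℕ
    tail β = 3 + (L * 2 + extra β)

    tail-val : ∀ β → tail β ≡ 3 + (L * 2 + extra β)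
    tail-val β = refl

    att : Word → Fin (suc L) → ℕ
    att β zero    = 2
    att β (suc p) = 3 + toℕ (combine p (bit β p))

    att-zero : ∀ β → att β zero ≡ 2
    att-zero β = refl

    2≤att : ∀ β p → 2 ≤ att β p
    2≤att β zero    = ≤-refl
    2≤att β (suc p) = s≤s (s≤s z≤n)

    att≤ : ∀ β p → att β p ≤ 2 + L * 2
    att≤ β zero    = m≤m+n 2 _
    att≤ β (suc p) = s≤s (s≤s (FinP.toℕ<n (combine p (bit β p))))

    att<len : ∀ β p {x} → x ≤ 3 → x + att β p < 3 + tail β
    att<len β p {x} x≤ = s≤s (≤-trans (+-mono-≤ x≤ (att≤ β p)) (+-monoʳ-≤ 5 (m≤m+n (L * 2) (extra β))))

    att-inj : ∀ β β′ p p′ → att β p ≡ att β′ p′ → p ≡ p′ × (∀ q → p ≡ suc q → bit β q ≡ bit β′ q)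
    att-inj β β′ zero    zero     eq = refl , λ _ ()
    att-inj β β′ zero    (suc p′) ()
    att-inj β β′ (suc p) zero     ()
    att-inj β β′ (suc p) (suc p′) eq with p≡ , b≡ ← FinP.combine-injective p (bit β p) p′ (bit β′ p′) (FinP.toℕ-injective (+-cancelˡ-≡ 3 _ _ eq)) =
      cong suc p≡ , λ { q refl → trans b≡ (cong (bit β′) (sym p≡)) }

  len : Word → ℕ
  len β = 3 + tail β

  data Vx : Set where
    sp : (β : Word) → Fin (len β) → Vx
    pd : (β : Word) → Fin (suc L) → Vx

  attF : ∀ β → Fin (suc L) → Fin (len β)
  attF β p = fromℕ< (att<len β p {0} z≤n)

  toℕ-attF : ∀ β p → toℕ (attF β p) ≡ att β p
  toℕ-attF β p = FinP.toℕ-fromℕ< _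

  parent : Vx → Maybe Vx
  parent (sp β zero)    = nothing
  parent (sp β (suc i)) = just (sp β (Fin.inject₁ i))
  parent (pd β p)       = just (sp β (attF β p))

  adj : Vx → Vx → Set
  adj u w = parent u ≡ just w ⊎ parent w ≡ just u

  adj-sym : ∀ {u w} → adj u w → adj w u
  adj-sym (inj₁ e) = inj₂ e
  adj-sym (inj₂ e) = inj₁ e

  sp-≡ : ∀ {β} {i k : Fin (len β)} → toℕ i ≡ toℕ k → sp β i ≡ sp β k
  sp-≡ eq = cong (sp _) (FinP.toℕ-injective eq)

  sp-toℕ : ∀ {β β′ i k} → sp β i ≡ sp β′ k → toℕ i ≡ toℕ k
  sp-toℕ refl = refl

  data Nb (β : Word) (i : ℕ) : Vx → Set where
    prev : ∀ {k : Fin (len β)} → suc (toℕ k) ≡ i → Nb β i (sp β k)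
    next : ∀ {k : Fin (len β)} → toℕ k ≡ suc i → Nb β i (sp β k)
    pend : ∀ {p} → att β p ≡ i → Nb β i (pd β p)

  nb-up : ∀ {β w} i → parent (sp β i) ≡ just w → Nb β (toℕ i) w
  nb-up (suc i) refl = prev (cong suc (FinP.toℕ-inject₁ i))

  nb-down : ∀ {β i} w → parent w ≡ just (sp β i) → Nb β (toℕ i) w
  nb-down (sp β (suc k)) refl = next (cong suc (sym (FinP.toℕ-inject₁ k)))
  nb-down (pd β p)       refl = pend (sym (toℕ-attF β p))

  nb : ∀ {β i w} → adj (sp β i) w → Nb β (toℕ i) w
  nb (inj₁ e) = nb-up _ e
  nb (inj₂ e) = nb-down _ e

  nb-pd : ∀ {β p w} → adj (pd β p) w → w ≡ sp β (attF β p)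
  nb-pd (inj₁ refl) = refl
  nb-pd {w = sp β (suc k)} (inj₂ ())
  nb-pd {w = pd β p}       (inj₂ ())

  adj-next : ∀ {β} {i k : Fin (len β)} → toℕ k ≡ suc (toℕ i) → adj (sp β i) (sp β k)
  adj-next {β} {i} {suc k} eq = inj₂ (cong just (sp-≡ (trans (FinP.toℕ-inject₁ k) (suc-injective eq))))

  adj-pd : ∀ {β p} {i : Fin (len β)} → att β p ≡ toℕ i → adj (sp β i) (pd β p)
  adj-pd {β} {p} eq = inj₂ (cong just (sp-≡ (trans (toℕ-attF β p) eq)))

  at : ∀ β x → x < len β → Fin (len β)
  at β x x< = fromℕ< x<

  toℕ-at : ∀ {β x} (x< : x < len β) → toℕ (at β x x<) ≡ x
  toℕ-at x< = FinP.toℕ-fromℕ< x<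

  -- Degrees without counting. `Start` asks for a leaf whose neighbour has degree at most two and is
  -- followed by a branching vertex. Position 0 of a spine is of this kind because of the pendant
  -- vertex at position 2.
  Leaf Two Start : Vx → Set
  Leaf v  = ∀ {x y} → adj v x → adj v y → x ≡ y
  Two v   = ∀ {x y z} → adj v x → adj v y → adj v z → x ≡ y ⊎ y ≡ z ⊎ x ≡ z
  Start v = Leaf v × ∃₂ λ v₁ v₂ → adj v v₁ × Two v₁ × adj v₁ v₂ × v₂ ≢ v × ¬ Two v₂

  bare-two : ∀ {β i} → (∀ p → att β p ≢ toℕ i) → Two (sp β i)
  bare-two {β} {i} none ax ay az = go (nb ax) (nb ay) (nb az)
    where
    go : ∀ {x y z} → Nb β (toℕ i) x → Nb β (toℕ i) y → Nb β (toℕ i) z → x ≡ y ⊎ y ≡ z ⊎ x ≡ z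
    go (pend e) _ _ = ⊥-elim (none _ e)
    go _ (pend e) _ = ⊥-elim (none _ e)
    go _ _ (pend e) = ⊥-elim (none _ e)
    go (prev e) (prev f) _        = inj₁ (sp-≡ (suc-injective (trans e (sym f))))
    go (next e) (next f) _        = inj₁ (sp-≡ (trans e (sym f)))
    go (prev e) (next f) (prev g) = inj₂ (inj₂ (sp-≡ (suc-injective (trans e (sym g)))))
    go (prev e) (next f) (next g) = inj₂ (inj₁ (sp-≡ (trans f (sym g))))
    go (next e) (prev f) (prev g) = inj₂ (inj₁ (sp-≡ (suc-injective (trans f (sym g)))))
    go (next e) (prev f) (next g) = inj₂ (inj₂ (sp-≡ (trans e (sym g))))

  pred-at : ∀ {β} (i : Fin (len β)) → 1 ≤ toℕ i → ∃ λ (k : Fin (len β)) → suc (toℕ k) ≡ toℕ i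
  pred-at (suc i) _ = Fin.inject₁ i , cong suc (FinP.toℕ-inject₁ i)

  branch : ∀ {β p i} → att β p ≡ toℕ i → ¬ Two (sp β i)
  branch {β} {p} {i} eq two = case two (adj-sym (adj-next (sym k≡))) (adj-next l≡) (adj-pd eq) of λ where
      (inj₁ e)        → <⇒≢ (<-trans (≤-reflexive k≡) (≤-reflexive (sym l≡))) (sp-toℕ e)
      (inj₂ (inj₁ ()))
      (inj₂ (inj₂ ()))
    where
    k = proj₁ (pred-at i (≤-trans (s≤s z≤n) (≤-trans (2≤att β p) (≤-reflexive eq))))
    k≡ = proj₂ (pred-at i (≤-trans (s≤s z≤n) (≤-trans (2≤att β p) (≤-reflexive eq))))
    l< : suc (toℕ i) < len β
    l< = subst (λ x → suc x < len β) eq (att<len β p {1} (s≤s z≤n))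
    l≡ : toℕ (at β _ l<) ≡ suc (toℕ i)
    l≡ = toℕ-at l<

  not-leaf : ∀ {β} (i : Fin (len β)) → 1 ≤ toℕ i → suc (toℕ i) < len β → ¬ Leaf (sp β i)
  not-leaf {β} i 1≤i i< leaf = <⇒≢ (<-trans (≤-reflexive k≡) (≤-reflexive (sym (toℕ-at i<)))) (sp-toℕ (leaf (adj-sym (adj-next (sym k≡))) (adj-next (toℕ-at i<))))
    where
    k = proj₁ (pred-at i 1≤i)
    k≡ = proj₂ (pred-at i 1≤i)

  start-sp : ∀ β → Start (sp β zero)
  start-sp β = (λ ax ay → go (nb ax) (nb ay)) , sp β (suc zero) , sp β (suc (suc zero)) ,
      adj-next refl , bare-two (λ p eq → <⇒≱ (2≤att β p) (≤-reflexive eq)) , adj-next refl , (λ ()) , branch {β} {zero} {suc (suc zero)} (att-zero β)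
    where
    go : ∀ {x y} → Nb β 0 x → Nb β 0 y → x ≡ y
    go (next e) (next f) = sp-≡ (trans e (sym f))
    go (pend {p} e) _ = ⊥-elim (<⇒≱ (2≤att β p) (≤-trans (≤-reflexive e) z≤n))
    go _ (pend {p} e) = ⊥-elim (<⇒≱ (2≤att β p) (≤-trans (≤-reflexive e) z≤n))

  -- No pendant vertices at the last three positions of a spine.
  clear-end : ∀ {β p} x → len β ≤ x + 3 → att β p ≢ x
  clear-end {β} {p} x x≥ refl = <⇒≱ (att<len β p {3} ≤-refl) (≤-trans x≥ (≤-reflexive (+-comm _ 3)))

  -- A pendant vertex hangs from a branching vertex, inner vertices of a spine are no leaves, and
  -- the two vertices before the far end carry no pendant.
  start-only : ∀ v → Start v → ∃ λ β → v ≡ sp β zero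
  start-only (pd β p) (_ , v₁ , v₂ , a₁ , two , _) with refl ← nb-pd a₁ = ⊥-elim (branch {p = p} (sym (toℕ-attF β p)) two)
  start-only (sp β zero) _ = β , refl
  start-only (sp β i@(suc _)) (leaf , v₁ , v₂ , a₁ , two , a₂ , v₂≢ , ¬two) with suc (toℕ i) <? len β
  ... | yes i< = ⊥-elim (not-leaf i (s≤s z≤n) i< leaf)
  ... | no ≮ = ⊥-elim (¬two (second (nb a₁) a₂ v₂≢))
    where
    i≥ : len β ≤ suc (toℕ i)
    i≥ = ≮⇒≥ ≮
    second : ∀ {v₁ v₂} → Nb β (toℕ i) v₁ → adj v₁ v₂ → v₂ ≢ sp β i → Two v₂
    second (pend {p} e) _ _ = ⊥-elim (clear-end {β} {p} (toℕ i) (≤-trans i≥ (≤-trans (≤-reflexive (+-comm 1 _)) (+-monoʳ-≤ (toℕ i) (s≤s z≤n)))) e)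
    second (next {k} e) _ _ = ⊥-elim (<⇒≱ (FinP.toℕ<n k) (≤-trans i≥ (≤-reflexive (sym e))))
    second (prev {k} e) a₂ v₂≢ = third (nb a₂) v₂≢
      where
      third : ∀ {v₂} → Nb β (toℕ k) v₂ → v₂ ≢ sp β i → Two v₂
      third (next f) ne = ⊥-elim (ne (sp-≡ (trans f e)))
      third (pend {p} f) ne = ⊥-elim (clear-end {β} {p} (toℕ k) (≤-trans i≥ (≤-trans (≤-reflexive (cong suc (sym e))) (≤-trans (≤-reflexive (+-comm 2 _)) (+-monoʳ-≤ (toℕ k) (s≤s (s≤s z≤n)))))) f)
      third (prev {l} f) ne = bare-two (λ p → clear-end {β} {p} (toℕ l) (≤-trans i≥ (≤-reflexive (trans (cong suc (trans (sym e) (cong suc (sym f)))) (+-comm 3 _)))))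

  module Rigid (π π′ : Vx → Vx) (π′π : ∀ v → π′ (π v) ≡ v) (ππ′ : ∀ v → π (π′ v) ≡ v)
               (π-adj : ∀ {u w} → adj u w → adj (π u) (π w)) (π′-adj : ∀ {u w} → adj u w → adj (π′ u) (π′ w)) where

    π-inj : ∀ {u w} → π u ≡ π w → u ≡ w
    π-inj {u} {w} eq = trans (sym (π′π u)) (trans (cong π′ eq) (π′π w))

    π′-inj : ∀ {u w} → π′ u ≡ π′ w → u ≡ w
    π′-inj {u} {w} eq = trans (sym (ππ′ u)) (trans (cong π eq) (ππ′ w))

    pull : ∀ {v x} → adj (π v) x → adj v (π′ x)
    pull {v} {x} a = subst (λ z → adj z (π′ x)) (π′π v) (π′-adj a)

    π-leaf : ∀ {v} → Leaf v → Leaf (π v)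
    π-leaf l a b = π′-inj (l (pull a) (pull b))

    leaf-π : ∀ {v} → Leaf (π v) → Leaf v
    leaf-π l a b = π-inj (l (π-adj a) (π-adj b))

    π-two : ∀ {v} → Two v → Two (π v)
    π-two t a b c = case t (pull a) (pull b) (pull c) of λ where
      (inj₁ e)        → inj₁ (π′-inj e)
      (inj₂ (inj₁ e)) → inj₂ (inj₁ (π′-inj e))
      (inj₂ (inj₂ e)) → inj₂ (inj₂ (π′-inj e))

    two-π : ∀ {v} → Two (π v) → Two v
    two-π t a b c = case t (π-adj a) (π-adj b) (π-adj c) of λ where
      (inj₁ e)        → inj₁ (π-inj e)
      (inj₂ (inj₁ e)) → inj₂ (inj₁ (π-inj e))
      (inj₂ (inj₂ e)) → inj₂ (inj₂ (π-inj e))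

    π-start : ∀ {v} → Start v → Start (π v)
    π-start (l , v₁ , v₂ , a₁ , t , a₂ , ne , ¬t) = π-leaf l , π v₁ , π v₂ , π-adj a₁ , π-two t , π-adj a₂ , ne ∘ π-inj , ¬t ∘ two-π

    module From (β : Word) where

      β′ : Word
      β′ = proj₁ (start-only _ (π-start (start-sp β)))

      π-0 : π (sp β zero) ≡ sp β′ zero
      π-0 = proj₂ (start-only _ (π-start (start-sp β)))

      Walked : ℕ → Set
      Walked x = ∀ (i : Fin (len β)) → toℕ i ≡ x → ∃ λ i′ → π (sp β i) ≡ sp β′ i′ × toℕ i′ ≡ x

      -- The image of the next vertex is a neighbour of the image of the current one and differs
      -- from that of the previous one. It is no pendant vertex, since inner spine vertices are not
      -- leaves, and before the end of the spine the current vertex has degree two whereas a pendant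
      -- hangs from a branching one.
      walk₂ : ∀ x → Walked x → Walked (suc x) → Walked (suc (suc x))
      walk₂ x w₀ w₁ i i≡ = go (nb (subst (λ z → adj z (π (sp β i))) eq₁ (π-adj (adj-next {i = i₁} {k = i} (trans i≡ (cong suc (sym (toℕ-at x₁<)))))))) refl
        where
        x₁< : suc x < len β
        x₁< = <-trans (≤-reflexive (sym i≡)) (FinP.toℕ<n i)
        x₀< : x < len β
        x₀< = <-trans (n<1+n x) x₁<
        i₀ = at β x x₀<
        i₁ = at β (suc x) x₁<
        i₁′ = proj₁ (w₁ i₁ (toℕ-at x₁<))
        eq₁ = proj₁ (proj₂ (w₁ i₁ (toℕ-at x₁<)))
        v₁ = proj₂ (proj₂ (w₁ i₁ (toℕ-at x₁<)))
        eq₀ = proj₁ (proj₂ (w₀ i₀ (toℕ-at x₀<)))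
        v₀ = proj₂ (proj₂ (w₀ i₀ (toℕ-at x₀<)))
        go : ∀ {v} → Nb β′ (toℕ i₁′) v → π (sp β i) ≡ v → ∃ λ i′ → π (sp β i) ≡ sp β′ i′ × toℕ i′ ≡ suc (suc x)
        go (next e) r = _ , r , trans e (cong suc v₁)
        go (prev e) r = ⊥-elim (<⇒≢ (<-trans (n<1+n x) (n<1+n (suc x))) (trans (sym (toℕ-at x₀<)) (trans (sp-toℕ (π-inj (trans eq₀ (trans (sp-≡ (trans v₀ (suc-injective (trans (sym v₁) (sym e))))) (sym r))))) i≡)))
        go (pend {p} e) r = ⊥-elim (no-pendant e r (suc (toℕ i) <? len β))
          where
          no-pendant : ∀ {p} → att β′ p ≡ toℕ i₁′ → π (sp β i) ≡ pd β′ p → Dec (suc (toℕ i) < len β) → ⊥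
          no-pendant {p} e r (yes i<) = not-leaf i (≤-trans (s≤s z≤n) (≤-reflexive (sym i≡))) i<
            (leaf-π (subst Leaf (sym r) (λ a b → trans (nb-pd a) (sym (nb-pd b)))))
          no-pendant {p} e r (no ≮) = branch {β′} {p} {i₁′} e (subst Two eq₁ (π-two (bare-two {β} {i₁} (λ q → clear-end {β} {q} (toℕ i₁) end))))
            where
            end : len β ≤ toℕ i₁ + 3
            end = ≤-trans (≮⇒≥ ≮) (≤-trans (≤-reflexive (trans (cong suc i≡) (trans (+-comm 2 (suc x)) (cong (_+ 2) (sym (toℕ-at x₁<)))))) (+-monoʳ-≤ (toℕ i₁) (m≤m+n 2 1)))

      walk₁ : Walked 1
      walk₁ i i≡ = go (nb (subst (λ z → adj z (π (sp β i))) π-0 (π-adj (adj-next {i = zero} {k = i} i≡))))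
        where
        go : ∀ {v} → Nb β′ 0 v → ∃ λ i′ → v ≡ sp β′ i′ × toℕ i′ ≡ 1
        go (next e) = _ , refl , e
        go (pend {p} e) = ⊥-elim (<⇒≱ (2≤att β′ p) (≤-trans (≤-reflexive e) z≤n))

      walk₀ : Walked 0
      walk₀ zero _ = zero , π-0 , refl

      walks : ∀ x → Walked x × Walked (suc x)
      walks zero    = walk₀ , walk₁
      walks (suc x) = proj₂ (walks x) , walk₂ x (proj₁ (walks x)) (proj₂ (walks x))

      spine : ∀ i → ∃ λ i′ → π (sp β i) ≡ sp β′ i′ × toℕ i′ ≡ toℕ i
      spine i = proj₁ (walks (toℕ i)) i refl

      pendant : ∀ p → ∃ λ p′ → π (pd β p) ≡ pd β′ p′ × att β p ≡ att β′ p′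
      pendant p = go (nb (subst (λ z → adj z (π (pd β p))) eq (π-adj (adj-pd {β} {p} {attF β p} (sym (toℕ-attF β p)))))) refl
        where
        i′ = proj₁ (spine (attF β p))
        eq = proj₁ (proj₂ (spine (attF β p)))
        i′≡ : toℕ i′ ≡ att β p
        i′≡ = trans (proj₂ (proj₂ (spine (attF β p)))) (toℕ-attF β p)
        no-spine : ∀ {k : Fin (len β′)} (l : Fin (len β)) → toℕ l ≡ toℕ k → π (pd β p) ≢ sp β′ k
        no-spine {k} l l≡ r = case π-inj (trans r (sym (trans (proj₁ (proj₂ (spine l))) (sp-≡ (trans (proj₂ (proj₂ (spine l))) l≡))))) of λ ()
        go : ∀ {v} → Nb β′ (toℕ i′) v → π (pd β p) ≡ v → ∃ λ p′ → π (pd β p) ≡ pd β′ p′ × att β p ≡ att β′ p′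
        go (pend {p′} e) r = p′ , r , trans (sym i′≡) (sym e)
        go (prev {k} e) r = ⊥-elim (no-spine (at β (toℕ k) k<) (toℕ-at k<) r)
          where
          k< : toℕ k < len β
          k< = <-trans (≤-reflexive (trans e i′≡)) (att<len β p {0} z≤n)
        go (next {k} e) r = ⊥-elim (no-spine (at β (toℕ k) k<) (toℕ-at k<) r)
          where
          k< : toℕ k < len β
          k< = ≤-trans (≤-reflexive (cong suc (trans e (cong suc i′≡)))) (att<len β p {1} (s≤s z≤n))

      -- Positions along the spine are preserved, and the position of its pendant vertex shows each
      -- bit.
      β≡β′ : β ≡ β′
      β≡β′ = bits-inj λ q → proj₂ (att-inj β β′ (suc q) _ (proj₂ (proj₂ (pendant (suc q))))) q refl

      spine-fixed : ∀ i → π (sp β i) ≡ sp β i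
      spine-fixed i = go β≡β′ (spine i)
        where
        go : ∀ {β′} → β ≡ β′ → (∃ λ i′ → π (sp β i) ≡ sp β′ i′ × toℕ i′ ≡ toℕ i) → π (sp β i) ≡ sp β i
        go refl (i′ , e , v) = trans e (sp-≡ v)

      pendant-fixed : ∀ p → π (pd β p) ≡ pd β p
      pendant-fixed p = go β≡β′ (pendant p)
        where
        go : ∀ {β′} → β ≡ β′ → (∃ λ p′ → π (pd β p) ≡ pd β′ p′ × att β p ≡ att β′ p′) → π (pd β p) ≡ pd β p
        go refl (p′ , e , v) = trans e (cong (pd β) (sym (proj₁ (att-inj β β p p′ v))))

    π-id : ∀ v → π v ≡ v
    π-id (sp β i) = From.spine-fixed β i
    π-id (pd β p) = From.pendant-fixed β p

zero-sum : ∀ N R → 1 ≤ N → sumL (λ (β : Fin N) → if does (toℕ β ≟ 0) then R else 0) (allFin N) ≡ R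
zero-sum (suc n) R _ = trans (sumL-allFin-suc {n} (λ β → if does (toℕ β ≟ 0) then R else 0))
  (trans (cong (R +_) (sumL-zero (allFin n) (λ _ → refl))) (+-identityʳ R))

-- The caterpillars as a forest with numbered vertices

module CaterpillarForest (L R Y : ℕ) (Y<R : Y < R) where

  open Caterpillars L R

  verticesOf : Word → List Vx
  verticesOf β = map (sp β) (allFin (len β)) ++ map (pd β) (allFin (suc L))

  vertices : List Vx
  vertices = concatMap verticesOf (allFin (2 ^ L))

  m : ℕ
  m = length vertices

  wordOf : Vx → Word
  wordOf (sp β _) = β
  wordOf (pd β _) = β

  ∈-verticesOf : ∀ {β v} → v ∈ verticesOf β → wordOf v ≡ β
  ∈-verticesOf {β} v∈ = [ (λ p → case MemP.∈-map⁻ (sp β) p of λ { (_ , _ , refl) → refl }) ,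
                           (λ p → case MemP.∈-map⁻ (pd β) p of λ { (_ , _ , refl) → refl }) ]′ (MemP.∈-++⁻ (map (sp β) (allFin (len β))) v∈)

  complete : ∀ v → v ∈ vertices
  complete (sp β i) = ∈-concatMap verticesOf (MemP.∈-allFin β) (MemP.∈-++⁺ˡ (MemP.∈-map⁺ (sp β) (MemP.∈-allFin i)))
  complete (pd β p) = ∈-concatMap verticesOf (MemP.∈-allFin β) (MemP.∈-++⁺ʳ (map (sp β) (allFin (len β))) (MemP.∈-map⁺ (pd β) (MemP.∈-allFin p)))

  vertices-unique : Unique vertices
  vertices-unique = concatMap-unique verticesOf (UniqueP.allFin⁺ (2 ^ L))
    (λ {β} _ → UniqueP.++⁺ (UniqueP.map⁺ (λ { refl → refl }) (UniqueP.allFin⁺ (len β))) (UniqueP.map⁺ (λ { refl → refl }) (UniqueP.allFin⁺ (suc L)))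
      (λ (p , q) → case MemP.∈-map⁻ (sp β) p of λ { (_ , _ , refl) → case MemP.∈-map⁻ (pd β) q of λ { (_ , _ , ()) } }))
    (λ _ _ p q → trans (sym (∈-verticesOf p)) (∈-verticesOf q))

  size-vertices : m ≡ 2 ^ L * (7 + L * 3) + R
  size-vertices = begin
    length vertices                                     ≡⟨ sumL-one vertices ⟨
    sumL (λ _ → 1) vertices                             ≡⟨ sumL-concatMap (λ _ → 1) verticesOf (allFin (2 ^ L)) ⟩
    sumL (λ β → sumL (λ _ → 1) (verticesOf β)) (allFin (2 ^ L)) ≡⟨ sumL-cong (allFin (2 ^ L)) (λ {β} _ → one β) ⟩
    sumL (λ β → (7 + L * 3) + extra β) (allFin (2 ^ L)) ≡⟨ sumL-+ (λ _ → 7 + L * 3) extra (allFin (2 ^ L)) ⟩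
    sumL (λ _ → 7 + L * 3) (allFin (2 ^ L)) + sumL extra (allFin (2 ^ L))
      ≡⟨ cong₂ _+_ (trans (sumL-const (7 + L * 3) (allFin (2 ^ L))) (cong (_* (7 + L * 3)) (ListP.length-tabulate {n = 2 ^ L} id))) (zero-sum (2 ^ L) R (m^n>0 2 L)) ⟩
    2 ^ L * (7 + L * 3) + R                             ∎
    where
    open ≡-Reasoning
    open +-*-Solver
    one : ∀ β → sumL (λ _ → 1) (verticesOf β) ≡ (7 + L * 3) + extra β
    one β = trans (sumL-one (verticesOf β)) (trans (ListP.length-++ (map (sp β) (allFin (len β))))
      (trans (cong₂ _+_ (trans (ListP.length-map (sp β) (allFin (len β))) (ListP.length-tabulate {n = len β} id))
                        (trans (ListP.length-map (pd β) (allFin (suc L))) (ListP.length-tabulate {n = suc L} id)))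
      (trans (cong (λ t → 3 + t + suc L) (tail-val β))
        (solve 2 (λ l x → con 3 :+ (con 3 :+ (l :* con 2 :+ x)) :+ (con 1 :+ l) := con 7 :+ l :* con 3 :+ x) refl L (extra β)))))

  to : Fin m → Vx
  to = lookup vertices

  from : Vx → Fin m
  from v = Any.index (complete v)

  to-from : ∀ v → to (from v) ≡ v
  to-from v = sym (AnyP.lookup-index (complete v))

  from-to : ∀ i → from (to i) ≡ i
  from-to i = lookup-injective vertices-unique _ _ (to-from (to i))

  to-inj : ∀ {i k} → to i ≡ to k → i ≡ k
  to-inj = lookup-injective vertices-unique _ _

  from-inj : ∀ {u w} → from u ≡ from w → u ≡ w
  from-inj {u} {w} eq = trans (sym (to-from u)) (trans (cong to eq) (to-from w))

  par : Fin m → Maybe (Fin m)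
  par i = Data.Maybe.Base.map from (parent (to i))

  par⇒parent : ∀ {i k} → par i ≡ just k → parent (to i) ≡ just (to k)
  par⇒parent {i} {k} eq with parent (to i)
  par⇒parent {i} {.(from v)} refl | just v = cong just (sym (to-from v))

  parent⇒par : ∀ {i k} → parent (to i) ≡ just (to k) → par i ≡ just k
  parent⇒par {i} {k} eq rewrite eq = cong just (from-to k)

  parent⇒par′ : ∀ {u w} → parent u ≡ just w → par (from u) ≡ just (from w)
  parent⇒par′ {u} {w} eq = parent⇒par (trans (cong parent (to-from u)) (trans eq (cong just (sym (to-from w)))))

  height : Vx → ℕ
  height (sp β i) = toℕ i
  height (pd β p) = len β

  parent-lower : ∀ {u w} → parent u ≡ just w → height w < height u
  parent-lower {sp β (suc i)} refl = s≤s (≤-reflexive (FinP.toℕ-inject₁ i))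
  parent-lower {pd β p}       refl = FinP.toℕ<n (attF β p)

  open Parents par using (Ends; ends?; edgesAt; deg; Adj′; NonRoot; nonRoot?)

  adj-to : ∀ {i k} → Adj′ i k → adj (to i) (to k)
  adj-to (inj₁ e) = inj₁ (par⇒parent e)
  adj-to (inj₂ e) = inj₂ (par⇒parent e)

  adj-from : ∀ {u w} → adj u w → Adj′ (from u) (from w)
  adj-from (inj₁ e) = inj₁ (parent⇒par′ e)
  adj-from (inj₂ e) = inj₂ (parent⇒par′ e)

  rigid : (π π′ : Fin m → Fin m) → (∀ v → π′ (π v) ≡ v) → (∀ v → π (π′ v) ≡ v) →
    (∀ {u w} → Adj′ u w → Adj′ (π u) (π w)) → (∀ {u w} → Adj′ u w → Adj′ (π′ u) (π′ w)) → ∀ v → π v ≡ v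
  rigid π π′ π′π ππ′ a a′ v = to-inj (trans (cong (to ∘ π) (sym (from-to v)))
    (Rigid.π-id (to ∘ π ∘ from) (to ∘ π′ ∘ from)
      (λ u → trans (cong (to ∘ π′) (from-to _)) (trans (cong to (π′π _)) (to-from u)))
      (λ u → trans (cong (to ∘ π) (from-to _)) (trans (cong to (ππ′ _)) (to-from u)))
      (λ e → adj-to (a (adj-from e))) (λ e → adj-to (a′ (adj-from e))) (to v)))

  ∈-edgesAt : ∀ {v e} → Ends v e → e ∈ edgesAt v
  ∈-edgesAt {v} {e} h = MemP.∈-filter⁺ (ends? v) (MemP.∈-allFin e) h

  edgesAt-unique : ∀ v → Unique (edgesAt v)
  edgesAt-unique v = UniqueP.filter⁺ (ends? v) (UniqueP.allFin⁺ m)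

  edge-cases : ∀ {v e} → e ∈ edgesAt v → e ≡ v ⊎ parent (to e) ≡ just (to v)
  edge-cases {v} {e} e∈ with proj₂ (MemP.∈-filter⁻ (ends? v) {xs = allFin m} e∈)
  ... | p , eq , inj₁ refl = inj₁ refl
  ... | p , eq , inj₂ refl = inj₂ (par⇒parent eq)

  edge-up : ∀ {v w} → parent (to v) ≡ just w → v ∈ edgesAt v
  edge-up {v} {w} eq = ∈-edgesAt (from w , parent⇒par (trans eq (cong just (sym (to-from w)))) , inj₁ refl)

  edge-down : ∀ {v w} → parent w ≡ just (to v) → from w ∈ edgesAt v
  edge-down {v} {w} eq = ∈-edgesAt (v , trans (parent⇒par′ eq) (cong just (from-to v)) , inj₂ refl)

  nonempty : ∀ {e} {es : List (Fin m)} → e ∈ es → 1 ≤ length es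
  nonempty (here _)  = s≤s z≤n
  nonempty (there _) = s≤s z≤n

  some-edge : ∀ v u → to v ≡ u → 1 ≤ deg v
  some-edge v (sp β zero)    eq = nonempty (edge-down {v} {sp β (suc zero)} (cong just (sym eq)))
  some-edge v (sp β (suc i)) eq = nonempty (edge-up {v} (cong parent eq))
  some-edge v (pd β p)       eq = nonempty (edge-up {v} (cong parent eq))

  following : ∀ β → Fin (len β) → Fin m
  following β i with suc (toℕ i) <? len β
  ... | yes i< = from (sp β (at β (suc (toℕ i)) i<))
  ... | no  _  = from (sp β i)

  following-is : ∀ {β i k} → toℕ k ≡ suc (toℕ i) → following β i ≡ from (sp β k)
  following-is {β} {i} {k} eq with suc (toℕ i) <? len β
  ... | yes i< = cong from (sp-≡ (trans (toℕ-at i<) (sym eq)))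
  ... | no ≮   = ⊥-elim (≮ (≤-trans (≤-reflexive (cong suc (sym eq))) (FinP.toℕ<n k)))

  hanging : ∀ β → Fin (len β) → Fin m
  hanging β i with FinP.any? (λ p → att β p ≟ toℕ i)
  ... | yes (p , _) = from (pd β p)
  ... | no  _       = from (sp β i)

  hanging-is : ∀ {β i p} → att β p ≡ toℕ i → hanging β i ≡ from (pd β p)
  hanging-is {β} {i} {p} eq with FinP.any? (λ p → att β p ≟ toℕ i)
  ... | yes (q , eq′) = cong (from ∘ pd β) (proj₁ (att-inj β β q p (trans eq′ (sym eq))))
  ... | no none       = ⊥-elim (none (p , eq))

  few-edges : ∀ v u → to v ≡ u → deg v ≤ 3
  few-edges v (pd β p) eq = length-⊆ {ys = v ∷ v ∷ v ∷ []} (edgesAt-unique v) λ {e} e∈ → case edge-cases {v} e∈ of λ where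
      (inj₁ e≡) → here e≡
      (inj₂ e≡) → ⊥-elim (no-child (to e) (trans e≡ (cong just eq)))
    where
    no-child : ∀ w → parent w ≢ just (pd β p)
    no-child (sp _ (suc _)) ()
    no-child (pd _ _) ()
  few-edges v (sp β i) eq = length-⊆ {ys = v ∷ following β i ∷ hanging β i ∷ []} (edgesAt-unique v) λ {e} e∈ → case edge-cases {v} e∈ of λ where
      (inj₁ e≡) → here e≡
      (inj₂ e≡) → child e (to e) refl (trans e≡ (cong just eq))
    where
    child : ∀ e w → to e ≡ w → parent w ≡ just (sp β i) → e ∈ v ∷ following β i ∷ hanging β i ∷ []
    child e w e≡ p≡ = go (nb-down w p≡) e≡
      where
      e-from : ∀ {w} → to e ≡ w → e ≡ from w
      e-from eq = trans (sym (from-to e)) (cong from eq)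
      go : ∀ {w} → Nb β (toℕ i) w → to e ≡ w → e ∈ v ∷ following β i ∷ hanging β i ∷ []
      go (prev {k} f) r = ⊥-elim (<⇒≱ (parent-lower (subst (λ x → parent x ≡ just (sp β i)) (trans (sym e≡) r) p≡)) (≤-trans (n≤1+n _) (≤-reflexive f)))
      go (next {k} f) r = there (here (trans (e-from r) (sym (following-is f))))
      go (pend {p} f) r = there (there (here (trans (e-from r) (sym (hanging-is f)))))

  β₀ : Word
  β₀ = fromℕ< (m^n>0 2 L)

  len-β₀ : len β₀ ≡ 6 + L * 2 + R
  len-β₀ = trans (cong (3 +_) (tail-val β₀)) (cong (λ x → 6 + (L * 2 + (if does (x ≟ 0) then R else 0))) (FinP.toℕ-fromℕ< (m^n>0 2 L)))

  -- Beyond every pendant, as these sit at positions up to 2 + 2 L. Since Y < R the path also ends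
  -- before the last vertex of the spine, so that all its vertices have degree two.
  path-at : ℕ → ℕ
  path-at x = 6 + L * 2 + x

  path< : ∀ {x} → x < R → path-at x < len β₀
  path< x< = ≤-trans (+-monoʳ-< (6 + L * 2) x<) (≤-reflexive (sym len-β₀))

  y-pos : Fin Y → Fin (len β₀)
  y-pos i = at β₀ (path-at (toℕ i)) (path< (<-trans (FinP.toℕ<n i) Y<R))

  y-val : ∀ i → toℕ (y-pos i) ≡ path-at (toℕ i)
  y-val i = toℕ-at (path< (<-trans (FinP.toℕ<n i) Y<R))

  y : Fin Y → Fin m
  y i = from (sp β₀ (y-pos i))

  y-inj : ∀ {i k} → y i ≡ y k → i ≡ k
  y-inj {i} {k} eq = FinP.toℕ-injective (+-cancelˡ-≡ (6 + L * 2) _ _ (trans (sym (y-val i)) (trans (sp-toℕ (from-inj eq)) (y-val k))))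

  parent-next : ∀ {β} {i k : Fin (len β)} → toℕ k ≡ suc (toℕ i) → parent (sp β k) ≡ just (sp β i)
  parent-next {β} {i} {suc k} eq = cong just (sp-≡ (trans (FinP.toℕ-inject₁ k) (suc-injective eq)))

  y-par : ∀ i k → toℕ k ≡ suc (toℕ i) → par (y k) ≡ just (y i)
  y-par i k eq = parent⇒par′ (parent-next (trans (y-val k) (trans (cong path-at eq) (trans (+-suc (6 + L * 2) (toℕ i)) (cong suc (sym (y-val i)))))))

  y-has-parent : ∀ i → ∃ λ w → parent (sp β₀ (y-pos i)) ≡ just w
  y-has-parent i = go (y-pos i) (≤-trans (s≤s z≤n) (≤-reflexive (sym (y-val i))))
    where
    go : ∀ (k : Fin (len β₀)) → 1 ≤ toℕ k → ∃ λ w → parent (sp β₀ k) ≡ just w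
    go (suc k) _ = _ , refl

  y-root : ∀ i → NonRoot (y i)
  y-root i = let (w , eq) = y-has-parent i in from w , parent⇒par′ eq

  y-deg : ∀ i → deg (y i) ≡ 2
  y-deg i = ≤-antisym
      (length-⊆ {ys = y i ∷ n ∷ []} (edgesAt-unique (y i)) λ {e} e∈ → case edge-cases {y i} e∈ of λ where
        (inj₁ e≡) → here e≡
        (inj₂ e≡) → there (here (child e (trans e≡ (cong just (to-from _))))))
      (length-⊆ {xs = y i ∷ n ∷ []} ((y≢n ∷ []) ∷ [] ∷ []) λ where
        (here refl) → edge-up {y i} (trans (cong parent (to-from _)) (proj₂ (y-has-parent i)))
        (there (here refl)) → edge-down {y i} (trans (parent-next n-val) (cong just (sym (to-from _)))))
    where
    n< : suc (path-at (toℕ i)) < len β₀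
    n< = ≤-trans (s≤s (≤-reflexive (sym (+-suc (6 + L * 2) (toℕ i))))) (path< (<-≤-trans (s≤s (FinP.toℕ<n i)) Y<R))
    n-pos : Fin (len β₀)
    n-pos = at β₀ _ n<
    n-val : toℕ n-pos ≡ suc (toℕ (y-pos i))
    n-val = trans (toℕ-at n<) (cong suc (sym (y-val i)))
    n : Fin m
    n = from (sp β₀ n-pos)
    y≢n : y i ≢ n
    y≢n eq = <⇒≢ (≤-reflexive (sym n-val)) (sp-toℕ (from-inj eq))
    child : ∀ e → parent (to e) ≡ just (sp β₀ (y-pos i)) → e ≡ n
    child e p≡ = go (nb-down (to e) p≡) refl
      where
      go : ∀ {w} → Nb β₀ (toℕ (y-pos i)) w → to e ≡ w → e ≡ n
      go (prev {k} f) r = ⊥-elim (<⇒≱ (parent-lower (subst (λ x → parent x ≡ just (sp β₀ (y-pos i))) r p≡)) (≤-trans (n≤1+n _) (≤-reflexive f)))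
      go (next {k} f) r = trans (sym (from-to e)) (cong from (trans r (sp-≡ (trans f (sym n-val)))))
      go (pend {p} f) r = ⊥-elim (<⇒≱ (s≤s (att≤ β₀ p)) (≤-trans (≤-trans (+-monoˡ-≤ (L * 2) (m≤m+n 3 3)) (m≤m+n _ (toℕ i))) (≤-reflexive (trans (sym (y-val i)) (sym f)))))

  forest : Forest m Y
  forest = record
    { par = par ; irrefl = λ {v} e → <⇒≢ (parent-lower (par⇒parent {v} e)) refl
    ; no-2-cyc = λ {u} {w} e e′ → <⇒≱ (parent-lower (par⇒parent {u} e)) (<⇒≤ (parent-lower (par⇒parent {w} e′)))
    ; deg≥1 = λ v → some-edge v (to v) refl ; deg≤3 = λ v → few-edges v (to v) refl ; rigid = rigid
    ; y = y ; y-inj = y-inj ; y-deg = y-deg ; y-root = y-root ; y-par = y-par }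

  nonroots-bound : length (filter nonRoot? (allFin m)) + 2 ^ L ≤ m
  nonroots-bound = begin
    length nr + 2 ^ L                       ≡⟨ cong (length nr +_) (trans (ListP.length-map rootOf (allFin (2 ^ L))) (ListP.length-tabulate {n = 2 ^ L} id)) ⟨
    length nr + length (map rootOf (allFin (2 ^ L))) ≡⟨ ListP.length-++ nr ⟨
    length (nr ++ map rootOf (allFin (2 ^ L))) ≤⟨ length-⊆ (UniqueP.++⁺ (UniqueP.filter⁺ nonRoot? (UniqueP.allFin⁺ m))
        (UniqueP.map⁺ (λ eq → case from-inj eq of λ { refl → refl }) (UniqueP.allFin⁺ (2 ^ L))) disjoint) (λ {z} _ → MemP.∈-allFin z) ⟩
    length (allFin m)                       ≡⟨ ListP.length-tabulate {n = m} id ⟩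
    m                                       ∎
    where
    open ≤-Reasoning
    nr : List (Fin m)
    nr = filter nonRoot? (allFin m)
    rootOf : Word → Fin m
    rootOf β = from (sp β zero)
    disjoint : ∀ {e} → ¬ (e ∈ nr × e ∈ map rootOf (allFin (2 ^ L)))
    disjoint (p , q) with MemP.∈-map⁻ rootOf q
    ... | β , _ , refl with proj₂ (MemP.∈-filter⁻ nonRoot? {xs = allFin m} p)
    ...   | k , eq = case trans (sym (cong parent (to-from (sp β zero)))) (par⇒parent eq) of λ ()

-- Logarithms and powers of two

log-upper : ∀ n → n < 2 ^ suc ⌊log₂ n ⌋
log-upper n = ≰⇒> λ le → <⇒≱ (n<1+n ⌊log₂ n ⌋)
  (≤-trans (≤-reflexive (sym (⌊log₂[2^n]⌋≡n (suc ⌊log₂ n ⌋)))) (⌊log₂⌋-mono-≤ le))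

log-lower : ∀ n → 1 ≤ n → 2 ^ ⌊log₂ n ⌋ ≤ n
log-lower n 1≤n = go n n ≤-refl 1≤n
  where
  open ≤-Reasoning
  go : ∀ b n → n ≤ b → 1 ≤ n → 2 ^ ⌊log₂ n ⌋ ≤ n
  go (suc b) (suc zero)    n≤ _ = ≤-refl
  go (suc b) n@(suc (suc n′)) n≤ _ = begin
    2 ^ ⌊log₂ n ⌋                ≡⟨ cong (2 ^_) (m+[n∸m]≡n 1≤log) ⟨
    2 * 2 ^ (⌊log₂ n ⌋ ∸ 1)      ≡⟨ cong (λ x → 2 * 2 ^ x) (⌊log₂⌊n/2⌋⌋≡⌊log₂n⌋∸1 n) ⟨
    2 * 2 ^ ⌊log₂ ⌊ n /2⌋ ⌋      ≤⟨ *-monoʳ-≤ 2 (go b ⌊ n /2⌋ (≤-trans (s≤s (⌊n/2⌋≤n n′)) (≤-pred n≤)) (s≤s z≤n)) ⟩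
    2 * ⌊ n /2⌋                  ≡⟨ cong (⌊ n /2⌋ +_) (+-identityʳ ⌊ n /2⌋) ⟩
    ⌊ n /2⌋ + ⌊ n /2⌋            ≤⟨ +-monoʳ-≤ ⌊ n /2⌋ (⌊n/2⌋≤⌈n/2⌉ n) ⟩
    ⌊ n /2⌋ + ⌈ n /2⌉            ≡⟨ ⌊n/2⌋+⌈n/2⌉≡n n ⟩
    n                            ∎
    where
    1≤log : 1 ≤ ⌊log₂ n ⌋
    1≤log = ⌊log₂⌋-mono-≤ {2} {n} (s≤s (s≤s z≤n))

n<2^n : ∀ n → n < 2 ^ n
n<2^n zero    = s≤s z≤n
n<2^n (suc n) = ≤-trans (+-mono-≤ (m^n>0 2 n) (n<2^n n)) (≤-reflexive (cong (2 ^ n +_) (sym (+-identityʳ (2 ^ n)))))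

double≤2^ : ∀ t → t + t ≤ 2 ^ t
double≤2^ zero             = z≤n
double≤2^ (suc zero)       = ≤-refl
double≤2^ (suc t@(suc _)) = begin
    suc t + suc t      ≡⟨ cong suc (+-suc t t) ⟩
    2 + (t + t)        ≤⟨ +-mono-≤ (^-monoʳ-≤ 2 {1} {t} (s≤s z≤n)) (double≤2^ t) ⟩
    2 ^ t + 2 ^ t      ≡⟨ cong (2 ^ t +_) (+-identityʳ (2 ^ t)) ⟨
    2 ^ suc t          ∎
  where open ≤-Reasoning

-- For t = l - a the assumption gives a ≤ t, hence l ≤ 2 t ≤ 2 ^ t.
*2^-bound : ∀ l a → a + a ≤ l → l * 2 ^ a ≤ 2 ^ l
*2^-bound l a 2a≤ = begin
    l * 2 ^ a              ≤⟨ *-monoˡ-≤ (2 ^ a) (≤-trans l≤ (double≤2^ t)) ⟩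
    2 ^ t * 2 ^ a          ≡⟨ ^-distribˡ-+-* 2 t a ⟨
    2 ^ (t + a)            ≡⟨ cong (2 ^_) (m∸n+n≡m a≤l) ⟩
    2 ^ l                  ∎
  where
  open ≤-Reasoning
  a≤l : a ≤ l
  a≤l = ≤-trans (m≤m+n a a) 2a≤
  t = l ∸ a
  l≤ : l ≤ t + t
  l≤ = ≤-trans (≤-reflexive (sym (m∸n+n≡m a≤l))) (+-monoʳ-≤ t (≤-trans (≤-reflexive (sym (m+n∸n≡m a a))) (∸-monoˡ-≤ a 2a≤)))

-- The constant 16 is the least possible: equality holds at x = 3.
8*≤2^ : ∀ x → 8 * x ≤ 2 ^ x + 16
8*≤2^ 0 = z≤n
8*≤2^ 1 = m≤m+n 8 10
8*≤2^ 2 = m≤m+n 16 4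
8*≤2^ 3 = ≤-refl
8*≤2^ (suc x@(suc (suc (suc y)))) = begin
    8 * suc x             ≡⟨ *-suc 8 x ⟩
    8 + 8 * x             ≤⟨ +-mono-≤ (^-monoʳ-≤ 2 {3} {x} (s≤s (s≤s (s≤s z≤n)))) (8*≤2^ x) ⟩
    2 ^ x + (2 ^ x + 16)  ≡⟨ trans (sym (+-assoc (2 ^ x) _ 16)) (cong (λ z → 2 ^ x + z + 16) (sym (+-identityʳ (2 ^ x)))) ⟩
    2 ^ suc x + 16        ∎
  where open ≤-Reasoning

2^≤⇒1≤ : ∀ a {m} → 2 ^ a ≤ m → 1 ≤ m
2^≤⇒1≤ a = ≤-trans (m^n>0 2 a)

2^≤⇒≤log : ∀ a {m} → 2 ^ a ≤ m → a ≤ ⌊log₂ m ⌋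
2^≤⇒≤log a le = ≤-trans (≤-reflexive (sym (⌊log₂[2^n]⌋≡n a))) (⌊log₂⌋-mono-≤ le)

-- Rational arithmetic and the threshold

-- N is 0 by default if nothing in the range satisfies P; this is why P N is claimed only in the
-- presence of a witness.
largest : {P : ℕ → Set} → (∀ n → Dec (P n)) → ∀ b →
  ∃ λ N → (∀ n → 1 ≤ n → n ≤ b → P n → n ≤ N) × (∀ n → 1 ≤ n → n ≤ b → P n → P N)
largest P? zero = 0 , (λ _ _ n≤ _ → n≤) , λ _ 1≤n n≤ _ → contradiction (≤-trans 1≤n n≤) λ ()
largest P? (suc b) with P? (suc b) | largest P? b
... | yes p | _ = suc b , (λ _ _ n≤ _ → n≤) , λ _ _ _ _ → p
... | no ¬p | N , up , holds = N , (λ n 1≤n n≤ p → up n 1≤n (below n n≤ p) p) , λ n 1≤n n≤ p → holds n 1≤n (below n n≤ p) p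
  where
  below : ∀ n → n ≤ suc b → _ → n ≤ b
  below n n≤ p = ≤-pred (≤∧≢⇒< n≤ λ { refl → ¬p p })

toℚ≃ : ∀ n → ℚ.toℚᵘ (toℚ n) ℚᵘ.≃ ℚᵘ.mkℚᵘ (ℤ.+ n) 0
toℚ≃ n = ℚP.toℚᵘ-fromℚᵘ (ℚᵘ.mkℚᵘ (ℤ.+ n) 0)

toℚ-+ : ∀ a b → toℚ (a + b) ≡ toℚ a ℚ.+ toℚ b
toℚ-+ a b = ℚP.toℚᵘ-injective (ℚᵘP.≃-trans (toℚ≃ (a + b)) (ℚᵘP.≃-sym
  (ℚᵘP.≃-trans (ℚP.toℚᵘ-homo-+ (toℚ a) (toℚ b)) (ℚᵘP.≃-trans (ℚᵘP.+-cong (toℚ≃ a) (toℚ≃ b))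
    (ℚᵘ.*≡* (cong (ℤ._* ℤ.1ℤ) (trans (cong₂ ℤ._+_ (ℤP.*-identityʳ (ℤ.+ a)) (ℤP.*-identityʳ (ℤ.+ b))) (sym (ℤP.pos-+ a b)))))))))

toℚ-* : ∀ a b → toℚ (a * b) ≡ toℚ a ℚ.* toℚ b
toℚ-* a b = ℚP.toℚᵘ-injective (ℚᵘP.≃-trans (toℚ≃ (a * b)) (ℚᵘP.≃-sym
  (ℚᵘP.≃-trans (ℚP.toℚᵘ-homo-* (toℚ a) (toℚ b)) (ℚᵘP.≃-trans (ℚᵘP.*-cong (toℚ≃ a) (toℚ≃ b))
    (ℚᵘ.*≡* (cong (ℤ._* ℤ.1ℤ) (sym (ℤP.pos-* a b))))))))

toℚ-*-/ : ∀ d x .{{_ : NonZero d}} → toℚ d ℚ.* ((ℤ.+ x) ℚ./ d) ≡ toℚ x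
toℚ-*-/ d@(suc d′) x = ℚP.toℚᵘ-injective (ℚᵘP.≃-trans (ℚP.toℚᵘ-homo-* (toℚ d) _)
  (ℚᵘP.≃-trans (ℚᵘP.*-cong (toℚ≃ d) (ℚP.toℚᵘ-fromℚᵘ (ℚᵘ.mkℚᵘ (ℤ.+ x) d′))) (ℚᵘP.≃-trans
    (ℚᵘ.*≡* (trans (ℤP.*-identityʳ _) (trans (ℤP.*-comm (ℤ.+ d) (ℤ.+ x)) (cong ((ℤ.+ x) ℤ.*_) (cong (λ z → ℤ.+ suc z) (sym (+-identityʳ d′)))))))
    (ℚᵘP.≃-sym (toℚ≃ x)))))

toℚ-mono-≤ : ∀ {a b} → a ≤ b → toℚ a ℚ.≤ toℚ b
toℚ-mono-≤ {a} {b} a≤b = ℚP.toℚᵘ-cancel-≤ (ℚᵘP.≤-respˡ-≃ (ℚᵘP.≃-sym (toℚ≃ a)) (ℚᵘP.≤-respʳ-≃ (ℚᵘP.≃-sym (toℚ≃ b))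
  (ℚᵘ.*≤* (ℤP.*-monoʳ-≤-nonNeg ℤ.1ℤ (ℤ.+≤+ a≤b)))))

toℚ-cancel-≤ : ∀ {a b} → toℚ a ℚ.≤ toℚ b → a ≤ b
toℚ-cancel-≤ {a} {b} le with a ≤? b
... | yes a≤b = a≤b
... | no a≰b = case ℚᵘP.≤-respˡ-≃ (toℚ≃ a) (ℚᵘP.≤-respʳ-≃ (toℚ≃ b) (ℚP.toℚᵘ-mono-≤ le)) of λ where
  (ℚᵘ.*≤* le′) → ℤP.drop‿+≤+ (ℤP.*-cancelʳ-≤-pos (ℤ.+ a) (ℤ.+ b) ℤ.1ℤ le′)

toℚ-*-cancel-≤ : ∀ d .{{_ : NonZero d}} {x y} → toℚ d ℚ.* x ℚ.≤ toℚ d ℚ.* y → x ℚ.≤ y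
toℚ-*-cancel-≤ d = ℚP.*-cancelˡ-≤-pos (toℚ d) {{ℚP.normalize-pos d 1}}

/-pos : ∀ x d .{{_ : NonZero x}} .{{_ : NonZero d}} → ℚ.0ℚ ℚ.< (ℤ.+ x) ℚ./ d
/-pos x d = ℚP.positive⁻¹ _ {{ℚP.normalize-pos x d}}

ℚ-+-cancelʳ-≤ : ∀ z {x y} → x ℚ.+ z ℚ.≤ y ℚ.+ z → x ℚ.≤ y
ℚ-+-cancelʳ-≤ z {x} {y} le = subst₂ ℚ._≤_ (cancel x) (cancel y) (ℚP.+-monoˡ-≤ (ℚ.- z) le)
  where
  open ℚSolver.+-*-Solver
  cancel : ∀ w → w ℚ.+ z ℚ.- z ≡ w
  cancel w = solve 2 (λ w z → w :+ z :- z := w) refl w z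

module Excess (m₂ X : ℕ) .{{_ : NonZero m₂}} where

  r : ℚ
  r = ℚ.1ℚ ℚ.+ (ℤ.+ X) ℚ./ m₂

  -- This becomes ε: r m + ε equals the threshold N exactly, so the rational condition on n₂ reduces
  -- to n₂ ≤ N.
  excess : ℕ → ℕ → ℚ
  excess N m = toℚ N ℚ.- r ℚ.* toℚ m

  r*+excess : ∀ N m → r ℚ.* toℚ m ℚ.+ excess N m ≡ toℚ N
  r*+excess N m = solve 2 (λ n rm → rm :+ (n :- rm) := n) refl (toℚ N) (r ℚ.* toℚ m)
    where open ℚSolver.+-*-Solver

  m₂*r : toℚ m₂ ℚ.* r ≡ toℚ (m₂ + X)
  m₂*r = trans (ℚP.*-distribˡ-+ (toℚ m₂) ℚ.1ℚ _) (trans (cong₂ ℚ._+_ (ℚP.*-identityʳ (toℚ m₂)) (toℚ-*-/ m₂ X)) (sym (toℚ-+ m₂ X)))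

  module _ (N m ℓ : ℕ) where

    scaled : toℚ m₂ ℚ.* (excess N m ℚ.* toℚ ℓ) ℚ.+ toℚ (ℓ * (m * (m₂ + X))) ≡ toℚ (ℓ * (m₂ * N))
    scaled = begin
      M ℚ.* (excess N m ℚ.* l) ℚ.+ toℚ (ℓ * (m * (m₂ + X)))
        ≡⟨ cong (M ℚ.* (excess N m ℚ.* l) ℚ.+_) (trans (toℚ-* ℓ _) (cong (l ℚ.*_) (trans (toℚ-* m _) (cong (toℚ m ℚ.*_) (sym m₂*r))))) ⟩
      M ℚ.* (excess N m ℚ.* l) ℚ.+ l ℚ.* (toℚ m ℚ.* (M ℚ.* r))
        ≡⟨ solve 5 (λ M n r m l → M :* ((n :- r :* m) :* l) :+ l :* (m :* (M :* r)) := l :* (M :* n)) refl M (toℚ N) r (toℚ m) l ⟩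
      l ℚ.* (M ℚ.* toℚ N) ≡⟨ trans (toℚ-* ℓ _) (cong (l ℚ.*_) (toℚ-* m₂ N)) ⟨
      toℚ (ℓ * (m₂ * N)) ∎
      where
      open ≡-Reasoning
      open ℚSolver.+-*-Solver
      M = toℚ m₂
      l = toℚ ℓ

    excess-upper : ∀ c → ℓ * (m₂ * N) ≤ ℓ * (m * (m₂ + X)) + c * m → excess N m ℚ.* toℚ ℓ ℚ.≤ (ℤ.+ c) ℚ./ m₂ ℚ.* toℚ m
    excess-upper c le = toℚ-*-cancel-≤ m₂ (ℚ-+-cancelʳ-≤ (toℚ (ℓ * (m * (m₂ + X)))) (begin
      toℚ m₂ ℚ.* (excess N m ℚ.* toℚ ℓ) ℚ.+ toℚ B  ≡⟨ scaled ⟩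
      toℚ (ℓ * (m₂ * N))                           ≤⟨ toℚ-mono-≤ (≤-trans le (≤-reflexive (+-comm B (c * m)))) ⟩
      toℚ (c * m + B)                              ≡⟨ trans (toℚ-+ (c * m) B) (cong (ℚ._+ toℚ B) (trans (toℚ-* c m)
                                                       (trans (cong (ℚ._* toℚ m) (sym (toℚ-*-/ m₂ c))) (ℚP.*-assoc (toℚ m₂) _ _)))) ⟩
      toℚ m₂ ℚ.* ((ℤ.+ c) ℚ./ m₂ ℚ.* toℚ m) ℚ.+ toℚ B ∎))
      where
      open ℚP.≤-Reasoning
      B = ℓ * (m * (m₂ + X))

    excess-lower : ∀ t .{{_ : NonZero (t * m₂)}} → m + t * (ℓ * (m * (m₂ + X))) ≤ t * (ℓ * (m₂ * N)) →
      (ℤ.+ 1) ℚ./ (t * m₂) ℚ.* toℚ m ℚ.≤ excess N m ℚ.* toℚ ℓ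
    excess-lower t le = toℚ-*-cancel-≤ (t * m₂) (ℚ-+-cancelʳ-≤ (toℚ (t * B)) (begin
      toℚ (t * m₂) ℚ.* ((ℤ.+ 1) ℚ./ (t * m₂) ℚ.* toℚ m) ℚ.+ toℚ (t * B)
        ≡⟨ cong (ℚ._+ toℚ (t * B)) (trans (sym (ℚP.*-assoc (toℚ (t * m₂)) _ _)) (trans (cong (ℚ._* toℚ m) (toℚ-*-/ (t * m₂) 1)) (ℚP.*-identityˡ (toℚ m)))) ⟩
      toℚ m ℚ.+ toℚ (t * B)        ≡⟨ toℚ-+ m (t * B) ⟨
      toℚ (m + t * B)              ≤⟨ toℚ-mono-≤ le ⟩
      toℚ (t * A)                  ≡⟨ trans (toℚ-* t A) (cong (toℚ t ℚ.*_) (sym scaled)) ⟩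
      toℚ t ℚ.* (toℚ m₂ ℚ.* (excess N m ℚ.* toℚ ℓ) ℚ.+ toℚ B)
        ≡⟨ trans (ℚP.*-distribˡ-+ (toℚ t) _ (toℚ B)) (cong₂ ℚ._+_ (trans (sym (ℚP.*-assoc (toℚ t) (toℚ m₂) _)) (cong (ℚ._* _) (sym (toℚ-* t m₂)))) (sym (toℚ-* t B))) ⟩
      toℚ (t * m₂) ℚ.* (excess N m ℚ.* toℚ ℓ) ℚ.+ toℚ (t * B) ∎))
      where
      open ℚP.≤-Reasoning
      A = ℓ * (m₂ * N)
      B = ℓ * (m * (m₂ + X))

-- The bounds for fixed parameters and the threshold N

module Bounds (n₁ m₂ j k : ℕ) (3≤n₁ : 3 ≤ n₁) (n₁≡ : n₁ ≡ 2 + sumTo j (λ i → m₂ C i) + k)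
              (j< : j < halfBound m₂) (k< : k < m₂ C suc j) (1≤k : 1 ≤ k) where

  open ≤-Reasoning

  twice-j : suc j * 2 ≤ m₂ ∸ 1
  twice-j = ≤-trans (*-monoˡ-≤ 2 j<) (m/n*n≤m (m₂ ∸ 1) 2)

  1≤m₂ : 1 ≤ m₂
  1≤m₂ = ≤-trans (≤-trans (s≤s z≤n) twice-j) (m∸n≤m m₂ 1)

  2j<m₂ : suc j + suc j < m₂
  2j<m₂ = ≤-trans (s≤s (≤-trans (≤-reflexive (trans (cong (suc j +_) (sym (+-identityʳ (suc j)))) (*-comm 2 (suc j)))) twice-j))
    (≤-reflexive (m+[n∸m]≡n 1≤m₂))

  u : ℕ
  u = m₂ ∸ (suc j + suc j)

  1≤u : 1 ≤ u
  1≤u = m<n⇒0<n∸m 2j<m₂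

  m₂≡ : u + suc j + suc j ≡ m₂
  m₂≡ = trans (+-assoc u (suc j) (suc j)) (m∸n+n≡m (<⇒≤ 2j<m₂))

  -- r = 1 + X / m₂; the bounds hold once ⌊log₂ m₁⌋ ≥ ℓ₀.
  S₁ X D W Z c₀ p Y W₀ K₀ K₁ κ ℓ₀ Cᵤ cu : ℕ
  S₁ = sumTo j (λ i → (m₂ ∸ i) * (m₂ C i))
  X  = S₁ + (m₂ ∸ j ∸ 1) * k
  D  = m₂ + X
  W  = u + suc j
  Z  = S₁ + W * (k + 2)
  c₀ = sumL card (subsets m₂)
  p  = length (level m₂ (suc j))
  Y  = n₁ + m₂ + 6 + (length (levels m₂ j) + (k + 2) + p + (m₂ + 2 + p))
  W₀ = length (words (letters m₂) ((2 + n₁) * u))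
  K₀ = m₂ * (m₂ + 2 + p) + (W * p + Y * Z)
  K₁ = c₀ + K₀ + W₀
  κ  = n₁ * m₂ ^ m₂
  -- The three groups serve `room`, `K₁≤L`, and both `Y<R` and `top-large`.
  ℓ₀ = 84 + 2 * κ + (10 + 2 * K₁) + (Y + n₁)
  cu = suc (suc (length (letters m₂))) * (2 + n₁)
  Cᵤ = c₀ + u * suc (2 * cu)

  1≤Cᵤ : 1 ≤ Cᵤ
  1≤Cᵤ = ≤-trans (*-mono-≤ 1≤u (s≤s z≤n)) (m≤n+m (u * suc (2 * cu)) c₀)

  W≡ : m₂ ∸ j ∸ 1 ≡ W
  W≡ = trans (∸-+-assoc m₂ j 1) (trans (cong (m₂ ∸_) (+-comm j 1)) (trans (cong (_∸ suc j) (sym m₂≡)) (m+n∸n≡m W (suc j))))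

  Z≡ : Z ≡ D + u
  Z≡ = begin-equality
    S₁ + W * (k + 2)               ≡⟨ solve 4 (λ s u d k → s :+ (u :+ d) :* (k :+ con 2) := u :+ d :+ d :+ (s :+ (u :+ d) :* k) :+ u) refl S₁ u (suc j) k ⟩
    u + suc j + suc j + (S₁ + W * k) + u ≡⟨ cong₂ (λ a b → a + (S₁ + b * k) + u) m₂≡ (sym W≡) ⟩
    D + u                          ∎
    where
    open +-*-Solver

  -- A set with i ≤ j missing parts is worth its price W plus its surplus, together m₂ - i. Hence
  -- the upper bound allows each small part the value Z that the construction achieves.
  surplus-value : W * n₁ + sumL (λ A → card A ∸ W) (levels m₂ j) ≡ Z
  surplus-value = begin-equality
    W * n₁ + sumL (λ A → card A ∸ W) (levels m₂ j) ≡⟨ cong₂ (λ a b → W * a + b) n₁≡ (sumL-concatMap (λ A → card A ∸ W) (level m₂) (upTo (suc j))) ⟩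
    W * (2 + S + k) + sumL (λ i → sumL (λ A → card A ∸ W) (level m₂ i)) (upTo (suc j))
      ≡⟨ solve 4 (λ w s k t → w :* (con 2 :+ s :+ k) :+ t := w :* s :+ t :+ w :* (k :+ con 2)) refl W S k _ ⟩
    W * S + sumL (λ i → sumL (λ A → card A ∸ W) (level m₂ i)) (upTo (suc j)) + W * (k + 2)
      ≡⟨ cong (λ z → z + sumL (λ i → sumL (λ A → card A ∸ W) (level m₂ i)) (upTo (suc j)) + W * (k + 2)) (sym (sumL-* W (λ i → m₂ C i) (upTo (suc j)))) ⟩
    sumL (λ i → W * (m₂ C i)) (upTo (suc j)) + sumL (λ i → sumL (λ A → card A ∸ W) (level m₂ i)) (upTo (suc j)) + W * (k + 2)
      ≡⟨ cong (_+ W * (k + 2)) (sym (sumL-+ (λ i → W * (m₂ C i)) _ (upTo (suc j)))) ⟩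
    sumL (λ i → W * (m₂ C i) + sumL (λ A → card A ∸ W) (level m₂ i)) (upTo (suc j)) + W * (k + 2)
      ≡⟨ cong (_+ W * (k + 2)) (sumL-cong (upTo (suc j)) (λ i∈ → at-level _ (≤-pred (MemP.∈-upTo⁻ i∈)))) ⟩
    Z ∎
    where
    open +-*-Solver
    S = sumTo j (λ i → m₂ C i)
    at-level : ∀ i → i ≤ j → W * (m₂ C i) + sumL (λ A → card A ∸ W) (level m₂ i) ≡ (m₂ ∸ i) * (m₂ C i)
    at-level i i≤j = begin-equality
      W * (m₂ C i) + sumL (λ A → card A ∸ W) (level m₂ i)
        ≡⟨ cong (W * (m₂ C i) +_) (sumL-cong (level m₂ i) (λ {A} A∈ → cong (_∸ W) (trans (sym (m+n∸n≡m (card A) i)) (cong (_∸ i) (level-card m₂ i A∈))))) ⟩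
      W * (m₂ C i) + sumL (λ _ → m₂ ∸ i ∸ W) (level m₂ i)  ≡⟨ cong (W * (m₂ C i) +_) (trans (sumL-const (m₂ ∸ i ∸ W) (level m₂ i)) (trans (*-comm (length (level m₂ i)) _) (cong ((m₂ ∸ i ∸ W) *_) (length-level m₂ i)))) ⟩
      W * (m₂ C i) + (m₂ ∸ i ∸ W) * (m₂ C i)              ≡⟨ *-distribʳ-+ (m₂ C i) W (m₂ ∸ i ∸ W) ⟨
      (W + (m₂ ∸ i ∸ W)) * (m₂ C i)                       ≡⟨ cong (_* (m₂ C i)) (m+[n∸m]≡n W≤) ⟩
      (m₂ ∸ i) * (m₂ C i)                                 ∎
      where
      W≤ : W ≤ m₂ ∸ i
      W≤ = ≤-trans (≤-reflexive (sym (trans (cong (_∸ suc j) (sym m₂≡)) (m+n∸n≡m W (suc j))))) (∸-monoʳ-≤ m₂ (≤-trans i≤j (n≤1+n j)))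

  i₁ : Fin n₁
  i₁ = fromℕ< (≤-trans (s≤s z≤n) 3≤n₁)

  b₀ : Fin m₂
  b₀ = fromℕ< 1≤m₂

  module Upper {m₁ n₂ N : ℕ} (c : KV m₁ n₁ m₂ n₂ → Fin N) (dist : Labelled.Dist FinP._≟_ c) where

    open Asymmetric FinP._≟_ c (allFin N) (UniqueP.allFin⁺ N) (λ u → MemP.∈-allFin (c u)) i₁ dist
      using (Q; trees; usable-trees; trees-count; trees-small-large; trees-usable; lack; numWords)
    open Asymmetric.Bound FinP._≟_ c (allFin N) (UniqueP.allFin⁺ N) (λ u → MemP.∈-allFin (c u)) i₁ dist u j m₂≡
      using (weight-bound)

    weight : m₂ * n₂ + u * Q + lack ≤ c₀ + m₁ * Z
    weight = ≤-trans weight-bound (≤-reflexive (trans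
      (solve 5 (λ w m n c s → w :* (m :* n) :+ (c :+ m :* s) := c :+ m :* (w :* n :+ s)) refl W m₁ n₁ c₀ _)
      (cong (λ z → c₀ + m₁ * z) surplus-value)))
      where open +-*-Solver

    -- The term `lack` occurs in `weight` as a loss and in `trees-usable` as a gain, so it cancels
    -- and only usable trees are left to count.
    by-usable : m₂ * n₂ ≤ c₀ + m₁ * D + u * (length usable-trees + W₀)
    by-usable = +-cancelʳ-≤ (u * m₁) _ _ (begin
      m₂ * n₂ + u * m₁                           ≤⟨ +-monoʳ-≤ (m₂ * n₂) (*-monoʳ-≤ u trees-count) ⟩
      m₂ * n₂ + u * (length trees + Q)           ≡⟨ solve 4 (λ a u t q → a :+ u :* (t :+ q) := a :+ u :* q :+ u :* t) refl (m₂ * n₂) u (length trees) Q ⟩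
      m₂ * n₂ + u * Q + u * length trees         ≤⟨ +-monoʳ-≤ (m₂ * n₂ + u * Q) (trees-usable u) ⟩
      m₂ * n₂ + u * Q + (u * (length usable-trees + W₀) + lack)
        ≡⟨ solve 3 (λ a b c → a :+ (b :+ c) := a :+ c :+ b) refl (m₂ * n₂ + u * Q) (u * (length usable-trees + W₀)) lack ⟩
      m₂ * n₂ + u * Q + lack + u * (length usable-trees + W₀) ≤⟨ +-monoˡ-≤ _ weight ⟩
      c₀ + m₁ * Z + u * (length usable-trees + W₀) ≡⟨ cong (λ z → c₀ + m₁ * z + u * (length usable-trees + W₀)) Z≡ ⟩
      c₀ + m₁ * (D + u) + u * (length usable-trees + W₀)
        ≡⟨ solve 5 (λ c m d u t → c :+ m :* (d :+ u) :+ t := c :+ m :* d :+ t :+ u :* m) refl c₀ m₁ D u (u * (length usable-trees + W₀)) ⟩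
      c₀ + m₁ * D + u * (length usable-trees + W₀) + u * m₁ ∎)
      where open +-*-Solver

    by-trees : m₂ * n₂ ≤ c₀ + m₁ * D + u * length trees
    by-trees = +-cancelʳ-≤ (u * m₁) _ _ (begin
      m₂ * n₂ + u * m₁                           ≤⟨ +-monoʳ-≤ (m₂ * n₂) (*-monoʳ-≤ u trees-count) ⟩
      m₂ * n₂ + u * (length trees + Q)           ≡⟨ solve 4 (λ a u t q → a :+ u :* (t :+ q) := a :+ u :* q :+ u :* t) refl (m₂ * n₂) u (length trees) Q ⟩
      m₂ * n₂ + u * Q + u * length trees         ≤⟨ +-monoˡ-≤ (u * length trees) (≤-trans (m≤m+n _ lack) weight) ⟩
      c₀ + m₁ * Z + u * length trees             ≡⟨ cong (λ z → c₀ + m₁ * z + u * length trees) Z≡ ⟩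
      c₀ + m₁ * (D + u) + u * length trees
        ≡⟨ solve 5 (λ c m d u t → c :+ m :* (d :+ u) :+ t := c :+ m :* d :+ t :+ u :* m) refl c₀ m₁ D u (u * length trees) ⟩
      c₀ + m₁ * D + u * length trees + u * m₁ ∎)
      where open +-*-Solver

    module _ (ℓ : ℕ) (2^ℓ≤ : 2 ^ ℓ ≤ m₁) where

      -- Trees are split at this size: the smaller ones have at most 2 ^ (cu L) words, no more than
      -- the square root of 2 ^ ℓ, and the larger ones number less than m₁ / L.
      L : ℕ
      L = ℓ / (cu + cu)

      few-words : ℓ * numWords L ≤ m₁
      few-words = begin
        ℓ * numWords L                       ≤⟨ *-monoʳ-≤ ℓ (length-words (letters m₂) ((2 + n₁) * L)) ⟩
        ℓ * suc b ^ ((2 + n₁) * L)           ≤⟨ *-monoʳ-≤ ℓ (^-monoˡ-≤ ((2 + n₁) * L) (<⇒≤ (n<2^n (suc b)))) ⟩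
        ℓ * (2 ^ suc b) ^ ((2 + n₁) * L)     ≡⟨ cong (ℓ *_) (^-*-assoc 2 (suc b) ((2 + n₁) * L)) ⟩
        ℓ * 2 ^ (suc b * ((2 + n₁) * L))     ≤⟨ *-monoʳ-≤ ℓ (^-monoʳ-≤ 2 (≤-trans (≤-reflexive (sym (*-assoc (suc b) (2 + n₁) L))) (*-monoˡ-≤ L (*-monoˡ-≤ (2 + n₁) (n≤1+n (suc b)))))) ⟩
        ℓ * 2 ^ (cu * L)                     ≤⟨ *2^-bound ℓ (cu * L) (≤-trans (≤-reflexive (trans (sym (*-distribʳ-+ L cu cu)) (*-comm (cu + cu) L))) (m/n*n≤m ℓ (cu + cu))) ⟩
        2 ^ ℓ                                ≤⟨ 2^ℓ≤ ⟩
        m₁                                   ∎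
        where b = length (letters m₂)

      few-trees : ℓ * length trees ≤ suc (2 * cu) * m₁
      few-trees = let (large , split , bound) = trees-small-large L in begin
        ℓ * length trees                     ≤⟨ *-monoʳ-≤ ℓ split ⟩
        ℓ * (numWords L + large)             ≡⟨ *-distribˡ-+ ℓ (numWords L) large ⟩
        ℓ * numWords L + ℓ * large           ≤⟨ +-mono-≤ few-words (*-monoˡ-≤ large ℓ≤) ⟩
        m₁ + (2 * cu) * suc L * large        ≡⟨ cong (m₁ +_) (trans (*-assoc (2 * cu) (suc L) large) (cong (2 * cu *_) (*-comm (suc L) large))) ⟩
        m₁ + 2 * cu * (large * suc L)        ≤⟨ +-monoʳ-≤ m₁ (*-monoʳ-≤ (2 * cu) bound) ⟩
        m₁ + 2 * cu * m₁                     ∎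
        where
        ℓ≤ : ℓ ≤ 2 * cu * suc L
        ℓ≤ = begin
          ℓ                                  ≡⟨ m≡m%n+[m/n]*n ℓ (cu + cu) ⟩
          ℓ % (cu + cu) + L * (cu + cu)      ≤⟨ +-monoˡ-≤ (L * (cu + cu)) (<⇒≤ (m%n<n ℓ (cu + cu))) ⟩
          suc L * (cu + cu)                  ≡⟨ trans (*-comm (suc L) (cu + cu)) (cong (λ z → (cu + z) * suc L) (sym (+-identityʳ cu))) ⟩
          2 * cu * suc L                     ∎

      upper : ℓ * (m₂ * n₂) ≤ ℓ * (m₁ * D) + Cᵤ * m₁
      upper = begin
        ℓ * (m₂ * n₂)                                      ≤⟨ *-monoʳ-≤ ℓ by-trees ⟩
        ℓ * (c₀ + m₁ * D + u * length trees)               ≡⟨ solve 5 (λ l c d u t → l :* (c :+ d :+ u :* t) := l :* d :+ (c :* l :+ u :* (l :* t))) refl ℓ c₀ (m₁ * D) u (length trees) ⟩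
        ℓ * (m₁ * D) + (c₀ * ℓ + u * (ℓ * length trees))   ≤⟨ +-monoʳ-≤ (ℓ * (m₁ * D)) (+-mono-≤ (*-monoʳ-≤ c₀ (≤-trans (<⇒≤ (n<2^n ℓ)) 2^ℓ≤)) (*-monoʳ-≤ u few-trees)) ⟩
        ℓ * (m₁ * D) + (c₀ * m₁ + u * (suc (2 * cu) * m₁)) ≡⟨ cong (ℓ * (m₁ * D) +_) (solve 4 (λ c u k m → c :* m :+ u :* (k :* m) := (c :+ u :* k) :* m) refl c₀ u (suc (2 * cu)) m₁) ⟩
        ℓ * (m₁ * D) + Cᵤ * m₁                             ∎
        where open +-*-Solver

  Lower : ℕ → ℕ → Set
  Lower L m₁ = ∃ λ top → (∀ n₂ → 1 ≤ n₂ → n₂ ≤ top → HasDistinguishingPartition (K m₁ n₁ m₂ n₂)) × m₁ * D + u * 2 ^ L ≤ m₂ * top + K₀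

  lower-at : ∀ L R → Y < R → Lower L (2 ^ L * (7 + L * 3) + R)
  lower-at L R Y<R = subst (Lower L) size-vertices (base m b₀ + E ∸ reserve ,
      (λ n₂ 1≤n₂ n₂≤ → range n₂ 1≤n₂ (≤-trans (+-monoˡ-≤ reserve n₂≤) (≤-reflexive (m∸n+n≡m reserve≤)))) ,
      +-cancelʳ-≤ (u * m) _ _ (begin
        m * D + u * 2 ^ L + u * m                ≡⟨ trans (solve 4 (λ m d u c → m :* d :+ c :+ u :* m := m :* (d :+ u) :+ c) refl m D u (u * 2 ^ L)) (cong (λ z → m * z + u * 2 ^ L) (sym Z≡)) ⟩
        m * Z + u * 2 ^ L                        ≤⟨ top-bound (2 ^ L) nonroots-bound ⟩
        m₂ * (base m b₀ + E) + (W * p + Y * Z) + u * m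
          ≡⟨ cong (λ z → m₂ * z + (W * p + Y * Z) + u * m) (m∸n+n≡m reserve≤) ⟨
        m₂ * (base m b₀ + E ∸ reserve + reserve) + (W * p + Y * Z) + u * m
          ≡⟨ cong (_+ u * m) (solve 4 (λ a t r y → a :* (t :+ r) :+ y := a :* t :+ (a :* r :+ y)) refl m₂ (base m b₀ + E ∸ reserve) reserve (W * p + Y * Z)) ⟩
        m₂ * (base m b₀ + E ∸ reserve) + K₀ + u * m ∎))
    where
    open CaterpillarForest L R Y Y<R using (m; forest; size-vertices; nonroots-bound)
    open Range n₁ m₂ j k u forest m₂≡ n₁≡ 1≤k k< 3≤n₁ b₀ using (reserve; step)
      renaming (base to base′; E to E′; range to range′; top-bound to top-bound′; Y≤E to Y≤E′)
    open +-*-Solver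
    base = base′ ≤-refl
    E = E′ ≤-refl
    range = range′ ≤-refl
    top-bound = top-bound′ ≤-refl
    reserve≤ : reserve ≤ base m b₀ + E
    reserve≤ = ≤-trans (≤-trans (m≤n+m reserve (step + p)) (≤-trans (m≤n+m _ (n₁ + m₂ + 6)) (Y≤E′ ≤-refl))) (m≤n+m E (base m b₀))

  module Large (m₁ ℓ : ℕ) (2^ℓ≤ : 2 ^ ℓ ≤ m₁) (m₁< : m₁ < 2 ^ suc ℓ) (ℓ₀≤ : ℓ₀ ≤ ℓ) where

    open +-*-Solver using (solve; con; _:+_; _:*_; _:=_)

    -- The 2 ^ L caterpillars of size 7 + 3 L take up at most half of the m₁ vertices, and 2 ^ (2 g)
    -- exceeds the number of keys in the pigeonhole argument.
    a e L g : ℕ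
    a = ⌊log₂ ℓ ⌋ + 4
    e = suc a
    L = ℓ ∸ e
    g = suc ⌊ ℓ + κ /2⌋

    large-κ : 84 + 2 * κ ≤ ℓ
    large-κ = ≤-trans (≤-trans (m≤m+n _ (10 + 2 * K₁)) (m≤m+n _ (Y + n₁))) ℓ₀≤

    large-K₁ : 10 + 2 * K₁ ≤ ℓ
    large-K₁ = ≤-trans (≤-trans (m≤n+m _ (84 + 2 * κ)) (m≤m+n _ (Y + n₁))) ℓ₀≤

    large-Y : suc (Y + n₁) ≤ ℓ
    large-Y = ≤-trans (+-monoˡ-≤ (Y + n₁) (≤-trans (m≤m+n 1 83) (≤-trans (m≤m+n 84 (2 * κ)) (m≤m+n _ (10 + 2 * K₁))))) ℓ₀≤

    1≤ℓ : 1 ≤ ℓ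
    1≤ℓ = ≤-trans (s≤s z≤n) large-Y

    8e≤ : 8 * e ≤ ℓ + 56
    8e≤ = begin
      8 * e                       ≡⟨ solve 1 (λ x → con 8 :* (con 1 :+ (x :+ con 4)) := con 8 :* x :+ con 40) refl ⌊log₂ ℓ ⌋ ⟩
      8 * ⌊log₂ ℓ ⌋ + 40          ≤⟨ +-monoˡ-≤ 40 (≤-trans (8*≤2^ ⌊log₂ ℓ ⌋) (+-monoˡ-≤ 16 (log-lower ℓ 1≤ℓ))) ⟩
      ℓ + 16 + 40                 ≡⟨ +-assoc ℓ 16 40 ⟩
      ℓ + 56                      ∎

    K₁≤L : suc K₁ + e ≤ ℓ
    K₁≤L = *-cancelˡ-≤ 8 (begin
      8 * (suc K₁ + e)            ≡⟨ *-distribˡ-+ 8 (suc K₁) e ⟩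
      8 * suc K₁ + 8 * e          ≤⟨ +-monoʳ-≤ (8 * suc K₁) 8e≤ ⟩
      8 * suc K₁ + (ℓ + 56)       ≡⟨ solve 2 (λ k l → con 8 :* (con 1 :+ k) :+ (l :+ con 56) := l :+ (con 64 :+ con 8 :* k)) refl K₁ ℓ ⟩
      ℓ + (64 + 8 * K₁)           ≤⟨ +-monoʳ-≤ ℓ (≤-trans (+-mono-≤ (m≤m+n 64 6) (*-monoˡ-≤ K₁ (m≤m+n 8 6))) (≤-reflexive (solve 1 (λ k → con 70 :+ con 14 :* k := con 7 :* (con 10 :+ con 2 :* k)) refl K₁))) ⟩
      ℓ + 7 * (10 + 2 * K₁)       ≤⟨ +-monoʳ-≤ ℓ (*-monoʳ-≤ 7 large-K₁) ⟩
      8 * ℓ                       ∎)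

    e≤ℓ : e ≤ ℓ
    e≤ℓ = ≤-trans (m≤n+m e (suc K₁)) K₁≤L

    L+e : L + e ≡ ℓ
    L+e = m∸n+n≡m e≤ℓ

    K₁<L : suc K₁ ≤ L
    K₁<L = ≤-trans (≤-reflexive (sym (m+n∸n≡m (suc K₁) e))) (∸-monoˡ-≤ e K₁≤L)

    2K₁≤ : 2 * K₁ ≤ 2 ^ L
    2K₁≤ = ≤-trans (*-monoʳ-≤ 2 (<⇒≤ (n<2^n K₁))) (^-monoʳ-≤ 2 K₁<L)

    g+g≥ : suc ℓ + κ ≤ g + g
    g+g≥ = s≤s (begin
      ℓ + κ                                    ≡⟨ ⌊n/2⌋+⌈n/2⌉≡n (ℓ + κ) ⟨
      ⌊ ℓ + κ /2⌋ + ⌈ ℓ + κ /2⌉                ≤⟨ +-monoʳ-≤ ⌊ ℓ + κ /2⌋ (⌊n/2⌋-mono (n≤1+n (suc (ℓ + κ)))) ⟩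
      ⌊ ℓ + κ /2⌋ + g                          ∎)

    g+g≤ : g + g ≤ ℓ + κ + 2
    g+g≤ = begin
      g + g                                    ≡⟨ solve 1 (λ x → (con 1 :+ x) :+ (con 1 :+ x) := x :+ x :+ con 2) refl ⌊ ℓ + κ /2⌋ ⟩
      ⌊ ℓ + κ /2⌋ + ⌊ ℓ + κ /2⌋ + 2            ≤⟨ +-monoˡ-≤ 2 (≤-trans (+-monoʳ-≤ ⌊ ℓ + κ /2⌋ (⌊n/2⌋≤⌈n/2⌉ (ℓ + κ))) (≤-reflexive (⌊n/2⌋+⌈n/2⌉≡n (ℓ + κ)))) ⟩
      ℓ + κ + 2                                ∎

    -- g is about ℓ / 2 and e is logarithmic in ℓ. The constant 84 is 56 from `8e≤`, 24 from 4 times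
    -- 6, and 4 from `g+g≤`.
    room : e + e + 6 + g ≤ ℓ
    room = *-cancelˡ-≤ 4 (begin
      4 * (e + e + 6 + g)                      ≡⟨ solve 2 (λ e g → con 4 :* (e :+ e :+ con 6 :+ g) := con 8 :* e :+ con 24 :+ con 2 :* (g :+ g)) refl e g ⟩
      8 * e + 24 + 2 * (g + g)                 ≤⟨ +-mono-≤ (+-monoˡ-≤ 24 8e≤) (*-monoʳ-≤ 2 g+g≤) ⟩
      ℓ + 56 + 24 + 2 * (ℓ + κ + 2)            ≡⟨ solve 2 (λ l k → l :+ con 56 :+ con 24 :+ con 2 :* (l :+ k :+ con 2) := con 3 :* l :+ (con 84 :+ con 2 :* k)) refl ℓ κ ⟩
      3 * ℓ + (84 + 2 * κ)                     ≤⟨ +-monoʳ-≤ (3 * ℓ) large-κ ⟩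
      3 * ℓ + ℓ                                ≡⟨ +-comm (3 * ℓ) ℓ ⟩
      4 * ℓ                                    ∎)

    -- The summand 4 in `a` is 1 for the rounding of the logarithm and 3 for the factor 8.
    size≤ : 7 + L * 3 ≤ 2 ^ a
    size≤ = begin
      7 + L * 3                    ≤⟨ +-monoʳ-≤ 7 (*-monoˡ-≤ 3 (m∸n≤m ℓ e)) ⟩
      7 + ℓ * 3                    ≤⟨ +-mono-≤ (m≤m+n 7 1) (*-monoʳ-≤ ℓ (m≤m+n 3 5)) ⟩
      suc ℓ * 8                    ≤⟨ *-monoˡ-≤ 8 (log-upper ℓ) ⟩
      2 ^ suc ⌊log₂ ℓ ⌋ * 2 ^ 3    ≡⟨ ^-distribˡ-+-* 2 (suc ⌊log₂ ℓ ⌋) 3 ⟨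
      2 ^ (suc ⌊log₂ ℓ ⌋ + 3)      ≡⟨ cong (2 ^_) (sym (+-suc ⌊log₂ ℓ ⌋ 3)) ⟩
      2 ^ a                        ∎

    L+a : suc (L + a) ≡ ℓ
    L+a = trans (sym (+-suc L a)) L+e

    R : ℕ
    R = m₁ ∸ 2 ^ L * (7 + L * 3)

    trees≤ : 2 ^ L * (7 + L * 3) ≤ 2 ^ (L + a)
    trees≤ = ≤-trans (*-monoʳ-≤ (2 ^ L) size≤) (≤-reflexive (sym (^-distribˡ-+-* 2 L a)))

    double : 2 ^ (L + a) + 2 ^ (L + a) ≤ m₁
    double = ≤-trans (≤-reflexive (trans (cong (2 ^ (L + a) +_) (sym (+-identityʳ _))) (cong (2 ^_) L+a))) 2^ℓ≤

    R-large : 2 ^ (L + a) ≤ R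
    R-large = ≤-trans (≤-reflexive (sym (m+n∸n≡m _ (2 ^ (L + a))))) (≤-trans (∸-monoˡ-≤ (2 ^ (L + a)) double) (∸-monoʳ-≤ m₁ trees≤))

    Y<R : Y < R
    Y<R = ≤-trans (≤-trans (s≤s (≤-trans (m≤m+n Y n₁) (≤-pred (≤-trans large-Y (≤-reflexive (sym L+a)))))) (n<2^n (L + a))) R-large

    abstract
      lower : Lower L m₁
      lower = subst (Lower L) (m+[n∸m]≡n (≤-trans trees≤ (≤-trans (m≤m+n _ _) double))) (lower-at L R Y<R)

    top : ℕ
    top = proj₁ lower

    below-top : ∀ n₂ → 1 ≤ n₂ → n₂ ≤ top → HasDistinguishingPartition (K m₁ n₁ m₂ n₂)
    below-top = proj₁ (proj₂ lower)

    top-lower : m₁ * D + u * 2 ^ L ≤ m₂ * top + K₀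
    top-lower = proj₂ (proj₂ lower)

    -- Half of the gain of the 2 ^ L trees absorbs the constant K₀.
    top-gain : 2 * (m₁ * D) + 2 ^ L ≤ 2 * (m₂ * top)
    top-gain = +-cancelʳ-≤ (2 ^ L) _ _ (begin
      2 * (m₁ * D) + 2 ^ L + 2 ^ L             ≡⟨ solve 2 (λ x y → con 2 :* x :+ y :+ y := con 2 :* (x :+ con 1 :* y)) refl (m₁ * D) (2 ^ L) ⟩
      2 * (m₁ * D + 1 * 2 ^ L)                 ≤⟨ *-monoʳ-≤ 2 (≤-trans (+-monoʳ-≤ (m₁ * D) (*-monoˡ-≤ (2 ^ L) 1≤u)) top-lower) ⟩
      2 * (m₂ * top + K₀)                      ≡⟨ *-distribˡ-+ 2 (m₂ * top) K₀ ⟩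
      2 * (m₂ * top) + 2 * K₀                  ≤⟨ +-monoʳ-≤ _ (≤-trans (*-monoʳ-≤ 2 (≤-trans (m≤n+m K₀ c₀) (m≤m+n _ W₀))) 2K₁≤) ⟩
      2 * (m₂ * top) + 2 ^ L                   ∎)

    -- The forest has at least m₁ / (64 ℓ) trees, which is the source of the lower half of the
    -- estimate of ε.
    gain-large : m₁ ≤ 64 * ℓ * 2 ^ L
    gain-large = begin
      m₁                                       ≤⟨ <⇒≤ m₁< ⟩
      2 ^ suc ℓ                                ≡⟨ cong (λ z → 2 * 2 ^ z) (sym L+e) ⟩
      2 * 2 ^ (L + e)                          ≡⟨ cong (2 *_) (^-distribˡ-+-* 2 L e) ⟩
      2 * (2 ^ L * 2 ^ e)                      ≤⟨ *-monoʳ-≤ 2 (*-monoʳ-≤ (2 ^ L) e-bound) ⟩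
      2 * (2 ^ L * (32 * ℓ))                   ≡⟨ solve 2 (λ x l → con 2 :* (x :* (con 32 :* l)) := con 64 :* l :* x) refl (2 ^ L) ℓ ⟩
      64 * ℓ * 2 ^ L                           ∎
      where
      e-bound : 2 ^ e ≤ 32 * ℓ
      e-bound = begin
        2 ^ suc (⌊log₂ ℓ ⌋ + 4)    ≡⟨ cong (2 *_) (^-distribˡ-+-* 2 ⌊log₂ ℓ ⌋ 4) ⟩
        2 * (2 ^ ⌊log₂ ℓ ⌋ * 16)   ≡⟨ solve 1 (λ x → con 2 :* (x :* con 16) := con 32 :* x) refl (2 ^ ⌊log₂ ℓ ⌋) ⟩
        32 * 2 ^ ⌊log₂ ℓ ⌋         ≤⟨ *-monoʳ-≤ 32 (log-lower ℓ 1≤ℓ) ⟩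
        32 * ℓ                     ∎

    top-large : n₁ < top
    top-large = *-cancelˡ-< m₂ n₁ top (≤-trans (s≤s (*-monoʳ-≤ m₂ n₁≤)) (≤-trans mD< mD≤))
      where
      n₁≤ : n₁ ≤ m₁
      n₁≤ = ≤-trans (≤-trans (m≤n+m n₁ (suc Y)) large-Y) (≤-trans (<⇒≤ (n<2^n ℓ)) 2^ℓ≤)
      mD≤ : m₁ * D + 1 ≤ m₂ * top
      mD≤ = *-cancelˡ-≤ 2 (begin
        2 * (m₁ * D + 1)          ≡⟨ *-distribˡ-+ 2 (m₁ * D) 1 ⟩
        2 * (m₁ * D) + 2 * 1      ≤⟨ +-monoʳ-≤ _ (^-monoʳ-≤ 2 {1} {L} (≤-trans (s≤s z≤n) K₁<L)) ⟩
        2 * (m₁ * D) + 2 ^ L      ≤⟨ top-gain ⟩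
        2 * (m₂ * top)            ∎)
      mD< : suc (m₂ * m₁) ≤ m₁ * D + 1
      mD< = ≤-trans (s≤s (≤-trans (≤-reflexive (*-comm m₂ m₁)) (*-monoʳ-≤ m₁ (m≤m+n m₂ X)))) (≤-reflexive (+-comm 1 _))

    -- Chosen so that, by m₁ < 2 ^ (ℓ + 1), fewer than 2 ^ (L - 2) disjoint trees can have more than
    -- S vertices.
    S : ℕ
    S = 2 ^ (e + 3) ∸ 1

    S≡ : suc S ≡ 2 ^ (e + 3)
    S≡ = m+[n∸m]≡n (m^n>0 2 (e + 3))

    L≡ : ∃ λ r → L ≡ 2 + r × e + 4 + g ≤ r
    L≡ = L ∸ 2 , sym (m+[n∸m]≡n 2≤L) , (begin
        e + 4 + g                         ≡⟨ sym (m+n∸n≡m (e + 4 + g) (2 + e)) ⟩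
        e + 4 + g + (2 + e) ∸ (2 + e)     ≡⟨ cong (_∸ (2 + e)) (solve 2 (λ e g → e :+ con 4 :+ g :+ (con 2 :+ e) := e :+ e :+ con 6 :+ g) refl e g) ⟩
        e + e + 6 + g ∸ (2 + e)           ≤⟨ ∸-monoˡ-≤ (2 + e) room ⟩
        ℓ ∸ (2 + e)                       ≡⟨ trans (cong (ℓ ∸_) (+-comm 2 e)) (sym (∸-+-assoc ℓ e 2)) ⟩
        L ∸ 2                             ∎)
      where
      2≤L : 2 ≤ L
      2≤L = ≤-trans (≤-reflexive (sym (m+n∸n≡m 2 e))) (∸-monoˡ-≤ e (≤-trans 2+e≤ room))
        where
        2+e≤ : 2 + e ≤ e + e + 6 + g
        2+e≤ = ≤-trans (≤-trans (+-mono-≤ (m≤m+n 2 4) (m≤m+n e e)) (≤-reflexive (+-comm 6 (e + e)))) (m≤m+n _ g)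

    r : ℕ
    r = proj₁ L≡

    pairs : m₁ * n₁ * m₂ ^ m₂ < 2 ^ g * 2 ^ g
    pairs = begin-strict
      m₁ * n₁ * m₂ ^ m₂          ≡⟨ *-assoc m₁ n₁ _ ⟩
      m₁ * κ                     <⟨ *-mono-< m₁< (n<2^n κ) ⟩
      2 ^ suc ℓ * 2 ^ κ          ≡⟨ ^-distribˡ-+-* 2 (suc ℓ) κ ⟨
      2 ^ (suc ℓ + κ)            ≤⟨ ^-monoʳ-≤ 2 g+g≥ ⟩
      2 ^ (g + g)                ≡⟨ ^-distribˡ-+-* 2 g g ⟩
      2 ^ g * 2 ^ g              ∎

    -- 2 ^ L is four times 2 ^ r: one quarter allows for the large trees, one for the grid, and the
    -- other half for K₁.
    enough : ∀ us → 2 ^ L ≤ K₁ + us → ∀ l → l * suc S ≤ m₁ → l + suc S * (2 ^ g + 2 ^ g) ≤ us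
    enough us us≥ l l≤ = +-cancelˡ-≤ K₁ _ _ (begin
      K₁ + (l + suc S * (2 ^ g + 2 ^ g))       ≤⟨ +-monoʳ-≤ K₁ (+-mono-≤ (<⇒≤ l<) grid) ⟩
      K₁ + (2 ^ r + 2 ^ r)                     ≤⟨ +-monoˡ-≤ (2 ^ r + 2 ^ r) K₁≤ ⟩
      (2 ^ r + 2 ^ r) + (2 ^ r + 2 ^ r)        ≡⟨ solve 1 (λ x → (x :+ x) :+ (x :+ x) := con 2 :* (con 2 :* x)) refl (2 ^ r) ⟩
      2 ^ (2 + r)                              ≡⟨ cong (2 ^_) (proj₁ (proj₂ L≡)) ⟨
      2 ^ L                                    ≤⟨ us≥ ⟩
      K₁ + us                                  ∎)
      where
      l< : l < 2 ^ r
      l< = *-cancelʳ-< (2 ^ (e + 3)) l (2 ^ r) (begin-strict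
        l * 2 ^ (e + 3)            ≡⟨ cong (l *_) S≡ ⟨
        l * suc S                  ≤⟨ l≤ ⟩
        m₁                         <⟨ m₁< ⟩
        2 ^ suc ℓ                  ≡⟨ cong (2 ^_) (trans (cong suc (trans (sym L+e) (cong (_+ e) (proj₁ (proj₂ L≡))))) (solve 2 (λ r e → con 1 :+ (con 2 :+ r :+ e) := r :+ (e :+ con 3)) refl r e)) ⟩
        2 ^ (r + (e + 3))          ≡⟨ ^-distribˡ-+-* 2 r (e + 3) ⟩
        2 ^ r * 2 ^ (e + 3)        ∎)
      grid : suc S * (2 ^ g + 2 ^ g) ≤ 2 ^ r
      grid = begin
        suc S * (2 ^ g + 2 ^ g)    ≡⟨ cong₂ _*_ S≡ (cong (2 ^ g +_) (sym (+-identityʳ (2 ^ g)))) ⟩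
        2 ^ (e + 3) * 2 ^ suc g    ≡⟨ ^-distribˡ-+-* 2 (e + 3) (suc g) ⟨
        2 ^ (e + 3 + suc g)        ≤⟨ ^-monoʳ-≤ 2 (≤-trans (≤-reflexive (solve 2 (λ e g → e :+ con 3 :+ (con 1 :+ g) := e :+ con 4 :+ g) refl e g)) (proj₂ (proj₂ L≡))) ⟩
        2 ^ r                      ∎
      K₁≤ : K₁ ≤ 2 ^ r + 2 ^ r
      K₁≤ = *-cancelˡ-≤ 2 (≤-trans 2K₁≤ (≤-reflexive (trans (cong (2 ^_) (proj₁ (proj₂ L≡))) (cong (λ z → 2 * (2 ^ r + z)) (+-identityʳ (2 ^ r))))))

    descend : ∀ n₂ → top ≤ n₂ → HasDistinguishingPartition (K m₁ n₁ m₂ (suc n₂)) → HasDistinguishingPartition (K m₁ n₁ m₂ n₂)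
    descend n₂ top≤ (c , d) = fromHasDist (MergeTrees.merge-step FinP._≟_ c′ (allFin _) (UniqueP.allFin⁺ _) (λ u → MemP.∈-allFin (c′ u)) i₁ d′
        (fromℕ< (≤-trans (s≤s z≤n) (≤-trans top-large top≤))) (<⇒≢ (≤-trans top-large top≤)) S (2 ^ g) pairs
        (enough _ usable))
      where
      norm = normalise (_≟_ , c , d)
      c′ = proj₁ norm
      d′ = proj₂ norm
      us = length (Asymmetric.usable-trees FinP._≟_ c′ (allFin _) (UniqueP.allFin⁺ _) (λ u → MemP.∈-allFin (c′ u)) i₁ d′)
      usable : 2 ^ L ≤ K₁ + us
      usable = *-cancelˡ-≤ u {{>-nonZero 1≤u}} (+-cancelˡ-≤ (m₁ * D) _ _ (begin
        m₁ * D + u * 2 ^ L                         ≤⟨ top-lower ⟩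
        m₂ * top + K₀                              ≤⟨ +-monoˡ-≤ K₀ (*-monoʳ-≤ m₂ (≤-trans top≤ (n≤1+n n₂))) ⟩
        m₂ * suc n₂ + K₀                           ≤⟨ +-monoˡ-≤ K₀ (Upper.by-usable c′ d′) ⟩
        c₀ + m₁ * D + u * (us + W₀) + K₀           ≡⟨ solve 6 (λ c m u s w k → c :+ m :+ u :* (s :+ w) :+ k := m :+ ((c :+ k) :+ u :* (w :+ s))) refl c₀ (m₁ * D) u us W₀ K₀ ⟩
        m₁ * D + ((c₀ + K₀) + u * (W₀ + us))       ≤⟨ +-monoʳ-≤ (m₁ * D) (+-monoˡ-≤ (u * (W₀ + us)) (≤-trans (≤-reflexive (sym (*-identityˡ (c₀ + K₀)))) (*-monoˡ-≤ (c₀ + K₀) 1≤u))) ⟩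
        m₁ * D + (u * (c₀ + K₀) + u * (W₀ + us))   ≡⟨ cong (m₁ * D +_) (trans (sym (*-distribˡ-+ u (c₀ + K₀) (W₀ + us))) (cong (u *_) (sym (+-assoc (c₀ + K₀) W₀ us)))) ⟩
        m₁ * D + u * (K₁ + us)                     ∎))

  abstract
    -- For large m₁ both the logarithm and m₂ are at least 1, so every attained n₂ is at most b;
    -- this crude bound makes the search finite.
    maximal : ∀ m₁ → let b = ⌊log₂ m₁ ⌋ * (m₁ * D) + Cᵤ * m₁ ; P = λ n₂ → HasDistinguishingPartition (K m₁ n₁ m₂ n₂) in
      ∃ λ N → (∀ n₂ → 1 ≤ n₂ → n₂ ≤ b → P n₂ → n₂ ≤ N) × (∀ n₂ → 1 ≤ n₂ → n₂ ≤ b → P n₂ → P N)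
    maximal m₁ = largest (λ n₂ → hasDistinguishingPartition?) _

  N : ℕ → ℕ
  N m₁ = proj₁ (maximal m₁)

  module _ (m₁ : ℕ) (large : 2 ^ ℓ₀ ≤ m₁) where

    private
      ℓ = ⌊log₂ m₁ ⌋
      1≤m₁ : 1 ≤ m₁
      1≤m₁ = 2^≤⇒1≤ ℓ₀ large
      2^ℓ≤ : 2 ^ ℓ ≤ m₁
      2^ℓ≤ = log-lower m₁ 1≤m₁
      ℓ₀≤ : ℓ₀ ≤ ℓ
      ℓ₀≤ = 2^≤⇒≤log ℓ₀ large

    open Large m₁ ℓ 2^ℓ≤ (log-upper m₁) ℓ₀≤ using (top; below-top; top-gain; gain-large; top-large; 1≤ℓ; descend; L)

    bounded : ∀ n₂ → HasDistinguishingPartition (K m₁ n₁ m₂ n₂) → ℓ * (m₂ * n₂) ≤ ℓ * (m₁ * D) + Cᵤ * m₁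
    bounded n₂ (c , d) = let (c′ , d′) = normalise (_≟_ , c , d) in Upper.upper c′ d′ ℓ 2^ℓ≤

    within : ∀ n₂ → HasDistinguishingPartition (K m₁ n₁ m₂ n₂) → n₂ ≤ ℓ * (m₁ * D) + Cᵤ * m₁
    within n₂ h = ≤-trans (≤-trans (≤-trans (≤-reflexive (sym (*-identityˡ n₂))) (*-monoˡ-≤ n₂ (*-mono-≤ 1≤ℓ 1≤m₂)))
      (≤-reflexive (*-assoc ℓ m₂ n₂))) (bounded n₂ h)

    below-N : ∀ n₂ → 1 ≤ n₂ → HasDistinguishingPartition (K m₁ n₁ m₂ n₂) → n₂ ≤ N m₁
    below-N n₂ 1≤ h = proj₁ (proj₂ (maximal m₁)) n₂ 1≤ (within n₂ h) h

    at-top : HasDistinguishingPartition (K m₁ n₁ m₂ top)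
    at-top = below-top top (≤-trans (s≤s z≤n) top-large) ≤-refl

    top≤N : top ≤ N m₁
    top≤N = below-N top (≤-trans (s≤s z≤n) top-large) at-top

    at-N : HasDistinguishingPartition (K m₁ n₁ m₂ (N m₁))
    at-N = proj₂ (proj₂ (maximal m₁)) top (≤-trans (s≤s z≤n) top-large) (within top at-top) at-top

    downward : ∀ d n₂ → top ≤ n₂ → d + n₂ ≡ N m₁ → HasDistinguishingPartition (K m₁ n₁ m₂ n₂)
    downward zero    n₂ top≤ refl = at-N
    downward (suc d) n₂ top≤ eq   = descend n₂ top≤ (downward d (suc n₂) (≤-trans top≤ (n≤1+n n₂)) (trans (+-suc d n₂) eq))

    up-to-N : ∀ n₂ → 1 ≤ n₂ → n₂ ≤ N m₁ → HasDistinguishingPartition (K m₁ n₁ m₂ n₂)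
    up-to-N n₂ 1≤ n₂≤ = [ below-top n₂ 1≤ , (λ top≤n₂ → downward (N m₁ ∸ n₂) n₂ top≤n₂ (m∸n+n≡m n₂≤)) ]′ (≤-total n₂ top)

    N-upper : ℓ * (m₂ * N m₁) ≤ ℓ * (m₁ * D) + Cᵤ * m₁
    N-upper = bounded (N m₁) at-N

    -- The factor 128 is 64 from `gain-large` times 2 from `top-gain`.
    N-lower : m₁ + 128 * (ℓ * (m₁ * D)) ≤ 128 * (ℓ * (m₂ * N m₁))
    N-lower = begin
      m₁ + 128 * (ℓ * (m₁ * D))                     ≤⟨ +-monoˡ-≤ _ gain-large ⟩
      64 * ℓ * 2 ^ L + 128 * (ℓ * (m₁ * D))         ≡⟨ solve 3 (λ l p x → con 64 :* l :* p :+ con 128 :* (l :* x) := con 64 :* l :* (con 2 :* x :+ p)) refl ℓ (2 ^ L) (m₁ * D) ⟩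
      64 * ℓ * (2 * (m₁ * D) + 2 ^ L)               ≤⟨ *-monoʳ-≤ (64 * ℓ) (≤-trans top-gain (*-monoʳ-≤ 2 (*-monoʳ-≤ m₂ top≤N))) ⟩
      64 * ℓ * (2 * (m₂ * N m₁))                    ≡⟨ solve 2 (λ l x → con 64 :* l :* (con 2 :* x) := con 128 :* (l :* x)) refl ℓ (m₂ * N m₁) ⟩
      128 * (ℓ * (m₂ * N m₁))                       ∎
      where open +-*-Solver

theorem1p4 : (n₁ m₂ j k : ℕ) → .{{_ : NonZero m₂}} → 3 ≤ n₁ →
    n₁ ≡ 2 + sumTo j (λ i → m₂ C i) + k →
    j < halfBound m₂ → k < m₂ C (suc j) → 1 ≤ k →
    ∃[ ε ] (IsTheta-m/logm ε × ∃[ M ] (∀ m₁ → M ≤ m₁ → ∀ n₂ → 1 ≤ n₂ →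
    (HasDistinguishingPartition (K m₁ n₁ m₂ n₂)
    ⇔ (toℚ n₂ ℚ.≤ ℚ._+_ (ℚ._*_ (rVal m₂ j k) (toℚ m₁)) (ε m₁)))))
theorem1p4 n₁ m₂ j k 3≤n₁ n₁≡ j< k< 1≤k =
  (λ m₁ → excess (N m₁) m₁) ,
  ((ℤ.+ 1) ℚ./ (128 * m₂) , (ℤ.+ Cᵤ) ℚ./ m₂ , 2 ^ ℓ₀ , /-pos 1 (128 * m₂) , /-pos Cᵤ m₂ ,
    λ m₁ large → excess-lower (N m₁) m₁ ⌊log₂ m₁ ⌋ 128 (N-lower m₁ large) , excess-upper (N m₁) m₁ ⌊log₂ m₁ ⌋ Cᵤ (N-upper m₁ large)) ,
  2 ^ ℓ₀ , λ m₁ large n₂ 1≤n₂ → mk⇔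
    (λ h → ℚP.≤-trans (toℚ-mono-≤ (below-N m₁ large n₂ 1≤n₂ h)) (ℚP.≤-reflexive (sym (r*+excess (N m₁) m₁))))
    (λ le → up-to-N m₁ large n₂ 1≤n₂ (toℚ-cancel-≤ (ℚP.≤-trans le (ℚP.≤-reflexive (r*+excess (N m₁) m₁)))))
  where
  open Bounds n₁ m₂ j k 3≤n₁ n₁≡ j< k< 1≤k using (X; Cᵤ; ℓ₀; 1≤Cᵤ; N; below-N; up-to-N; N-upper; N-lower)
  open Excess m₂ X using (excess; r*+excess; excess-upper; excess-lower)
  instance
    Cᵤ-nonZero : NonZero Cᵤ
    Cᵤ-nonZero = >-nonZero 1≤Cᵤ
    128m₂-nonZero : NonZero (128 * m₂)
    128m₂-nonZero = m*n≢0 128 m₂
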